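{- Let $G$ be a $2K_2$-free graph with $D(G)=5$. Then there exists a $D$-partition of $G$ that contains a sink set.
   Context: All graphs are finite and simple. $G$ is $2K_2$-free if it has no induced subgraph consisting of two independent edges. For disjoint vertex sets $A,B$, $A$ dominates $B$ if every vertex of $B$ is adjacent to at least one vertex of $A$. An upper domatic partition of size $k$ is a partition of $V(G)$ into $k$ nonempty parts such that for any two parts $V_i,V_j$, $V_i$ dominates $V_j$ or $V_j$ dominates $V_i$ (or both); $D(G)$ is the maximum such $k$, and a $D$-partition is an upper domatic partition of size $D(G)$. A part of a partition with $k$ parts is a sink set if it is dominated by all the other $k-1$ parts. -}

module Defs where

open import Data.Nat using (ℕ; _>_)
open import Data.Fin using (Fin)
open import Data.Product using (Σ; ∃; _×_; _,_)
open import Data.Sum using (_⊎_)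
open import Relation.Binary.PropositionalEquality using (_≡_; _≢_)
open import Relation.Nullary using (¬_)
open import Data.Empty using (⊥)

record Graph (n : ℕ) : Set₁ where
  field
    Adj     : Fin n → Fin n → Set
    irrefl  : ∀ v → ¬ Adj v v
    sym     : ∀ {u v} → Adj u v → Adj v u
open Graph public

TwoK2Free : ∀ {n} → Graph n → Set
TwoK2Free {n} G = ∀ (a b c d : Fin n) →
  a ≢ b → a ≢ c → a ≢ d → b ≢ c → b ≢ d → c ≢ d →
  Adj G a b → Adj G c d →
  ¬ Adj G a c → ¬ Adj G a d → ¬ Adj G b c → ¬ Adj G b d → ⊥

-- A partition of V(G) into k parts: a labelling p : Fin n → Fin k,
-- with part i = p⁻¹(i). Parts are nonempty: p is surjective.
Partition : ℕ → ℕ → Set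
Partition n k = Σ (Fin n → Fin k) λ p → ∀ (i : Fin k) → ∃ λ v → p v ≡ i

Dominates : ∀ {n k} → Graph n → (Fin n → Fin k) → Fin k → Fin k → Set
Dominates G p i j = ∀ v → p v ≡ j → ∃ λ u → p u ≡ i × Adj G u v

IsUpperDomatic : ∀ {n k} → Graph n → Partition n k → Set
IsUpperDomatic {k = k} G (p , _) =
  ∀ (i j : Fin k) → i ≢ j → Dominates G p i j ⊎ Dominates G p j i

UpperDomaticPartition : ∀ {n} → Graph n → ℕ → Set
UpperDomaticPartition {n} G k = Σ (Partition n k) (IsUpperDomatic G)

UpperDomaticNumberIs : ∀ {n} → Graph n → ℕ → Set
UpperDomaticNumberIs G d =
  UpperDomaticPartition G d × (∀ k → k > d → ¬ UpperDomaticPartition G k)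

IsSink : ∀ {n k} → Graph n → Partition n k → Fin k → Set
IsSink {k = k} G (p , _) s = ∀ (i : Fin k) → i ≢ s → Dominates G p i s

module Submission where

-- Order the parts of an upper domatic 5-partition by a tournament of domination. If some part i is dominated by all
-- others except one part j, a vertex of i dominated by j (or the whole of i) becomes a sink after moving the rest of i
-- to j. Otherwise the tournament is regular: the parts lie on a circle and each is dominated by the two preceding ones.
-- Choose for every vertex a parent in each of these two parts; its p-parent is one step back, its q-parent two steps
-- back. A vertex that is both a p-parent and a q-parent has neighbours in all other parts, and again gives a sink.
-- If no such vertex exists, the graph has a 6-part upper domatic partition. To see this, follow p-parents and q-parents
-- to find closed walks a and b of length five, and refute, by a certificate tree, every way in which these can be
-- adjacent: an inner node decides an adjacency or adds a parent, and a leaf is either an induced 2K₂ or a labelling of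
-- the vertices by six labels, constant on each part except for the finitely many vertices already named.
-- Adjacency is not decidable, but a case distinction on it is harmless because the trees prove ⊥.

open import Defs
open import Agda.Builtin.Nat using (div-helper; mod-helper)
open import Data.Bool using (Bool; true; false; _∧_; _∨_; not; T; if_then_else_)
open import Data.Bool.Properties using (T-∧; T-∨)
open import Data.Empty using (⊥; ⊥-elim)
open import Data.Fin using (_≟_; Fin; zero; suc; toℕ; #_)
open import Data.Fin.Properties using (any?; all?; toℕ-injective)
open import Data.List using (List; []; _∷_; allFin; map; _++_)
open import Data.List.Membership.Propositional using (_∈_)
open import Data.List.Membership.Propositional.Properties using (∈-allFin; ∈-map⁻)
open import Data.List.Relation.Unary.All as All using (All; []; _∷_)
open import Data.List.Relation.Unary.All.Properties using (++⁺)
open import Data.List.Relation.Unary.Any using (here; there)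
open import Data.Nat using (ℕ; zero; suc; _+_; s≤s; _≡ᵇ_; _<ᵇ_; _%_; _<_)
open import Data.Nat.GeneralisedArithmetic using (fold; fold-+)
open import Data.Nat.Properties using (+-comm; ≤-refl; ≡ᵇ⇒≡; ≡⇒≡ᵇ; <-cmp; <⇒<ᵇ)
open import Data.Product using (Σ; ∃; _×_; _,_; proj₁; proj₂)
open import Data.Sum using (_⊎_; inj₁; inj₂; swap)
open import Data.Unit using (tt)
open import Data.Vec using (Vec; []; _∷_; lookup)
open import Function using (_∘_; Equivalence)
open import Relation.Binary.Definitions using (tri<; tri≈; tri>)
open import Relation.Binary.PropositionalEquality using (_≡_; _≢_; refl; trans; cong; subst; subst₂) renaming (sym to ≡-sym)
open import Relation.Nullary using (¬_; yes; no; contradiction)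
open import Relation.Nullary.Decidable using (False; toWitnessFalse; _⊎-dec_; from-yes)

-- The graph may be arbitrarily large while a certificate names finitely many vertices, so the
-- argument needs dominations that survive a relabelling of the named vertices. The two parent
-- functions supply them: no vertex is a parent of both kinds, so exceptional labels on p-parents
-- leave every q-parent with the label of its part, and conversely. A vertex about which nothing is
-- known thus still has a neighbour of a predictable label, and a leaf can be tested on the five
-- parts and the named vertices alone.
--
-- Closing the walks after five steps gives a and b one vertex in each part, and the situation
-- becomes symmetric under rotation of the circle. This leaves four trees for the adjacencies
-- between a and b. Call a position joined if the vertex of b there is adjacent to the vertex of a
-- one part back. A joined position right after an unjoined one is refuted, and so is a circle
-- without joined positions; hence all are joined. Under this assumption, a vertex of a that is not
-- adjacent to the vertex of b two parts back is refuted, and the last tree refutes the case in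
-- which all these adjacencies hold.

module Checker where

  -- Boolean tests and their reflection

  ∧-split : ∀ {x y} → T (x ∧ y) → T x × T y
  ∧-split = Equivalence.to T-∧

  ∨-split : ∀ {x y} → T (x ∨ y) → T x ⊎ T y
  ∨-split = Equivalence.to T-∨

  all any : {A : Set} → (A → Bool) → List A → Bool
  all f [] = true
  all f (x ∷ xs) = f x ∧ all f xs
  any f [] = false
  any f (x ∷ xs) = f x ∨ any f xs

  all-∈ : ∀ {A : Set} (f : A → Bool) {xs x} → T (all f xs) → x ∈ xs → T (f x)
  all-∈ f {y ∷ _} t (here refl) = proj₁ (∧-split {f y} t)
  all-∈ f {y ∷ _} t (there m) = all-∈ f (proj₂ (∧-split {f y} t)) m

  any-∈ : ∀ {A : Set} (f : A → Bool) xs → T (any f xs) → ∃ λ x → x ∈ xs × T (f x)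
  any-∈ f (y ∷ ys) t with ∨-split {f y} t
  ... | inj₁ fy = y , here refl , fy
  ... | inj₂ t′ with x , m , fx ← any-∈ f ys t′ = x , there m , fx

  infix 15 _==_
  -- A Boolean comparison instead of a decision procedure: evaluating a certificate then builds no
  -- proofs, and `==⇒≡` recovers the equation where soundness asks for it.
  _==_ : ∀ {k} → Fin k → Fin k → Bool
  zero == zero = true
  suc i == suc j = i == j
  _ == _ = false

  ==⇒≡ : ∀ {k} {i j : Fin k} → T (i == j) → i ≡ j
  ==⇒≡ {i = zero} {zero} _ = refl
  ==⇒≡ {i = suc i} {suc j} t = cong suc (==⇒≡ t)

  ≡⇒== : ∀ {k} {i j : Fin k} → i ≡ j → T (i == j)
  ≡⇒== {i = zero} refl = tt
  ≡⇒== {i = suc i} refl = ≡⇒== {i = i} refl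

  not-T : ∀ {b} → T (not b) → ¬ T b
  not-T {true} ()

  -- The circle of five classes and the decimal encoding of labels

  prev : Fin 5 → Fin 5
  prev zero = (# 4)
  prev (suc zero) = (# 0)
  prev (suc (suc zero)) = (# 1)
  prev (suc (suc (suc zero))) = (# 2)
  prev (suc (suc (suc (suc zero)))) = (# 3)

  -- shift true and shift false are the classes of the p- and q-parents.
  shift : Bool → Fin 5 → Fin 5
  shift true  i = prev i
  shift false i = prev (prev i)

  -- Labels are the digits 0 to 5. Larger digits collapse to 5; this cannot harm soundness, because
  -- a leaf is judged by the labelling that actually results from its numerals.
  clip : ℕ → Fin 6
  clip 0 = (# 0)
  clip 1 = (# 1)
  clip 2 = (# 2)
  clip 3 = (# 3)
  clip 4 = (# 4)
  clip _ = (# 5)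

  -- These values are 10 to the power k, minus 1: the builtin division helper takes its divisor
  -- diminished by one. The literals cover all names that occur in the certificates, the largest
  -- being 13. From 20 on the divisor is 1, which gives a meaningless but still well-defined digit.
  nines : ℕ → ℕ
  nines 0 = 0
  nines 1 = 9
  nines 2 = 99
  nines 3 = 999
  nines 4 = 9999
  nines 5 = 99999
  nines 6 = 999999
  nines 7 = 9999999
  nines 8 = 99999999
  nines 9 = 999999999
  nines 10 = 9999999999
  nines 11 = 99999999999
  nines 12 = 999999999999
  nines 13 = 9999999999999
  nines 14 = 99999999999999
  nines 15 = 999999999999999
  nines 16 = 9999999999999999
  nines 17 = 99999999999999999
  nines 18 = 999999999999999999
  nines 19 = 9999999999999999999
  nines _ = 0

  -- A whole labelling is packed into one numeral whose decimal digit number k, counted from the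
  -- right starting at 0, is the label of class k or of the vertex with name k. The helpers compute
  -- the quotient by the power of ten and the remainder modulo 10.
  digit : ℕ → ℕ → Fin 6
  digit N k = clip (mod-helper 0 9 (div-helper 0 (nines k) N (nines k)) 9)

  -- Certificate trees over finitely many named vertices

  record Vtx : Set where
    constructor vtx
    field
      name : ℕ
      -- `true` marks a p-parent and `false` a q-parent. Only parents are ever named, and since no
      -- vertex is a parent of both kinds, the vertex determines this field. Two names of different
      -- kinds therefore denote different vertices.
      kind : Bool
      class : Fin 5
  open Vtx public

  -- A refutation: ! is a labelling by six labels (default digits per class, then exceptional digits per vertex), $ an
  -- induced 2K₂, % a case distinction on an adjacency, and new names the f-parent of x.
  data Tree : Set where
    ! : (L E : ℕ) → Tree
    $ : (a b c d : ℕ) → Tree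
    %  : (x y : ℕ) → Tree → Tree → Tree
    new  : (x : ℕ) (f : Bool) (z : ℕ) → Tree → Tree

  -- A pair missing from both `es` and `ns` is undecided. Non-adjacency is never inferred from the
  -- absence of an edge: `ns` contains only what the initial situation or a `%` node has assumed.
  record State : Set where
    constructor state
    field
      vs : List Vtx
      es : List (Vtx × Vtx)
      ns : List (Vtx × Vtx)
  open State public

  link : ℕ → ℕ → ℕ × ℕ → Bool
  link a b (x , y) = ((x ≡ᵇ a) ∧ (y ≡ᵇ b)) ∨ ((x ≡ᵇ b) ∧ (y ≡ᵇ a))

  joins : ℕ → ℕ → Vtx × Vtx → Bool
  joins a b (v , w) = link a b (name v , name w)

  edge? : State → ℕ → ℕ → Bool
  edge? s a b = any (joins a b) (es s)

  nonedge? : State → ℕ → ℕ → Bool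
  nonedge? s a b = any (joins a b) (ns s)

  same : Bool → Bool → Bool
  same true b = b
  same false b = not b

  -- The f-parent of `x` lies in class `i` and is adjacent to `x`. A named vertex therefore differs
  -- from it if it has another kind or another class, or if it is a known non-neighbour of `x`.
  -- Before a tree may add the parent, it has to be in a non-adjacency branch for every named vertex
  -- of the right kind and class.
  apart : State → ℕ → Bool → Fin 5 → Vtx → Bool
  apart s x f i v = nonedge? s x (name v) ∨ not (same f (kind v) ∧ (class v == i))

  fresh? : State → ℕ → Bool → Fin 5 → Bool
  fresh? s x f i = all (apart s x f i) (vs s)

  differs : ℕ → Vtx → Bool
  differs z v = not (name v ≡ᵇ z)

  unused? : State → ℕ → Bool
  unused? s z = all (differs z) (vs s)

  -- In continuation style, so that a name without a vertex makes the check fail instead of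
  -- producing a dummy vertex.
  withVtx : List Vtx → ℕ → (Vtx → Bool) → Bool
  withVtx [] x k = false
  withVtx (v ∷ vs) x k = if name v ≡ᵇ x then k v else withVtx vs x k

  -- Testing a labelling by six labels

  pick : Vtx → Fin 6 → List (Vtx × Fin 6) → List (Vtx × Fin 6)
  pick v zero    r = r
  pick v (suc l) r = (v , suc l) ∷ r

  -- Digit 0 in `E` means that the vertex keeps the label of its class. Exceptional labels are
  -- therefore 1 to 5, and a vertex has label 0 only by default.
  picks : ℕ → List Vtx → List (Vtx × Fin 6)
  picks E [] = []
  picks E (v ∷ vs) = pick v (digit E (name v)) (picks E vs)

  -- Five stored values in place of a function on `Fin 5`: during evaluation, each default label and
  -- each flag of `frees` can be computed once and shared by all later tests.
  data Five (A : Set) : Set where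
    five : A → A → A → A → A → Five A

  at : ∀ {A} → Five A → Fin 5 → A
  at (five a b c d e) zero = a
  at (five a b c d e) (suc zero) = b
  at (five a b c d e) (suc (suc zero)) = c
  at (five a b c d e) (suc (suc (suc zero))) = d
  at (five a b c d e) (suc (suc (suc (suc zero)))) = e

  table : ∀ {A} → (Fin 5 → A) → Five A
  table h = five (h (# 0)) (h (# 1)) (h (# 2)) (h (# 3)) (h (# 4))

  at-table : ∀ {A} (h : Fin 5 → A) i → at (table h) i ≡ h i
  at-table h zero = refl
  at-table h (suc zero) = refl
  at-table h (suc (suc zero)) = refl
  at-table h (suc (suc (suc zero))) = refl
  at-table h (suc (suc (suc (suc zero)))) = refl

  labelOf : Fin 6 → Fin 6 → Fin 6
  labelOf zero    l = l
  labelOf (suc e) l = suc e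

  labelAt : Five (Fin 6) → ℕ → Vtx → Fin 6
  labelAt c E v = labelOf (digit E (name v)) (at c (class v))

  labelled : Five (Fin 6) → ℕ → Vtx × Vtx → (ℕ × Fin 6) × (ℕ × Fin 6)
  labelled c E (v , w) = (name v , labelAt c E v) , (name w , labelAt c E w)

  plain : Bool → Fin 5 → Vtx × Fin 6 → Bool
  plain f i (v , _) = not (same f (kind v) ∧ (class v == i))

  -- If the flag of a class is set, every f-parent in that class carries the default label.
  -- Exceptional vertices of the other kind are allowed there, since they are never f-parents.
  frees : Bool → List (Vtx × Fin 6) → Five Bool
  frees f ps = table λ i → all (plain f i) ps

  module Leaf (c : Five (Fin 6)) (p-free q-free : Five Bool) (ps : List (Vtx × Fin 6))
              (ls : List ((ℕ × Fin 6) × (ℕ × Fin 6))) where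

    cl : Fin 5 → Fin 6
    cl = at c

    free : Bool → Fin 5 → Bool
    free true  = at p-free
    free false = at q-free

    sure : Bool → Fin 5 → Fin 6 → Bool
    sure f i s = (cl (shift f i) == s) ∧ free f (shift f i)

    -- A guarantee for all vertices of the class at once, including the unboundedly many that have
    -- no name. It is the only source of domination for vertices with a default label.
    guar : Fin 5 → Fin 6 → Bool
    guar i s = sure true i s ∨ sure false i s

    reaches : ℕ → Fin 6 → (ℕ × Fin 6) × (ℕ × Fin 6) → Bool
    reaches k s ((x , l) , (y , m)) = ((x ≡ᵇ k) ∧ (m == s)) ∨ ((y ≡ᵇ k) ∧ (l == s))

    domGen : Fin 6 → Fin 6 → Fin 5 → Bool
    domGen s t i = not (cl i == t) ∨ guar i s

    -- An exceptional vertex may use its known edges besides its parents. A named vertex that kept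
    -- the default label is judged by `domGen` together with the rest of its class.
    domExc : Fin 6 → Fin 6 → Vtx × Fin 6 → Bool
    domExc s t (v , l) = not (l == t) ∨ (guar (class v) s ∨ any (reaches (name v) s) ls)

    dom : Fin 6 → Fin 6 → Bool
    dom s t = all (domGen s t) (allFin 5) ∧ all (domExc s t) ps

    isTop : Vtx × Fin 6 → Bool
    isTop (_ , l) = l == (# 5)

    -- The certificates always aim at a partition in which part 5 is a sink. This settles
    -- nonemptiness too: part 5 contains a named vertex by `isTop`, and that vertex has a neighbour
    -- in each part that dominates part 5.
    under : Fin 6 → Bool
    under a = (a == (# 5)) ∨ dom a (# 5)

    ordered : Fin 6 → Fin 6 → Bool
    ordered a b = not (toℕ a <ᵇ toℕ b) ∨ (dom a b ∨ dom b a)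

    row : Fin 6 → Bool
    row a = all (ordered a) (allFin 6)

    ok : Bool
    ok = any isTop ps ∧ (all under (allFin 6) ∧ all row (allFin 6))

  leafOk : Five (Fin 6) → List (Vtx × Fin 6) → List ((ℕ × Fin 6) × (ℕ × Fin 6)) → Bool
  leafOk c ps ls = Leaf.ok c (frees true ps) (frees false ps) ps ls

  leafAt : Five (Fin 6) → ℕ → State → Bool
  leafAt c E s = leafOk c (picks E (vs s)) (map (labelled c E) (es s))

  check : State → Tree → Bool
  check s (! L E) = leafAt (table λ i → digit L (toℕ i)) E s
  check s ($ a b c d) = edge? s a b ∧ edge? s c d ∧ nonedge? s a c ∧ nonedge? s a d ∧ nonedge? s b c ∧ nonedge? s b d
  check s (% x y t u) =
    withVtx (vs s) x λ v → withVtx (vs s) y λ w →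
      check (state (vs s) ((v , w) ∷ es s) (ns s)) t ∧ check (state (vs s) (es s) ((v , w) ∷ ns s)) u
  check s (new x f z t) =
    withVtx (vs s) x λ v → let w = vtx z f (shift f (class v)) in
      fresh? s x f (shift f (class v)) ∧ unused? s z ∧ check (state (w ∷ vs s) ((v , w) ∷ es s) (ns s)) t

open Checker

-- Soundness of the certificate checker

module Soundness where

  same-refl : ∀ f → T (same f f)
  same-refl true = tt
  same-refl false = tt

  implied : ∀ {b c} → T (not b ∨ c) → T b → T c
  implied {true} t _ = t

  refuted : ∀ {b c} → T (b ∨ not c) → T c → T b
  refuted {true} _ _ = tt
  refuted {false} {true} ()

  withVtx-sound : ∀ vs x {k} → T (withVtx vs x k) → ∃ λ v → v ∈ vs × name v ≡ x × T (k v)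
  withVtx-sound (v ∷ vs) x t with name v ≡ᵇ x in eq
  ... | true = v , here refl , ≡ᵇ⇒≡ (name v) x (subst T (≡-sym eq) tt) , t
  ... | false with w , m , e , t′ ← withVtx-sound vs x t = w , there m , e , t′

  module _ {n} (G : Graph n) (cls : Fin n → Fin 5) (par : Bool → Fin n → Fin n)
    (par-cls : ∀ f v → cls (par f v) ≡ shift f (cls v))
    (par-adj : ∀ f v → Adj G (par f v) v)
    (par-disj : ∀ x y → par true x ≢ par false y)
    (2K2-free : TwoK2Free G) (no6 : ¬ UpperDomaticPartition G 6) where

    -- Here the disjointness of p-parents and q-parents enters soundness: the mixed cases contradict
    -- it in either order.
    same-kind : ∀ {f g x y} → par f x ≡ par g y → f ≡ g
    same-kind {true} {true} _ = refl
    same-kind {false} {false} _ = refl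
    same-kind {true} {false} e = contradiction e (par-disj _ _)
    same-kind {false} {true} e = contradiction (≡-sym e) (par-disj _ _)

    record Valid (s : State) (ρ : ℕ → Fin n) : Set where
      field
        in-class : ∀ {v} → v ∈ vs s → cls (ρ (name v)) ≡ class v
        of-kind : ∀ {v} → v ∈ vs s → ∃ λ u → par (kind v) u ≡ ρ (name v)
        distinct : ∀ {v w} → v ∈ vs s → w ∈ vs s → ρ (name v) ≡ ρ (name w) → v ≡ w
        ends : ∀ {e} → e ∈ es s → proj₁ e ∈ vs s × proj₂ e ∈ vs s
        adj : ∀ {e} → e ∈ es s → Adj G (ρ (name (proj₁ e))) (ρ (name (proj₂ e)))
        nonadj : ∀ {v w} → (v , w) ∈ ns s → ¬ Adj G (ρ (name v)) (ρ (name w))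
        nonends : ∀ {e} → e ∈ ns s → proj₁ e ∈ vs s × proj₂ e ∈ vs s
    open Valid

    link-sound : ∀ a b x y → T (link a b (x , y)) → (x ≡ a × y ≡ b) ⊎ (x ≡ b × y ≡ a)
    link-sound a b x y t with ∨-split {(x ≡ᵇ a) ∧ (y ≡ᵇ b)} t
    ... | inj₁ u with p , q ← ∧-split {x ≡ᵇ a} u = inj₁ (≡ᵇ⇒≡ x a p , ≡ᵇ⇒≡ y b q)
    ... | inj₂ u with p , q ← ∧-split {x ≡ᵇ b} u = inj₂ (≡ᵇ⇒≡ x b p , ≡ᵇ⇒≡ y a q)

    edge-sound : ∀ {s ρ} a b → Valid s ρ → T (edge? s a b) → Adj G (ρ a) (ρ b)
    edge-sound {s} a b V t with (v , w) , m , l ← any-∈ (joins a b) (es s) t with link-sound a b (name v) (name w) l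
    ... | inj₁ (refl , refl) = adj V m
    ... | inj₂ (refl , refl) = sym G (adj V m)

    nonedge-sound : ∀ {s ρ} a b → Valid s ρ → T (nonedge? s a b) → ¬ Adj G (ρ a) (ρ b)
    nonedge-sound {s} a b V t with (v , w) , m , l ← any-∈ (joins a b) (ns s) t with link-sound a b (name v) (name w) l
    ... | inj₁ (refl , refl) = nonadj V m
    ... | inj₂ (refl , refl) = nonadj V m ∘ sym G

    module _ {s : State} {ρ : ℕ → Fin n} (V : Valid s ρ) (c : Five (Fin 6)) (E : ℕ) where
      open Leaf c (frees true (picks E (vs s))) (frees false (picks E (vs s))) (picks E (vs s)) (map (labelled c E) (es s))

      private
        exc : Vtx → Fin 6
        exc v = digit E (name v)

        both : ∀ {a b} → T a → T b → T (a ∧ b)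
        both {true} {true} _ _ = tt

      picks⁻ : ∀ us {v l} → (v , l) ∈ picks E us → v ∈ us × exc v ≡ l × l ≢ zero
      picks⁻ (u ∷ us) m with digit E (name u) in eq
      ... | zero = let i , r = picks⁻ us m in there i , r
      picks⁻ (u ∷ us) (here refl) | suc l = here refl , eq , λ ()
      picks⁻ (u ∷ us) (there m) | suc l = let i , r = picks⁻ us m in there i , r

      picks⁺ : ∀ us {v} → v ∈ us → exc v ≢ zero → (v , exc v) ∈ picks E us
      picks⁺ (u ∷ us) {v} (here refl) ne with digit E (name u)
      ... | zero = contradiction refl ne
      ... | suc l = here refl
      picks⁺ (u ∷ us) {v} (there m) ne with digit E (name u)
      ... | zero = picks⁺ us m ne
      ... | suc l = there (picks⁺ us m ne)

      -- The first exceptional name that denotes `v` decides its label; by `distinct` a vertex has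
      -- at most one. The search compares elements of `Fin n`, which is decidable, and never asks
      -- about adjacency.
      label-in : List Vtx → Fin n → Fin 6
      label-in [] v = cl (cls v)
      label-in (w ∷ ws) v with exc w | ρ (name w) ≟ v
      ... | suc l | yes _ = suc l
      ... | _ | _ = label-in ws v

      label : Fin n → Fin 6
      label = label-in (vs s)

      -- An earlier exceptional match `u` would denote the same vertex as `w`, and `distinct` then
      -- identifies `u` with `w`.
      label-exc : ∀ ws {w v} → (∀ {u} → u ∈ ws → u ∈ vs s) → w ∈ ws → exc w ≢ zero → ρ (name w) ≡ v →
        label-in ws v ≡ exc w
      label-exc (u ∷ ws) {w} {v} sub m ne e with exc u in x | ρ (name u) ≟ v
      ... | suc l | yes e′ with refl ← distinct V (sub (here refl)) (sub m) (trans e′ (≡-sym e)) = ≡-sym x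
      label-exc (u ∷ ws) sub (there m) ne e | suc _ | no _ = label-exc ws (sub ∘ there) m ne e
      label-exc (u ∷ ws) sub (here refl) ne e | suc _ | no ne′ = contradiction e ne′
      label-exc (u ∷ ws) sub (there m) ne e | zero | _ = label-exc ws (sub ∘ there) m ne e
      label-exc (u ∷ ws) sub (here refl) ne e | zero | _ = contradiction x ne

      label-gen : ∀ ws v → (∀ {u} → u ∈ ws → exc u ≢ zero → ρ (name u) ≢ v) → label-in ws v ≡ cl (cls v)
      label-gen [] v h = refl
      label-gen (u ∷ ws) v h with exc u in x | ρ (name u) ≟ v
      ... | suc _ | yes e = contradiction e (h (here refl) λ z → contradiction (trans (≡-sym x) z) λ ())
      ... | suc _ | no _ = label-gen ws v (h ∘ there)
      ... | zero | _ = label-gen ws v (h ∘ there)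

      -- Domination is tested differently for exceptional and for default labels. This splits the
      -- vertices accordingly and remembers which name gave an exceptional label.
      label-view : ∀ ws v → (∃ λ u → u ∈ ws × exc u ≢ zero × ρ (name u) ≡ v × label-in ws v ≡ exc u)
        ⊎ label-in ws v ≡ cl (cls v)
      label-view [] v = inj₂ refl
      label-view (u ∷ ws) v with exc u in x | ρ (name u) ≟ v
      ... | suc _ | yes e = inj₁ (u , here refl , (λ z → contradiction (trans (≡-sym x) z) λ ()) , e , ≡-sym x)
      ... | suc _ | no _ with label-view ws v
      ...   | inj₁ (w , m , r) = inj₁ (w , there m , r)
      ...   | inj₂ e = inj₂ e
      label-view (u ∷ ws) v | zero | _ with label-view ws v
      ...   | inj₁ (w , m , r) = inj₁ (w , there m , r)
      ...   | inj₂ e = inj₂ e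

      -- The label of a named vertex can be read off its own digit: if that digit is 0, no other
      -- name gives the vertex an exceptional label, because `distinct` would identify the two
      -- names.
      label-known : ∀ {w} → w ∈ vs s → label (ρ (name w)) ≡ labelAt c E w
      label-known {w} m with exc w in x
      ... | suc l = trans (label-exc (vs s) (λ i → i) m (λ z → contradiction (trans (≡-sym x) z) λ ()) refl) x
      ... | zero = trans (label-gen (vs s) (ρ (name w)) ne) (cong cl (in-class V m))
        where
        ne : ∀ {u} → u ∈ vs s → exc u ≢ zero → ρ (name u) ≢ ρ (name w)
        ne i t e with refl ← distinct V i m e = t x

      free-sound : ∀ f i → T (free f i) → T (all (plain f i) (picks E (vs s)))
      free-sound true i = subst T (at-table (λ i → all (plain true i) (picks E (vs s))) i)
      free-sound false i = subst T (at-table (λ i → all (plain false i) (picks E (vs s))) i)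

      -- The parent has the default label unless it is one of the exceptional vertices. Such a
      -- vertex is a parent of its own kind, so by `same-kind` its kind would be `f`, and its class
      -- would be that of the parent. The freeness test excludes an exceptional vertex with this
      -- kind and class.
      sure-sound : ∀ f i t v → cls v ≡ i → T (sure f i t) → label (par f v) ≡ t
      sure-sound f i t v refl u with e , fr ← ∧-split {cl (shift f i) == t} u =
        trans (label-gen (vs s) (par f v) ne) (trans (cong cl (par-cls f v)) (==⇒≡ e))
        where
        ne : ∀ {u} → u ∈ vs s → exc u ≢ zero → ρ (name u) ≢ par f v
        ne {u} m x e′ with _ , k ← of-kind V m with refl ← same-kind (trans k e′) =
          not-T (all-∈ (plain f (shift f (cls v))) (free-sound f (shift f (cls v)) fr) (picks⁺ (vs s) m x))
            (both (same-refl f) (≡⇒== (trans (≡-sym (in-class V m)) (trans (cong cls e′) (par-cls f v)))))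

      guar-sound : ∀ i t v → cls v ≡ i → T (guar i t) → ∃ λ u → label u ≡ t × Adj G u v
      guar-sound i t v e g with ∨-split {sure true i t} g
      ... | inj₁ h = par true v , sure-sound true i t v e h , par-adj true v
      ... | inj₂ h = par false v , sure-sound false i t v e h , par-adj false v

      -- The test works on labels stored with the names of the two ends. `ends` puts both ends among
      -- the listed vertices, and `label-known` then turns the stored labels into the true ones.
      near-sound : ∀ {w} t → T (any (reaches (name w) t) (map (labelled c E) (es s))) → ∃ λ u → label u ≡ t × Adj G u (ρ (name w))
      near-sound {w} t h = from-edge (∈-map⁻ (labelled c E) (proj₁ (proj₂ found))) (proj₂ (proj₂ found))
        where
        found = any-∈ (reaches (name w) t) (map (labelled c E) (es s)) h
        from-edge : ∀ {z} → (∃ λ e → e ∈ es s × z ≡ labelled c E e) → T (reaches (name w) t z) → ∃ λ u → label u ≡ t × Adj G u (ρ (name w))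
        from-edge ((x , y) , i , refl) l with ∨-split {(name x ≡ᵇ name w) ∧ (labelAt c E y == t)} l
        ... | inj₁ l₁ with p , q ← ∧-split {name x ≡ᵇ name w} l₁ =
          ρ (name y) , trans (label-known (proj₂ (ends V i))) (==⇒≡ q) ,
          subst (Adj G _) (cong ρ (≡ᵇ⇒≡ (name x) (name w) p)) (sym G (adj V i))
        ... | inj₂ l₂ with p , q ← ∧-split {name y ≡ᵇ name w} l₂ =
          ρ (name x) , trans (label-known (proj₁ (ends V i))) (==⇒≡ q) ,
          subst (Adj G _) (cong ρ (≡ᵇ⇒≡ (name y) (name w) p)) (adj V i)

      dom-exc : ∀ a {w} v → w ∈ vs s → ρ (name w) ≡ v →
        T (guar (class w) a ∨ any (reaches (name w) a) (map (labelled c E) (es s))) → ∃ λ u → label u ≡ a × Adj G u v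
      dom-exc a {w} v m refl h with ∨-split {guar (class w) a} h
      ... | inj₁ g = guar-sound (class w) a v (in-class V m) g
      ... | inj₂ g = near-sound {w} a g

      dom-sound : ∀ a b → T (dom a b) → Dominates G label a b
      dom-sound a b t v e = go (label-view (vs s) v)
        where
        halves = ∧-split {all (domGen a b) (allFin 5)} t
        go : (∃ λ u → u ∈ vs s × exc u ≢ zero × ρ (name u) ≡ v × label v ≡ exc u) ⊎ label v ≡ cl (cls v) →
          ∃ λ u → label u ≡ a × Adj G u v
        go (inj₂ c) = guar-sound (cls v) a v refl
          (implied (all-∈ (domGen a b) (proj₁ halves) (∈-allFin (cls v))) (≡⇒== (trans (≡-sym c) e)))
        go (inj₁ (w , m , x , r , c)) = dom-exc a v m r
          (implied (all-∈ (domExc a b) (proj₂ halves) (picks⁺ (vs s) m x)) (≡⇒== (trans (≡-sym c) e)))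

      leaf-sound : T ok → ⊥
      leaf-sound t = no6 ((label , nonempty) , compare)
        where
        t₁ = ∧-split {any isTop (picks E (vs s))} t
        t₂ = ∧-split {all under (allFin 6)} (proj₂ t₁)
        peak = any-∈ isTop (picks E (vs s)) (proj₁ t₁)
        w = proj₁ (proj₁ peak)
        x = picks⁻ (vs s) (proj₁ (proj₂ peak))

        label-top : label (ρ (name w)) ≡ # 5
        label-top = trans (label-exc (vs s) (λ i → i) (proj₁ x) (λ z → proj₂ (proj₂ x) (trans (≡-sym (proj₁ (proj₂ x))) z)) refl)
          (trans (proj₁ (proj₂ x)) (==⇒≡ (proj₂ (proj₂ peak))))

        nonempty : ∀ a → ∃ λ v → label v ≡ a
        nonempty a with ∨-split {a == (# 5)} (all-∈ under (proj₁ t₂) (∈-allFin a))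
        ... | inj₁ e = ρ (name w) , trans label-top (≡-sym (==⇒≡ e))
        ... | inj₂ d with v , e , _ ← dom-sound a (# 5) d (ρ (name w)) label-top = v , e

        either-sound : ∀ a b → toℕ a < toℕ b → Dominates G label a b ⊎ Dominates G label b a
        either-sound a b a<b with ∨-split {dom a b} (implied (all-∈ (ordered a) (all-∈ row (proj₂ t₂) (∈-allFin a)) (∈-allFin b)) (<⇒<ᵇ a<b))
        ... | inj₁ p = inj₁ (dom-sound a b p)
        ... | inj₂ p = inj₂ (dom-sound b a p)

        compare : ∀ a b → a ≢ b → Dominates G label a b ⊎ Dominates G label b a
        compare a b a≢b with <-cmp (toℕ a) (toℕ b)
        ... | tri< a<b _ _ = either-sound a b a<b
        ... | tri≈ _ e _ = contradiction (toℕ-injective e) a≢b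
        ... | tri> _ _ b<a = swap (either-sound b a b<a)

    -- Induction on the tree. The interpretation of the names varies along the way, since `new`
    -- extends it, whereas the graph and its parents stay fixed.
    sound : ∀ s t {ρ} → T (check s t) → Valid s ρ → ⊥
    sound s (! L E) h V = leaf-sound V (table λ i → digit L (toℕ i)) E h
    sound s ($ a b c d) {ρ} h V = 2K2-free (ρ a) (ρ b) (ρ c) (ρ d)
      -- 2K2-freeness is stated for four distinct vertices. The known adjacencies provide this:
      -- identifying the two ends of an edge contradicts irreflexivity, and identifying ends of
      -- different edges would turn one of the edges into a pair that is known to be non-adjacent.
      (λ e → irrefl G (ρ b) (subst (λ z → Adj G z (ρ b)) e ab)) (λ e → nbc (sym G (subst (λ z → Adj G z (ρ b)) e ab)))
      (λ e → nbd (sym G (subst (λ z → Adj G z (ρ b)) e ab))) (λ e → nac (subst (Adj G (ρ a)) e ab))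
      (λ e → nad (subst (Adj G (ρ a)) e ab)) (λ e → irrefl G (ρ d) (subst (λ z → Adj G z (ρ d)) e cd))
      ab cd nac nad nbc nbd
      where
      h₁ = ∧-split {edge? s a b} h
      h₂ = ∧-split {edge? s c d} (proj₂ h₁)
      h₃ = ∧-split {nonedge? s a c} (proj₂ h₂)
      h₄ = ∧-split {nonedge? s a d} (proj₂ h₃)
      h₅ = ∧-split {nonedge? s b c} (proj₂ h₄)
      ab = edge-sound a b V (proj₁ h₁)
      cd = edge-sound c d V (proj₁ h₂)
      nac = nonedge-sound a c V (proj₁ h₃)
      nad = nonedge-sound a d V (proj₁ h₄)
      nbc = nonedge-sound b c V (proj₁ h₅)
      nbd = nonedge-sound b d V (proj₂ h₅)
    sound s (% x y t u) {ρ} h V with v , v∈ , refl , h′ ← withVtx-sound (vs s) x h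
      with w , w∈ , refl , h″ ← withVtx-sound (vs s) y h′ =
      sound _ u (proj₂ hs) record
        { in-class = in-class V ; of-kind = of-kind V ; distinct = distinct V ; ends = ends V ; adj = adj V
        ; nonends = λ { (here refl) → v∈ , w∈ ; (there m) → nonends V m }
        -- The case distinction is made without deciding adjacency: the refutation of the first
        -- subtree, read as a function of the assumed edge, is the proof of non-adjacency on which
        -- the second subtree runs.
        ; nonadj = λ { (here refl) e → sound _ t (proj₁ hs) (with-edge e) ; (there m) → nonadj V m } }
      where
      hs = ∧-split {check (state (vs s) ((v , w) ∷ es s) (ns s)) t} h″
      with-edge : Adj G (ρ (name v)) (ρ (name w)) → Valid (state (vs s) ((v , w) ∷ es s) (ns s)) ρ
      with-edge e = record
        { in-class = in-class V ; of-kind = of-kind V ; distinct = distinct V ; nonadj = nonadj V ; nonends = nonends V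
        ; ends = λ { (here refl) → v∈ , w∈ ; (there m) → ends V m }
        ; adj = λ { (here refl) → e ; (there m) → adj V m } }
    sound s (new x f z t) {ρ} h V with v , v∈ , refl , h′ ← withVtx-sound (vs s) x h = sound _ t {ρ′} (proj₂ h₂) record
        { in-class = λ { (here refl) → trans (cong cls ρ′z) (trans (par-cls f u) (cong (shift f) (in-class V v∈)))
                       ; (there m) → trans (cong cls (old m)) (in-class V m) }
        ; of-kind = λ { (here refl) → u , ≡-sym ρ′z
                      ; (there m) → let y , e = of-kind V m in y , trans e (≡-sym (old m)) }
        ; distinct = λ { (here refl) (here refl) _ → refl
                       ; (here refl) (there m) e → contradiction (trans (≡-sym ρ′z) (trans e (old m))) (other m)
                       ; (there m) (here refl) e → contradiction (trans (≡-sym ρ′z) (trans (≡-sym e) (old m))) (other m)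
                       ; (there m) (there m′) e → distinct V m m′ (trans (≡-sym (old m)) (trans e (old m′))) }
        ; ends = λ { (here refl) → there v∈ , here refl ; (there m) → let p , q = ends V m in there p , there q }
        ; adj = λ { (here refl) → subst₂ (Adj G) (≡-sym (old v∈)) (≡-sym ρ′z) (sym G (par-adj f u))
                  ; (there m) → subst₂ (Adj G) (≡-sym (old (proj₁ (ends V m)))) (≡-sym (old (proj₂ (ends V m)))) (adj V m) }
        ; nonends = λ m → let p , q = nonends V m in there p , there q
        ; nonadj = λ m e → nonadj V m (subst₂ (Adj G) (old (proj₁ (nonends V m))) (old (proj₂ (nonends V m))) e) }
      where
      u = ρ (name v)
      i = shift f (class v)
      h₁ = ∧-split {fresh? s (name v) f i} h′
      h₂ = ∧-split {unused? s z} (proj₂ h₁)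
      ρ′ : ℕ → Fin n
      ρ′ k = if k ≡ᵇ z then par f u else ρ k
      ρ′z : ρ′ z ≡ par f u
      ρ′z with z ≡ᵇ z in e
      ... | true = refl
      ... | false = ⊥-elim (subst T e (≡⇒≡ᵇ z z refl))
      old : ∀ {y} → y ∈ vs s → ρ′ (name y) ≡ ρ (name y)
      old {y} m with name y ≡ᵇ z in e
      ... | false = refl
      ... | true = contradiction (subst T (≡-sym e) tt) (not-T (all-∈ (differs z) (proj₁ h₂) m))
      -- If the parent of `u` already had the name of `y`, then `y` would have kind `f` and class
      -- `i`, and the freshness test would have certified it as a non-neighbour of `u`; but a parent
      -- is adjacent to its child.
      other : ∀ {y} → y ∈ vs s → par f u ≢ ρ (name y)
      other {y} m e with _ , k ← of-kind V m with refl ← same-kind (trans k (≡-sym e)) =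
        nonedge-sound (name v) (name y) V
          (refuted (all-∈ (apart s (name v) f i) (proj₁ h₁) m)
            (both (same-refl f) (≡⇒== (trans (≡-sym (in-class V m)) (trans (cong cls (≡-sym e)) (trans (par-cls f u) (cong (shift f) (in-class V v∈))))))))
          (subst (Adj G u) e (sym G (par-adj f u)))
        where
        both : ∀ {a b} → T a → T b → T (a ∧ b)
        both {true} {true} _ _ = tt

open Soundness

-- Initial states of a refutation

module Refutation where

  -- The checks below are stated as equations: Agda evaluates a type T (check s t) many times while checking a definition.
  passed : ∀ s t → check s t ≡ true → T (check s t)
  passed s t e = subst T (≡-sym e) tt

  same⇒≡ : ∀ {f g} → T (same f g) → f ≡ g
  same⇒≡ {true} {true} _ = refl
  same⇒≡ {false} {false} _ = refl

  eqVtx : Vtx → Vtx → Bool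
  eqVtx v w = (name v ≡ᵇ name w) ∧ (same (kind v) (kind w) ∧ (class v == class w))

  eqVtx-sound : ∀ v w → T (eqVtx v w) → v ≡ w
  eqVtx-sound (vtx x f i) (vtx y g j) t with p , q ← ∧-split {x ≡ᵇ y} t with r , s ← ∧-split {same f g} q
    with refl ← ≡ᵇ⇒≡ x y p | refl ← same⇒≡ {f} {g} r | refl ← ==⇒≡ {i = i} {j} s = refl

  present : List Vtx → Vtx → Bool
  present vs v = any (eqVtx v) vs

  present-sound : ∀ vs v → T (present vs v) → v ∈ vs
  present-sound vs v t with w , m , e ← any-∈ (eqVtx v) vs t with refl ← eqVtx-sound v w e = m

  endsIn : List Vtx → Vtx × Vtx → Bool
  endsIn vs (v , w) = present vs v ∧ present vs w

  listed : Vtx → Vtx → ℕ × ℕ → Bool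
  listed v w = λ (x , y) → link (name v) (name w) (x , y)

  -- Two initial vertices are told apart by their kinds, because the two kinds of parents are
  -- disjoint, or by their classes. If both agree, their difference is an assumption that has to be
  -- listed in `ds`.
  separate : List (ℕ × ℕ) → Vtx → Vtx → Bool
  separate ds v w = eqVtx v w ∨ (not (same (kind v) (kind w) ∧ (class v == class w)) ∨ any (listed v w) ds)

  separated : List Vtx → List (ℕ × ℕ) → Bool
  separated vs ds = all (λ v → all (separate ds v) vs) vs

  wellFormed : State → List (ℕ × ℕ) → Bool
  wellFormed s ds = separated (vs s) ds ∧ (all (endsIn (vs s)) (es s) ∧ all (endsIn (vs s)) (ns s))

  module _ {n} (G : Graph n) (cls : Fin n → Fin 5) (par : Bool → Fin n → Fin n)
    (par-cls : ∀ f v → cls (par f v) ≡ shift f (cls v))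
    (par-adj : ∀ f v → Adj G (par f v) v)
    (par-disj : ∀ x y → par true x ≢ par false y)
    (2K2-free : TwoK2Free G) (no6 : ¬ UpperDomaticPartition G 6) where

    Placed : (ℕ → Fin n) → Vtx → Set
    Placed ρ v = cls (ρ (name v)) ≡ class v × (∃ λ u → par (kind v) u ≡ ρ (name v))

    refute : ∀ s ds t (ρ : ℕ → Fin n) → T (wellFormed s ds) → T (check s t) → All (Placed ρ) (vs s) →
      All (λ e → Adj G (ρ (name (proj₁ e))) (ρ (name (proj₂ e)))) (es s) →
      All (λ e → ¬ Adj G (ρ (name (proj₁ e))) (ρ (name (proj₂ e)))) (ns s) →
      All (λ d → ρ (proj₁ d) ≢ ρ (proj₂ d)) ds → ⊥
    refute s ds t ρ wf h placed edges nonedges apart′ =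
      sound G cls par par-cls par-adj par-disj 2K2-free no6 s t h record
        { in-class = λ m → proj₁ (All.lookup placed m)
        ; of-kind = λ m → proj₂ (All.lookup placed m)
        ; distinct = distinct′
        ; ends = λ {e} m → ends′ e (all-∈ (endsIn (vs s)) (proj₁ w₂) m)
        ; adj = λ m → All.lookup edges m
        ; nonadj = λ m → All.lookup nonedges m
        ; nonends = λ {e} m → ends′ e (all-∈ (endsIn (vs s)) (proj₂ w₂) m) }
      where
      w₁ = ∧-split {separated (vs s) ds} wf
      w₂ = ∧-split {all (endsIn (vs s)) (es s)} (proj₂ w₁)
      ends′ : ∀ e → T (endsIn (vs s) e) → proj₁ e ∈ vs s × proj₂ e ∈ vs s
      ends′ (v , w) u with p , q ← ∧-split {present (vs s) v} u = present-sound (vs s) v p , present-sound (vs s) w q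
      both : ∀ {a b} → T a → T b → T (a ∧ b)
      both {true} {true} _ _ = tt
      distinct′ : ∀ {v w} → v ∈ vs s → w ∈ vs s → ρ (name v) ≡ ρ (name w) → v ≡ w
      distinct′ {v} {w} m m′ e
        with ∨-split {eqVtx v w} (all-∈ (separate ds v) (all-∈ (λ v → all (separate ds v) (vs s)) (proj₁ w₁) m) m′)
      ... | inj₁ p = eqVtx-sound v w p
      ... | inj₂ p with ∨-split {not (same (kind v) (kind w) ∧ (class v == class w))} p
      ...   | inj₁ q with c , (_ , k) ← All.lookup placed m | c′ , (_ , k′) ← All.lookup placed m′ =
        -- Equal values force equal kinds, by disjointness of the parents, and equal classes,
        -- contrary to the test.
        contradiction (both (subst (λ g → T (same (kind v) g)) (same-kind G cls par par-cls par-adj par-disj 2K2-free no6 (trans k (trans e (≡-sym k′)))) (same-refl (kind v)))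
          (≡⇒== (trans (≡-sym c) (trans (cong cls e) c′)))) (not-T q)
      ...   | inj₂ q with (x , y) , i , l ← any-∈ (listed v w) ds q
        with link-sound G cls par par-cls par-adj par-disj 2K2-free no6 (name v) (name w) x y l
      ...     | inj₁ (refl , refl) = contradiction e (All.lookup apart′ i)
      ...     | inj₂ (refl , refl) = contradiction (≡-sym e) (All.lookup apart′ i)

open Refutation

-- Certificates for orbits that do not close after five steps

module OrbitTrees where

  -- Vertex k+1 is the parent of vertex k along one orbit, so all names have the same kind. The
  -- default numeral is always 0: the parents of the other kind then all have label 0, and part 0
  -- dominates every other part through them. A leaf thus amounts to five sets of orbit vertices,
  -- labelled 1 to 5, that are pairwise comparable along known edges, with set 5 dominated by the
  -- other four.
  p0 = % 2 5 (! 0 134212112531) ($ 1 2 4 5)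
  p1 = % 1 10 (% 1 8 (% 6 10 (! 0 132114211251) (% 5 10 (% 6 9 (! 0 12314321250) (% 7 9 (! 0 143213210051) (% 7 10 (! 0 41321321250) ($ 6 7 9 10)))) (% 5 9 (% 6 11 (! 0 212314311250) (% 5 11 (% 2 8 (! 0 13413211250) (% 2 9 (! 0 114313521220) (% 3 8 (! 0 132412123150) (% 3 9 (! 0 124313521021) ($ 2 3 8 9))))) ($ 5 6 10 11))) (% 6 9 (% 4 9 (! 0 124125132130) (% 4 10 (! 0 142311231250) ($ 4 5 9 10))) ($ 5 6 9 10))))) (% 2 8 (% 5 10 (! 0 142112312351) (% 6 9 (! 0 123114212351) (% 6 10 (! 0 132114211251) (% 5 9 (% 1 5 (! 0 123112412351) (% 2 5 (! 0 132112312451) (% 2 9 (! 0 123113212451) ($ 1 2 5 9)))) ($ 5 6 9 10))))) (% 2 9 (% 2 7 (! 0 123113212451) (% 1 7 (% 2 6 (! 0 21013212451) (% 3 6 (! 0 132124123150) (% 3 7 (! 0 132142123150) ($ 2 3 6 7)))) ($ 1 2 7 8))) ($ 1 2 8 9)))) (% 6 10 (% 2 10 (% 4 7 (! 0 142135121321) (% 5 7 (! 0 142115321321) (% 5 8 (! 0 142115321321) (% 4 8 (% 0 9 (! 0 143215211231) (% 0 10 (% 3 9 (! 0 143215211231) (% 4 9 (! 0 143215211231) (% 4 10 (% 0 7 (! 0 142135212312) (% 0 8 (! 0 40125132132) (% 1 7 (! 0 142135101321) (% 1 8 (! 0 31421251230) ($ 0 1 7 8))))) (% 3 10 (% 0 7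 (! 0 142135212312) (% 0 8 (! 0 40125123132) (% 1 7 (! 0 142135101321) (% 1 8 (! 0 11421132352) ($ 0 1 7 8))))) ($ 3 4 9 10))))) ($ 0 1 9 10))) ($ 4 5 7 8))))) (% 2 9 (% 4 10 (! 0 143125121231) (% 5 10 (! 0 143115211231) (% 4 9 (% 1 4 (! 0 132124121351) (% 1 5 (! 0 132114211351) (% 2 4 (! 0 134212012531) p0))) (% 5 9 (% 1 4 (! 0 132124121351) (% 1 5 (! 0 132114211351) (% 2 4 (! 0 14212312531) p0))) ($ 4 5 9 10))))) ($ 1 2 9 10))) (% 6 9 (% 2 9 (% 4 7 (! 0 124135121321) (% 5 7 (! 0 14215321321) (% 5 8 (! 0 14315211231) (% 4 8 (% 5 10 (! 0 134115211231) (% 5 11 (! 0 114215321321) (% 6 11 (! 0 214315021231) ($ 5 6 10 11)))) ($ 4 5 7 8))))) (% 2 10 (% 1 8 (! 0 13214212351) (% 2 8 (% 3 8 (! 0 13412012531) (% 3 9 (! 0 134215211231) (% 4 8 (! 0 132411231520) (% 4 9 (! 0 134215211231) ($ 3 4 8 9))))) ($ 1 2 8 9))) ($ 1 2 9 10))) ($ 1 6 9 10)))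
  p2 = % 8 11 (! 0 112431352120) ($ 7 8 10 11)
  p3 = % 7 10 (! 0 21341321251) (% 7 11 (! 0 211341321251) (% 8 10 (! 0 112431352120) p2))
  p4 = % 5 7 (! 0 1231421251) (% 4 7 (% 7 10 (! 0 132141321251) (% 8 10 (! 0 12341321251) (% 8 11 (! 0 112341321251) (% 7 11 (% 2 8 (! 0 1241231351) (% 2 9 (! 0 212041231351) (% 3 8 (! 0 12341321251) (% 3 9 (% 3 11 (! 0 321041321251) (% 7 9 (! 0 123141321251) (% 9 11 (! 0 312041321251) (% 3 7 (% 4 9 (! 0 1230245210) (% 4 10 (! 0 212041253131) (% 5 9 (! 0 123131421251) (% 5 10 (! 0 132131421251) ($ 4 5 9 10))))) ($ 3 9 7 11))))) ($ 2 3 8 9))))) ($ 7 8 10 11))))) (% 4 8 (% 5 10 (! 0 21231431251) (% 5 11 (! 0 211231431251) (% 1 10 (% 4 10 (% 1 8 (! 0 11431352120) (% 1 9 (! 0 142132132150) (% 5 8 (! 0 1231431251) (% 5 9 (! 0 132121432150) ($ 1 5 8 9))))) (% 4 11 p3 ($ 4 5 10 11))) (% 1 11 (% 4 11 p3 (% 4 10 (% 7 10 (! 0 21341321251) (% 7 11 (! 0 211341321251) (% 8 10 (! 0 241320152110) p2))) ($ 4 5 10 11))) ($ 1 5 10 11))))) (% 5 8 (% 2 10 (! 0 21321421351) (% 2 11 (! 0 211321421351) (% 1 10 (% 3 11 (! 0 231321421051) (% 3 10 (% 2 6 (! 0 132113421250) (% 2 7 (! 0 1321421351) (% 3 6 (!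 0 132123421051) (% 3 7 (! 0 21241303151) ($ 2 3 6 7))))) ($ 2 3 10 11))) (% 1 11 (% 2 9 (! 0 212311421351) (% 1 9 (% 2 6 (! 0 212312411351) (% 2 7 (! 0 1321421351) (% 3 6 (! 0 123123421050) (% 3 7 (! 0 213241123150) ($ 2 3 6 7))))) ($ 1 2 9 10))) ($ 1 2 10 11))))) ($ 4 5 7 8))))
  p5 = % 5 10 (! 0 142132311251) (% 6 10 (! 0 142123112351) ($ 1 10 5 6))
  p6 = % 5 9 (! 0 124132311251) (% 6 9 (! 0 124123112351) ($ 1 9 5 6))
  p7 = % 2 5 (% 0 5 (% 4 7 (% 4 9 (! 0 123142152132) (% 4 10 (! 0 132142152132) (% 5 9 (% 1 9 (! 0 123142132152) (% 1 10 (! 0 21241231351) (% 2 9 (! 0 14210321521) (% 2 10 (! 0 122120431531) ($ 1 2 9 10))))) (% 5 10 (% 1 8 (! 0 1241231351) (% 1 9 (! 0 123142132152) (% 2 8 (! 0 21221431531) (% 2 9 (! 0 122120431531) ($ 1 2 8 9))))) ($ 4 5 9 10))))) (% 5 7 (% 3 8 (! 0 12341521321) (% 4 8 (! 0 1241531231) (% 3 7 (% 1 9 (! 0 123142123152) (% 1 10 (! 0 132142123152) (% 2 9 (! 0 123130421521) (% 2 10 (! 0 132130421521) ($ 1 2 9 10))))) ($ 3 4 7 8)))) (% 1 4 (% 4 8 (! 0 1321241351) (% 5 8 (% 2 7 (! 0 132112452) (% 2 8 (! 0 1321231451) (% 3 7 (! 0 12341112352) (% 3 8 (! 0 12431531221)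 ($ 2 3 7 8))))) ($ 4 5 7 8))) ($ 1 7 4 5)))) (% 0 6 (% 1 4 (% 2 9 (! 0 13211231452) (% 2 10 (! 0 132111231452) (% 1 10 p5 (% 1 9 p6 ($ 1 2 9 10))))) (% 0 4 (% 1 9 p6 (% 1 10 p5 (% 0 9 (% 0 2 (! 0 13212311425) (% 2 9 (! 0 14211231325) (% 5 9 (! 0 14211321235) ($ 0 9 2 5)))) (% 0 10 (% 0 2 (! 0 132112311425) (% 2 10 (! 0 142111231325) (% 5 10 (! 0 142111321235) ($ 0 10 2 5)))) ($ 0 1 9 10))))) ($ 0 1 4 5))) ($ 0 1 5 6))) (% 2 6 (% 1 4 (% 2 9 (! 0 123132121451) (% 2 10 (! 0 132132121451) (% 1 10 (% 6 10 (! 0 142123132150) (% 5 10 (% 3 5 (! 0 142112321350) (% 3 10 (! 0 142132123150) ($ 2 3 5 10))) ($ 1 10 5 6))) (% 1 9 (% 6 9 (! 0 124123132150) (% 6 10 (% 4 6 (! 0 123123142150) (% 4 10 (! 0 132132142150) ($ 1 4 6 10))) ($ 2 6 9 10))) ($ 1 2 9 10))))) (% 2 4 (% 1 9 (! 0 123123112451) (% 1 10 (! 0 132123112451) (% 2 9 (% 7 9 (! 0 124131231521) (% 7 10 (% 2 7 (! 0 132141231521) (% 2 10 (! 0 142131231521) (% 4 7 (! 0 123131241521) (% 4 10 (! 0 132121241531) ($ 2 4 7 10))))) ($ 1 7 9 10))) (% 2 10 (% 4 9 (! 0 123121241531) (% 4 10 (! 0 132101241521) (% 5 10 (! 0 142121321531)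 (% 5 9 ($ 1 2 5 9) ($ 4 5 9 10))))) ($ 1 2 9 10))))) ($ 1 2 4 5))) ($ 1 2 5 6))
  p8 = % 2 8 (% 5 9 (! 0 12314312512) (% 6 8 (! 0 12413211521) (% 6 9 (% 0 11 (! 0 212314212513) (% 1 10 (! 0 123104212531) (% 1 11 (! 0 213214211531) (% 0 10 (% 0 3 (! 0 12314212513) (% 0 4 (! 0 123124132115) (% 1 3 (! 0 123104212531) (% 1 4 (! 0 13214011532) ($ 0 1 3 4))))) ($ 0 1 10 11))))) (% 5 8 (% 2 9 (! 0 123124321521) (% 2 10 (! 0 132124321521) (% 3 9 (! 0 12412313510) (% 3 10 (! 0 21214313512) ($ 2 3 9 10))))) ($ 5 6 8 9))))) (% 1 8 (% 6 9 (% 2 9 (! 0 14213211521) (% 3 9 (! 0 124315211321) (% 3 8 (% 1 9 (! 0 14315211321) (% 1 10 (! 0 123411012351) (% 2 10 (! 0 13214212531) ($ 1 2 9 10)))) ($ 2 3 8 9)))) (% 2 9 (% 0 9 (! 0 124313211521) (% 0 10 (! 0 123114212513) (% 6 10 (% 0 4 (! 0 123114211523) (% 0 5 (! 0 123124321521) (% 1 4 (! 0 132124121530) (% 1 5 (! 0 13212311451) ($ 0 1 4 5))))) ($ 0 6 9 10)))) (% 6 8 (% 5 9 (! 0 12415311231) (% 5 10 (! 0 12415321231) (% 6 10 (% 3 9 (! 0 123415211321) (% 3 8 (% 4 9 (! 0 123415211321) (% 4 10 (! 0 142125132310) ($ 4 5 9 10))) ($ 2 3 8 9))) ($ 5 6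 9 10)))) ($ 2 6 8 9)))) (% 2 7 (% 0 7 (! 0 1243211521) (% 0 8 (% 2 9 (! 0 13214212513) (% 7 9 (! 0 1243211521) (% 7 10 (! 0 11243211521) (% 2 10 (% 0 2 (! 0 213212415) (% 0 3 (! 0 12314212315) (% 3 8 (! 0 21214213513) ($ 0 8 2 3)))) ($ 2 7 9 10))))) ($ 0 1 7 8))) ($ 1 2 7 8)))
  p9 = % 3 7 (% 2 9 (! 0 12313211451) (% 3 9 (! 0 12342115311) ($ 2 3 8 9))) ($ 2 3 7 8)
  p10 = % 0 7 (% 0 5 (% 2 8 (% 6 8 (! 0 12413201521) (% 6 9 (! 0 1324321521) (% 5 8 (% 2 9 (! 0 123423521101) (% 2 10 (! 0 21421521313) (% 6 10 (! 0 11324321521) ($ 2 6 9 10)))) (% 5 9 (% 0 8 (! 0 12413212513) (% 0 9 (! 0 14211321125) (% 1 8 (! 0 13413201521) (% 1 9 (! 0 14323521121) ($ 0 1 8 9))))) ($ 5 6 8 9))))) (% 1 8 (% 1 5 (! 0 12313421251) (% 5 8 (! 0 12413521231) (% 6 8 (! 0 12415321231) ($ 1 8 5 6)))) (% 2 7 (% 6 8 (! 0 1243101521) (% 6 9 (! 0 1243201521) (% 2 9 (% 6 10 (! 0 11243201521) (% 7 9 (! 0 124132100510) (% 7 10 (! 0 123140212513) ($ 6 7 9 10)))) ($ 2 6 8 9)))) ($ 1 2 7 8)))) (% 1 5 (% 1 8 (% 2 10 (! 0 12313212451) (% 2 11 (! 0 112313212451) (% 1 10 (% 2 7 (! 0 12313212451)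 (% 2 8 (! 0 12311112452) (% 3 8 (! 0 21432312151) p9))) (% 1 11 (% 2 7 (! 0 12313212451) (% 2 8 (! 0 12311112452) (% 3 8 (! 0 212432101351) p9))) ($ 1 2 10 11))))) (% 2 8 (% 1 9 (! 0 123113212451) (% 5 8 (% 0 3 (! 0 12432123511) (% 0 4 (! 0 12431112532) (% 1 3 (! 0 12312311452) (% 1 4 (! 0 12312311452) ($ 0 1 3 4))))) (% 5 9 (% 0 8 (! 0 123411112532) (% 0 9 (! 0 124123521113) ($ 0 1 8 9))) ($ 1 5 8 9)))) (% 2 7 (% 1 9 (! 0 13213212451) (% 2 9 (% 0 8 (! 0 123142101523) (% 0 9 (! 0 124123100513) ($ 0 1 8 9))) ($ 1 2 8 9))) ($ 1 2 7 8)))) ($ 0 1 5 6))) ($ 0 1 6 7)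
  p11 = % 1 5 (% 0 7 (% 5 8 (% 1 8 (! 0 12411321152) (% 1 9 (! 0 12312412351) (% 2 8 (! 0 12432101521) (% 2 9 (% 0 8 (! 0 12431521231) (% 0 9 (! 0 124310212531) ($ 0 1 8 9))) ($ 1 2 8 9))))) (% 1 8 (% 4 8 (! 0 1421231351) (% 5 9 (! 0 123112412352) (% 4 9 (% 1 4 (! 0 123121241350) (% 1 9 (! 0 124121231350) (% 2 4 (! 0 1321231451) (% 2 9 (! 0 123112312452) ($ 1 2 4 9))))) ($ 4 5 8 9)))) (% 5 7 (% 1 9 (! 0 123131421251) (% 5 9 (% 2 5 (! 0 1230411521) (% 3 5 (! 0 123140512312) (% 3 6 (! 0 123142511321) ($ 2 3 5 6)))) ($ 1 5 8 9))) ($ 1 5 7 8)))) (% 0 6 (% 1 8 (% 5 8 (! 0 1421321152) (% 5 9 (! 0 123121421352) (% 6 8 (! 0 12413212351) (% 6 9 (% 1 9 (! 0 14213212351) (% 2 9 (! 0 123121321452) ($ 1 2 6 9))) ($ 5 6 8 9))))) (% 0 8 (% 5 7 (! 0 12341521231) (% 5 8 (! 0 12431521231) ($ 1 5 7 8))) ($ 0 1 7 8))) ($ 0 1 6 7))) (% 2 5 (% 0 5 (% 0 7 (% 0 9 (! 0 123121421315) (% 0 10 (! 0 132121421315) (% 7 9 (! 0 123140312512) (% 7 10 (! 0 132140312512) ($ 0 7 9 10))))) (% 0 6 (% 0 9 (! 0 13212412315) (% 0 10 (! 0 132112412315) (% 1 9 (! 0 2123421531) (% 1 10 (! 0 21123421531)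 ($ 0 1 9 10))))) ($ 0 1 6 7))) (% 0 6 (% 5 9 (! 0 123132411521) (% 5 10 (! 0 132132411521) (% 2 10 (% 6 10 (% 0 4 (! 0 142125120313) (% 1 4 (! 0 142123021531) ($ 0 1 4 5))) (% 6 9 (% 1 9 (! 0 124125311231) (% 2 9 (! 0 134125310211) ($ 1 2 6 9))) ($ 5 6 9 10))) (% 2 9 (% 5 11 (! 0 123123421521) (% 2 11 (% 6 9 (% 0 4 (! 0 124125120313) (% 1 4 (! 0 124123021531) ($ 0 1 4 5))) (% 6 10 (% 1 10 (! 0 243215321112) ($ 1 2 6 10)) ($ 5 6 9 10))) ($ 2 5 10 11))) ($ 2 5 9 10))))) ($ 0 1 5 6))) ($ 1 2 5 6))

  -- The names are twelve consecutive vertices. The vertices 1 and 6, five steps apart and hence of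
  -- the same class, are compared at the root. If they are not adjacent, 2K2-freeness applied to the
  -- orbit edges 1 2 and 6 7 makes one of the pairs 1 7, 2 6 and 2 7 adjacent, and the tree branches
  -- accordingly.
  path-tree : Tree
  path-tree = % 1 6 (% 1 9 (% 6 9 (! 0 13214211251) (% 5 9 (% 1 5 (! 0 14211321251) (% 2 4 (! 0 14212312351) (% 1 4 (% 6 10 (! 0 132124132150) (% 7 9 (! 0 124132132150) (% 7 10 (! 0 134121231250) ($ 6 7 9 10)))) (% 2 5 (% 2 8 (! 0 124112312351) (% 2 9 (! 0 3212112451) (% 3 8 (! 0 124312112351) (% 3 9 (! 0 124123113251) ($ 2 3 8 9))))) ($ 1 2 4 5))))) (% 6 10 (% 4 10 (! 0 142125132130) (% 5 10 (! 0 123114311251) (% 4 9 (% 1 4 (! 0 132124132150) (% 1 5 (! 0 134212310051) (% 2 4 (! 0 132114212351) (% 2 5 (! 0 132124112351) ($ 1 2 4 5))))) ($ 4 5 9 10)))) (% 5 10 (% 6 8 (! 0 13214321251) (% 5 8 (% 2 8 (! 0 12413521321) (% 2 9 (! 0 134113211251) (% 3 8 (! 0 132412513210) (% 3 9 (! 0 134213211251) ($ 2 3 8 9))))) ($ 5 6 8 9))) ($ 5 6 9 10))))) p1) (% 1 7 (% 1 5 p4 p7) (% 2 6 (% 0 6 p8 p10) (% 2 7 p11 ($ 1 2 6 7))))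

  c0 = % 0 7 (% 0 2 (! 0 1231212415) (% 0 3 (% 4 8 (! 0 1342123125) (% 5 7 (! 0 1231421125) (% 5 8 (! 0 1241312315) (% 4 7 (% 1 8 (! 0 1342123125) (% 1 9 (! 0 1241321325) (% 2 8 (! 0 1341213215) (% 2 9 (! 0 2141321305) ($ 1 2 8 9))))) ($ 4 5 7 8))))) (% 2 5 (% 0 4 (! 0 1241231305) (% 3 7 (! 0 2140313215) (% 4 7 (% 3 9 (! 0 3112432125) (% 4 9 (! 0 2131431215) ($ 0 9 3 4))) ($ 0 7 3 4)))) (% 3 5 (% 0 4 (! 0 2142132315) (% 1 3 (! 0 1241321325) (% 1 4 (! 0 2112413235) ($ 0 1 3 4)))) ($ 0 5 2 3))))) (% 2 5 (% 5 7 (! 0 1241321521) (% 5 8 (% 0 2 (! 0 2112412315) (% 0 3 (! 0 1321413512) (% 3 9 (! 0 2312413521) (% 2 9 (% 0 4 (! 0 3120431512) (% 1 3 (! 0 1231421523) (% 1 4 (! 0 1321411532) ($ 0 1 3 4)))) ($ 0 9 2 3))))) (% 0 8 (% 5 9 (! 0 3231421521) (% 6 8 (! 0 2132412513) (% 6 9 (! 0 1323421125) ($ 5 6 8 9)))) ($ 0 5 7 8)))) (% 0 2 (% 1 6 (! 0 1231321425) (% 0 6 (% 2 6 (! 0 13212415) (% 3 5 (! 0 2123123415) (% 3 6 (% 3 8 (! 0 2123123415) (% 3 9 (! 0 2123113415) (% 6 8 (! 0 2132312415) (% 6 9 (! 0 1132312415) ($ 3 6 8 9))))) ($ 2 3 5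 6)))) (% 1 7 (% 1 5 (! 0 1011321245) (% 2 6 (% 6 9 (! 0 1243212513) (% 7 9 (! 0 3213212415) ($ 0 9 6 7))) ($ 1 2 5 6))) ($ 0 1 6 7)))) (% 5 7 (% 0 3 (% 5 8 (! 0 1241512313) (% 5 9 (! 0 2130413215) (% 6 8 (! 0 2142512313) (% 6 9 (! 0 1142512313) ($ 5 6 8 9))))) (% 3 5 (% 3 9 (! 0 2120415313) (% 2 9 (% 0 4 (! 0 3130421215) (% 1 3 (! 0 1241521323) (% 1 4 (! 0 1241312532) ($ 0 1 3 4)))) ($ 0 9 2 3))) ($ 0 5 2 3))) ($ 0 5 2 7))))
  c1 = % 2 8 (% 2 6 (% 6 8 (! 0 2314201521) (% 6 9 (! 0 2314321521) (% 5 8 (% 3 8 (! 0 413513212) (% 3 9 (! 0 2412313511) (% 4 8 (! 0 2413231521) (% 4 9 (! 0 3413221521) ($ 3 4 8 9))))) (% 5 9 (% 0 2 (! 0 3113212415) (% 0 6 (! 0 1123421125) (% 2 9 (! 0 4113212513) ($ 0 9 2 6)))) ($ 5 6 8 9))))) (% 1 6 (% 2 5 (! 0 2313421521) (% 5 8 (! 0 2413521321) (% 6 8 (! 0 2415321321) ($ 2 8 5 6)))) (% 1 7 (% 2 5 (% 3 6 (! 0 1112413523) (% 3 7 (% 0 3 (! 0 1320214513) (% 0 4 (! 0 1211431532) (% 1 3 (! 0 1321201453) (% 1 4 (! 0 1321211453) ($ 0 1 3 4))))) ($ 2 3 6 7))) (% 1 5 (% 3 6 (! 0 1113412352) (% 3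 7 (! 0 2142113253) ($ 2 3 6 7))) ($ 1 2 5 6))) ($ 1 2 6 7)))) (% 3 7 (% 1 7 (% 1 3 (! 0 142123152) (% 1 4 (! 0 2142123153) (% 0 3 (% 3 8 (! 0 1321204135) (% 3 9 (! 0 3142125132) (% 4 8 (! 0 1121234135) (% 4 9 (! 0 1021234135) ($ 3 4 8 9))))) (% 0 4 (% 1 5 (! 0 2112311245) (% 4 7 (! 0 2120143135) (% 5 7 (! 0 1241531132) ($ 1 7 4 5)))) ($ 0 1 3 4))))) (% 1 8 (% 1 6 (% 0 3 (! 0 2132124135) (% 0 7 (! 0 1321321245) (% 1 3 (! 0 2132124153) ($ 0 1 3 7)))) (% 2 6 (% 0 6 (! 0 1234211135) (% 0 7 (! 0 1243211135) ($ 0 1 6 7))) ($ 1 2 6 7))) ($ 1 2 7 8))) (% 3 8 (% 1 7 (% 3 6 (% 0 3 (! 0 2123124135) (% 0 6 (! 0 2124123135) (% 1 3 (! 0 2123124153) (% 1 6 (! 0 2124123153) ($ 0 1 3 6))))) (% 2 6 (% 4 7 (% 3 5 (! 0 1111425323) (% 5 8 (! 0 1432512123) (% 6 8 (! 0 145231321) ($ 3 8 5 6)))) (% 4 6 (% 1 3 (! 0 1111234253) (% 1 4 (! 0 1111243253) ($ 1 7 3 4))) ($ 3 4 6 7))) ($ 2 3 6 7))) (% 1 8 (% 1 6 (% 2 6 (! 0 2314321251) (% 3 6 (! 0 1214213153) ($ 2 3 6 7))) (% 2 6 (% 1 5 (! 0 2313421251) (% 5 8 (! 0 2413521231) (% 6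 8 (! 0 2415321231) ($ 1 8 5 6)))) ($ 1 2 6 7))) ($ 1 2 7 8))) ($ 2 3 7 8)))
  c2 = % 4 9 (% 1 4 (% 3 6 (% 0 2 (! 0 2124123135) (% 0 3 (! 0 1124123125) (% 3 9 (! 0 3101245212) (% 2 9 (% 0 7 (! 0 1124123135) (% 0 8 (! 0 3214213215) (% 1 7 (! 0 1231243251) (% 1 8 (! 0 1321243251) ($ 0 1 7 8))))) ($ 0 9 2 3))))) (% 4 6 (% 2 7 (! 0 1234152132) (% 3 7 (! 0 3134152112) (% 2 6 (% 2 8 (! 0 2314212513) (% 3 8 (! 0 2124153213) ($ 2 3 7 8))) ($ 2 3 6 7)))) (% 0 3 (% 3 7 (! 0 1123134125) (% 4 7 (% 1 6 (! 0 2013211245) (% 1 7 (! 0 3132121145) (% 2 6 (! 0 3214211325) (% 2 7 (! 0 1243153122) ($ 1 2 6 7))))) ($ 3 4 6 7))) ($ 0 6 3 4)))) (% 1 5 (% 0 3 (% 1 6 (! 0 2123101245) (% 1 7 (! 0 3132121245) (% 2 6 (! 0 3124121325) (% 2 7 (% 1 9 (! 0 3102121245) (% 2 4 (! 0 1132342511) (% 2 9 (! 0 4123121325) ($ 1 2 4 9)))) ($ 1 2 6 7))))) (% 1 3 (% 3 6 (! 0 2124135213) (% 4 6 (! 0 2124153213) ($ 0 6 3 4))) ($ 0 1 3 4))) ($ 0 1 4 5))) (% 5 9 (% 0 3 (% 1 6 (! 0 2124313215) (% 2 6 (! 0 3114212315) (% 2 5 (% 3 6 (! 0 1124123125) (%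 2 7 (% 3 7 (! 0 2123114315) (% 4 6 (! 0 2124313215) (% 4 7 (! 0 3211423521) ($ 3 4 6 7)))) (% 3 7 (% 1 7 (! 0 3211124325) ($ 1 2 6 7)) ($ 2 3 6 7)))) (% 1 5 (% 3 6 (! 0 1124123125) (% 3 5 (% 2 7 (! 0 3211124325) (% 3 7 (% 1 7 (! 0 3131202145) ($ 1 2 6 7)) ($ 2 3 6 7))) ($ 2 3 5 6))) ($ 1 2 5 6))))) (% 3 9 (% 0 2 (! 0 4113213215) (% 3 6 (% 4 7 (! 0 2124135113) (% 4 8 (! 0 4212135113) (% 5 7 (! 0 3134215211) (% 5 8 (! 0 4313215211) ($ 4 5 7 8))))) (% 2 6 (% 2 7 (! 0 2124313511) (% 2 8 (! 0 2124313521) (% 3 7 (! 0 4212125313) (% 3 8 (! 0 4212115313) ($ 2 3 7 8))))) ($ 0 6 2 3)))) ($ 0 9 3 4))) ($ 0 9 4 5))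
  c3 = % 5 9 (% 1 9 (! 0 4211321251) (% 1 8 (% 2 7 (! 0 3212412351) (% 2 8 (! 0 3211421351) (% 3 8 (% 1 6 (! 0 3413212051) (% 1 7 (! 0 3231421051) (% 2 6 (! 0 3212411351) ($ 1 2 6 7)))) (% 3 7 (% 3 9 (% 2 5 (! 0 4321215311) (% 2 6 (! 0 3212411351) (% 3 5 (! 0 3112405212) (% 3 6 (! 0 1323421152) ($ 2 3 5 6))))) (% 2 9 (% 4 8 (! 0 2411231351) (% 4 9 (! 0 2311431251) ($ 3 4 8 9))) ($ 2 3 8 9))) ($ 2 3 7 8))))) (% 2 8 (% 1 6 (! 0 3212411351) (% 1 7 (% 0 7 (! 0 3112412352) (% 6 9 (! 0 4312511231) (% 7 9 (! 0 4321521131) ($ 0 9 6 7)))) (% 0 7 (% 2 6 (% 3 8 (! 0 1431112532) (% 3 9 (! 0 4313521212) (% 4 8 (! 0 3412121532) (% 4 9 (! 0 4311521231) ($ 3 4 8 9))))) (% 2 7 (% 5 7 (! 0 1340521231) (% 5 8 (! 0 2342101521) ($ 1 5 7 8))) ($ 1 2 6 7))) ($ 0 1 6 7)))) (% 2 9 (% 1 7 (% 2 7 (! 0 1132112452) (% 3 8 (! 0 4321521231) (% 3 7 (% 4 7 (! 0 2021431351) (% 4 8 (! 0 4211531321) (% 5 7 (! 0 1241321152) (% 5 8 (! 0 1341212351) ($ 4 5 7 8))))) ($ 2 3 7 8)))) (% 2 7 (% 3 8 (! 0 4321521231) (% 3 9 (! 0 4012513231) (% 4 8 (! 0 4211531321)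 (% 4 9 (! 0 4021231531) ($ 3 4 8 9))))) ($ 1 2 7 8))) ($ 1 2 8 9))))) (% 6 9 (% 4 9 (% 1 8 (% 4 8 (! 0 3411321251) (% 5 7 (! 0 1321432152) (% 5 8 (! 0 1421320152) (% 4 7 (% 2 5 (! 0 2311431251) (% 2 6 (! 0 4325112312) (% 3 5 (! 0 1321432152) (% 3 6 (! 0 4321153212) ($ 2 3 5 6))))) ($ 4 5 7 8))))) (% 1 9 (% 2 7 (! 0 4213212351) (% 2 8 (! 0 4213211351) (% 1 7 (% 3 7 (! 0 1241323152) (% 3 8 (! 0 4321321251) ($ 2 3 7 8))) ($ 1 2 7 8)))) (% 5 8 (% 2 8 (! 0 2411531321) (% 2 9 (% 1 6 (! 0 1123420152) (% 1 7 (! 0 1132432152) (% 2 6 (! 0 2114531321) (% 2 7 (! 0 4312212531) ($ 1 2 6 7))))) ($ 1 2 8 9))) ($ 1 5 8 9)))) (% 0 4 (% 4 8 (% 0 7 (! 0 3211341125) (% 0 8 (! 0 1421132125) (% 1 8 (% 0 2 (! 0 3211341125) (% 0 3 (! 0 2311241135) (% 2 9 (! 0 3411321251) (% 3 9 (! 0 2411253131) ($ 0 9 2 3))))) (% 1 7 (% 2 7 (! 0 2143111253) (% 2 8 (! 0 2431352121) (% 3 7 (! 0 2341212153) (% 3 8 (! 0 3412352111) ($ 2 3 7 8))))) ($ 0 1 7 8))))) (% 5 8 (% 3 8 (! 0 2413523111) (% 3 9 (% 0 7 (! 0 4132123115) (% 1 6 (! 0 1321421253) (% 1 7 (! 0 1123421153)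 ($ 0 1 6 7)))) ($ 3 4 8 9))) ($ 4 5 8 9))) ($ 0 9 4 5))) ($ 0 9 5 6))
  c4 = % 0 4 (% 6 9 (% 4 7 (% 0 7 (! 0 1142132125) (% 0 8 (! 0 2132142135) (% 1 7 (! 0 1243210152) (% 1 8 (% 0 2 (! 0 2132142135) (% 0 3 (! 0 1132142135) (% 2 9 (! 0 1234212351) (% 3 9 (! 0 4235213211) ($ 0 9 2 3))))) ($ 0 1 7 8))))) (% 4 6 (% 3 7 (! 0 3124153112) (% 3 8 (! 0 3124153212) (% 4 8 (% 2 7 (! 0 1234152123) (% 2 8 (! 0 1421251323) ($ 2 3 7 8))) ($ 3 4 7 8)))) (% 0 7 (% 3 7 (! 0 1143132125) (% 3 6 (% 3 8 (! 0 2134135212) (% 4 8 (! 0 2311241235) ($ 3 4 7 8))) ($ 3 4 6 7))) ($ 0 4 6 7)))) (% 5 9 (% 0 7 (% 1 4 (! 0 2111231245) (% 2 4 (! 0 2111341235) (% 2 5 (% 0 2 (! 0 1231321425) (% 2 7 (! 0 1243132125) (% 5 7 (! 0 1243132125) ($ 0 7 2 5)))) ($ 1 2 4 5)))) (% 7 9 (% 4 6 (! 0 1234152123) (% 4 7 (! 0 1243152123) ($ 0 4 6 7))) ($ 0 9 6 7))) ($ 0 9 5 6))) (% 1 4 (% 4 9 (% 6 9 (% 1 7 (! 0 3132142150) (% 2 7 (! 0 3124121351) (% 1 8 (% 2 5 (! 0 2311341250) (% 2 6 (! 0 4215031321) (% 3 5 (! 0 3213241251) (% 3 6 (! 0 2312143151)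 ($ 2 3 5 6))))) (% 2 8 (% 0 7 (! 0 3211241352) (% 0 8 (! 0 3123142152) ($ 0 1 7 8))) ($ 1 2 7 8))))) (% 5 9 (% 1 8 (! 0 2311341251) (% 1 9 (! 0 4211231251) (% 6 8 (! 0 4321251231) ($ 1 6 8 9)))) ($ 0 9 5 6))) (% 5 9 (% 3 9 (% 3 7 (! 0 4132315212) (% 4 6 (! 0 1123142152) (% 3 6 (% 0 7 (! 0 1124321153) (% 6 9 (! 0 3004215211) (% 7 9 (! 0 1234132152) ($ 0 9 6 7)))) (% 4 7 (% 2 5 (! 0 4123513212) (% 2 6 (! 0 1231142352) (% 3 5 (! 0 3102415212) ($ 2 3 5 6)))) ($ 3 4 6 7))))) (% 0 3 (% 3 5 (! 0 2123415213) (% 3 6 (! 0 2124311253) ($ 0 3 5 6))) ($ 0 9 3 4))) ($ 0 9 4 5))) ($ 0 1 4 5))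
  c5 = % 0 6 (% 0 4 (% 4 6 (! 0 1123142125) (% 3 6 (% 2 7 (! 0 1234132125) (% 3 7 (! 0 1134132125) (% 3 8 (% 1 6 (! 0 1204135132) (% 1 7 (! 0 1124123135) (% 2 6 (! 0 2104132315) ($ 1 2 6 7)))) (% 2 8 (% 4 8 (% 0 7 (! 0 1421152313) (% 0 8 (! 0 421132125) (% 1 7 (! 0 1124123135) (% 1 8 (! 0 2114213235) ($ 0 1 7 8))))) (% 4 7 (% 3 9 (! 0 3231241125) (% 4 9 (! 0 3124123115) ($ 3 4 8 9))) ($ 3 4 7 8))) ($ 2 3 7 8))))) (% 3 7 (% 0 3 (% 1 6 (! 0 1134132125) (% 1 7 (! 0 1243135112) (% 2 7 (! 0 2123114315) (% 2 6 (% 1 8 (! 0 1231124135) (% 2 8 (! 0 1321234521) ($ 1 2 7 8))) ($ 1 2 6 7))))) (% 2 6 (% 0 2 (! 0 2114212315) (% 2 9 (! 0 2124113513) (% 3 9 (! 0 3134212125) ($ 0 9 2 3)))) (% 0 2 (% 1 6 (! 0 1134132125) (% 2 7 (! 0 2123113415) (% 1 7 (% 3 8 (! 0 1243115312) (% 3 9 (! 0 2143215321) (% 4 8 (! 0 2121243135) (% 4 9 (! 0 2123143115) ($ 3 4 8 9))))) ($ 1 2 6 7)))) ($ 0 6 2 3)))) (% 4 7 (% 2 6 (% 2 7 (! 0 2124130315) (% 3 8 (! 0 2123143215) (% 2 8 (% 0 2 (! 0 2114212315) (% 0 3 (! 0 1234113512) (% 2 9 (! 0 3134120215) (% 3 9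 (! 0 3132142115) ($ 0 9 2 3))))) ($ 2 3 7 8)))) (% 2 7 (% 3 8 (! 0 2123143215) (% 3 9 (! 0 3132142115) (% 4 8 (! 0 1323140125) (% 4 9 (! 0 3143151212) ($ 3 4 8 9))))) ($ 2 3 6 7))) ($ 3 4 6 7))))) c2) (% 1 5 c3 (% 1 6 c4 ($ 0 1 5 6)))

  -- Opposite vertices of a closed orbit of length ten lie in the same class. The tree compares the
  -- opposite pair 0 5 and, if it is adjacent, the pair 2 7. If 0 and 5 are not adjacent, the edges
  -- 0 1 and 5 6 force one of the pairs 0 6, 1 5 and 1 6 to be adjacent.
  cycle-tree : Tree
  cycle-tree = % 0 5 (% 2 7 c0 c1) c5

open OrbitTrees

-- Orbits of a single parent function

module Orbits where

  shifts : Bool → ℕ → Fin 5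
  shifts f = fold (# 0) (shift f)

  fivefold : ∀ f i → fold i (shift f) 5 ≡ i
  fivefold true zero = refl
  fivefold true (suc (zero)) = refl
  fivefold true (suc (suc (zero))) = refl
  fivefold true (suc (suc (suc (zero)))) = refl
  fivefold true (suc (suc (suc (suc (zero))))) = refl
  fivefold false zero = refl
  fivefold false (suc (zero)) = refl
  fivefold false (suc (suc (zero))) = refl
  fivefold false (suc (suc (suc (zero)))) = refl
  fivefold false (suc (suc (suc (suc (zero))))) = refl

  step : Bool → ℕ → Vtx
  step f k = vtx k f (shifts f k)

  steps : Bool → ℕ → List Vtx
  steps f zero = step f 0 ∷ []
  steps f (suc k) = step f (suc k) ∷ steps f k

  links : Bool → ℕ → List (Vtx × Vtx)
  links f zero = []
  links f (suc k) = (step f k , step f (suc k)) ∷ links f k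

  -- Steps of an orbit whose indices agree modulo 5 have the same class as well as the same kind, so
  -- the state alone cannot separate them. Among twelve steps these are seven pairs at distance five
  -- and two at distance ten; among ten steps, five pairs at distance five.
  apart-12 apart-10 : List (ℕ × ℕ)
  apart-12 = (0 , 5) ∷ (1 , 6) ∷ (2 , 7) ∷ (3 , 8) ∷ (4 , 9) ∷ (5 , 10) ∷ (6 , 11) ∷ (0 , 10) ∷ (1 , 11) ∷ []
  apart-10 = (0 , 5) ∷ (1 , 6) ∷ (2 , 7) ∷ (3 , 8) ∷ (4 , 9) ∷ []

  path-state cycle-state : Bool → State
  path-state f = state (steps f 11) (links f 11) []
  cycle-state f = state (steps f 9) ((step f 9 , step f 0) ∷ links f 9) []

  path-wf : ∀ f → T (wellFormed (path-state f) apart-12)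
  path-wf true = tt
  path-wf false = tt

  -- One tree serves p-orbits and q-orbits. It has no `new` node, and since all classes have default
  -- label 0, its leaves ask for nothing that distinguishes the two step lengths round the circle.
  -- The same holds for `cycle-tree`.
  path-check : ∀ f → check (path-state f) path-tree ≡ true
  path-check true = refl
  path-check false = refl

  cycle-wf : ∀ f → T (wellFormed (cycle-state f) apart-10)
  cycle-wf true = tt
  cycle-wf false = tt

  cycle-check : ∀ f → check (cycle-state f) cycle-tree ≡ true
  cycle-check true = refl
  cycle-check false = refl

  module _ {n} (G : Graph n) (cls : Fin n → Fin 5) (par : Bool → Fin n → Fin n)
    (par-cls : ∀ f v → cls (par f v) ≡ shift f (cls v))
    (par-adj : ∀ f v → Adj G (par f v) v)
    (par-disj : ∀ x y → par true x ≢ par false y)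
    (2K2-free : TwoK2Free G) (no6 : ¬ UpperDomaticPartition G 6) where

    private
      Placed′ = Placed G cls par par-cls par-adj par-disj 2K2-free no6
      refute′ = refute G cls par par-cls par-adj par-disj 2K2-free no6

    iter : Bool → ℕ → Fin n → Fin n
    iter f k v = fold v (par f) k

    iter-cls : ∀ f k v → cls (iter f k v) ≡ fold (cls v) (shift f) k
    iter-cls f zero v = refl
    iter-cls f (suc k) v = trans (par-cls f _) (cong (shift f) (iter-cls f k v))

    module _ (f : Bool) (u : Fin n) (class-0 : shift f (cls u) ≡ # 0) where

      private
        x : ℕ → Fin n
        -- Shifted by one step, so that even `x 0` is the parent of something, as every named vertex
        -- has to be.
        x k = iter f (suc k) u

        x-cls : ∀ k → cls (x k) ≡ shifts f k
        x-cls zero = trans (par-cls f u) class-0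
        x-cls (suc k) = trans (par-cls f (x k)) (cong (shift f) (x-cls k))

        placed : ∀ k → All (Placed′ x) (steps f k)
        placed zero = (x-cls 0 , u , refl) ∷ []
        placed (suc k) = (x-cls (suc k) , x k , refl) ∷ placed k

        linked : ∀ k → All (λ e → Adj G (x (name (proj₁ e))) (x (name (proj₂ e)))) (links f k)
        linked zero = []
        linked (suc k) = sym G (par-adj f (x k)) ∷ linked k

      no-long-path : (∀ k → x k ≢ x (5 + k)) → x 0 ≢ x 10 → x 1 ≢ x 11 → ⊥
      no-long-path ne ne₀ ne₁ = refute′ (path-state f) apart-12 path-tree x (path-wf f) (passed (path-state f) path-tree (path-check f))
        (placed 11) (linked 11) []
        (ne 0 ∷ ne 1 ∷ ne 2 ∷ ne 3 ∷ ne 4 ∷ ne 5 ∷ ne 6 ∷ ne₀ ∷ ne₁ ∷ [])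

      no-10-cycle : (∀ k → x k ≢ x (5 + k)) → x 0 ≡ x 10 → ⊥
      no-10-cycle ne e = refute′ (cycle-state f) apart-10 cycle-tree x (cycle-wf f) (passed (cycle-state f) cycle-tree (cycle-check f))
        -- Since `x 10` is `x 0`, the step from `x 9` to its parent is the edge that closes the
        -- cycle.
        (placed 9) (subst (Adj G (x 9)) (≡-sym e) (sym G (par-adj f (x 9))) ∷ linked 9) []
        (ne 0 ∷ ne 1 ∷ ne 2 ∷ ne 3 ∷ ne 4 ∷ [])

    -- If no p-orbit (or q-orbit) closes after five steps, it closes after ten steps or contains a path with twelve vertices.
    some-5-cycle : ∀ f u → shift f (cls u) ≡ # 0 → (∀ z → iter f 5 z ≢ z) → ⊥
    some-5-cycle f u e open′ with iter f 1 u ≟ iter f 11 u | iter f 2 u ≟ iter f 12 u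
    ... | yes r | _ = no-10-cycle f u e (λ k r → open′ _ (≡-sym r)) r
    ... | no ne₀ | no ne₁ = no-long-path f u e (λ k r → open′ _ (≡-sym r)) ne₀ ne₁
    -- The coincidence `r` occurs one step past class 0. Four more steps turn it into one between
    -- the sixth and the sixteenth iterate, which is the hypothesis of `no-10-cycle` for the walk
    -- that starts five steps later and hence in the same class.
    ... | no _ | yes r = no-10-cycle f (iter f 5 u) class-5 (λ k r → open′ _ (≡-sym r))
          (cong (iter f 4) r)
      where
      class-5 : shift f (cls (iter f 5 u)) ≡ # 0
      class-5 = trans (cong (shift f) (trans (iter-cls f 5 u) (fivefold f (cls u)))) e

open Orbits

-- Certificates for the adjacencies between two closed walks

module CycleTrees where

  -- In the trees of this part the names 0 to 4 are the vertices of a and 5 to 9 those of b, each in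
  -- the order of their classes; larger names are parents added by `new`. Some pieces have names of
  -- their own because the same situation occurs in several branches.
  s0 = % 7 8 (! 0 301421205) ($ 2 8 7 9)
  s1 = % 5 9 (% 0 7 (% 4 7 (! 0 12231410005) (% 3 7 (% 0 2 (! 12110 3040000305) (% 0 3 (! 21210 30004005) (% 3 8 (! 1010 322400005) (% 2 8 (% 2 7 (! 22210 30004500) (% 2 9 (! 32210 4500) s0)) ($ 0 8 2 3))))) (% 3 9 (% 0 3 (! 10210 3300004005) (% 0 9 (! 13210 4000000005) (% 3 8 (! 1010 322400005) ($ 0 8 3 9)))) (% 4 9 (% 0 3 (! 100 200423005) (% 3 8 (! 1010 322400005) (% 0 2 (% 2 7 (! 0 1021401305) (% 2 9 (! 21000 400305) ($ 2 3 7 9))) (% 2 8 (% 2 7 (! 0 1130420205) ($ 0 7 2 3)) ($ 0 8 2 3))))) ($ 3 4 7 9))))) (% 0 9 (% 0 2 (! 13210 4000000005) (% 0 3 (! 0 1022403105) (% 2 9 (! 1000 3000420205) (% 3 9 (% 3 8 (! 1010 322400005) (% 2 8 (% 2 7 (! 0 1122304500) s0) ($ 0 8 2 3))) ($ 0 9 2 3))))) (% 7 8 (% 4 7 (! 0 1321400025) (% 4 9 (! 0 1321420005) ($ 0 4 7 9))) ($ 0 8 7 9)))) (% 1 5 (% 0 2 (! 32100 400005) (% 0 3 (! 32210 405000) (% 3 8 (! 1010 322400005) (% 2 8 (% 1 3 (! 21000 300045) (% 1 4 (! 11000 20000320045) (% 3 9 (% 2 6 (! 0 1324521) (% 2 9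 (! 0 11002304520) (% 5 6 (! 0 11003412025) ($ 2 5 6 9)))) (% 4 9 (% 4 8 (! 0 11321420005) ($ 4 9 5 8)) ($ 1 9 3 4))))) ($ 0 8 2 3))))) (% 1 8 (% 1 10 (! 0 12301200045) (% 9 10 (% 0 10 (! 1000 32000420205) (% 8 10 (! 0 11300412025) (% 0 9 (% 1 3 (! 0 13002011245) (% 1 4 (! 21000 3000300045) (% 3 8 (! 1010 322400005) (% 4 8 (! 0 11300412025) ($ 1 8 3 4))))) ($ 0 8 9 10)))) ($ 1 9 5 10))) ($ 1 9 5 8)))
  s2 = % 2 9 (% 0 2 (! 21000 400305) (% 0 3 (! 0 1002413205) ($ 0 6 2 3))) ($ 2 3 6 9)
  -- A typical count of labels. In `! 32100 400005` the classes 0 and 1 share label 0, the other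
  -- classes keep labels of their own, and a 0 and b 0 are split off as parts 5 and 4. Merging two
  -- classes loses one part and splitting off two vertices gains two, which makes six out of five.
  -- The adjacency of a 0 and a 2 supplies the neighbour of label 1 that a 0 needs in order to be
  -- the sink.
  s3 = % 0 2 (! 32100 400005) (% 0 3 (! 32210 405000) (% 2 6 (! 21000 3400005) ($ 0 6 2 3)))
  s4 = % 5 11 (% 2 6 (! 21000 300003400005) (% 6 11 (! 32100 400000500000) ($ 0 6 2 11))) ($ 0 5 2 11)
  s5 = % 0 7 (! 2100 3000430005) (% 0 9 (! 0 13002412015) (% 7 8 (! 0 10320410125) (% 8 9 (! 0 1322400015) ($ 0 8 7 9))))
  s6 = % 1 5 (% 1 3 (! 21000 300045) (% 1 4 (! 11000 20000320045) (% 3 9 (% 0 2 (! 32100 400005) (% 0 11 (% 0 3 (! 32210 405000) (% 3 11 (! 32210 405000) (% 0 9 (% 5 11 (! 32100 400000500000) (% 7 11 (! 10 2230405300) (% 2 7 (% 0 7 (! 32100 400005) (% 4 7 (! 10 3320204500) (% 2 4 (% 3 6 (! 0 202003014531) (% 3 8 (! 0 10300412125) (% 4 6 (! 22210 34500) (% 4 8 (! 0 300141225) ($ 3 4 6 8))))) ($ 0 4 2 7)))) ($ 2 11 5 7)))) (% 9 11 (% 0 7 (! 32100 400005) (% 4 7 (! 10 2230405300) (% 4 9 (! 21000 403000300005) ($ 0 4 7 9)))) ($ 0 11 3 9))))) s4)) (% 4 9 (% 3 7 (! 2210 405303) (% 2 9 (% 0 2 (! 32100 400005) (% 5 9 (%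 0 11 (! 21000 303000400005) s4) (% 0 9 (% 4 8 (! 0 11300242105) (% 8 9 (! 0 12300412105) ($ 4 9 5 8))) ($ 0 5 2 9)))) (% 2 7 (% 4 8 (! 0 320421115) (% 8 9 (! 10 420203503) (% 2 4 (% 0 7 (! 32100 400005) (% 0 9 (! 0 3001042125) (% 7 8 (! 2210 40500303) ($ 0 8 7 9)))) ($ 2 8 4 9)))) ($ 2 3 7 9)))) ($ 1 9 3 4))))) (% 5 9 (% 2 7 (% 2 10 (% 3 8 (! 0 10300412125) (% 4 8 (! 0 20300421115) (% 3 6 (% 7 8 (! 0 10320410125) (% 8 9 (! 0 322401115) (% 0 7 (% 3 7 (! 22210 30004500) (% 3 9 (! 0 23102405110) (% 4 7 (! 0 12231410005) (% 4 9 (! 0 12230410105) ($ 3 4 7 9))))) (% 0 9 (% 3 7 (! 22210 30004500) (% 3 9 (! 0 23102405110) (% 4 7 (! 0 13221410005) (% 4 9 (! 21000 3000400005) ($ 3 4 7 9))))) ($ 0 8 7 9))))) (% 4 6 s5 ($ 3 4 6 8))))) (% 1 10 (% 3 8 (! 0 10300412125) (% 4 6 s5 (% 4 8 (! 0 20300421115) (% 3 6 (% 1 6 (! 0 12003121045) (% 6 10 (! 0 14325100032) (% 8 10 (! 0 20300421115) ($ 1 10 6 8)))) ($ 3 4 6 8))))) ($ 1 2 5 10))) (% 1 7 (% 8 9 (! 0 2300421115) (% 2 9 (% 1 10 (! 0 13300121245) (% 2 10 (% 1 3 (! 21000 300345) (% 1 4 (! 0 23100431125) (% 3 9 (! 0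 12200413135) (% 4 9 (! 32110 4000000500) ($ 1 9 3 4))))) ($ 1 2 5 10))) (% 7 8 (% 3 7 (! 0 1342502100) (% 3 8 (! 0 10300412125) (% 4 7 (! 0 10320410125) (% 4 8 (! 0 2300421115) ($ 3 4 7 8))))) ($ 2 8 7 9)))) ($ 1 2 5 7))) (% 8 9 (% 0 2 (! 20100 300400005) (% 2 6 (! 0 312402115) (% 6 11 (! 0 11302412005) (% 0 11 (% 0 3 (! 0 102310402105) (% 3 6 (! 0 11322410005) ($ 0 6 2 3))) ($ 0 6 2 11))))) ($ 1 9 5 8)))
  s7 = % 8 9 (! 0 11302412005) ($ 0 8 7 9)
  s8 = % 1 7 (! 0 130402125) (% 7 11 (! 0 112231400005) ($ 1 11 7 9))
  s9 = % 2 5 (% 5 6 (! 21000 3400005) (% 9 11 (! 21000 300003400005) (% 5 9 (% 3 8 (! 0 201302401015) (% 4 6 (! 1000 23002430005) (% 4 8 (! 0 11302412005) (% 3 6 (% 0 9 (! 1000 23002400005) (% 0 7 (% 1 3 (! 1000 322003400025) (% 1 4 (! 2100 3000430005) (% 4 11 (! 21000 300003400005) (% 3 11 (% 0 3 (! 0 201002413015) (% 0 11 (! 13210 400000000005) ($ 0 8 3 11))) ($ 1 11 3 4))))) (% 4 9 (! 2100 304000530000) (% 4 7 (% 7 8 (! 0 201312400015) s7) ($ 0 4 7 9))))) ($ 3 4 6 8))))) (% 6 11 (% 3 8 (! 0 201302401015) (% 4 6 (! 1000 320002430005) (% 4 8 (! 0 11302412005) (% 3 6 (% 0 9 (! 1000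 323002400005) (% 7 8 (! 0 102314210005) (% 8 9 (! 0 11302412005) (% 0 7 (% 1 3 (! 1000 322003400025) (% 1 4 (! 2100 300000430005) (% 3 11 (! 11210 300004005000) (% 4 11 (! 21000 300003400005) ($ 1 11 3 4))))) ($ 0 8 7 9))))) ($ 3 4 6 8))))) ($ 5 11 6 9))))) (% 2 8 (% 2 7 (% 5 6 (! 21000 3400005) (% 9 11 (! 21000 300003400005) (% 6 11 (% 0 9 (! 1000 323002400005) (% 7 8 (! 0 10320410125) (% 8 9 (! 0 11302412005) (% 0 7 s8 ($ 0 8 7 9))))) (% 5 9 (% 0 7 s8 (% 0 9 (! 0 203112400015) (% 7 8 (! 0 10320410125) s7))) ($ 5 11 6 9))))) (% 1 7 (% 1 6 (! 0 100103021245) (% 6 11 (% 7 8 (! 0 210302400115) (% 6 7 (% 0 7 (! 0 1130402125) (% 0 9 (! 1000 323002400005) s7)) ($ 1 7 6 8))) ($ 1 11 6 8))) ($ 1 2 5 7))) ($ 1 2 5 8))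
  s10 = % 0 2 (! 32100 45) (% 0 3 (! 21100 3045) ($ 0 6 2 3))
  s11 = % 1 3 s10 ($ 1 6 3 5)
  s12 = % 3 7 (! 32210 4500) (% 3 9 (! 0 3224101005) (% 4 7 (! 0 103224010105) (% 4 9 (! 0 3204021115) ($ 3 4 7 9))))
  s13 = % 1 6 (% 1 5 (! 0 111002312045) (% 5 6 (! 21000 3400005) (% 3 6 (% 1 8 (! 0 101302100045) (% 8 11 (! 0 111302412005) (% 5 11 (% 1 10 (! 0 121203100045) (% 6 10 (% 0 9 (! 1000 233002400005) (% 7 8 (! 0 200312400015) (% 8 9 (! 0 11302412005) (% 0 7 (% 1 7 (! 0 110223100045) (% 7 11 (! 0 102231400005) (% 9 11 (! 21000 300003400005) ($ 1 11 7 9)))) ($ 0 8 7 9))))) ($ 1 6 5 10))) ($ 1 11 5 8)))) s11))) (% 2 9 (% 2 8 (% 6 11 (% 1 8 (! 0 10300412125) (% 8 11 (! 0 110302412005) (% 5 11 (% 3 8 (! 32210 4500) (% 4 6 (! 1000 320002430005) (% 4 8 (! 0 11302412005) (% 3 6 (% 7 8 (! 0 102304210105) (% 8 9 (! 0 11302412005) (% 0 9 s12 (% 0 7 (% 0 3 (! 0 200102413015) (% 2 7 (! 0 12230410105) (% 3 7 (! 32210 4500) (% 0 2 (% 3 9 (! 0 213301405210) (% 4 7 (! 0 12230410105) (% 4 9 (! 2100 300000430005) ($ 3 4 7 9)))) ($ 0 7 2 3))))) ($ 0 8 7 9))))) ($ 3 4 6 8))))) (% 1 5 (% 0 2 (!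 32100 400005) (% 0 3 (! 32210 405000) (% 3 6 (% 0 7 (! 32100 400005) (% 0 9 s12 (% 1 7 (! 21110 3453) ($ 0 1 7 9)))) ($ 0 6 2 3)))) ($ 1 11 5 8))))) (% 1 8 (! 0 10300412125) (% 8 11 (% 0 2 (! 20100 300400005) (% 0 3 (! 0 111200413205) (% 3 6 (! 0 11322410105) ($ 0 6 2 3)))) ($ 1 11 6 8)))) (% 1 8 (% 3 6 (! 0 110301402025) (% 3 8 (! 0 10300415212) ($ 2 3 6 8))) ($ 1 2 6 8))) ($ 1 2 6 9))
  s14 = % 3 9 (! 0 2003112415000) ($ 2 3 7 9)
  s15 = % 4 7 (% 1 7 (% 1 6 (! 0 102113020045) (% 3 7 (! 0 3241510021) (% 6 7 (! 0 3241500021) (% 1 3 (% 7 8 (! 0 4032120251) (% 1 8 (% 0 7 (! 0 1231400025) (% 0 9 (! 0 2133400015) (% 7 11 (! 0 3241510021) (% 9 11 (% 3 9 (! 0 3011204052) (% 3 11 (! 33210 400000005000) (% 4 9 (! 0 311232045) (% 4 11 (! 0 311232045) ($ 3 4 9 11))))) ($ 0 11 7 9))))) ($ 1 7 6 8))) ($ 1 7 3 6))))) (new 7 true 12 (% 0 7 (! 0 2132410015) (% 6 7 (! 0 3241520021) (% 0 12 (% 0 9 (! 0 2133410015) (% 7 11 (! 0 103241520021) (% 9 11 (% 2 7 (! 0 1103042501200) (% 3 7 (! 0 2132415010) (% 3 9 (! 0 2133415010) (% 2 9 (% 1 4 (! 0 102132410035) (% 2 4 (! 0 103120412500) ($ 1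 2 4 7))) ($ 2 3 7 9))))) ($ 0 11 7 9)))) (% 6 12 (% 1 12 (! 10000 2000004203035) ($ 0 1 7 12)) ($ 0 6 7 12))))))) (new 4 false 12 (% 5 12 (% 0 9 (! 0 2003112410005) (% 4 9 (% 0 3 (! 0 1022314005) (% 0 2 (% 2 7 (! 0 101020421305) (% 2 9 (! 21000 400305) (% 3 7 (! 1000 2030430205) s14))) (% 2 11 (% 9 11 (% 6 11 (! 0 301022413005) (% 8 11 (! 2100 4300530000) (% 2 6 (% 2 4 (! 0 304020153201) (% 4 11 (! 0 301021423005) (% 11 12 (! 0 304025103201) (% 2 12 (% 4 6 (! 3210 4000050000) (% 4 8 (! 0 304220153201) (% 6 12 (! 0 3201021420500) (% 8 12 (! 0 3201120421500) ($ 4 12 6 8))))) ($ 2 11 4 12))))) (% 2 8 (% 2 4 (! 0 304020153201) (% 4 8 (! 0 304220153201) ($ 0 4 2 8))) ($ 2 11 6 8))))) (% 7 11 (% 2 7 (! 2110 4050030300) (% 2 9 (! 0 103020412501) (% 3 7 (! 0 102030415201) s14))) (% 0 7 (% 2 7 (! 0 101030420205) (% 3 7 (! 0 101030422105) ($ 0 7 2 3))) ($ 0 11 7 9)))) (% 3 11 (% 0 7 (! 0 101032435002) (% 9 11 (! 33210 400000005000) (% 7 11 (% 4 11 (! 33210 400000005000) (% 7 12 (! 20210 3400050003000) (% 11 12 (! 0 3200113412005) ($ 4 12 7 11)))) ($ 0 11 7 9)))) ($ 0 11 2 3))))) (% 0 7 (% 3 7 (! 0 1032412005) (% 3 9 (!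 0 2003112415000) ($ 3 4 7 9))) ($ 0 4 7 9)))) (% 7 12 (% 9 12 (! 0 1102133420005) (% 4 9 (% 0 7 (! 0 1002031420105) (% 0 9 (! 0 1003021420105) (% 7 11 (! 0 1203241520001) (% 9 11 (! 0 1102133420005) ($ 0 11 7 9))))) ($ 4 12 5 9))) ($ 4 12 5 7))))
  s16 = % 9 10 (% 0 2 (! 21000 400305) (% 2 4 (! 21000 3000400503) (% 0 9 (% 4 9 (! 21000 430305) (% 4 10 (! 1000 43000520203) (% 3 9 (% 1 6 (! 0 23204121005) (% 2 8 (! 0 12100314502) (% 1 8 (% 0 3 (! 0 1022403105) (% 2 11 (! 0 112100314502) (% 3 11 (% 1 3 (! 0 2003011345) (% 1 4 (! 32110 4000000050) (% 4 8 (! 0 114100235032) (% 3 8 (new 8 true 12 (! 0 302415211)) ($ 1 8 3 4))))) ($ 0 11 2 3)))) ($ 1 2 6 8)))) (% 3 10 (% 0 3 (! 0 1022403105) (% 0 10 (! 1000 32000420205) (% 1 10 (! 3210 45000000000) (% 1 3 (% 2 11 (! 0 21100314520) (% 3 11 (% 1 6 (! 0 32004125031) (% 1 8 (! 0 12003011345) (% 2 8 (! 32210 4500) ($ 1 2 6 8)))) ($ 0 11 2 3))) ($ 0 1 3 10))))) ($ 3 4 9 10))))) (% 4 9 (% 9 11 (% 0 3 (! 0 121000423105) (% 3 11 (! 33210 400000005000) (% 2 11 (% 3 9 (! 0 21100324520) (% 5 11 (! 0 301100412502) ($ 3 5 9 11))) ($ 0 11 2 3)))) (% 2 11 (% 1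 3 (! 0 21100314520) (% 3 9 (! 0 21100324520) (% 1 5 (% 1 6 (! 21110 3453) (% 1 8 (! 21000 300045) (% 2 8 (% 4 8 (% 0 7 (! 100 232200430005) (% 7 11 (! 0 214330120501) ($ 0 11 7 9))) ($ 0 4 2 8)) ($ 1 2 6 8)))) ($ 1 9 3 5)))) ($ 0 11 2 9))) ($ 0 4 2 9))))) (% 6 10 (% 1 5 (% 1 3 (! 21000 300045) (% 1 4 (! 0 1201321045) (% 3 9 (! 0 3104015212) (% 4 9 (% 1 6 (! 0 2201321045) (% 1 10 (! 0 21001321045) (% 2 10 (! 21000 3000400503) ($ 1 2 6 10)))) ($ 1 9 3 4))))) (% 1 10 (% 3 9 (! 0 3104015212) (% 1 3 (% 0 2 (! 21000 400305) (% 0 9 (! 0 3104012125) (% 2 4 (! 0 10000213452) (% 4 9 (! 0 21004123035) ($ 0 4 2 9))))) ($ 1 9 3 5))) ($ 1 9 5 10))) ($ 5 10 6 9))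
  s17 = % 8 9 (! 0 1000201324521) ($ 1 9 5 8)
  s18 = % 2 6 (% 0 12 (% 0 2 (! 0 12001314502) (% 3 11 (% 8 11 (! 33210 400000005000) (% 3 8 (% 5 9 (! 0 103201425021) (% 8 9 (! 32100 400500000) (% 1 5 (% 1 3 (! 21000 300045) (% 1 8 (! 21000 300045) ($ 0 1 3 8))) (% 1 8 (% 1 10 (! 0 13201415023) (% 9 10 (! 0 21301425021) ($ 1 9 5 10))) ($ 1 9 5 8))))) (% 6 11 (% 1 8 (! 0 211201403035) (% 5 9 (! 0 103201425021) (% 8 9 (! 0 213201415003) (% 1 5 (% 1 6 (! 0 200011300245) (% 1 11 (! 21000 300045) (% 5 11 (! 0 301101402025) ($ 1 5 6 11)))) ($ 1 9 5 8))))) ($ 3 11 6 8)))) (% 2 11 (% 0 9 (% 1 5 (! 0 1000001324521) (% 1 10 (! 0 1020002324511) (% 5 9 (! 0 2103413015) (% 9 10 (% 1 8 (! 0 21001324521) s17) ($ 1 9 5 10))))) (% 9 11 (% 1 5 (! 0 1000001324521) (% 1 8 (! 0 1200200324511) (% 5 9 (! 100 203200425000) s17))) ($ 0 11 3 9))) ($ 0 11 2 3)))) (% 6 12 (% 1 12 (! 32110 4000005000000) (% 1 3 (% 1 5 (! 21000 300045) (% 5 9 (! 0 3201415021) (% 8 9 (! 0 11302412035) (% 1 8 (% 1 10 (! 0 13201415023) (% 9 10 (! 210 4305003000) ($ 1 9 5 10))) ($ 1 9 5 8))))) ($ 0 1 3 12))) ($ 0 6 3 12))) (% 0 2 (% 2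 9 (! 21000 400305) (% 5 9 (% 4 6 (! 2100 3000430005) (% 4 8 (! 0 3012415201) (% 3 8 (% 0 9 (! 13210 4000000005) (% 2 7 (! 0 102110304502) (% 0 7 (% 3 7 (! 0 1032402105) (% 7 8 (! 0 101230401205) ($ 0 7 3 8))) ($ 0 2 7 9)))) ($ 3 4 6 8)))) ($ 2 5 6 9))) ($ 0 6 2 3))
  s19 = % 3 6 (% 5 6 (! 0 11003412025) (% 5 9 s15 (% 2 6 (% 9 10 (% 0 9 (! 0 23204121015) (% 0 10 (! 1000 32000420205) (% 4 9 (% 1 8 (! 0 12104213035) (% 1 5 (% 4 8 (! 0 11201243035) (% 8 9 (! 0 12304121035) ($ 4 9 5 8))) (% 8 9 (% 1 3 (! 22100 304005030) (% 3 9 (! 0 13204125021) ($ 1 9 3 5))) ($ 1 9 5 8)))) (% 4 10 (% 1 3 (! 2100 45000030030) (% 1 4 (! 0 12104213035) (% 3 9 (! 0 13204125021) ($ 1 9 3 4)))) ($ 0 4 9 10))))) (% 6 10 (% 1 5 (% 1 3 (! 21000 300045) (% 1 4 (! 0 1201321045) (% 4 9 (! 21000 3004300005) (% 3 9 (% 0 2 (! 32100 400005) (% 0 3 (! 0 2104213015) (% 2 11 (! 0 1324521) (% 3 11 (% 0 7 (! 32100 400005) (% 0 9 (! 11210 3004005000) (% 4 7 (% 1 7 (! 0 11320245) (% 2 4 (! 21110 3004500) (% 2 7 (! 0 1324521) ($ 1 2 4 7)))) ($ 0 4 7 9)))) ($ 0 11 2 3))))) ($ 1 9 3 4))))) (%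 1 10 (% 1 3 (! 1000 23002300045) (% 3 9 (! 0 33201425021) ($ 1 9 3 5))) ($ 1 9 5 10))) ($ 5 10 6 9))) (% 2 9 s16 ($ 2 5 6 9))))) (new 3 false 12 (% 5 6 s3 (% 3 9 (% 0 3 (% 2 9 (! 0 11002413205) (% 5 9 (% 0 7 (! 100 202200403005) (% 0 9 (! 12210 3000004005) (% 4 9 (! 100 3200425000) (% 4 7 (% 4 6 (! 0 1010201423005) (% 4 8 (! 0 3011432105) (% 3 8 (% 7 11 (! 0 1200211403015) (% 9 11 (! 100 203200425000) ($ 0 11 7 9))) ($ 3 4 6 8)))) ($ 0 4 7 9))))) (% 2 6 (% 3 8 (! 0 11201403025) (% 4 6 (! 0 1010201423005) (% 4 8 (! 0 1000100432315) ($ 3 4 6 8)))) ($ 2 5 6 9)))) s18) (% 5 9 (% 2 6 (% 4 6 (! 1000 23002430005) (% 4 9 (% 3 8 (! 2100 4300530000) (% 4 8 (! 11210 4003053000) ($ 3 4 6 8))) ($ 3 4 6 9))) s2) ($ 3 5 6 9)))))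
  s20 = % 9 12 (! 2100 3004000500003) (% 2 9 (% 0 7 (! 31210 405) (% 0 9 (! 13210 4000000005) (% 4 7 (! 0 24032120501) (% 4 9 (! 2110 30000030405) ($ 0 4 7 9))))) ($ 2 12 5 9))
  s21 = % 2 10 (! 21000 3000000300405) ($ 1 2 5 10)
  s22 = % 2 8 (% 5 12 (! 32100 400005) (% 2 7 (% 1 10 (% 1 3 (! 0 20200121345) (% 3 9 (% 0 7 (! 0 101130202405) (% 4 7 (! 0 101120403235) (% 4 9 (! 0 101100234532) (% 0 9 (% 2 6 (! 0 1011023403205) (% 2 9 (! 0 3100212415) (% 6 12 (! 0 12201413035) (% 9 12 (! 13210 4000000005) ($ 2 12 6 9))))) ($ 0 4 7 9))))) (% 5 9 (% 1 4 (! 0 1200121345) (% 4 9 (! 2100 30000430005) ($ 1 9 3 4))) ($ 1 9 3 5)))) (% 2 10 (% 5 9 s20 (% 9 10 (% 3 9 (% 0 7 (! 31210 405) (% 7 11 (! 32210 40000500) (% 0 9 (% 2 9 (! 21000 3000300405) (% 6 12 (! 21000 3000000300405) (% 9 12 (! 31210 4000000005) (% 2 6 (% 3 6 (! 0 1013202405) (% 3 8 (! 32210 4500) (% 4 6 (! 2100 34000030005) (% 4 8 (! 0 131100232405) ($ 3 4 6 8))))) ($ 2 12 6 9))))) (% 9 11 (% 0 10 (! 2110 30000000405) (% 4 9 (! 2110 30000030405) (% 4 10 (! 0 132100314502) ($ 0 4 9 10)))) ($ 0 11 7 9))))) (% 1 3 (% 3 7 (! 22210 30004500) (% 4 7 (!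 0 121130400235) (% 4 9 (! 2110 30000030405) ($ 3 4 7 9)))) ($ 1 9 3 5))) ($ 1 9 5 10))) ($ 1 2 5 10))) (% 7 12 (% 1 7 (% 1 10 (! 0 21200121345) s21) ($ 1 2 5 7)) ($ 2 12 5 7)))) (% 1 8 (% 5 12 (! 32100 400005) (% 8 12 (% 2 7 (% 1 10 (! 0 1021002102345) (% 2 10 (% 1 3 (! 0 1011000212345) (% 5 9 s20 (% 3 9 (% 3 6 (! 0 10102314532) (% 3 8 (! 32210 4500) (% 2 6 (% 1 4 (! 1000 2002000200345) (% 4 8 (% 2 4 (! 0 101132425) (% 4 10 (! 0 10201243135) (% 8 10 (! 0 30201421135) ($ 2 10 4 8)))) ($ 1 8 3 4))) ($ 2 3 6 8)))) ($ 1 9 3 5)))) ($ 1 2 5 10))) (% 7 12 (% 1 7 (% 0 7 (! 0 101030201245) (% 2 9 (! 21000 3000000300405) (% 0 9 (% 1 10 (! 2100 3000000045) s21) ($ 0 2 7 9)))) ($ 1 2 5 7)) ($ 2 12 5 7))) ($ 2 12 5 8))) ($ 1 2 5 8))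
  s23 = % 2 4 (% 0 3 (! 0 10200423115) (% 3 11 (! 32210 4500) (% 2 11 (% 2 6 (% 4 10 (! 1010 20002340305) (% 2 10 (% 4 6 (! 1010 20002340305) (% 4 9 (! 2110 30000040503) (% 3 9 (% 3 6 (! 0 2002013104501) (% 3 8 (! 32210 4500) (% 4 8 (% 1 4 (! 0 110200423135) (% 1 8 (! 0 110200423135) (% 8 9 (! 0 10302432115) ($ 1 9 4 8)))) ($ 3 4 6 8)))) (% 3 6 (% 1 4 (! 0 110200423135) (% 1 3 (% 0 7 (! 10000 2000043300502) (% 0 9 (! 0 3214010125) (% 7 12 (! 21000 4000000300305) (% 9 12 (! 0 2011004312305) ($ 0 12 7 9))))) ($ 1 9 3 4))) ($ 3 4 6 9))))) ($ 2 4 5 10))) (% 3 6 (% 0 7 (% 2 9 (! 0 1202130402105) (% 6 12 (! 21000 4000000300305) (% 9 12 (! 2100 4003000300005) ($ 2 12 6 9)))) (% 6 7 (% 7 11 (! 32210 40000500) (% 0 9 (% 2 9 (! 1210 4003030500) (% 3 9 (! 0 3104212015) ($ 0 9 2 3))) (% 9 11 (% 4 7 (! 0 104235120021) (% 4 9 (% 7 12 (! 21000 4000000300305) (% 9 12 (! 21000 4003000300005) ($ 0 12 7 9))) ($ 0 4 7 9))) ($ 0 11 7 9)))) ($ 0 6 2 7))) ($ 0 6 2 3))) ($ 0 11 2 3)))) (% 4 8 (% 0 7 (% 1 5 (! 32100 400005) (% 1 10 (! 0 2012031402105) (% 5 9 (! 2100 3003000400005) (% 9 10 (! 0 121130420205)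 ($ 1 9 5 10))))) (% 4 7 (% 2 6 (% 5 6 (! 21000 3400005) (% 2 10 (% 1 10 (! 0 120100423135) (% 9 10 (! 0 121140520303) (% 5 9 (% 0 10 (! 0 2033041210501) (% 4 10 (! 21000 30003400005) ($ 0 4 2 10))) (% 1 5 (% 6 10 (! 0 12314120035) ($ 5 10 6 9)) ($ 1 9 5 10))))) (% 6 10 (% 10 12 (! 0 1031122430005) ($ 2 12 5 10)) ($ 2 6 5 10)))) (% 6 7 (% 1 10 (! 0 1012241300530) (% 1 5 (% 0 3 (! 32210 405000) (% 3 6 (! 0 2314120035) ($ 0 6 2 3))) (% 2 10 (% 5 9 (! 0 23142500110) (% 9 10 (! 0 121140520303) ($ 1 9 5 10))) ($ 1 2 5 10)))) ($ 0 6 2 7))) ($ 0 4 2 7))) ($ 0 4 2 8))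
  s24 = % 0 12 (% 5 12 (! 32100 4000000500000) (% 2 7 (% 2 8 s23 (% 8 12 (% 1 5 (% 1 6 (! 0 122310145) (% 1 8 (! 21000 300045) (% 2 6 (% 3 6 (! 0 1011304212035) (% 3 8 (! 2210 405303) (% 4 6 (! 0 1001302431025) (% 4 8 (! 21100 3000400503000) ($ 3 4 6 8))))) ($ 1 2 6 8)))) (% 1 8 (% 1 10 (% 0 7 (! 0 2012031402105) (% 2 6 (! 1000 23002300045) (% 6 7 (! 1000 23002300045) ($ 0 6 2 7)))) (% 2 10 (% 1 3 (! 21110 3450) (% 1 4 (! 1000 20000320345) (% 3 8 (! 32210 4500) (% 4 8 (! 21100 3000400503000) ($ 1 8 3 4))))) ($ 1 2 5 10))) ($ 1 2 5 8))) ($ 2 12 5 8))) (% 7 12 (% 2 10 (! 21000 4000000300305) (% 10 12 (% 2 9 (! 21000 4000000300305) (% 3 9 (% 2 8 (% 2 4 (! 21000 4000000300305) (% 4 8 (% 0 3 (! 1100 2002200403005) (% 2 6 (! 0 2011233410005) (% 3 6 (! 0 2011233410005) ($ 0 6 2 3)))) ($ 0 4 2 8))) (% 8 12 (% 0 3 (! 1100 2002200403005) (% 3 11 (! 10100 3200020403005) (% 2 11 (% 8 11 (! 22100 3000400503000) (% 5 11 (% 0 9 (! 0 4203120101305) (% 9 11 (! 0 1301200421205) ($ 0 11 3 9))) ($ 2 11 5 8))) ($ 0 11 2 3)))) ($ 2 12 5 8))) (% 3 7 (% 1 5 (! 32210 40500000) (% 1 10 (% 0 3 (! 0 2101120403105)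 (% 0 7 (! 0 2101130402105) (% 3 11 (! 10100 3000022403005) (% 7 11 (! 0 122130415210) ($ 0 11 3 7))))) ($ 1 2 5 10))) ($ 2 3 7 9)))) ($ 2 12 5 10))) ($ 2 12 5 7)))) (% 5 12 (% 2 6 (! 21000 3000003400005) (% 6 12 (! 32100 4000000500000) ($ 0 6 2 12))) ($ 0 5 2 12))
  s25 = % 1 5 (! 11000 20000320245) (% 1 10 (! 1000 2032003200045) (% 5 12 (! 1000 3022003400025) (% 10 12 (! 1000 3020000320245) ($ 1 12 5 10))))
  s26 = % 3 6 (% 1 3 s25 (% 1 5 (! 11000 20000320245) (% 3 12 (% 3 7 (% 2 10 (! 21110 3004500) (% 2 5 (% 0 2 (! 0 2000103014512) (% 0 3 (! 10100 200020403005) (% 2 11 (! 0 11003214512) (% 3 11 (% 0 7 (! 0 1011231400025) (% 7 11 (! 23210 40005000) (% 9 11 (! 33210 400000005000) (% 0 9 (% 2 9 (! 0 11002314502) ($ 0 9 2 3)) ($ 0 11 7 9))))) ($ 0 11 2 3))))) (% 1 10 (% 1 6 (! 0 1020203121045) (% 1 8 (! 1000 2032003200045) (% 6 12 (! 0 3020102415013) (% 8 12 (! 0 1011322410035) ($ 1 12 6 8))))) ($ 1 2 5 10)))) (% 1 6 (% 1 8 (! 32110 4000050) (% 2 8 (! 0 1000102013453) (% 2 5 (% 2 7 (! 0 1001002103453) (% 2 9 (! 21110 3000450) ($ 2 3 7 9))) ($ 1 2 5 8)))) (% 4 7 (% 8 12 (! 0 1111322400035) (% 1 8 (% 6 12 (!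 0 3011202415013) (% 9 12 (! 1000 3022000320245) ($ 1 12 6 9))) (% 5 12 (% 6 12 (! 11210 3000004005000) ($ 1 12 6 8)) ($ 1 12 5 8)))) (% 4 9 (% 1 4 (! 33210 45000) ($ 1 7 3 4)) ($ 3 4 7 9))))) (% 5 12 (% 4 12 (! 21000 3000003400005) (% 1 4 (% 1 6 (! 0 1000203121045) (% 4 6 (! 0 1000203141025) (% 4 9 (! 0 1001201423035) ($ 1 4 6 9)))) ($ 1 12 3 4))) ($ 1 12 3 5))))) (% 5 9 (% 4 6 (! 1000 23002430005) (% 4 9 (% 1 5 (! 11000 20000320245) (% 1 10 (! 2100 34000530000) (% 5 12 (! 2100 3004000530000) (% 10 12 (! 21000 30003400005) ($ 1 12 5 10))))) ($ 3 4 6 9))) ($ 3 5 6 9))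
  s27 = % 5 12 (% 9 12 (! 21000 3000003400005) ($ 1 12 7 9)) ($ 1 12 5 7)
  s28 = % 1 6 (! 0 11002302145) ($ 1 5 6 9)
  s29 = % 0 7 (% 1 5 (! 32100 400005) (% 2 5 (% 5 12 (% 9 12 (! 21000 3000003400005) (% 7 12 (% 2 7 (! 0 1002231400025) (% 2 12 (! 0 2001032410105) (% 6 7 (! 0 11032400215) (% 6 12 (% 1 3 (! 1000 3022003400025) (% 1 4 (! 2100 3000000430005) (% 3 12 (! 0 3001120415210) (% 4 12 (! 21000 3000003400005) ($ 1 12 3 4))))) ($ 2 6 7 12))))) ($ 1 12 7 9))) (% 7 12 (% 3 7 (! 10100 200030402005) (% 4 7 (! 0 1012231400025) (% 4 9 (! 10100 202230400005) (% 3 9 (% 0 2 (! 0 11022300415) (% 0 3 (! 0 1130204315) (% 2 7 (! 0 1012231400025) ($ 0 7 2 3)))) ($ 3 4 7 9))))) ($ 1 12 5 7))) (% 2 7 (% 7 12 (! 0 1012231400025) s27) ($ 1 2 5 7)))) (% 0 9 (% 5 6 (! 21000 3400005) (% 5 9 (! 1000 23002400005) (% 3 9 (% 9 12 (% 1 3 (! 0 1004103215032) (% 1 5 (! 0 1002103413025) (% 3 12 (! 0 3012201415013) (% 5 12 (! 3210 4005000000000) ($ 1 12 3 5))))) (% 3 12 (% 9 10 (! 0 2014103315012) (% 6 10 (% 1 8 (! 0 1012201413035) (% 5 12 (! 1000 2033002400005) (% 8 12 (! 0 2013301415012) (% 1 5 (% 1 6 (! 0 2000201321045) ($ 1 5 6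 9)) ($ 1 12 5 8))))) ($ 5 10 6 9))) (% 1 3 (% 1 6 (! 32110 4000050) (% 6 12 (! 1000 3022004300025) ($ 1 12 6 9))) ($ 1 12 3 9)))) (% 3 6 (% 2 7 (% 7 12 (% 6 10 (% 1 10 (! 0 1022131400035) (% 5 12 (! 1000 2033002400005) (% 10 12 (! 1000 2043005300002) (% 1 5 s28 ($ 1 12 5 10))))) (% 9 10 (% 1 5 s28 (% 1 8 (! 0 1012231400035) (% 2 5 (! 0 1002031402501) (% 2 8 (! 0 13224010125) ($ 1 2 5 8))))) ($ 5 10 6 9))) (% 1 5 s28 s27)) (% 2 9 (% 9 10 (! 0 13004021215) (% 6 10 (% 3 7 (! 21110 3004500) (% 4 7 (! 0 3114020215) (% 4 9 (! 32110 4005000000) ($ 3 4 7 9)))) ($ 5 10 6 9))) ($ 1 2 7 9))) ($ 3 5 6 9))))) ($ 0 1 7 9))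
  s30 = % 9 10 (! 21000 3000400503) ($ 5 10 6 9)
  s31 = % 2 11 (% 2 4 (% 2 5 (% 3 7 (! 32210 4500) (% 3 9 (! 0 12001304512) (% 4 9 (! 21000 3000400503) (% 4 7 (% 5 12 (% 1 3 (! 0 1000120314520) (% 1 4 (! 0 110200423135) (% 3 12 (! 0 3101022431005) (% 4 12 (% 5 9 (! 2100 4003000530000) (% 6 10 (! 2100 4030000530000) s30)) ($ 1 12 3 4))))) (% 2 12 (% 1 3 (! 0 1000120314520) (% 1 4 (! 0 110200423135) (% 3 12 (! 0 2000120314510) (% 4 12 (! 21000 3000000400503) ($ 1 12 3 4))))) ($ 2 5 6 12))) ($ 3 4 7 9))))) (% 0 9 (% 5 9 (! 0 3112412005) (% 6 10 (! 0 1023024120105) (% 9 10 (! 32110 4000000500) ($ 5 10 6 9)))) (% 5 9 (% 4 10 (! 2110 33000040500) (% 2 10 (% 7 11 (! 1000 2033420005) (% 9 11 (! 0 312000423115) (% 0 7 (% 0 10 (! 1000 32000420205) (% 6 10 (! 0 1034035110202) ($ 0 6 2 10))) ($ 0 11 7 9)))) ($ 2 4 5 10))) ($ 0 5 2 9)))) (% 4 8 (% 0 9 (% 5 9 (! 0 3102402115) (% 6 10 (! 0 13202403115) (% 9 10 (! 0 23204101125) ($ 5 10 6 9)))) (% 4 9 (% 2 5 (% 1 3 (! 0 1010203413025) (% 1 5 (! 0 1010304212035) (% 3 12 (! 0 1201020324501) (% 5 12 (% 4 10 (! 1000 23002340005) (% 5 9 (! 2100 3004000530000) (% 9 10 (!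 0 3012004231015) ($ 4 9 5 10)))) ($ 1 12 3 5))))) (% 5 9 (% 1 5 (! 0 1010304212035) (% 1 10 (! 2100 34000530000) (% 2 10 (! 32110 4000000500) ($ 1 2 5 10)))) ($ 0 5 2 9))) ($ 0 4 2 9))) ($ 0 4 2 8))) ($ 0 11 2 3)
  s32 = % 8 12 (! 0 3000402512011) ($ 1 12 4 8)
  s33 = % 6 12 (% 5 6 (! 1000 22003420005) (% 3 6 (% 0 3 (! 0 2000104213015) (% 3 11 (! 32210 4500) (% 0 2 (% 1 5 (! 32100 400005) (% 5 12 (% 1 4 (! 2100 3000000430005) (% 3 12 (! 0 3000201425021) (% 4 12 (! 21000 3000000400305) (% 1 3 (% 0 9 (! 2100 3003000400005) (% 1 7 (! 21000 345) (% 0 7 (% 2 5 (! 21000 400305) (% 2 7 (! 31210 405) ($ 1 2 5 7))) ($ 0 1 7 9)))) ($ 1 12 3 4))))) (% 8 12 (% 1 3 (! 0 1010203413025) (% 3 12 (! 0 4000203125011) ($ 1 12 3 5))) ($ 1 12 5 8)))) s31))) (% 5 12 (% 3 8 (! 32210 4500) (% 4 6 (! 1000 3020002430005) (% 4 8 (% 0 2 (% 1 4 (! 2100 3000000430005) (% 4 12 (! 21000 3000000400305) s32)) (% 0 3 (% 1 4 (! 0 100100243125) (% 4 12 (! 0 1100200243105) s32)) ($ 0 6 2 3))) ($ 3 4 6 8)))) (% 3 12 (% 0 2 (% 1 5 (! 32100 400005) (% 8 12 (% 3 8 (! 32210 4500) (% 4 6 (! 100 2200300432005) (% 4 8 (!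 0 11203413205) ($ 3 4 6 8)))) ($ 1 12 5 8))) (% 0 3 (% 2 4 (! 0 10200423115) (% 4 9 (! 0 111200423105) (% 0 9 (% 1 5 (! 32210 405000) (% 1 10 (! 0 2010201413025) (% 10 12 (! 0 2012200413105) ($ 1 12 5 10)))) ($ 0 4 2 9)))) ($ 0 6 2 3))) ($ 3 5 6 12))))) (% 8 12 (% 9 12 (% 8 11 (! 32100 400500000) (% 0 2 (% 0 12 (! 2100 4003000300005) (% 11 12 (! 20100 300300400005) ($ 0 11 8 12))) (% 2 11 (% 0 3 (! 0 1112300214503) (% 3 6 (% 4 8 (! 0 3012401203510) (% 2 4 (% 0 9 (! 32110 4000000500) (% 2 5 (! 21000 3000400503) (% 5 9 (! 32110 4000000500) ($ 0 5 2 9)))) ($ 0 4 2 8))) ($ 0 6 2 3))) ($ 0 11 2 8)))) ($ 1 12 6 9)) ($ 1 12 6 8))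
  s34 = % 1 6 (% 1 5 (! 0 1000102312045) (% 5 6 (! 21000 3400005) (% 3 6 (% 1 10 (! 0 1020203121045) (% 10 12 (! 0 1020102413035) (% 5 12 (% 6 10 (% 1 3 (! 21110 3004050) (% 1 4 (! 0 1000203121045) (% 4 12 (! 21000 3000003400005) (% 3 12 (% 6 12 (! 0 3000201425021) (% 9 12 (! 21000 3000003400005) (% 5 9 (% 0 9 (! 1000 2033002400005) (% 1 7 (% 0 7 (! 0 1010223100045) (% 4 7 (! 0 2010213120045) (% 4 9 (! 21000 3004300005) ($ 0 4 7 9)))) (% 0 7 (% 7 12 (% 6 7 (! 0 2131400025) ($ 1 6 5 7)) ($ 1 12 7 9)) ($ 0 1 7 9)))) ($ 5 12 6 9)))) ($ 1 12 3 4))))) ($ 1 6 5 10)) ($ 1 12 5 10)))) s11))) (% 2 9 (% 1 8 (% 9 12 (% 1 5 (! 21000 300045) (% 1 10 (! 21000 3000000300045) (% 5 12 (% 0 2 (! 21000 3000000400305) (% 0 9 (! 3210 4005000000000) (% 5 9 (! 21000 3000400035) (% 2 5 (% 2 4 (! 21000 3000400503) (% 4 9 (! 3210 4005000000000) ($ 0 4 2 9))) ($ 0 5 2 9))))) (% 10 12 (% 0 9 (! 3210 4005000000000) (% 0 12 (! 1000 4023000320205) (% 5 9 (! 21000 3000400035) ($ 0 5 9 12)))) ($ 1 12 5 10))))) (% 6 12 (% 5 6 (! 0 1203421015) (% 5 12 (% 6 10 (! 1000 2030004200035) (% 9 10 (! 21000 30000400035) (% 5 9 (% 2 12 (! 1000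 23000420235) (% 3 6 (% 1 4 (! 1000 3020000430025) (% 3 12 (! 0 3000201425021) (% 4 12 (! 2100 4003000530000) (% 1 3 (% 0 2 (! 0 1102012345) (% 0 9 (! 1000 23002400005) (% 2 4 (! 0 1201023451) (% 4 9 (! 1000 3022000430025) ($ 0 4 2 9))))) ($ 1 12 3 4))))) (% 3 12 (% 3 9 (! 0 3002001415021) (% 4 6 (! 1000 3022004300025) (% 4 9 (! 1000 3022000430025) ($ 3 4 6 9)))) ($ 2 3 6 12)))) ($ 5 10 6 9)))) (% 1 5 (! 21000 300045) (% 1 10 (! 1000 3020002300045) (% 10 12 (% 5 9 (! 21000 30000400035) (% 6 10 (! 1000 2030004200035) (% 9 10 (! 2100 4053000000030) ($ 5 10 6 9)))) ($ 1 12 5 10)))))) ($ 1 12 6 9))) (% 2 8 s33 ($ 1 2 6 8))) ($ 1 2 6 9))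
  -- Vertex 10 is the p-parent of b 0, and b 0 is adjacent to a 0 and a 3. The outermost questions
  -- follow the pairs a i and b (i - 2) for i from 0 to 3. Where such a pair is not adjacent, the
  -- q-parent of a i is a vertex outside the walks, and `new` adds it as vertex 11.
  s35 = % 0 8 (% 1 9 (% 2 5 (% 3 6 (% 8 9 (! 0 11322410005) s1) (new 3 false 11 (% 3 9 (% 3 8 (% 0 2 (! 100 2300405002) (% 0 3 (! 0 100211403005) (% 2 6 (! 0 11301402025) ($ 0 6 2 3)))) (% 2 6 (% 0 2 (! 0 100200324521) (% 0 3 (! 0 12201413005) (% 2 8 (! 0 100200324511) ($ 0 8 2 3)))) (% 2 8 (% 2 7 (! 0 100200324511) (% 2 9 (! 0 1200324501) (% 7 8 (! 0 301421205) (% 8 9 (! 0 301421205) ($ 2 8 7 9))))) ($ 2 3 6 8)))) (% 5 9 (% 2 6 (% 4 6 (! 1000 23002430005) (% 4 9 (! 100 4203523000) ($ 3 4 6 9))) s2) (% 5 6 s3 ($ 3 5 6 9)))))) (new 2 false 11 (% 2 8 (% 1 8 (! 0 10300412125) s6) (% 1 5 (% 1 6 (! 0 11002312045) (% 1 8 (! 21000 300045) (% 2 6 (% 5 11 (! 21000 300003400005) (% 8 11 (! 0 111302412005) ($ 2 11 5 8))) ($ 1 2 6 8)))) (% 1 8 (% 5 11 (! 21000 300000400035) (% 8 11 (! 0 111300412025) ($ 2 11 5 8))) ($ 1 2 5 8)))))) (new 1 false 11 (% 2 6 (% 8 11 (! 0 111302412005) (% 1 5 (% 1 6 (! 0 111002312045)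 (% 5 6 (! 21000 3400005) (% 5 9 (% 0 7 (! 32100 400005) (% 0 9 (! 1000 23002400005) (% 1 7 (! 11000 20000320245) ($ 0 1 7 9)))) ($ 1 5 6 9)))) (% 5 11 (% 1 8 (! 0 201302401015) s9) (% 1 8 (% 1 3 (! 0 101302102045) (% 3 11 (! 0 110301402025) ($ 1 11 3 5))) ($ 1 11 5 8))))) s13))) (new 0 false 11 (% 1 9 (% 2 5 s19 (new 2 false 12 (% 0 2 (% 1 5 (! 32100 400005) s22) s24))) (new 1 false 12 (% 2 6 (% 1 7 (% 5 6 (! 21000 3400005) (% 3 9 (% 0 3 (! 0 1012201413025) (% 1 3 s25 (% 0 9 (% 1 5 (! 11000 20000320245) (% 3 12 (% 1 6 (! 0 1001003021245) (% 1 8 (! 0 1012201413035) (% 8 12 (! 0 2013301415012) (% 6 12 (% 5 12 (! 0 3001201425021) ($ 1 12 5 8)) ($ 1 12 6 8))))) (% 5 12 (% 9 12 (! 3210 4005000000000) ($ 1 12 3 9)) ($ 1 12 3 5)))) ($ 0 1 3 9)))) s26)) s29) s34))))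
  s36 = % 4 8 (! 33210 400005000) (% 5 9 (! 21000 3000400005) ($ 4 9 5 8))
  s37 = % 1 10 (! 21000 3000000300045) (% 5 12 (% 0 2 (! 21000 3000000400305) (! 3210 4005000000000)) (% 10 12 (! 3210 4005000000000) ($ 1 12 5 10)))
  s38 = % 1 4 (! 0 10402335012) ($ 1 6 3 4)
  s39 = % 2 6 (! 0 2013301402005) (% 2 9 (! 0 1023002104105) ($ 1 2 6 9))
  s40 = % 1 9 (% 8 9 (! 33210 400005000) (% 3 9 (% 1 5 (! 0 23001114025) (% 1 8 (% 5 6 (! 0 23002114015) (% 5 9 (! 0 23100104025) (% 6 10 (! 0 23001004125) (% 9 10 (% 1 7 (! 0 23100021245) (% 2 7 (! 0 23001104125) (% 2 5 (% 2 6 (! 0 23102104015) (% 2 9 (new 7 true 12 (% 1 12 (! 0 3100021245) (% 2 12 (! 0 1100130204235) ($ 1 2 7 12)))) ($ 2 5 6 9))) ($ 1 2 5 7)))) ($ 5 10 6 9))))) (% 5 9 (% 1 6 (! 0 23001114025) (% 2 6 (! 0 23102104015) (% 2 8 (! 0 103110204205) ($ 1 2 6 8)))) ($ 1 9 5 8)))) (% 1 8 (% 9 10 (% 1 3 (! 2100 34300000050) (% 1 4 (! 32110 4000000050) (% 4 9 s36 ($ 1 9 3 4)))) (% 1 10 (% 4 6 (! 0 23012110145) (% 4 9 s36 (% 3 6 (% 1 3 (! 0 10201203045) (% 1 4 (! 0 10402331052) ($ 1 9 3 4))) ($ 3 4 6 9)))) (% 1 3 (% 1 5 (! 21000 300045)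 (% 5 9 (! 0 22100103045) ($ 1 9 5 10))) ($ 1 9 3 10)))) (% 1 3 (% 1 5 (! 21000 300045) (% 5 9 (% 4 9 (% 4 8 (! 33210 400005000) (! 21000 3000400005)) ($ 3 4 5 9)) ($ 1 9 5 8))) ($ 1 9 3 8))))) (new 1 false 12 (% 8 12 (! 33210 400005000) (% 1 5 (% 1 3 (! 21000 300045) (% 1 4 (! 0 1010200321045) ($ 1 5 3 4))) (% 1 8 (% 7 8 (! 23210 40005000) (% 8 9 (! 33210 400005000) (% 1 7 (% 4 6 (! 0 1010401235032) (% 4 9 s36 (% 3 6 (% 1 6 (! 0 1000203021245) (% 2 6 (! 11210 403005000) (% 2 9 (% 6 12 (! 0 1000203114025) (% 9 12 s37 ($ 1 12 6 9))) ($ 1 2 6 9)))) (% 3 9 (% 1 3 (! 0 1010201203045) (% 3 12 (% 2 6 (! 0 1013401205032) (% 1 6 s38 (% 2 9 (% 6 12 (! 0 23102104105) (% 9 12 (! 0 2013001204015) ($ 1 12 6 9))) ($ 1 2 6 9)))) (% 9 12 (% 1 6 s38 (% 2 6 (! 0 1013401205032) (% 2 9 s37 ($ 1 2 6 9)))) ($ 1 12 3 9)))) ($ 3 4 6 9))))) ($ 1 8 7 9)))) (% 5 12 (% 3 12 (% 1 6 (% 1 3 (! 21100 3045) (% 1 4 (! 0 2010301432015) (% 3 6 (! 0 1020103104025) (% 4 6 (! 0 2010301432015) ($ 1 6 3 4))))) (% 6 12 (% 3 6 (! 0 1000203104025) (% 4 6 (! 0 2010301432015) (% 4 9 (! 0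 4011002335012) (% 3 9 s39 ($ 3 4 6 9))))) ($ 1 12 6 8))) (% 1 3 (% 1 6 (! 21100 3045) (% 6 12 (% 3 6 (! 0 1000203114025) (% 3 9 s39 ($ 1 3 6 9))) ($ 1 12 6 8))) ($ 1 12 3 8))) ($ 1 12 5 8))))))
  s41 = % 0 8 (% 0 7 (! 210 300004005) (% 7 8 (! 23210 40005000) (% 8 9 (! 33210 400005000) (% 0 9 (% 1 6 (! 0 21302114005) (% 1 8 (! 110 20300004025) (% 2 6 (! 0 21302114005) (% 2 8 (! 10010 2300004205) ($ 1 2 6 8))))) ($ 0 8 7 9))))) (new 0 false 11 (% 7 11 (! 23210 40005000) (% 0 7 (% 2 9 (! 0 101130204205) (% 3 6 (! 1010 32204005) (% 2 6 (% 1 5 (! 32100 400005) (% 1 7 (! 0 230104125) (% 2 5 (% 2 7 (! 10010 230204005) (% 1 9 (% 1 10 (! 100 20302004035) (% 5 9 (! 10010 202230004005) (% 9 10 (% 8 9 (! 33210 400005000) (% 1 8 (% 0 9 (! 0 32402125031) (% 0 10 (! 22100 30000004005) (% 9 11 (! 210 300300004005) (% 10 11 (! 210 300300004005) ($ 0 11 9 10))))) ($ 1 9 5 8))) ($ 1 9 5 10)))) ($ 1 2 7 9))) (% 2 7 (% 1 10 (! 100 20302004035) (% 2 10 (! 32210 4500) ($ 1 2 5 10))) ($ 1 2 5 7))))) (% 3 9 (% 1 5 (! 32100 400005) (% 2 8 (! 0 101130204205) (% 2 5 (% 5 6 (! 32100 400005) (% 5 9 (! 10010 202230004005) ($ 2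 5 6 9))) (% 1 8 (% 1 6 (! 32100 45) (% 1 9 (% 5 9 (! 10010 202230004005) (% 9 10 (! 100 232000004035) (% 1 10 (% 2 7 (! 0 13021304105) (% 1 7 (new 2 false 12 (! 0 230102145)) ($ 1 2 5 7))) ($ 1 9 5 10)))) ($ 1 2 6 9))) ($ 1 2 5 8))))) ($ 2 3 6 9))))) (% 0 9 s40 (% 9 11 (% 3 11 (! 33210 400000005000) (% 8 9 (! 33210 400005000) (% 8 11 (! 33210 400005000) (% 3 9 (% 5 9 (! 13210 4000005000) (% 5 11 (% 4 11 (! 0 311200421005) ($ 3 4 5 11)) ($ 5 8 9 11))) ($ 3 8 9 11))))) ($ 0 11 7 9))))))
  s42 = % 1 3 (! 21000 300045) ($ 1 5 3 4)
  s43 = % 2 8 (! 0 310421205) ($ 0 8 2 9)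
  s44 = new 0 false 10 (% 3 10 (! 0 22131401005) (% 8 10 (! 0 22131401005) ($ 0 10 3 8)))
  s45 = new 0 false 10 (! 0 14152331002)
  s46 = % 1 9 (% 1 5 (! 21000 300045) (% 1 8 (% 3 6 (! 0 2301224051) (% 3 9 (! 0 2301214051) (% 4 6 (% 5 6 (! 32100 400005) (% 6 7 (! 2110 34000005) (% 4 7 (% 1 4 (! 2100 30045) (% 1 7 (! 0 230104152) (% 2 4 (! 2010 30040005) (% 2 7 (! 0 3112300245) ($ 1 2 4 7))))) ($ 4 6 5 7)))) (% 4 9 (new 0 false 10 (! 2100 300030045)) ($ 3 4 6 9))))) (% 5 9 s44 (% 8 9 (% 0 9 (! 0 3142102005) (% 4 9 (% 2 4 s45 (% 2 9 (new 0 false 10 (% 3 10 (! 210 33400005000) (% 8 10 (% 0 2 (! 21000 300405) (% 2 10 (! 0 2423105130) ($ 0 10 2 3))) ($ 0 10 3 8)))) ($ 2 5 4 9))) (% 4 8 (% 3 6 (! 20100 304000035) (% 3 9 (! 0 3401215021) (% 4 6 (! 0 2103242015) ($ 3 4 6 9)))) ($ 0 4 8 9)))) ($ 1 9 5 8))))) (% 3 6 (% 1 7 (! 0 230104152) (% 2 7 (! 0 1132400215) (% 2 9 (% 0 2 (! 21000 400305) (% 0 9 (! 12010 3040000005) (% 2 4 (new 0 false 10 (% 9 10 (! 0 21334112005) (% 2 10 (% 8 10 (! 0 312401235) (% 3 10 (new 1 false 11 (! 0 113114200235)) ($ 0 10 3 8))) ($ 0 10 2 9)))) (% 4 9 (%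 4 8 (! 20100 304000035) (% 5 9 (! 0 2033410511) (% 8 9 (! 20100 304000035) ($ 4 9 5 8)))) ($ 0 4 2 9))))) ($ 1 2 7 9)))) (% 3 9 (% 0 9 (% 1 7 (! 0 230104152) (% 2 7 (! 10010 3020400305) (% 2 9 (! 12010 3040000005) ($ 1 2 7 9)))) (% 5 9 (% 1 7 (! 0 230104152) (% 2 7 (! 0 2031410125) (% 2 9 (! 0 3021400521) ($ 1 2 7 9)))) ($ 0 5 3 9))) ($ 1 3 6 9)))
  s47 = new 5 true 10 (! 1000 20230345)
  s48 = new 5 true 12 (% 3 12 (! 0 2003102411305) (% 4 12 (! 2110 30345) ($ 3 4 5 12)))
  s49 = % 3 6 (% 1 8 (% 4 9 (! 2110 30345) (% 0 9 (% 0 2 (! 2110 345) (% 2 9 (! 32110 450) (% 3 9 (! 100 2403205000) ($ 0 9 2 3)))) (% 4 7 (% 2 4 (! 32110 450) (% 2 7 (! 0 130102452) (% 4 6 s47 (% 6 7 (new 5 true 10 (% 4 10 (! 2110 30345) (% 3 10 (% 5 6 (! 21000 3400005) (% 5 9 (! 100 2304025020) (% 6 10 (! 100 20304005020) (% 9 10 (! 0 23014120235) ($ 5 10 6 9))))) ($ 3 4 5 10)))) ($ 2 6 4 7))))) ($ 0 4 7 9)))) (% 0 8 (% 1 6 (! 0 223100145) (% 6 7 (! 0 314102025) (% 7 8 (% 0 9 (% 0 2 (! 0 122400315) (% 2 9 (! 0 1312400205) (% 3 9 (! 0 1423105200) ($ 0 9 2 3)))) (% 4 7 (% 2 4 (!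 0 304102125) (% 2 7 (! 210 340005000) (% 4 6 (! 0 2314210005) ($ 2 6 4 7)))) (% 4 9 (% 4 8 (! 0 1300142125) (% 5 9 (! 0 320411125) (% 8 9 (! 0 423105102) ($ 4 9 5 8)))) ($ 0 4 7 9)))) ($ 1 7 6 8)))) (% 1 3 (% 1 6 (! 32110 4000050) (% 7 8 (! 0 230104152) (% 6 7 (new 0 false 10 (% 0 2 (! 2110 345) (% 2 10 (! 0 12103452) (% 3 10 (! 0 10234105021) ($ 0 10 2 3))))) ($ 1 7 6 8)))) ($ 0 1 3 8)))) (% 6 7 (% 4 9 (% 2 4 (! 2110 34030005) (% 2 9 (! 0 3124210510) (% 5 9 (! 0 3142510210) ($ 2 5 4 9)))) (% 0 9 (% 8 9 (! 0 3124200015) (% 3 9 (% 0 8 (new 5 true 11 (% 5 6 (! 21000 3400005) (% 5 9 (! 0 102301412005) (% 6 11 (! 0 102304201015) (% 9 11 (! 0 2314102005) ($ 5 11 6 9)))))) (% 1 3 (new 3 false 11 (% 6 11 (! 21110 300045000030) (% 0 11 (new 5 true 12 (% 5 6 (! 21000 3400005) (% 5 9 (! 0 3012400215) (% 6 12 (! 2110 3000004000035) (% 9 12 (! 0 2003014100225) ($ 5 12 6 9)))))) ($ 0 6 3 11)))) (% 1 8 s48 ($ 0 1 3 8)))) (% 0 8 (% 0 2 (! 0 122400315) (% 2 9 (! 0 2314102005) ($ 0 9 2 3))) ($ 0 9 3 8)))) (% 4 7 (% 3 9 (% 5 9 (% 1 9 (! 0 3140215210) (% 1 3 (new 1 false 10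 (! 0 2230104152)) ($ 0 1 3 9))) ($ 0 5 3 9)) (% 4 6 (% 1 8 s47 (% 0 8 (% 7 8 (! 0 312400215) (% 8 9 (! 0 2314100025) ($ 0 8 7 9))) (% 1 3 (% 1 6 (! 32110 4000050) (% 1 9 (! 0 3021230145) ($ 1 3 6 9))) ($ 0 1 3 8)))) ($ 3 4 6 9))) ($ 0 4 7 9)))) ($ 0 6 3 7))
  s50 = % 1 9 (% 3 6 (% 1 5 (! 21000 300045) (% 1 8 (! 100 2403225000) (% 8 9 (! 22100 403005000) (% 5 9 (% 3 9 (! 0 4023105102) (% 4 9 (new 5 true 10 (new 7 true 11 (% 0 11 (! 0 12302411035) (% 1 11 (! 22100 300000034050) ($ 0 1 7 11))))) ($ 3 4 5 9))) ($ 1 9 5 8))))) (% 6 7 (% 4 9 (% 2 4 (! 2110 34030005) (% 2 9 (! 21110 34000530) (% 5 9 (new 5 true 11 (% 1 5 (! 21000 300045) (% 1 11 (! 32110 4000000050) (% 3 11 (% 0 11 (! 0 202034100135) (% 6 11 (! 32110 4005000000) ($ 0 6 3 11))) ($ 1 3 5 11))))) ($ 2 5 4 9)))) (% 0 9 (% 4 6 (! 0 2231400135) (% 3 9 (% 1 5 (! 21000 300045) (% 1 8 (! 0 3101202045) (% 5 9 (! 0 2031410135) (% 8 9 (! 0 3415102002) ($ 1 9 5 8))))) ($ 3 4 6 9))) (% 4 7 (% 2 4 (! 21110 34000530) (% 2 7 (! 0 3024310511) (% 1 4 (% 1 5 (! 21000 300045) (% 4 8 (! 2100 3300040050) (% 1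 8 (% 3 9 (! 100 302024050) (% 4 6 (! 0 2021230145) ($ 3 4 6 9))) ($ 1 4 5 8)))) ($ 1 2 4 7)))) ($ 0 4 7 9)))) ($ 0 6 3 7))) (% 0 9 (% 1 6 (! 32110 4000050) (% 3 9 (% 3 6 (% 2 9 (! 0 3224100125) (% 2 7 (% 0 2 (! 1000 20400325) (% 2 4 (! 32210 40000500) (% 4 7 (% 4 6 (! 0 3224511) (% 4 8 (! 0 2113204500) (% 6 7 (! 0 2013204500) (% 7 8 (! 210 340005000) ($ 4 7 6 8))))) ($ 0 4 2 7)))) ($ 1 2 7 9))) (% 6 7 (% 2 7 (! 0 2034100521) (% 2 9 (! 21110 34000530) ($ 1 2 7 9))) ($ 0 6 3 7))) (% 3 6 (% 0 2 (! 1000 20400325) (% 2 9 (! 0 3224100125) ($ 0 9 2 3))) ($ 1 3 6 9)))) ($ 0 1 7 9))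
  s51 = % 0 7 (% 0 8 (% 3 6 (! 100 304002025) (% 4 6 (! 100 2304200005) (% 3 9 (% 0 9 (! 0 2130401205) (% 5 9 (% 1 9 (! 0 1321402005) (% 1 3 (% 1 7 (! 0 130201245) (% 2 7 (! 0 130401225) (% 2 9 (! 0 1321402005) ($ 1 2 7 9)))) ($ 0 1 3 9))) ($ 0 5 3 9))) (% 4 9 (% 4 8 (! 100 300042025) (% 8 9 (! 10000 322400005) (% 5 9 (% 1 7 (! 0 230411125) (% 2 7 (! 0 1130224510) (% 1 9 (% 1 8 (! 0 320411125) (% 1 3 (new 5 true 11 (! 0 104301521032)) ($ 1 9 3 8))) (% 2 9 (% 0 2 (! 21000 400305) (% 0 9 (! 31210 4000000005) s43)) ($ 1 2 7 9))))) ($ 4 9 5 8)))) ($ 3 4 6 9))))) (% 1 3 (% 1 6 (! 32100 45) s46) (% 1 8 (% 1 7 (! 1000 30200245) (% 2 9 (! 10000 32400532) (% 1 9 (% 3 9 (% 5 9 s44 (% 0 9 (new 0 false 10 (! 0 12230401105)) ($ 0 5 3 9))) (% 4 9 (% 5 9 s44 (% 2 4 (% 4 8 (! 2100 43035) (% 8 9 s45 ($ 4 9 5 8))) ($ 2 5 4 9))) (% 1 4 (% 1 5 (! 21000 300045) (% 4 7 (% 2 4 (! 2010 30040005) (% 2 7 (! 0 1012330452) (% 4 6 (! 2100 30045) (% 6 7 (! 2110 34000005) ($ 2 6 4 7))))) ($ 1 4 5 7))) ($ 1 9 3 4)))) (% 2 7 (% 7 8 (! 210 340005000) (% 8 9 (%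 4 8 (! 0 2130124520) (% 4 9 (! 0 1130224510) (% 0 9 (% 0 2 (! 3210 40000005) (% 3 9 (! 0 2130104520) ($ 0 9 2 3))) ($ 0 4 8 9)))) ($ 1 8 7 9))) ($ 1 2 7 9))))) ($ 0 1 3 8)))) (% 1 7 s49 (% 1 3 s50 ($ 0 1 3 7)))
  s52 = % 1 3 (! 32100 45) ($ 0 1 3 8)
  s53 = % 6 7 (! 21110 45300030) ($ 1 6 5 7)
  s54 = % 8 11 (! 210 303400005000) ($ 0 11 3 8)
  s55 = % 1 10 (! 32110 4000000050) (% 9 10 (! 21000 30000400035) ($ 1 9 3 10))
  s56 = % 8 9 (! 0 3410521200) ($ 2 8 7 9)
  s57 = % 2 9 (% 0 2 (! 21000 400305) (% 0 9 (! 12010 4030000005) (% 2 4 (% 1 8 (% 2 8 (! 0 310402512) (% 4 6 (% 1 7 (! 10000 30200245) (% 1 9 (! 0 4023320511) (% 7 8 (! 0 341225001) (% 8 9 (! 0 103142125) ($ 1 8 7 9))))) (% 4 8 (% 4 7 (! 0 30142125) (% 4 9 (! 2100 43035) (% 7 8 (! 0 341225001) (% 8 9 (! 0 103142325) ($ 4 8 7 9))))) ($ 2 4 6 8)))) (% 2 8 (% 0 8 (! 0 302014521) (% 2 7 (! 32210 40000500) (% 7 8 (! 0 301224511) ($ 0 7 2 8)))) (% 1 6 (% 0 8 (! 0 1324112005) s52) ($ 1 2 6 8)))) (% 4 9 (% 1 8 (% 1 4 (! 3210 40005) (% 4 8 (! 2100 43035) (% 8 9 (new 5 true 10 (% 4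 10 (! 2100 30000040035) (% 3 10 (% 0 10 (! 21000 430305) (% 1 3 (! 32100 400000050) (% 1 10 (! 2100 30000030045) ($ 0 1 3 10)))) ($ 3 4 5 10)))) (% 1 9 (% 5 9 (% 0 8 s43 (new 0 false 10 (% 2 10 (! 0 12030410531) (% 9 10 (! 0 13140501202) ($ 0 10 2 9))))) ($ 4 9 5 8)) ($ 1 8 4 9))))) (% 0 8 (% 2 8 (! 0 2310401502) (% 8 9 (! 0 1312400205) ($ 0 8 2 9))) (% 1 3 (% 1 6 (! 32100 45) (% 2 8 (% 4 8 (! 0 213401325) ($ 0 4 2 8)) ($ 1 2 6 8))) ($ 0 1 3 8)))) ($ 0 4 2 9))))) (% 5 9 (% 1 6 (% 1 5 (! 32100 400005) (% 1 7 (! 21100 30000045) s53)) (% 1 9 (% 3 9 (% 1 8 (new 5 true 10 (% 4 10 (! 21000 30000400035) (% 3 10 (% 0 8 (! 0 21300411025) (new 0 false 11 (% 3 11 (! 0 203041205001) s54))) ($ 3 4 5 10)))) (% 2 8 (% 2 7 (! 0 2230114500) (% 7 8 (! 0 1231400025) (% 8 9 (! 2100 4000503003) ($ 2 8 7 9)))) ($ 1 2 6 8))) (% 4 9 (% 1 8 (new 5 true 10 (% 4 10 (! 21000 30000400035) (% 3 10 (% 1 3 (! 2100 4300030050) s55) ($ 3 4 5 10)))) (% 2 8 (% 2 7 (! 0 31224511) (% 7 8 (! 0 1231400025) s56)) ($ 1 2 6 8))) ($ 3 4 5 9))) ($ 1 2 6 9))) ($ 2 5 6 9))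
  s58 = % 4 10 (! 21000 430305) ($ 3 4 5 10)
  s59 = new 5 true 10 (! 0 11302400215)
  s60 = new 0 false 10 (! 10000 302300245)
  s61 = % 0 8 s59 s60
  s62 = % 2 9 (% 0 9 (% 0 8 s59 (% 3 9 (new 0 false 10 (% 0 2 (! 21000 345) (% 2 10 (! 2210 3000004500) (% 3 10 (new 5 true 11 (% 4 11 (! 21000 30345) (% 3 11 (% 5 6 (! 0 102003411205) (% 5 9 (! 0 102003411305) (% 6 11 (! 0 3104012125) (% 9 11 (% 0 11 (! 21000 300000000345) (% 1 3 (! 0 10322104051) (% 1 11 (! 3210 405000000000) ($ 0 1 3 11)))) ($ 5 11 6 9))))) ($ 3 4 5 11)))) ($ 0 10 2 3))))) (% 8 9 s60 ($ 0 9 3 8)))) (% 4 9 (% 4 8 (% 0 8 s59 (new 0 false 10 (% 0 2 (! 21000 345) (% 3 10 (! 100 22300045020) (% 2 10 (% 7 10 (! 0 20210103453) ($ 0 10 3 7)) ($ 0 10 2 3)))))) (% 8 9 s61 (% 5 9 (% 1 4 (! 2110 30045) (% 1 9 (% 0 8 s59 (new 0 false 10 (% 0 2 (! 21000 345) (% 2 10 (! 0 13010200452) (% 3 10 (% 9 10 (! 210 43300005000) ($ 0 10 2 9)) ($ 0 10 2 3)))))) ($ 1 8 4 9))) ($ 4 9 5 8)))) (% 4 7 (% 0 2 (! 21000 345) (% 2 4 (% 4 8 (! 0 21134521) (% 6 7 (! 21110 43000350) (% 7 8 (! 0 340102152) (% 4 6 (% 0 8 s59 (new 0 false 10 (! 0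 113142025))) ($ 4 7 6 8))))) ($ 0 4 2 9))) ($ 0 4 7 9)))) (% 1 9 (% 5 6 (% 0 9 (! 0 3012110245) (% 4 9 (% 4 8 (! 0 1302045112) (% 5 9 (! 0 3124500012) (% 8 9 (! 0 4302011152) ($ 4 9 5 8)))) (% 4 7 (% 4 6 (! 0 3012130245) (% 4 8 (! 0 2403025111) (% 6 7 (! 21000 3400005) (% 7 8 (! 2010 40503003) ($ 4 7 6 8))))) ($ 0 4 7 9)))) (% 5 9 (% 0 9 (! 0 2133100045) (% 4 7 (! 0 4032120251) (% 4 9 (% 0 8 s59 (new 0 false 10 (% 7 10 (! 0 13040210152) (% 3 10 (% 9 10 (! 210 43300005000) ($ 0 10 7 9)) ($ 0 10 3 7))))) ($ 0 4 7 9)))) ($ 2 5 6 9))) ($ 1 2 6 9))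
  s63 = % 2 7 (! 210 340005000) ($ 1 2 4 7)
  s64 = % 1 7 (% 1 6 (% 1 3 (! 10000 3202045) (% 0 8 (% 7 8 (! 0 312400215) (% 8 9 (! 10000 223000045) (% 0 9 (% 5 6 (! 21000 3400005) (% 5 9 (! 0 3224100015) (% 2 9 (new 5 true 10 (% 3 10 (! 0 20304115012) s58)) ($ 2 5 6 9)))) ($ 0 8 7 9)))) (% 1 8 (% 2 9 (! 10000 23400325) (% 5 6 (! 21000 3400005) (% 5 9 (% 4 9 (% 1 4 (! 3210 4000050000) (% 1 9 (! 0 3124100052) (% 4 8 (! 0 1302145102) (% 8 9 (! 0 2403100251) ($ 1 8 4 9))))) (% 3 9 (% 0 9 (! 0 2103100245) (% 1 9 (! 0 3124100052) ($ 0 1 3 9))) ($ 3 4 5 9))) ($ 2 5 6 9)))) ($ 0 1 3 8)))) (% 1 8 s62 (% 2 8 (% 2 9 (% 1 3 (! 21100 3450) (% 0 8 (% 6 7 (! 0 1304012125) (% 7 8 (! 0 310402512) ($ 1 7 6 8))) ($ 0 1 3 8))) (% 1 9 (% 1 3 (% 6 7 (! 0 3142500213) (% 7 8 (! 0 2341500211) ($ 1 7 6 8))) (% 0 8 (% 6 7 (! 0 1304012125) (% 7 8 (! 0 2341105200) ($ 1 7 6 8))) ($ 0 1 3 8))) ($ 1 2 6 9))) ($ 1 2 6 8)))) (% 1 3 (% 1 6 (! 10000 3202045) (% 1 9 (% 1 8 (% 0 9 (! 0 3112100245) (% 4 9 (! 2100 4300030050) (% 4 7 (% 4 8 (! 32100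 400000050) (% 1 4 (% 4 6 (! 0 1012130245) (% 6 7 (! 100 2403225000) (% 7 8 (% 2 9 (! 0 410223150) (% 5 6 (! 20210 340500000) (% 5 9 (! 0 1412023050) ($ 2 5 6 9)))) ($ 4 7 6 8)))) (% 7 8 (% 2 4 (! 0 420103152) s63) ($ 1 8 4 7)))) ($ 0 4 7 9)))) (% 2 8 (% 1 5 (! 21000 300045) (% 5 9 (% 4 9 (% 2 7 (! 0 2230114500) (% 2 9 (! 0 3210421500) (% 7 8 (! 0 2340115200) s56))) (% 3 9 (% 2 7 (! 0 2230114500) (% 2 9 (! 2210 3000004500) (% 7 8 (! 0 2340115200) (% 8 9 (! 210 3400005000) ($ 2 8 7 9))))) ($ 3 4 5 9))) (% 8 9 (% 0 2 (! 0 1121400325) (% 0 8 (! 0 1322400115) (% 2 4 (! 20010 300004500) (% 4 8 (! 2100 4500030030) ($ 0 4 2 8))))) ($ 1 9 5 8)))) ($ 1 2 6 8))) (% 2 9 (% 0 9 (% 1 8 (% 7 8 (! 0 403112351) (% 8 9 (! 32100 400000050) ($ 1 8 7 9))) (% 2 8 (% 0 8 (! 0 2311400215) (% 3 9 (! 2210 3000004500) (% 8 9 (! 20010 300004500) ($ 0 9 3 8)))) ($ 1 2 6 8))) ($ 0 1 7 9)) ($ 1 2 6 9)))) ($ 0 1 3 7))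
  s65 = % 5 6 (! 32100 400005) (% 5 9 (% 0 7 (! 1000 2030400205) (% 0 9 (! 13210 4000000005) (% 2 7 (! 12110 3040000503) ($ 0 2 7 9)))) ($ 2 5 6 9))
  s66 = % 0 9 (! 0 3020001145) (% 5 9 (! 12110 3040000305) ($ 0 5 3 9))
  -- Here a 0 is adjacent to b 0, and a 3 is adjacent to b 2 and b 3 but not to b 0. As b 0 is not
  -- adjacent to a 4 either, its p-parent may be added at once.
  s67 = % 0 3 (new 5 true 10 (% 3 10 s41 (% 4 10 (% 4 6 (! 33210 45000) (% 4 8 (! 33210 400005000) (% 8 10 (! 33210 400005000) (% 6 10 (% 2 10 (% 2 7 (! 32210 4500) (% 2 9 (! 22210 30030004500) (% 1 7 (% 7 10 (% 1 5 (! 0 210321245) (% 2 5 (! 0 32141500210) (% 2 8 (! 32210 4500) (% 1 8 (% 1 6 (! 0 1203021145) (% 1 9 (! 0 13021320145) (% 2 6 (! 32110 450) ($ 1 2 6 9)))) ($ 1 2 5 8))))) (% 9 10 (% 3 6 (! 0 12003024115) (% 6 7 (! 21000 3004300005) ($ 3 7 6 10))) ($ 2 10 7 9))) (% 1 9 (% 5 9 (! 2100 43000530000) (% 8 9 (! 33210 400005000) (% 1 5 (% 1 3 (! 21000 300045) (% 1 4 (! 33210 45000) ($ 1 5 3 4))) (% 1 8 (% 1 4 (! 33210 45000) (% 1 10 (! 2100 43000030050) ($ 1 8 4 10))) ($ 1 9 5 8))))) ($ 1 2 7 9))))) (% 2 5 (% 1 4 (! 33210 45000) (% 2 4 (! 0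 10102034215) (% 1 10 (% 3 6 (! 0 10213104025) (% 2 6 (% 0 7 (! 2110 30034000005) (% 0 9 (! 1210 43005030000) (% 1 7 (! 0 20311402035) (% 1 9 (% 5 9 (! 2100 43000530000) (% 8 9 (! 33210 400005000) (% 1 5 s42 (% 1 8 (! 2100 43000030050) ($ 1 9 5 8))))) ($ 0 1 7 9))))) ($ 2 3 6 10))) ($ 1 2 4 10)))) ($ 2 3 5 10))) ($ 4 10 6 8))))) ($ 3 4 5 10)))) (% 2 5 (% 2 6 s51 (% 3 6 (% 0 7 (% 5 6 (! 32100 400005) s57) s64) (% 0 2 (% 2 9 (! 21000 400305) s65) ($ 0 6 2 3)))) (% 0 2 (% 1 5 (! 32100 400005) (% 1 7 (% 1 8 (% 1 6 (! 32100 45) (% 2 6 (! 2110 345) (% 2 9 (! 21000 345) (% 1 9 (% 3 6 (% 2 7 (! 2110 345) (% 0 7 (% 1 3 (! 0 132102045) (% 4 9 (! 0 4032210251) (% 1 4 (new 2 false 10 (! 0 11131200245)) (% 3 9 s66 ($ 1 9 3 4))))) (% 0 9 (% 0 8 (! 0 2311200045) (% 8 9 (! 0 2133100045) (% 3 9 (new 0 false 10 (% 3 10 (! 0 23020001145) (% 7 10 (! 0 13121200045) ($ 0 10 3 7)))) ($ 0 9 3 8)))) ($ 0 2 7 9)))) (% 3 9 (% 0 7 s66 (% 2 7 (! 2110 345) (% 0 9 (% 6 7 (! 0 3102011245) ($ 0 6 3 7)) ($ 0 2 7 9)))) ($ 2 3 6 9))) ($ 1 2 6 9))))) (% 2 8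 (% 0 8 (! 10 320004502) (% 1 3 (! 1110 2002345) ($ 0 1 3 8))) ($ 1 2 5 8))) (% 2 7 (% 0 7 (! 3210 40000005) (% 1 3 (% 1 8 (! 1110 2002345) (% 2 8 (% 0 9 (! 10 2230004500) (% 1 9 (% 4 7 (! 0 1130204520) (% 4 9 (! 10 2230004500) ($ 0 4 7 9))) ($ 0 1 7 9))) ($ 1 2 5 8))) ($ 0 1 3 7))) ($ 1 2 5 7)))) ($ 0 5 2 3)))
  s68 = % 1 3 (! 21000 300045) (% 1 6 (! 21110 4303050) (% 5 6 (! 0 2104023115) ($ 1 5 3 6)))
  s69 = % 1 5 (! 21000 300045) (% 1 8 (! 21100 3450) ($ 1 3 5 8))
  s70 = % 0 8 (! 0 322401115) (% 2 7 (! 32210 40000500) ($ 0 7 2 8))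
  s71 = % 4 10 (! 2110 30003040005) ($ 3 4 5 10)
  s72 = new 5 true 10 (% 3 10 (! 2210 45303) s71)
  s73 = new 5 true 10 (% 3 10 (! 0 132045112) s71)
  s74 = % 1 6 (new 5 true 10 (% 3 10 (! 0 21004135132) s71)) (% 6 7 s73 ($ 1 7 6 8))
  s75 = % 2 9 (% 0 2 (! 21000 400305) (% 0 9 (% 0 7 (! 12010 3040000005) (% 1 3 s69 (% 1 7 (% 1 4 (! 0 1233400125) (% 1 8 (! 0 311201452) (% 4 7 (% 1 6 (! 21100 3453) (% 6 7 (new 5 true 10 (% 3 10 (! 0 3124035110) s58)) ($ 1 7 6 8))) ($ 1 7 4 8)))) ($ 0 1 3 7)))) (% 4 9 (% 1 3 s69 (% 0 7 s70 (% 1 7 (% 1 8 (! 0 311201452) (% 1 4 (% 1 6 (! 21100 3453) (% 6 7 s72 ($ 1 7 6 8))) (% 4 7 s74 ($ 1 7 4 8)))) ($ 0 1 3 7)))) (% 2 4 (% 0 7 s70 (% 1 3 s69 (% 1 7 (% 4 7 (% 1 6 (! 21100 3453) (% 1 8 (! 0 311201452) (% 6 7 (new 5 true 10 (% 3 10 (! 0 21243135) (% 4 10 (! 0 240523113) ($ 3 4 5 10)))) ($ 1 7 6 8)))) ($ 0 4 7 9)) ($ 0 1 3 7)))) ($ 0 4 2 9))))) (% 2 7 (% 0 2 (! 1000 2030400502) (% 2 4 (! 32210 40000500) (% 0 7 (% 2 6 (! 0 231402501) (% 5 6 (! 10 30402502) (% 5 9 (% 3 9 (! 0 31224511) (% 4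 9 (! 1000 30420205) ($ 3 4 5 9))) ($ 2 5 6 9)))) (% 4 7 (% 6 7 (! 0 131402502) (% 2 6 (% 1 7 (% 1 6 (! 0 223100451) (% 1 8 (! 12110 30000450) ($ 1 7 6 8))) (% 1 3 (% 1 5 (! 21000 300045) (% 1 8 (! 0 302011452) ($ 1 3 5 8))) ($ 0 1 3 7))) ($ 0 6 2 7))) ($ 0 4 2 7))))) (% 8 9 (% 1 9 (% 0 7 (% 0 2 (! 1000 2030400205) (% 0 8 (! 10000 322400005) ($ 0 7 2 8))) (% 1 3 (% 1 5 (! 21000 300045) (% 1 8 (! 0 3412100251) ($ 1 3 5 8))) (% 1 7 (% 1 4 (% 1 6 (! 0 3124100152) (% 1 8 (! 0 3412100251) (% 6 7 (! 0 3142100152) ($ 1 7 6 8)))) (% 1 8 (% 3 9 (! 0 3420021150) (% 4 9 (! 100 4300052020) ($ 1 9 3 4))) (% 4 7 (% 3 9 (! 0 3142215000) (% 4 9 s74 ($ 1 9 3 4))) ($ 1 7 4 8)))) ($ 0 1 3 7)))) (% 1 7 (% 0 8 (! 10000 322400005) (% 1 8 (% 2 6 (! 0 311200452) (% 1 6 (% 5 6 (! 21000 3000045) (% 5 9 (! 0 3204100351) ($ 2 5 6 9))) ($ 1 2 6 9))) (% 0 9 (% 2 6 (! 11210 3405000000) (% 5 6 (! 0 1203400125) (% 5 9 (! 0 2133400015) ($ 2 5 6 9)))) ($ 0 1 8 9)))) ($ 1 2 7 9))) ($ 2 8 7 9)))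
  s76 = % 5 10 (! 32100 400005) (% 7 10 (! 21000 30000300405) ($ 2 10 5 7))
  s77 = % 2 7 (% 0 7 (! 3210 40000005) (% 1 3 (% 1 8 (! 0 200121345) ($ 1 3 5 8)) ($ 0 1 3 7))) ($ 1 2 5 7)
  s78 = % 0 3 (% 2 7 (! 22210 30004500) (% 2 9 (! 32210 4500) (% 1 7 (% 7 8 (% 1 6 (! 1110 3002245) (% 2 6 (! 0 104213205) (% 1 9 (% 1 5 (! 21100 340000053) (% 1 8 (! 21100 430000050) (% 8 9 (% 0 8 (! 0 4253300011) (% 0 9 (! 0 2043125031) (% 3 9 (! 0 3042205011) ($ 0 3 8 9)))) (% 5 9 (% 2 5 (! 0 1322410035) (% 3 9 (! 0 3040225011) ($ 2 3 5 9))) ($ 1 9 5 8))))) ($ 1 2 6 9)))) (% 8 9 (% 1 6 (! 1110 3002245) (% 6 7 (! 0 2104023115) (% 1 8 (% 2 6 (! 0 104213205) (% 1 9 (% 0 8 (! 0 322001145) (% 0 9 (! 0 3102010245) (% 3 9 (! 0 4320021150) ($ 0 3 8 9)))) ($ 1 2 6 9))) ($ 1 7 6 8)))) ($ 2 8 7 9))) (% 1 9 (% 8 9 (% 1 5 s68 (% 2 5 (% 2 6 (! 0 104213205) (% 5 6 (! 0 1213410025) (% 5 9 (% 0 8 (! 0 322401105) (% 0 9 (! 0 3012401205) (% 3 9 (! 0 2433501100) ($ 0 3 8 9)))) ($ 2 5 6 9)))) ($ 1 2 5 7))) (% 7 8 (% 1 5 s68 (% 2 5 (! 21100 340500000) ($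 1 2 5 7))) ($ 2 8 7 9))) ($ 1 2 7 9))))) (% 2 5 (% 7 8 (! 21100 340500000) s75) (% 0 2 (% 1 5 (! 32100 400005) (% 1 7 (% 1 6 (! 1110 2002345) (% 7 8 (% 2 6 (! 0 204121305) (% 2 9 (new 2 false 10 (% 2 7 (! 22210 430000500) s76)) (% 1 9 (% 2 7 (! 22210 430000500) (% 0 7 (% 1 8 (! 21100 430000050) (% 5 9 (! 12110 3040000305) (% 8 9 (! 0 4351200021) ($ 1 9 5 8)))) (% 0 9 (% 1 8 (! 21100 430000050) (% 5 9 (! 13210 4000000005) (% 8 9 (! 0 4352100021) ($ 1 9 5 8)))) ($ 0 2 7 9)))) ($ 1 2 6 9)))) (% 1 8 (% 2 7 (! 2110 345) (% 2 9 (! 21000 345) (% 8 9 (% 0 9 (! 11000 200020345) (% 0 7 (% 1 9 (! 0 2132100045) (% 2 6 (! 2110 345) ($ 1 2 6 9))) ($ 0 2 7 9))) ($ 2 8 7 9)))) (% 6 7 (% 4 7 (% 2 6 (! 0 14202315) (% 2 9 (new 2 false 10 (! 0 10214103235)) (% 1 9 (% 1 4 (! 0 1201031245) (% 4 9 s73 (% 8 9 (! 0 2104023135) ($ 1 9 4 8)))) ($ 1 2 6 9)))) (% 1 4 (% 0 7 (! 0 234001125) (% 0 9 (! 0 2345100231) (% 4 9 s72 ($ 0 4 7 9)))) ($ 1 7 4 8))) ($ 1 7 6 8))))) s77)) ($ 0 5 2 3)))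
  s79 = % 1 4 (! 2110 34030005) (% 1 9 (! 2110 4035000000) (% 2 4 (! 32210 4500) ($ 1 2 4 9)))
  s80 = new 2 false 10 s76
  s81 = % 5 9 (! 13210 4000000005) (% 8 9 (! 0 2403013521) ($ 3 9 5 8))
  s82 = % 1 4 (! 22210 30045000) (% 2 4 (! 32210 4500) (% 2 7 (! 22210 30004500) ($ 1 2 4 7)))
  s83 = % 1 9 (! 0 3041025021) ($ 1 2 6 9)
  s84 = % 1 6 (! 21110 34000050) s83
  s85 = % 2 6 (% 0 7 (! 2110 34000005) (% 1 7 (% 1 8 (! 22110 300000450) (% 4 7 (% 0 2 (% 2 7 (! 0 314010235) (% 2 9 (! 21010 4000305) (% 8 9 (! 0 1204021315) ($ 2 8 7 9)))) (% 0 3 (% 2 7 (! 22210 30004500) (% 2 9 (! 32210 4500) (% 8 9 (% 3 9 (! 0 3204031125) (% 4 6 (! 22210 30045000) (% 4 9 s79 ($ 3 4 6 9)))) ($ 2 8 7 9)))) (% 2 5 (% 2 7 (! 0 142300512) (% 8 9 (! 0 2413100520) (% 2 9 (new 3 false 10 (! 0 10122403513)) ($ 2 8 7 9)))) ($ 0 5 2 3)))) (% 1 4 (% 4 9 (! 2110 34030005) (% 8 9 (% 0 9 (! 0 3124020015) ($ 0 4 7 9)) ($ 4 8 7 9))) ($ 1 7 4 8)))) (% 0 9 (% 1 9 (! 2110 4035000000) (% 2 9 (! 2110 4035000000) (% 2 7 (% 0 3 (! 22210 30004500) (% 3 9 (! 10 2230004500) (% 0 2 (% 1 3 (! 2110 34000035)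 ($ 0 1 3 7)) ($ 0 9 2 3)))) ($ 1 2 7 9)))) (% 1 9 (% 4 9 (! 2110 4035000000) (% 4 7 (% 0 3 s82 (% 1 3 (% 1 4 (! 0 2230145210) (% 2 4 (! 21110 34000530) (% 2 7 (! 0 1130214520) ($ 1 2 4 7)))) ($ 0 1 3 7))) ($ 0 4 7 9))) ($ 0 1 7 9))))) (% 2 9 (% 0 3 (! 32210 4500) (% 0 2 (% 2 5 (! 21000 400305) (% 2 7 (! 32210 40000500) s80)) ($ 0 6 2 3))) (% 3 9 (% 0 3 (% 2 7 (! 22210 30004500) (% 8 9 (% 1 7 s84 (% 1 9 (% 0 7 (! 0 3042025011) (% 0 9 (! 0 4102013205) (% 4 7 (% 1 4 (! 22210 30045000) (% 2 4 (! 32210 4500) ($ 1 2 4 7))) (% 4 9 (! 0 3041225001) ($ 0 4 7 9))))) ($ 1 2 7 9))) ($ 2 8 7 9))) (% 0 2 (% 1 5 (! 32100 400005) (% 2 5 s65 (% 1 7 (% 0 9 s81 (% 5 9 (% 1 3 (! 0 31214251) (% 1 9 (! 0 3140215210) ($ 0 1 3 9))) ($ 0 5 3 9))) s77))) ($ 0 6 2 3))) ($ 2 3 6 9)))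
  s86 = % 4 10 (! 2110 33040005) ($ 3 4 5 10)
  s87 = % 4 9 (! 2110 33040005) ($ 1 4 6 9)
  s88 = % 4 7 (% 2 4 (% 0 3 (! 0 20143125) (% 0 7 (! 0 30142125) (% 1 3 (! 0 201034521) (% 1 7 (% 1 6 (! 21110 3000450) (% 1 8 (! 32110 450) (% 6 7 (new 5 true 10 (% 3 10 (! 0 21034521) s86)) ($ 1 7 6 8)))) ($ 0 1 3 7))))) (% 1 4 (% 0 3 (! 22210 30045000) (% 1 3 (! 0 201034251) (% 1 7 (% 2 7 (! 0 30112452) (% 4 6 (% 1 6 (! 33210 4050000) (% 1 8 s47 (% 6 7 (! 2110 34050000) ($ 1 7 6 8)))) (% 6 7 (% 1 6 (! 21110 34000050) (% 1 9 (! 0 2241030051) s87)) ($ 2 6 4 7)))) (% 0 7 (% 1 9 (! 0 1121343005) (% 2 7 (! 0 20343115) (% 2 9 (! 0 1121343005) ($ 1 2 7 9)))) ($ 0 1 3 7))))) (% 1 8 (% 1 3 (! 22100 405303000) (% 1 7 (% 2 7 (! 12110 30000450) (% 4 6 s47 (% 6 7 (new 5 true 10 (% 4 10 (! 2110 30345) (% 3 10 (% 0 3 (! 22100 405303000) (% 0 10 (! 2110 30000000345) (% 1 10 (% 5 6 (! 21000 3400005) (% 5 9 (! 0 13041210253) (% 9 10 (! 0 23014120235) (% 6 10 (% 1 9 (! 0 13041510223) (new 1 false 11 (% 3 11 (! 0 20041032351) (% 4 11 (! 21000 300000300045) ($ 1 11 3 4))))) ($ 5 10 6 9))))) ($ 0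 1 3 10)))) ($ 3 4 5 10)))) ($ 2 6 4 7)))) ($ 1 8 3 7))) ($ 1 2 4 8)))) (% 4 9 (% 2 4 (% 0 3 (! 0 224103125) (% 1 3 (! 0 201034521) (% 1 7 (% 1 4 (! 22110 30450) (% 1 8 (! 32110 450) ($ 1 7 4 8))) (% 0 7 (% 2 7 (! 32210 40000500) (% 2 9 (! 21000 3000400503) (% 1 9 (% 1 5 (! 32100 400005) (% 1 8 (! 0 224103135) (% 5 9 (! 0 2112343005) (% 8 9 (! 0 1212343005) ($ 1 9 5 8))))) ($ 1 2 7 9)))) ($ 0 1 3 7))))) (% 2 9 (% 0 3 (! 0 224103125) (% 1 3 (! 0 213104521) (% 0 7 (% 1 4 (! 3210 40005) (% 1 8 (! 0 224103135) ($ 1 2 4 8))) (% 1 7 (% 1 8 (! 32110 450) (% 1 4 (% 1 6 (! 21110 3000450) (% 6 7 (! 2110 34030005) ($ 1 7 6 8))) ($ 1 2 4 8))) ($ 0 1 3 7))))) (% 5 9 (% 1 4 (! 3210 4000050000) (% 1 9 (% 1 8 (% 1 7 (! 2110 30345) (% 1 3 (new 4 false 10 (! 0 12032145103)) ($ 1 8 3 7))) ($ 1 2 4 8)) ($ 1 2 4 9))) ($ 2 5 4 9)))) (% 8 9 (% 0 9 (! 11210 3405000000) (% 0 7 (% 0 8 (! 0 304121205) (% 1 8 (% 1 3 (! 20100 303000045) (% 1 7 (! 10000 230400025) ($ 1 8 3 7))) (% 1 9 (% 1 3 (! 20100 304000035) (% 3 9 (! 0 3405212011) (% 1 4 (% 1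 5 (! 32100 400005) (% 1 7 (! 10000 230400025) ($ 1 4 5 7))) ($ 1 9 3 4)))) ($ 0 1 8 9)))) ($ 0 4 7 9))) ($ 4 8 7 9)))
  s89 = new 8 true 11 (! 0 102314521200)
  s90 = new 5 true 10 (% 4 10 (! 2100 34000050030) (% 3 10 (% 1 10 (! 21000 3000300045) (% 8 10 (! 100 22400053030) ($ 1 8 3 10))) ($ 3 4 5 10)))
  s91 = % 0 10 (! 3210 45000000000) (% 5 9 (! 21000 3000400035) (% 5 10 (! 3210 45000000000) ($ 0 5 9 10)))
  s92 = % 1 9 (% 7 8 (! 21100 340500000) (% 1 3 (% 8 9 (! 0 4312100251) (% 4 7 (% 2 9 (% 0 2 (! 21000 400305) (% 0 9 (! 0 3112100245) (% 2 4 (! 0 2031145201) (% 4 9 (! 0 2031145201) ($ 0 4 2 9))))) (% 5 6 s89 (% 5 9 (% 3 9 (! 0 3042125101) (% 4 9 (! 0 2031145201) ($ 3 4 5 9))) ($ 2 5 6 9)))) (% 4 9 (% 5 6 s89 (% 2 9 (new 4 false 10 (% 7 10 (! 3210 4050000000) (% 5 10 (% 3 10 (! 0 24001051323) (% 6 10 (! 0 21001045323) ($ 3 6 5 10))) ($ 4 10 5 7)))) (% 5 9 (new 4 false 10 (% 7 10 (! 0 14231200153) (% 5 10 (% 3 10 (! 0 24031251103) (% 6 10 (! 0 3123145102) ($ 3 6 5 10))) ($ 4 10 5 7)))) ($ 2 5 6 9)))) ($ 4 8 7 9)))) (% 1 7 (% 4 9 s90 (% 4 7 (% 2 9 (! 0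 3041120251) (% 5 9 (! 0 3042120251) (% 5 6 (% 1 4 (% 1 5 (! 21000 300045) (% 4 6 (! 0 1021230045) ($ 1 4 5 6))) (% 3 9 (% 8 9 (! 0 4302011152) ($ 3 9 5 8)) ($ 1 9 3 4))) ($ 2 5 6 9)))) (% 8 9 (% 0 7 (! 10000 230200045) (% 0 9 (! 0 2133100045) ($ 0 4 7 9))) ($ 4 8 7 9)))) ($ 1 8 3 7)))) (% 2 9 (% 7 8 (! 21100 340500000) (% 1 7 (% 0 2 (! 21000 400305) (% 4 9 (new 1 false 10 (% 1 4 (! 2110 30045) (% 4 10 (! 1000 20000230345) (% 9 10 (% 0 9 (! 21000 30345) s91) ($ 1 10 4 9))))) (% 0 9 (% 8 9 (new 1 false 10 (! 0 2123100345)) (% 2 4 (% 4 7 (new 1 false 10 (! 1000 3020200345)) ($ 4 8 7 9)) ($ 2 9 4 8))) (% 2 4 (% 0 7 (! 0 131201245) (% 4 7 (new 1 false 10 (% 1 3 (! 0 10123452) (% 1 4 (! 0 1011230245) (% 3 10 (! 0 21134521) (% 4 10 (! 0 13021120453) ($ 1 10 3 4)))))) ($ 0 4 7 9))) ($ 0 4 2 9))))) (% 8 9 (% 1 3 (% 0 9 (new 1 false 10 (! 0 11213200345)) (% 0 7 (% 0 2 (! 21000 400305) (% 2 4 (! 0 103212345) (% 4 9 (new 1 false 10 (! 20100 3400000053)) ($ 0 4 2 9)))) ($ 0 1 7 9))) ($ 1 8 3 7)) ($ 1 8 7 9)))) ($ 1 2 6 9))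
  s93 = % 2 6 (% 7 8 (! 21100 340500000) (% 3 6 s88 (% 6 7 (% 0 7 (! 2110 34000005) (% 1 7 (% 4 7 (% 1 4 (% 1 6 (! 21110 34000050) (% 1 9 (! 0 2231040051) (% 4 6 (! 2110 34050000) s87))) (% 1 8 (% 4 6 s47 (% 4 9 (! 2110 30345) (% 3 9 (% 0 3 (! 10000 323200045) (% 0 9 s48 (% 5 9 (% 1 3 (! 0 1030124251) (% 1 9 (! 0 4030112152) ($ 0 1 3 9))) ($ 0 5 3 9)))) ($ 3 4 6 9)))) (% 2 4 (% 3 9 (! 0 1120234510) (% 4 6 (! 2110 34050000) (% 4 9 (! 2110 33040005) ($ 3 4 6 9)))) ($ 1 2 4 8)))) (% 4 9 (% 1 4 (! 2110 34030005) (% 1 8 (! 2110 30345) (% 2 4 ($ 1 7 4 8) ($ 1 2 4 8)))) (% 0 9 (% 8 9 (! 0 3124020015) ($ 4 8 7 9)) ($ 0 4 7 9)))) (% 0 9 (% 1 9 (! 1000 3024200005) (% 2 9 (! 1000 3024200005) (% 2 7 (% 0 3 (! 0 1243012510) (% 1 3 (! 0 2034100521) ($ 0 1 3 7))) ($ 1 2 7 9)))) (% 1 9 (% 1 4 (! 1000 3024320005) (% 2 4 (! 1000 3024320005) (% 1 8 (% 1 3 (% 4 9 (% 2 9 (! 0 2010123451) (% 5 9 (! 1000 3042500002) ($ 2 5 4 9))) (% 4 7 (% 2 7 (! 0 2010223451) ($ 1 2 4 7)) ($ 0 4 7 9))) ($ 1 8 3 7)) ($ 1 2 4 8)))) ($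 0 1 7 9))))) ($ 3 7 6 8)))) (% 3 6 (% 1 6 (% 0 3 (! 10000 322400035) (% 1 3 (! 10000 3202045) (% 1 7 (% 5 6 (! 21000 3400005) (% 2 9 (% 1 8 (! 10000 23400325) (% 2 4 (% 1 4 (! 0 2001031452) (% 7 8 (! 21100 340500000) (% 4 7 (new 5 true 10 (% 3 10 (! 0 12343215) s86)) ($ 1 7 4 8)))) (% 1 4 (% 0 2 (! 21000 400305) (% 0 9 (! 0 2113100245) (% 4 9 (% 4 7 (! 0 2031041052) (new 4 false 10 (% 2 10 (! 21100 3453) (% 5 10 (% 3 10 (! 2010 34030050000) (% 6 10 (new 5 true 11 (% 1 5 (! 10000 22300045) (% 1 11 (! 1000 202032430005) (% 4 11 (! 22100 300003040050) ($ 1 4 5 11))))) ($ 3 6 5 10))) ($ 2 5 4 10))))) ($ 0 4 2 9)))) ($ 1 2 4 8)))) (% 5 9 (% 4 9 (% 1 4 (! 3210 4000050000) (% 1 9 (! 0 4223100051) (% 2 4 (% 4 7 (! 2110 33040005) (% 7 8 (! 21100 340500000) (% 1 8 (new 1 false 10 (! 21000 3000400035)) ($ 1 7 4 8)))) ($ 1 2 4 9)))) (% 3 9 (% 1 9 (! 0 4223100051) (% 0 9 (% 4 7 (! 0 3014022015) (% 7 8 (! 21100 340500000) (% 8 9 (! 0 2133400015) ($ 4 8 7 9)))) ($ 0 1 3 9))) ($ 3 4 5 9))) ($ 2 5 6 9)))) (% 0 7 (% 1 5 (! 10000 22300045) (% 5 6 (! 21000 3400005) s53)) ($ 0 1 3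 7))))) (% 1 8 s92 ($ 1 2 6 8))) ($ 2 3 6 8))
  s94 = new 5 true 10 (! 0 431210152)
  s95 = % 5 6 (! 21000 3400005) ($ 2 5 4 6)
  s96 = % 3 6 (! 0 104203215) (% 4 9 s36 (% 4 6 (new 3 false 10 (% 5 10 (! 12100 30403005) (% 7 10 (! 0 23112034510) ($ 3 10 5 7)))) ($ 3 4 6 9)))
  s97 = % 4 8 (! 33210 400005000) ($ 2 4 6 8)
  s98 = % 5 6 (! 21000 3400005) ($ 3 6 5 7)
  s99 = % 0 3 (% 8 9 (! 33210 400005000) (% 3 9 (% 2 4 (! 0 3112024510) (% 2 7 (! 32210 4500) (% 1 4 (% 1 6 (! 0 3112124005) (% 4 6 (! 0 102043215) (% 4 9 s36 (% 1 9 (new 5 true 10 (! 0 3110124205)) ($ 1 4 6 9))))) (% 1 7 (% 1 3 (! 10000 2003245) (% 1 8 (% 4 8 (! 33210 400005000) (% 4 6 (% 1 6 (! 0 2103001245) (% 2 6 (! 0 3112024510) ($ 1 2 4 6))) (% 6 7 (% 2 6 (! 0 3112024510) (% 3 6 (! 11210 304005000) ($ 2 3 6 7))) (% 7 8 s94 ($ 4 7 6 8))))) (% 2 6 (! 0 3112024510) (% 2 8 (! 32210 4500) (% 1 6 (% 3 6 (! 0 3114102005) (% 4 6 (! 0 3004021215) ($ 1 6 3 4))) ($ 1 2 6 8)))))) ($ 1 2 4 7))))) (% 7 8 (% 2 7 (! 32210 4500) (% 2 8 (! 32210 4500) (% 1 7 (% 1 8 s94 (% 1 6 (% 3 6 (!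 10000 3002245) (% 4 9 s36 (% 4 6 (% 2 4 (! 0 2110043215) (% 2 6 (! 21110 3000450) s95)) ($ 3 4 6 9)))) (% 2 6 s96 ($ 1 2 6 8)))) (% 1 8 (% 1 4 (% 4 6 (! 10100 2030245) (% 4 9 s36 (% 3 6 (% 1 6 (! 0 3452123001) (% 1 9 (! 0 2113100345) ($ 1 4 6 9))) ($ 3 4 6 9)))) (% 2 4 (% 2 6 s96 (% 4 6 (! 2210 3030040500) s97)) ($ 1 2 4 7))) ($ 1 2 7 8))))) ($ 3 8 7 9)))) (% 2 6 (% 2 7 (! 0 3042120501) (% 6 7 (! 0 3024210105) (% 4 6 (% 0 8 (! 0 3224100105) (% 1 3 (! 0 3224100125) (% 1 8 (% 1 4 (! 0 2113142005) (% 1 7 (! 32110 450) (% 2 4 (! 21210 3004000500) ($ 1 2 4 7)))) ($ 0 1 3 8)))) (% 2 4 (% 4 9 (! 32110 4000000500) (% 3 9 (% 4 8 (% 0 8 (! 0 1211343005) (% 1 3 (% 1 5 (! 21000 300045) (% 1 7 (! 32110 450) ($ 1 3 5 7))) (% 1 8 (% 1 7 (! 32110 450) (% 1 9 (! 0 1012343205) (% 7 8 (! 0 101243235) (% 8 9 (! 210 4300005000) ($ 1 8 7 9))))) ($ 0 1 3 8)))) (% 7 8 (% 0 8 (! 0 4253312001) (new 0 false 10 (! 0 14153231002))) ($ 4 7 6 8))) (% 3 6 s98 ($ 3 4 6 9)))) ($ 2 6 4 7))))) (% 3 6 (% 6 7 (% 0 8 (! 0 3214100205) (% 1 3 (! 0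 3124100125) (% 1 8 (% 3 9 (! 100 2304205000) (% 8 9 (! 11210 3405000000) ($ 0 9 3 8))) ($ 0 1 3 8)))) (% 5 6 (% 0 8 (! 0 213401015) (% 1 3 (! 0 2113400215) (% 1 8 (% 3 9 (! 0 4223105100) (% 8 9 (! 0 1213420005) ($ 0 9 3 8))) ($ 0 1 3 8)))) ($ 3 6 5 7))) ($ 0 6 2 3)))
  s100 = % 0 8 (! 0 402123105) (new 0 false 10 (! 0 11412335002))
  s101 = % 1 5 (! 21000 300045) ($ 1 3 5 7)
  s102 = % 2 6 (% 4 9 (! 21000 3000400503) (% 3 9 (% 0 3 (% 4 6 (! 22210 34500) (% 4 8 (! 33210 400005000) (% 6 7 (% 0 7 (! 0 3024130105) (% 1 7 (% 1 3 (! 32110 450) (% 1 8 (! 32110 450) (% 7 8 (! 0 3124231005) ($ 1 7 3 8)))) (% 1 9 (% 1 5 (! 0 3002024511) (% 1 8 (! 0 1234021035) (% 5 9 (! 0 1322431005) (% 8 9 (! 33210 400005000) ($ 1 9 5 8))))) ($ 0 1 7 9)))) (% 7 8 s100 ($ 4 7 6 8))))) (% 5 9 (% 4 6 (! 21210 3004000500) (% 4 8 (! 0 2100134502) (% 6 7 (! 21210 3004000500) (% 7 8 (! 0 3210214500) ($ 4 7 6 8))))) ($ 0 5 3 9))) (% 4 6 (% 7 8 (! 1000 2023240005) (% 8 9 (% 0 8 (! 0 2113242005) (% 4 8 (! 0 1214230500) ($ 0 4 8 9))) ($ 3 8 7 9))) (% 3 6 (% 5 6 (! 21000 3400005) (%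 6 7 (% 8 9 (! 0 3124210500) (% 7 8 (% 0 3 (! 21110 3004500) (% 0 8 (! 0 2314201015) (% 1 3 (! 21110 34000530) (% 1 8 (! 21110 34000530) ($ 0 1 3 8))))) ($ 3 8 7 9))) ($ 3 6 5 7))) ($ 3 4 6 9))))) (% 0 3 (% 2 8 (! 32210 4500) (% 4 6 (! 22210 34500) s97)) (% 3 6 (% 6 7 (% 0 7 (! 0 234121005) (% 1 7 (% 1 8 (% 7 8 (! 21110 43000350) (% 8 9 s61 (% 3 9 (% 5 9 (! 0 3012014520) ($ 0 5 3 9)) ($ 3 8 7 9)))) (% 1 3 (% 1 6 (! 32110 4000050) (% 2 8 (! 21100 3450) ($ 1 2 6 8))) (% 7 8 (% 0 8 (! 0 312400215) ($ 0 1 3 8)) ($ 1 7 3 8)))) (% 1 9 (% 3 9 (! 0 3012214500) (% 4 9 (! 21000 3000400503) (% 1 3 s101 (% 1 4 (% 0 8 (! 0 1123400325) (% 1 8 (! 1000 230245) ($ 0 1 3 8))) ($ 1 9 3 4))))) ($ 0 1 7 9)))) (% 5 6 (% 2 8 (! 21100 403503) (% 4 6 (! 0 3142125) (% 4 8 (! 0 423512001) ($ 2 4 6 8)))) ($ 3 6 5 7))) ($ 0 6 2 3)))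
  s103 = % 3 9 (! 210 4330005000) (% 7 8 (! 32210 40000500) (% 8 9 (! 210 4530003000) ($ 3 8 7 9)))
  s104 = % 4 10 (! 33210 45000) ($ 3 4 5 10)
  s105 = new 5 true 10 (% 3 10 (! 0 10201432305) s104)
  s106 = % 1 4 (! 0 200321145) ($ 1 5 3 4)
  s107 = new 5 true 10 (% 1 10 (! 0 10200431325) (% 4 10 (! 33210 45000) ($ 1 4 5 10)))
  s108 = % 7 10 (! 210 30450003000) (% 8 10 (! 33210 400005000) ($ 0 10 7 8))
  s109 = % 0 8 (! 0 321400125) (new 0 false 10 (% 0 7 (! 0 132400215) s108))
  s110 = % 2 6 (% 4 8 (! 33210 400005000) (% 4 6 (% 1 4 (! 0 203041125) (% 1 7 (% 1 3 (! 0 1001032345) (% 1 8 s105 (% 7 8 s105 ($ 1 7 3 8)))) (% 1 8 s105 (% 8 9 (! 33210 400005000) (% 1 5 s42 (% 5 9 (new 5 true 10 (% 3 10 (! 0 12001432305) s104)) ($ 1 9 5 8))))))) (% 6 7 (% 8 9 (! 33210 400005000) (% 1 5 (% 1 3 (! 21000 300045) s106) (% 1 8 (% 7 8 (! 0 3425311100) (% 1 4 s107 (% 1 7 (new 5 true 10 (% 1 10 (! 100 23402325000) (% 5 9 (! 0 3041200152) (% 9 10 (! 0 2131203045) ($ 1 9 5 10))))) ($ 1 8 4 7)))) (% 5 9 (% 1 4 s107 (% 1 7 (! 0 3142500012) (% 2 4 (! 0 1322431005) (% 2 7 (! 0 243120521) ($ 1 2 4 7))))) ($ 1 9 5 8)))))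 (% 7 8 (% 2 7 s109 (% 2 4 s100 ($ 2 6 4 7))) ($ 4 7 6 8))))) (% 5 9 (% 1 6 (% 1 3 (! 21100 3045) (% 1 4 (! 0 1322431005) (% 3 6 (! 0 3124105002) (% 4 6 (% 2 4 (! 0 1322431005) s95) ($ 1 6 3 4))))) (% 1 8 (% 4 8 (! 33210 400005000) (% 6 7 (! 0 3142511200) (% 7 8 (! 0 3241512100) (% 4 6 (% 1 4 (! 0 112130245) (% 2 4 (new 5 true 10 (% 3 10 (! 0 20102134105) s104)) ($ 1 2 4 6))) ($ 4 7 6 8))))) (% 2 8 (% 2 7 (! 0 1240321500) (% 7 8 (! 0 1340521200) (% 8 9 (! 33210 400005000) ($ 2 8 7 9)))) ($ 1 2 6 8)))) (% 5 6 (% 4 8 (! 33210 400005000) (% 6 7 (! 21000 3400005) (% 7 8 (! 12100 30403005) (% 4 6 (% 1 6 (! 21000 3400005) (% 1 8 (! 0 103421205) (% 2 8 (! 0 203410125) ($ 1 2 6 8)))) ($ 4 7 6 8))))) ($ 2 5 6 9)))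
  s111 = % 0 10 (! 100 23402305000) (% 1 3 (! 0 12301204051) (% 1 10 (! 0 12401203053) ($ 0 1 3 10)))
  s112 = % 8 9 (! 210 4300005000) ($ 0 8 7 9)
  s113 = new 1 false 10 (% 1 8 (! 0 11202103045) (% 8 10 (! 33210 400005000) (% 6 10 (% 1 5 (! 21000 300045) (% 5 10 (% 4 10 (! 21000 30004300005) (% 3 10 (new 5 true 12 (! 0 1021302401035)) ($ 3 4 5 10))) ($ 1 10 5 8))) ($ 1 10 6 8))))
  s114 = % 1 3 (% 1 6 (! 32110 4000050) (% 6 7 (% 0 3 s113 (% 0 9 (new 1 false 10 (% 9 10 (! 0 13024010125) (% 6 10 (% 1 5 (! 21000 300045) (% 1 8 (! 0 2131300245) (% 5 10 (! 0 13021200345) (% 8 10 (! 0 22301004153) ($ 1 10 5 8))))) ($ 1 10 6 9)))) (% 5 9 (new 1 false 10 (% 6 10 (! 0 23041200153) (% 9 10 (! 21000 3000400035) ($ 1 10 6 9)))) ($ 0 5 3 9)))) (% 7 8 (% 2 4 (! 32110 450) (% 2 7 (! 12110 30000450) (% 4 6 (% 0 3 s113 (% 5 9 (! 1000 20230345) (% 0 9 (new 1 false 10 (! 0 13121200345)) ($ 0 5 3 9)))) ($ 2 6 4 7)))) (% 1 8 (% 4 8 (! 32100 400000050) (% 4 6 (% 0 3 (new 1 false 10 (! 0 11202103045)) (% 0 9 (new 1 false 10 (% 6 10 (! 0 13212100345) (% 9 10 (! 32110 4005000000) ($ 1 10 6 9)))) (% 5 9 (new 1 false 10 (% 1 5 (!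 21000 300045) (% 5 10 (! 100 20302024050) (% 9 10 (! 32110 4005000000) ($ 1 10 5 9))))) ($ 0 5 3 9)))) ($ 4 7 6 8))) ($ 1 7 6 8))))) (% 1 8 (% 0 3 (% 4 6 s105 (% 4 8 (! 33210 400005000) (% 7 8 s94 (% 6 7 (% 3 6 (! 11210 304005000) (new 3 false 11 (% 1 11 (! 20210 430003050) (% 7 11 (! 11210 300403005000) ($ 1 7 3 11))))) ($ 4 7 6 8))))) (% 0 9 (% 2 4 (! 32110 450) (% 4 6 (new 1 false 10 (% 9 10 (! 32110 4005000000) (% 3 10 (% 0 10 (! 100 20402035030) (% 5 10 (! 100 20402035030) ($ 0 5 3 10))) ($ 1 10 3 9)))) (% 6 7 (new 1 false 10 (% 1 6 (! 32110 4000050) (% 6 10 (! 0 3121200345) (% 9 10 (! 0 13024010125) ($ 1 10 6 9))))) (% 2 7 (new 1 false 10 (! 0 1130201452)) ($ 2 6 4 7))))) ($ 0 1 3 9))) (% 7 8 (% 0 3 (% 2 7 s109 (% 4 6 s105 (% 2 4 (new 1 false 10 (% 8 10 (! 33210 400005000) (% 3 10 (% 1 5 s106 (% 5 10 (! 0 10301204235) ($ 1 10 5 8))) ($ 1 10 3 8)))) (% 6 7 (new 1 false 10 (% 8 10 (! 33210 400005000) (% 3 10 (% 1 6 (! 21110 34000050) (% 6 10 (% 1 5 s106 (% 5 10 (% 7 10 (! 0 20314210035) (new 10 false 13 (! 0 10321402035))) ($ 1 10 5 8))) ($ 1 10 6 8))) ($ 1 10 3 8)))) ($ 2 6 4 7)))))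 (% 0 9 (% 0 8 (% 2 7 (! 0 321400125) (% 4 6 (! 0 2314210005) (% 6 7 (! 0 312400215) (% 2 4 (new 1 false 10 (! 0 2320401115)) ($ 2 6 4 7))))) ($ 0 1 3 8)) ($ 0 1 3 9))) ($ 1 7 3 8)))
  s115 = new 0 false 10 s108
  s116 = % 4 11 (! 33210 45000) ($ 3 4 5 11)
  s117 = new 1 false 10 (! 0 2034100521)
  s118 = % 8 10 (! 210 33400005000) ($ 0 10 3 8)
  s119 = new 0 false 10 (% 3 10 (! 210 30430005000) s118)
  s120 = % 2 6 (% 1 7 s114 (% 2 7 (% 1 3 s101 (% 0 3 (% 0 7 (new 1 false 10 (! 0 2230401125)) (% 0 9 (% 4 8 (! 33210 400005000) (% 7 8 (% 0 8 (! 0 321400125) s115) (% 4 6 (new 1 false 10 (% 1 8 (new 5 true 11 (% 3 11 (! 0 100201432305) s116)) (% 8 10 (! 33210 400005000) (% 1 4 (! 0 102034215) (% 4 10 (! 33210 45000) (% 7 10 (% 1 5 ($ 1 5 3 4) (% 5 10 (! 0 12020431305) ($ 1 10 5 8))) ($ 1 10 4 7))))))) (% 6 7 s117 ($ 4 7 6 8))))) ($ 0 1 7 9))) (% 0 9 (% 0 8 (% 4 8 (! 10000 322400005) (% 6 7 s117 (% 7 8 (! 0 321400125) (% 4 6 (% 0 2 (! 0 1224100305) (% 0 7 (! 0 2231400105) (% 2 8 (! 0 322400115) ($ 0 8 2 7)))) ($ 4 7 6 8))))) (% 1 8 (% 8 9 (! 210 4300005000) (% 7 8 s119 ($ 1 8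 7 9))) ($ 0 1 3 8))) ($ 0 1 3 9)))) ($ 1 2 7 9))) (% 1 6 (% 5 6 (! 21000 3400005) (% 5 9 (% 1 7 (% 1 3 (% 0 2 (! 32100 45) (% 0 3 (! 21100 3045) (% 3 6 (! 10000 3202045) ($ 0 6 2 3)))) (% 0 3 (% 4 6 (! 0 113120245) (% 4 8 (! 33210 400005000) (% 6 7 (! 0 213120245) (% 7 8 (% 1 4 (% 1 5 (! 12100 30403005) (% 1 8 s94 ($ 1 4 5 8))) (% 3 6 ($ 3 6 5 7) ($ 1 6 3 4))) ($ 4 7 6 8))))) (% 0 9 (% 0 2 (! 13210 4000000005) (% 3 6 (% 6 7 (! 0 213120245) ($ 3 6 5 7)) ($ 0 6 2 3))) ($ 0 1 3 9)))) (% 2 7 (% 1 5 (! 0 11320245) (% 6 7 (% 0 7 (! 21110 45300030) (% 0 9 (! 0 3012410205) ($ 0 1 7 9))) ($ 1 6 5 7))) ($ 1 2 7 9))) ($ 2 5 6 9))) ($ 1 2 6 9))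
  s121 = % 3 9 (% 1 9 (% 0 3 s110 (% 5 9 (% 1 8 (% 0 2 (% 0 9 (! 13210 4000000005) (% 2 7 (! 0 1022400315) (% 0 7 (% 0 8 (! 0 1320402015) (% 7 8 (! 12110 3040000305) ($ 0 7 3 8))) ($ 0 2 7 9)))) (% 2 6 (new 5 true 10 (% 4 10 (! 21000 30000400035) (% 3 10 s111 ($ 3 4 5 10)))) (% 3 6 (% 5 6 (! 0 3114225000) (% 6 7 (! 0 3124105200) ($ 3 6 5 7))) ($ 0 6 2 3)))) (% 0 8 (% 2 6 (% 0 7 (! 0 1321402005) (% 0 9 (! 0 1322401005) (% 7 8 (! 0 1321400025) s112))) (% 0 2 (% 2 8 (! 0 211400315) (% 1 6 (% 0 7 (! 0 1321402005) (% 0 9 (! 13210 4000000005) (% 2 7 (! 0 211400325) ($ 0 2 7 9)))) ($ 1 2 6 8))) (% 3 6 (% 5 6 (! 0 2113420005) (% 6 7 (! 0 1304102025) ($ 3 6 5 7))) ($ 0 6 2 3)))) (% 1 3 (% 1 5 (! 21000 300045) (% 1 7 (% 1 6 (! 0 3112024050) (% 2 6 (! 0 3220104150) (% 2 8 (! 0 3002114251) ($ 1 2 6 8)))) ($ 1 3 5 7))) ($ 0 1 3 8)))) (% 0 9 (% 2 6 (% 8 9 (! 210 4300005000) (% 1 8 (new 5 true 10 (% 3 10 s111 (% 9 10 (% 4 10 (! 11210 45003030000) ($ 3 4 5 10)) ($ 3 9 5 10)))) (% 1 5 (% 1 3 (! 21000 300045) (% 1 4 (! 11000 2200300045) ($ 1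 5 3 4))) ($ 1 9 5 8)))) (% 5 6 (% 0 2 (! 32100 400005) (% 3 6 (% 4 6 (! 0 3104202015) (% 4 8 (! 0 2013411205) (% 6 7 (! 21000 3400005) (% 7 8 (! 0 1213400025) ($ 4 7 6 8))))) ($ 0 6 2 3))) ($ 2 5 6 9))) ($ 0 5 3 9)))) s120) (% 2 7 (% 2 6 (% 7 8 (% 0 7 (! 0 132400215) (% 0 8 (! 0 321400125) (% 1 7 (% 0 3 s115 (% 1 3 (! 12110 30000450) (% 1 8 (! 0 131200452) ($ 0 1 3 8)))) (% 1 8 (% 0 9 (% 0 2 (! 0 122400315) (% 0 3 s115 ($ 0 9 2 3))) (% 1 9 (% 1 3 s101 (% 1 4 (! 0 2140302512) (% 4 9 (% 2 4 (! 32210 40000500) (% 5 9 (new 5 true 10 (% 4 10 (! 21000 30000400035) (% 3 10 s55 ($ 3 4 5 10)))) ($ 2 5 4 9))) ($ 1 9 3 4)))) ($ 0 1 7 9))) ($ 0 1 7 8))))) (% 8 9 (% 0 3 (! 33210 400005000) (% 0 8 (! 10000 322400005) (% 1 8 (% 6 7 (! 0 2134100520) (% 4 8 (% 3 6 s98 (% 4 6 (new 0 false 10 (! 0 2103142025)) (% 4 9 (% 2 4 (! 0 2130142500) (% 5 9 (! 20100 3400500000) ($ 2 5 4 9))) ($ 3 4 6 9)))) (% 4 6 (% 4 9 (! 21000 3004300005) (% 0 9 (% 0 2 (! 0 1212400305) ($ 0 9 2 3)) ($ 0 4 8 9))) ($ 4 7 6 8)))) (% 1 3 (% 1 5 (!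 21000 300045) (% 1 7 (% 1 6 (! 32110 4000050) (% 6 7 (! 0 234100521) ($ 1 7 6 8))) ($ 1 3 5 7))) ($ 0 1 3 8))))) ($ 3 8 7 9))) (% 3 6 (% 6 7 (% 5 6 (! 21000 3400005) (% 5 9 (% 4 9 (! 0 3142510002) ($ 3 4 5 9)) ($ 2 5 6 9))) (% 5 6 (% 0 2 (! 32100 400005) (% 0 7 (! 32100 400005) ($ 0 6 2 7))) ($ 3 6 5 7))) ($ 2 3 6 9))) ($ 2 3 7 9))
  s122 = % 2 4 (% 4 9 (! 21000 3000400503) (% 3 6 (% 5 6 (! 21000 3400005) (% 6 7 (% 0 7 (! 0 1131242005) (% 0 9 (! 0 3024120105) (% 1 7 (new 5 true 10 (% 3 10 (! 0 11243235) (% 4 10 (! 0 13021240503) ($ 3 4 5 10)))) (% 1 9 (% 1 3 s101 (% 1 4 (! 0 4213100521) (% 3 9 (! 0 2141353002) ($ 1 9 3 4)))) ($ 0 1 7 9))))) ($ 3 6 5 7))) (% 3 9 (% 5 9 (! 0 4010312502) (% 8 9 (% 0 7 (! 0 1131242005) (% 1 7 (! 11000 243235) (% 0 9 (new 3 false 11 (! 0 1012343205)) (% 1 9 (% 0 3 (% 0 8 (! 0 301242105) (new 0 false 10 (! 0 11010234205))) ($ 0 5 3 9)) ($ 0 1 7 9))))) ($ 3 9 5 8))) (% 4 6 (% 0 7 (! 0 1013240205) (% 0 9 (! 0 1013240205) (% 1 7 (% 1 6 (! 21110 3000450) (% 1 8 (! 32110 450) (% 6 7 (! 0 23140125) (%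 7 8 (! 20210 430050000) ($ 1 7 6 8))))) (% 1 9 (% 1 3 s101 (% 1 4 (! 0 4213100521) ($ 1 9 3 4))) ($ 0 1 7 9))))) ($ 3 4 6 9))))) (% 4 9 (% 4 6 (! 21000 3004300005) (% 6 7 (% 1 4 (% 0 7 (! 0 3121340005) (% 0 9 (! 21010 4030305) (% 1 7 (new 5 true 10 (% 3 10 (! 0 21231145) s71)) (% 1 9 (% 1 5 (! 0 3012100452) (% 1 8 (! 21000 3000300045) (% 5 9 (! 3210 4000050000) (% 8 9 (! 30210 400050000) ($ 1 9 5 8))))) ($ 0 1 7 9))))) (% 1 7 (% 1 8 (! 32110 450) (% 2 8 (new 5 true 10 (% 4 10 (! 2110 30003040005) (% 5 9 (! 0 3120412500) (% 9 10 (! 0 13124200510) ($ 4 9 5 10))))) ($ 1 2 4 8))) ($ 1 2 4 7))) ($ 2 6 4 7))) (% 0 9 (% 6 7 (! 0 3024210105) (% 4 6 (% 2 8 (! 0 4223100501) (% 8 9 (! 11210 3405000000) ($ 2 9 4 8))) ($ 2 6 4 7))) ($ 0 4 2 9)))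
  s123 = % 5 9 (% 2 4 (% 0 3 (! 0 1100243215) (% 1 3 (! 32110 450) (% 0 9 (% 1 6 (! 21110 3000450) (% 1 8 (! 32110 450) (% 6 7 (! 0 3210412025) (% 7 8 (! 0 3121420005) ($ 1 7 6 8))))) (% 1 9 (% 1 6 (! 21110 3000450) (% 1 8 (! 32110 450) (% 6 7 (! 0 2240153130) (% 7 8 (! 0 1431251002) ($ 1 7 6 8))))) ($ 0 1 3 9))))) (% 6 7 (% 0 9 (! 0 3121420005) (% 1 9 (! 0 3142500012) (% 0 3 (% 1 4 (! 33210 45000) (% 1 8 (% 1 3 (! 22100 403003050) (% 8 9 (! 0 212130345) ($ 1 8 3 9))) (% 2 8 (% 7 8 (! 0 2403120521) (% 8 9 (! 0 311420235) ($ 2 8 7 9))) ($ 1 2 4 8)))) (% 1 3 (% 1 5 (! 21000 300045) (new 1 false 10 (% 5 10 (! 0 13041200253) (% 9 10 (! 21000 3000400035) ($ 1 10 5 9))))) ($ 0 1 3 9))))) (% 4 6 (% 7 8 (! 0 2324150001) (% 1 8 (% 3 6 s98 (new 3 false 10 (! 100 2304052020))) (% 1 6 (% 0 3 (! 33210 45000) (% 0 9 (! 0 2123140005) (% 1 3 (! 32110 4000050) (% 1 9 (! 0 4013012052) ($ 0 1 3 9))))) ($ 1 7 6 8)))) ($ 2 6 4 7)))) (% 8 9 (% 0 9 (% 1 6 (! 11210 3405000000) (% 6 7 (! 0 3214010025) (% 7 8 (! 0 4253310001) (% 1 8 (% 2 4 (! 32110 450) (% 4 6 (! 11210 3405000000)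 ($ 2 6 4 7))) ($ 1 7 6 8))))) (% 0 3 (% 2 4 (! 0 1100243215) (% 4 6 (! 33210 45000) (% 6 7 (% 1 4 (! 33210 45000) (% 2 8 (! 0 2413100520) (% 1 8 (% 0 8 (! 10000 322400005) (new 0 false 10 (% 8 10 (! 0 13214020035) (% 9 10 (! 0 3245101021) ($ 0 10 8 9))))) ($ 1 2 4 8)))) ($ 2 6 4 7)))) ($ 0 5 3 9))) ($ 3 9 5 8))
  s124 = % 3 6 s98 (new 3 false 10 (% 0 3 (! 33210 45000) (% 1 3 s101 (% 1 10 (! 0 10011230245) (% 0 10 (% 6 10 (! 22210 33040500) (% 8 10 (% 5 10 (! 0 30100412225) (% 7 10 (! 10000 20033400205) ($ 3 10 5 7))) ($ 3 10 6 8))) ($ 0 1 3 10))))))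
  s125 = % 2 7 (new 5 true 10 (% 3 10 (% 3 6 (% 5 6 (! 21000 3400005) (% 6 7 (% 0 3 (! 0 20204103125) (% 0 10 (! 0 20031420521) (% 1 3 (! 0 10203104521) (% 1 10 (! 0 2231400521) ($ 0 1 3 10))))) ($ 3 6 5 7))) (% 6 10 (% 7 10 (! 0 20030411521) (% 9 10 (! 21000 3004300005) (% 3 9 (% 4 6 (! 210 30300045000) (% 6 7 (! 0 20031420521) (% 4 10 (% 1 4 (! 210 30300045000) (% 1 8 (! 21000 30004000035) (% 2 4 (! 0 21030421501) (% 2 8 (! 0 12230411500) ($ 1 2 4 8))))) ($ 4 7 6 10)))) ($ 3 10 7 9)))) (% 8 10 (% 2 8 (! 0 11322400510) (% 2 10 (! 0 21030421501) (% 7 8 (! 21100 340500000) (% 7 10 (! 0 20030411521) ($ 2 7 8 10))))) ($ 3 10 6 8)))) (% 4 10 (% 2 4 (! 0 11031420502) (% 2 10 (! 0 22031410501) (% 4 6 (! 2110 3040005) (% 6 10 (% 1 4 (! 3210 40000050000) (% 1 10 (! 20100 40305000030) ($ 1 2 4 10))) ($ 2 6 4 10))))) ($ 3 4 5 10)))) (% 2 9 (% 0 2 (! 21000 400305) s122) (% 3 9 (% 1 7 s123 (% 1 9 (% 1 4 (% 5 9 (% 6 7 (! 0 3142511002) (% 2 4 s124 (% 4 6 (% 3 6 s98 (new 3 false 10 (! 100 4305022030))) ($ 2 6 4 7)))) (% 8 9 (% 4 6 (! 10210 304050000) (% 6 7 (! 0 3425211001) (% 2 4 s124 ($ 2 6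 4 7)))) ($ 3 9 5 8))) (% 2 4 (% 5 9 (% 8 9 (! 0 2433511001) (% 1 8 (new 5 true 10 (% 4 10 (! 21000 30000400035) (% 3 10 (% 1 3 s101 (% 1 10 (! 0 12001203453) (% 8 10 (! 0 30100412532) ($ 1 8 3 10)))) ($ 3 4 5 10)))) (% 4 9 (new 5 true 10 (% 3 10 (! 0 12100234510) (% 4 10 (! 21000 30003400005) ($ 3 4 5 10)))) ($ 1 9 4 8)))) (% 8 9 (% 0 3 (new 5 true 10 (% 3 10 (! 0 20200134125) (% 4 10 (! 100 22403053000) ($ 3 4 5 10)))) (% 0 9 (new 5 true 10 (% 1 5 s42 (% 1 10 (! 0 11322341005) (% 9 10 (! 21000 3000400305) ($ 1 9 5 10))))) ($ 0 5 3 9))) ($ 3 9 5 8))) ($ 1 2 4 7))) ($ 1 2 7 9))) ($ 2 3 7 9)))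
  s126 = % 6 7 (! 21000 3400005) ($ 0 6 2 7)
  s127 = % 0 2 (! 32100 400005) (% 0 7 (! 32100 400005) s126)
  s128 = new 5 true 10 (% 1 10 (! 0 10200413523) (% 3 10 (! 0 22133145) ($ 1 3 5 10)))
  s129 = % 1 7 (% 1 3 (! 0 4235100123) (% 6 7 (! 21000 3400005) ($ 1 7 3 6))) ($ 1 2 4 7)
  s130 = % 1 9 (% 1 8 (% 2 7 s127 (% 3 9 (% 5 9 (% 1 7 (! 0 4123500012) (% 1 4 (% 1 5 (! 10000 3402025) (% 4 6 (! 0 1002343015) ($ 1 4 5 6))) (% 2 4 (% 2 9 (! 0 4002301521) (% 4 6 (! 0 4013512002) (% 4 9 (! 0 4123510002) ($ 2 4 6 9)))) ($ 1 2 4 7)))) (% 8 9 (% 0 3 (! 10000 203400025) (% 0 9 (! 0 1213400025) ($ 0 5 3 9))) ($ 3 9 5 8))) (% 2 9 (% 0 2 (! 32100 400005) (% 2 4 (% 1 4 (! 1000 230245) (% 1 3 (% 1 5 (! 10000 3402025) (% 1 7 s128 ($ 1 3 5 7))) (% 4 9 s90 ($ 1 9 3 4)))) (% 4 9 (% 1 4 (! 21000 3000300045) s129) (% 0 9 (% 1 4 (! 0 2101032045) s129) ($ 0 4 2 9))))) ($ 2 3 7 9)))) (% 2 8 (% 2 7 s127 (% 7 8 (! 0 2413501200) (% 8 9 (% 2 9 (! 0 1412300520) (% 3 9 (% 0 3 (! 0 203421105) (% 0 9 (! 0 1213400025) (% 5 9 (! 0 2413500101) ($ 0 5 3 9))))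 ($ 2 3 7 9))) (% 2 9 (% 1 5 (! 10000 3402025) (% 5 9 (! 10 4330200500) ($ 1 9 5 8))) ($ 2 8 7 9))))) ($ 1 2 6 8))) (% 2 9 (% 2 8 (% 0 7 (! 32100 400005) (% 0 9 (new 1 false 10 (! 0 1223400125)) (% 1 7 (% 1 8 (! 0 311201452) (% 6 7 (! 21000 3400005) (% 7 8 (! 20010 400300500) ($ 1 7 6 8)))) ($ 0 1 7 9)))) (% 1 8 (% 0 7 (! 32100 400005) (% 1 7 (% 6 7 (! 21000 3400005) (% 1 3 (% 0 2 (! 32100 400005) (% 0 9 (! 0 1123200345) (% 2 4 (% 1 5 (! 10000 3402025) s128) (% 4 9 (new 1 false 10 (% 1 4 (! 2110 30045) (% 4 10 (! 1000 20000230345) (% 9 10 s91 ($ 1 10 4 9))))) ($ 0 4 2 9))))) ($ 1 7 3 6))) (% 0 9 (% 1 4 (! 0 2113400215) (% 2 4 (! 0 123412025) (% 2 7 (% 0 2 (! 32100 400005) s126) ($ 1 2 4 7)))) ($ 0 1 7 9)))) ($ 1 2 6 8))) ($ 1 2 6 9))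
  s131 = % 4 9 (! 21000 3000400503) ($ 1 9 3 4)
  s132 = % 2 4 (% 1 6 (% 0 7 (! 10000 232400005) (% 0 9 (new 5 true 10 (% 1 5 (! 0 131242035) (% 1 10 (! 0 12231341005) (% 6 10 (! 0 23014120205) ($ 1 6 5 10))))) (% 1 7 (new 5 true 10 (% 3 10 (! 0 23121145) (% 4 10 (! 0 10032340215) ($ 3 4 5 10)))) (% 1 9 (% 1 3 (% 0 3 (! 21100 3045) (! 10000 3202045)) (% 1 4 (! 0 4123100152) (% 3 9 (! 0 2141353002) s131))) ($ 0 1 7 9))))) (% 1 7 (% 1 8 (new 5 true 10 (% 4 10 (! 1000 20000340325) (% 3 10 (% 5 9 (! 0 3241250103) (% 6 10 (! 0 31101402532) s30)) ($ 3 4 5 10)))) (% 2 8 (new 5 true 10 (% 5 9 (! 0 13221400510) (% 9 10 (! 21000 3000400503) (% 6 10 (% 1 10 (! 0 30021230145) (% 2 10 (% 3 10 (! 0 30101402502) (% 4 10 (! 0 30021240135) ($ 3 4 5 10))) ($ 1 2 6 10))) ($ 5 10 6 9))))) ($ 1 2 6 8))) (% 2 7 (% 0 7 (! 10000 232400005) (% 0 9 (! 1210 4003030500) (% 1 9 (% 1 3 s101 (% 1 4 (! 210 3340050000) (% 3 9 (! 0 2040131502) s131))) ($ 0 1 7 9)))) ($ 1 2 6 7)))) (% 0 9 (% 1 4 (! 0 3124100125) (% 2 7 (! 0 4235100201) (% 1 7 (new 5 true 10 (% 5 9 (! 0 3121420005) (% 6 10 (! 0 23014120205) (% 9 10 (!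 0 23214100025) ($ 5 10 6 9))))) ($ 1 2 4 7)))) (% 4 9 (% 0 7 (! 10000 232400005) (% 1 7 (% 1 8 (new 5 true 10 (! 0 3142150102)) (% 2 8 (new 5 true 10 (% 4 10 (! 2110 30003040005) (% 5 9 (! 0 3120412500) (% 9 10 (! 0 13042051012) ($ 4 9 5 10))))) (% 1 4 (% 1 6 (! 0 2134010052) ($ 1 2 6 8)) ($ 1 2 4 8)))) (% 1 9 (% 2 7 (! 0 4032151012) (% 1 4 (% 1 6 (! 0 3124010052) ($ 1 2 6 7)) ($ 1 2 4 7))) ($ 0 1 7 9)))) ($ 0 4 2 9)))
  s133 = % 4 6 (! 33210 45000) ($ 1 6 3 4)
  s134 = % 2 9 (% 0 2 (! 21000 400305) (% 0 3 (% 0 9 (% 3 9 (% 5 9 (! 0 3010421205) (% 8 9 (! 0 4100213205) ($ 3 9 5 8))) (% 4 6 (% 5 6 (! 0 1013420205) (% 2 4 (new 3 false 10 (% 5 10 (! 0 1230423105) (% 8 10 (! 0 301242511) ($ 3 10 5 8)))) ($ 2 5 4 6))) (% 4 9 (% 1 4 (! 3210 4000050000) (% 2 4 (! 32110 4000000500) (% 2 7 (! 0 3020241105) (% 1 7 (% 1 8 (! 21000 30345) (% 6 7 (! 0 4132052110) (% 7 8 (! 22210 430003500) (% 1 6 (% 1 3 (! 21100 3045) ($ 1 6 3 4)) ($ 1 7 6 8))))) ($ 1 2 4 7))))) ($ 3 4 6 9)))) (% 2 4 (% 0 7 (! 0 2030142105) (% 3 9 (! 22110 34500) ($ 0 3 7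 9))) (% 4 9 (% 0 7 (% 0 8 (! 0 2300241105) (% 2 7 (! 0 3020341105) (% 7 8 (! 22210 430003500) ($ 0 7 2 8)))) (% 3 9 (% 5 9 (! 11210 3000045000) (% 8 9 (! 0 3100224501) ($ 3 9 5 8))) ($ 0 3 7 9))) ($ 0 4 2 9)))) ($ 0 6 2 3))) (% 3 9 (% 1 9 (% 5 9 (% 0 2 (% 7 8 (! 0 210420315) (% 2 7 (% 1 4 (! 0 120410325) (% 1 8 (! 0 120410325) (% 4 9 (! 0 2040312501) (% 8 9 (! 0 211420305) ($ 1 9 4 8))))) (% 8 9 (% 0 7 (! 0 1420321520) (% 0 9 (! 13210 4000000005) ($ 0 2 7 9))) ($ 2 8 7 9)))) (% 0 3 (% 1 4 (! 33210 45000) (% 2 4 (! 0 2200134501) (% 2 7 (% 1 8 (! 0 2141312500) (% 4 9 (! 11210 3000045000) (% 8 9 (! 0 2140312500) ($ 1 9 4 8)))) (% 1 7 (% 4 9 (! 11210 3000045000) (% 1 8 (% 7 8 (! 0 1020231345) (% 8 9 (new 3 false 10 (% 6 10 (! 0 3102013245) (% 8 10 (! 0 23420011150) ($ 3 10 6 8)))) ($ 2 8 7 9))) (% 8 9 (% 1 6 (! 0 2433500110) (% 6 7 (! 0 3142500210) (% 7 8 (! 0 241530311) ($ 1 7 6 8)))) ($ 1 9 4 8)))) ($ 1 2 4 7))))) ($ 0 6 2 3))) (% 8 9 (% 5 6 (% 4 6 (! 0 304151202) ($ 3 4 5 6)) ($ 2 5 6 9)) ($ 3 9 5 8))) (% 1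 6 (% 5 6 (! 21000 3400005) (% 5 9 (% 1 3 s10 (% 0 3 (% 1 4 (! 33210 45000) s133) (% 0 9 (% 0 2 (! 13210 4000000005) ($ 0 6 2 3)) ($ 0 1 3 9)))) ($ 2 5 6 9))) ($ 1 2 6 9))) ($ 2 3 6 9))
  s135 = % 3 8 (% 2 9 (% 0 2 (! 21000 400305) (% 0 9 s99 (% 2 4 s102 (% 4 9 (% 0 3 (% 1 4 (! 33210 45000) (% 2 7 (! 32210 4500) (% 1 7 (% 4 8 (! 33210 400005000) (% 8 9 (! 33210 400005000) (% 5 9 (% 0 7 (! 0 130421215) (% 3 9 (% 1 3 (! 10000 2003245) (% 7 8 (! 0 2140531300) (% 1 8 (% 4 6 (! 33210 45000) (% 6 7 (! 100 2403035020) ($ 4 7 6 8))) ($ 1 7 3 8)))) ($ 0 3 7 9))) ($ 4 9 5 8)))) ($ 1 2 4 7)))) (% 2 6 (% 4 6 (! 21000 3004300005) (% 2 7 s103 (% 6 7 (% 1 7 (% 0 8 (! 0 2314201015) (% 1 3 (! 32110 450) (% 1 8 (! 32110 450) ($ 0 1 3 8)))) (% 1 4 (% 0 8 (! 0 2314201015) (% 1 3 s101 (% 1 8 (! 2110 30045) ($ 0 1 3 8)))) ($ 1 2 4 7))) ($ 2 6 4 7)))) (% 3 6 (% 2 7 s103 (% 1 7 (% 6 7 (% 1 6 (! 0 23121145) (% 1 8 (% 3 9 (! 0 4235121000) (% 7 8 (! 21110 43000350) (% 8 9 s61 ($ 3 8 7 9)))) (% 2 8 (% 1 3 (! 21100 3450)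 (% 7 8 (! 0 1435002120) ($ 1 7 3 8))) ($ 1 2 6 8)))) (% 5 6 (% 4 8 (! 0 423512001) (% 5 9 (! 0 3124510002) (% 8 9 (! 0 3415221000) ($ 4 9 5 8)))) ($ 3 6 5 7))) (% 1 4 (% 1 5 (! 0 11232145) (% 1 8 (! 2110 30045) (% 4 8 (% 0 8 (! 0 211343005) (% 1 3 ($ 1 3 5 7) ($ 0 1 3 8))) ($ 1 4 5 8)))) ($ 1 2 4 7)))) ($ 0 6 2 3)))) ($ 0 4 2 9))))) s121) (% 4 8 (% 2 6 s125 (% 3 6 (% 5 6 (% 1 6 (! 21000 3400005) s130) (% 6 7 (% 2 9 (% 0 2 (! 21000 400305) s132) (% 5 9 (% 4 9 (! 0 4131250002) (% 3 9 (% 0 7 (! 10000 232400005) (% 0 9 (! 0 3212410005) (% 1 7 (% 1 9 (! 0 3142500012) (% 1 6 (% 0 3 (! 0 2014013025) (% 1 3 (% 0 2 (! 32100 45) (! 10000 3202045)) ($ 0 1 3 9))) ($ 1 2 6 9))) (% 1 9 (% 8 9 (! 11210 3405000000) (% 1 4 (% 1 6 (! 0 3014012052) (% 2 7 (! 0 3142500112) ($ 1 2 6 7))) (% 1 8 (% 1 6 (! 32110 4000050) (% 2 7 (new 5 true 10 (% 3 10 (! 0 2014215303) (% 4 10 (! 21000 30000400035) ($ 3 4 5 10)))) ($ 1 2 6 7))) ($ 1 9 4 8)))) ($ 0 1 7 9))))) ($ 3 4 5 9))) ($ 2 5 6 9))) ($ 3 6 5 7))) (% 2 8 s134 ($ 2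 3 6 8)))) ($ 3 4 5 8))
  s136 = % 2 11 (% 3 11 (% 3 8 (! 0 100300124521) (% 8 11 (! 0 300400211521) (% 3 6 (% 5 6 (! 32100 400005) (% 6 7 (% 0 3 (! 0 101202103405) (% 0 11 (! 2110 300000000405) (% 1 3 (! 20100 304000035) (% 1 11 (% 1 6 (! 0 200104303125) (% 1 8 (! 2110 300003000045) (% 6 11 (! 0 200104303125) ($ 1 11 6 8)))) ($ 0 1 3 11))))) ($ 3 6 5 7))) (% 6 11 (% 4 6 (! 22210 300040030500) (% 4 9 (! 2110 300000030405) (% 3 9 (% 2 6 (! 0 201013120405) (% 6 10 (! 21000 30000300405) (% 9 10 (! 0 112040313502) (% 2 9 (% 4 11 (! 0 200010343125) (% 6 7 (! 0 401205103203) (% 7 11 (! 22210 300040000500) ($ 4 7 6 11)))) ($ 2 10 6 9))))) ($ 3 4 6 9)))) ($ 3 11 6 8))))) (% 4 11 (% 4 6 (! 3210 40005) (% 4 9 (! 2110 300000030405) (% 6 11 (% 1 6 (! 0 100322040135) (% 2 6 (! 0 201013120405) (% 2 9 (! 30210 400000000500) (% 1 9 (% 1 3 (! 0 230141235) (% 1 4 (! 3210 40005) (% 3 9 (% 6 10 (! 21000 30000300405) (% 9 10 (! 0 112040313502) ($ 2 10 6 9))) ($ 1 9 3 4)))) ($ 1 2 6 9))))) (% 9 11 (% 3 9 (! 11000 300000232405) (% 3 6 (% 5 6 (! 32100 400005) ($ 3 6 5 11)) ($ 3 4 6 9))) ($ 4 11 6 9))))) ($ 3 4 5 11))) (% 3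 11 (% 1 5 (! 32100 400005) (% 1 11 (% 5 10 (! 32100 400005) (% 10 11 (% 0 3 (! 0 100100123425) (% 0 11 (! 3210 400000000005) (% 6 11 (% 1 4 (! 0 100100122345) (% 1 7 (! 0 110020210345) (% 4 11 (! 0 110020143235) (% 7 11 (! 0 210040312531) ($ 1 11 4 7))))) (% 3 6 (% 5 6 (! 32100 400005) (% 5 9 (! 0 200312401135) (% 9 11 (% 1 6 (! 0 100122010345) (% 1 8 (! 0 100200121345) (% 8 11 (! 30210 400500000000) ($ 1 11 6 8)))) ($ 5 11 6 9)))) ($ 0 6 3 11))))) ($ 2 10 5 11))) ($ 1 2 5 11))) ($ 2 3 5 11))
  s137 = % 1 7 (! 2110 345) ($ 1 3 5 7)
  s138 = % 1 5 (! 32100 45) s137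
  s139 = % 1 4 (! 2100 30045) (% 1 7 (! 2110 345) ($ 1 8 4 7))
  s140 = % 1 8 s139 ($ 0 1 3 8)
  s141 = % 0 7 (! 210 430003005) s112
  s142 = new 2 false 10 (! 0 14020135201)
  s143 = % 0 8 (! 0 11230403205) (new 0 false 11 (! 0 122310403105))
  s144 = % 9 11 (! 21000 43000300005) ($ 3 9 5 11)
  s145 = % 2 6 (% 3 8 (! 33210 400005000) (% 5 9 (% 0 9 (! 0 4010213205) (% 1 9 (% 1 4 (! 33210 45000) (% 1 8 (new 2 false 10 (% 5 10 (! 21000 30000400035) (% 0 10 (% 2 9 (! 0 3020014512) (% 9 10 (! 0 12142313500) ($ 2 10 5 9))) ($ 0 5 2 10)))) (% 4 9 s142 (% 8 9 (new 2 false 10 (% 5 10 (! 21000 30003400005) (% 0 10 s143 ($ 0 5 2 10)))) ($ 1 9 4 8))))) (% 1 7 (% 1 5 (! 0 31212451) (% 2 9 (! 0 4132021510) ($ 1 2 5 9))) ($ 0 1 7 9)))) (% 8 9 (% 0 9 (new 5 true 11 (% 3 11 (! 0 3012124105) (% 9 11 (! 0 203100124105) ($ 3 9 5 11)))) (% 1 9 (new 2 false 10 (% 5 10 (! 21000 30003400005) (% 0 10 (% 7 10 (! 0 24253031100) (% 9 10 (new 5 true 11 (% 3 11 (! 0 21013134502) s144)) ($ 0 10 7 9))) ($ 0 5 2 10)))) (% 1 7 (% 1 6 (! 0 32211451) (% 6 7 (! 0 2304101521) (% 7 8 (! 22210 430000500) (% 1 8 (new 1 false 10 (! 0 1230201451))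 ($ 1 7 6 8))))) ($ 0 1 7 9)))) ($ 3 9 5 8)))) (% 6 7 (% 3 8 (! 33210 400005000) (% 5 9 (% 0 9 (! 0 4010213205) (% 1 9 (% 1 4 (! 33210 45000) (% 4 9 s142 (% 1 8 (new 2 false 10 (! 0 12020134531)) (% 8 9 (new 2 false 10 (% 0 10 s143 (% 5 10 (! 21000 30003400005) ($ 0 5 2 10)))) ($ 1 9 4 8))))) (% 1 7 (% 1 5 (! 10000 22300045) (% 2 9 (% 2 4 (! 22110 34500) (% 4 9 (! 0 2100143125) ($ 0 4 2 9))) ($ 1 2 5 9))) ($ 0 1 7 9)))) (% 8 9 (% 2 9 (! 0 4310212500) (% 1 9 (new 2 false 10 (% 5 10 (! 21000 30003400005) (% 0 10 (% 6 10 (! 21000 30004300005) (% 9 10 (new 5 true 11 (% 3 11 (! 0 14023125301) s144)) ($ 2 10 6 9))) ($ 0 5 2 10)))) (% 1 6 (% 0 9 (! 0 3024121015) (% 1 7 (! 21110 43000050) ($ 0 1 7 9))) ($ 1 2 6 9)))) ($ 3 9 5 8)))) ($ 0 6 2 7))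
  s146 = % 0 7 (new 2 false 10 (% 5 10 (! 32100 400005) (% 0 10 (% 6 10 (! 32100 40000000005) (% 9 10 (! 2100 43000300005) (% 2 6 (% 4 6 (! 0 213040125) (% 3 6 (% 5 6 (! 32100 400005) (% 6 7 (! 0 11124300305) ($ 3 6 5 7))) (% 3 9 (% 3 8 (! 33210 400005000) (% 5 9 (! 2100 33000400005) (% 8 9 (% 0 9 (! 0 13140202105) (% 0 8 (new 3 false 11 (% 5 11 (! 32100 400005) (% 7 11 (! 0 100142303502) ($ 3 11 5 7)))) (% 8 10 (new 0 false 11 (! 0 121140303502)) ($ 0 10 8 9)))) ($ 3 9 5 8)))) (% 4 9 (% 2 4 (! 0 10030242521) (% 2 9 (! 0 22030041105) (% 4 10 (% 1 4 (! 3210 40005) (% 1 9 (! 0 23041250021) ($ 1 2 4 9))) ($ 2 10 4 9)))) ($ 3 4 6 9))))) (% 2 9 (% 2 4 (! 0 10030242521) (% 4 9 (! 0 22030041105) (% 0 9 (% 3 6 (! 0 13142200105) (% 3 9 (! 0 3010214205) (% 4 6 (! 1100 2030042005) ($ 3 4 6 9)))) ($ 0 4 2 9)))) ($ 2 10 6 9))))) ($ 0 5 2 10)))) (% 3 9 s145 (% 0 9 (% 2 6 (% 0 8 (% 3 6 (! 0 304202511) (% 4 6 (! 0 1203141005) (% 4 9 (% 1 4 (! 3210 4000050000) (% 2 4 (! 0 322040115) (% 2 9 (! 0 4132210500) (% 1 9 (% 1 5 (! 21100 300400005) (% 1 8 (! 0 320041125) (% 5 9 (! 21000 3000400005) (%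 8 9 (! 0 3201141005) ($ 1 9 5 8))))) ($ 1 2 4 9))))) ($ 3 4 6 9)))) (% 2 9 (% 4 6 (! 0 3014210205) (% 3 6 (% 5 6 (! 21000 3400005) (% 6 7 (! 31210 4000500) ($ 3 6 5 7))) (% 4 9 (new 0 false 10 (% 2 10 (! 0 23020041105) (% 7 10 (! 32210 40000500) ($ 0 10 2 7)))) ($ 3 4 6 9)))) (% 8 9 (% 4 6 (! 210 3400053000) (% 4 9 (! 0 4312052100) (% 3 6 (% 5 6 (! 21000 3400005) (% 6 7 (! 0 2314012510) ($ 3 6 5 7))) ($ 3 4 6 9)))) ($ 0 9 2 8)))) (% 6 7 (% 2 9 (% 4 6 (! 0 3014120205) (% 4 9 (! 0 4132012510) (% 3 6 (new 2 false 10 (! 0 13242100501)) ($ 3 4 6 9)))) (% 3 6 (% 0 8 (! 0 2314100205) (% 8 9 (! 0 3425200101) ($ 0 9 2 8))) ($ 2 3 6 9))) ($ 0 6 2 7))) ($ 0 3 7 9)))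
  s147 = new 5 true 11 (! 0 242310531)
  s148 = % 0 8 s141 (new 0 false 10 (% 3 10 (! 0 14202335011) s118))
  s149 = % 0 3 (! 2210 4305) (% 0 8 (! 210 430003005) ($ 0 7 3 8))
  s150 = % 7 8 (% 1 6 (! 32100 45) (% 2 9 (! 32210 40000500) (% 1 9 (% 1 3 s137 (% 3 9 (% 0 3 (! 2210 4305) (% 0 9 (new 2 false 10 (% 6 10 (! 2210 33000004500) (% 9 10 (! 13210 4000000005) (% 2 6 (% 0 8 s147 (new 0 false 11 (% 3 11 (! 210 300430005000) s54))) ($ 2 10 6 9))))) (% 5 9 (new 2 false 10 (% 5 10 (! 32100 400005) (% 8 10 (! 0 22140301530) ($ 2 10 5 8)))) ($ 0 5 3 9)))) (% 4 9 (% 2 6 (% 4 8 (! 2100 43035) (% 5 9 (! 0 1041320532) (% 8 9 (% 0 9 (! 0 2042130531) (% 0 8 (new 2 false 10 (% 2 4 (! 32210 40000500) (% 4 10 (! 0 12132040035) (% 9 10 (! 0 12042130531) ($ 2 10 4 9))))) ($ 0 2 8 9))) ($ 4 9 5 8)))) (% 3 6 (% 5 6 (! 32100 400005) (% 6 7 (% 4 8 (! 2100 43035) (% 5 9 (! 0 1342500012) (% 8 9 (! 0 3425010011) ($ 4 9 5 8)))) ($ 3 6 5 7))) ($ 2 3 6 9))) (% 1 4 (% 2 6 (! 0 1002121345) (% 3 6 (% 5 6 (! 32100 400005) (% 6 7 (! 0 3212300145) ($ 3 6 5 7))) ($ 2 3 6 9))) ($ 1 9 3 4))))) (% 2 6 (%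 0 7 (! 3210 40000005) (% 1 7 (! 2110 345) (% 0 9 (% 0 3 (! 2210 4305) (% 0 8 s147 (% 3 9 s119 (% 8 9 (% 3 6 (! 0 104202315) (% 4 6 (! 0 3214200105) (% 4 9 (! 0 2043130521) ($ 3 4 6 9)))) ($ 0 9 3 8))))) ($ 0 1 7 9)))) ($ 1 2 6 9))))) (% 2 6 (% 1 7 (! 2110 345) (% 1 9 (% 1 4 (! 0 1002121345) (% 4 8 (% 1 3 ($ 1 3 5 7) (% 4 9 (! 2100 43035) (% 3 9 (% 0 3 (! 2210 4305) (% 0 9 (new 2 false 10 (% 5 10 (! 32100 400005) (% 8 10 (% 8 9 (! 12010 4000303005) (% 9 10 (! 13210 4000000005) (% 7 10 (% 0 8 (! 0 24050031132) (% 0 10 (! 0 30122100415) ($ 0 9 8 10))) ($ 7 9 8 10)))) ($ 2 10 5 8)))) (% 5 9 s148 ($ 0 5 3 9)))) ($ 1 9 3 4)))) ($ 1 8 4 7))) (% 8 9 (% 0 9 (% 1 4 (! 10100 2020345) (% 4 8 (% 3 6 (! 0 104202315) (% 3 9 (! 2100 4000303005) (% 4 6 (! 2100 43035) (% 4 9 (! 2100 43035) ($ 3 4 6 9))))) ($ 1 8 4 7))) (% 0 7 s149 ($ 0 1 7 9))) ($ 1 8 7 9)))) (% 6 7 (% 1 6 (! 32100 45) (% 1 9 (% 2 9 (! 0 4031200521) (% 3 9 (% 0 3 (! 2210 4305) (% 0 9 (% 1 4 (! 2100 3000000045) (% 1 7 (! 2110 345) (% 4 8 (new 2 false 10 (%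 5 10 (! 32100 400005) (% 8 10 (! 0 22143101530) ($ 2 10 5 8)))) ($ 1 8 4 7)))) (% 5 9 (% 1 7 (! 2110 345) (% 1 4 (% 0 8 s141 (new 0 false 10 (! 0 11402331052))) (% 4 8 s148 ($ 1 8 4 7)))) ($ 0 5 3 9)))) (% 3 6 (% 8 9 (! 10000 204203035) ($ 3 8 7 9)) ($ 2 3 6 9)))) (% 2 9 (% 0 7 s149 (% 0 9 (! 0 4032100521) (% 1 7 (! 2110 345) ($ 0 1 7 9)))) ($ 1 2 6 9)))) ($ 2 7 6 8)))
  s151 = % 5 9 (! 21000 3000400035) (% 8 10 (! 33210 400005000) ($ 5 8 9 10))
  s152 = % 0 8 (! 0 11310204205) (new 0 false 11 (! 0 121210304305))
  s153 = % 7 8 (% 0 7 (% 1 6 (! 32100 45) (% 2 9 (! 32210 4500) (% 1 9 (new 2 false 10 (% 5 10 (! 32100 400005) (% 0 10 (% 2 6 (! 0 10140302532) (% 6 10 (! 32100 40000000005) (% 9 10 (! 0 12120304305) ($ 2 10 6 9)))) ($ 0 5 2 10)))) (% 2 6 (new 1 false 10 (% 5 10 (! 0 10232401105) (% 1 3 (! 2100 3045) (% 3 10 (% 6 10 (! 0 20121304305) (% 9 10 s151 ($ 1 10 6 9))) (% 9 10 s151 ($ 1 10 3 9)))))) ($ 1 2 6 9))))) (% 2 6 (% 0 9 (new 2 false 10 (% 5 10 (! 21000 30000400035) (% 8 10 (% 0 8 (! 0 1310204205) (new 0 false 11 (! 0 123410305102))) ($ 2 10 5 8)))) (% 1 7 (new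 2 false 10 (! 0 10430102251)) (% 1 9 (new 2 false 10 (% 5 10 (! 21000 30000400035) (% 0 10 (% 8 10 (% 7 10 (! 0 40120302315) (% 9 10 s152 ($ 0 10 7 9))) ($ 2 10 5 8)) ($ 0 5 2 10)))) ($ 0 1 7 9)))) (% 6 7 (% 1 6 (! 32110 4000050) (% 2 9 (! 32210 4500) (% 1 9 (new 2 false 10 (% 5 10 (! 21000 30000400035) (% 0 10 (% 6 10 (! 21000 30004000035) (% 9 10 s152 ($ 2 10 6 9))) ($ 0 5 2 10)))) ($ 1 2 6 9)))) ($ 0 6 2 7)))) (% 1 7 (% 2 6 (% 4 8 (! 33210 400005000) (% 4 6 (new 2 false 10 (% 2 4 (new 5 true 11 (% 3 11 (! 0 200102134105) s116)) (% 4 10 (! 2110 30345) (% 0 10 (% 5 10 (! 21000 30000400035) (% 8 10 (% 7 10 (! 0 30310201245) ($ 4 7 8 10)) ($ 2 10 5 8))) ($ 0 4 2 10))))) (% 6 7 (new 2 false 10 (! 0 10132100452)) ($ 4 7 6 8)))) (% 6 7 (% 1 6 (! 32110 4000050) (% 2 9 (! 32210 4500) (% 1 9 (new 2 false 10 (% 6 10 (! 21000 30004000035) (% 9 10 (! 0 13042010251) ($ 2 10 6 9)))) ($ 1 2 6 9)))) ($ 2 7 6 8))) (% 1 9 (% 4 8 (! 33210 400005000) (% 1 4 (% 4 6 (! 0 1002131245) (% 6 7 (new 2 false 10 (% 5 10 (! 21000 30000400035) (% 0 10 (% 8 10 (! 0 11203002345) ($ 2 10 5 8)) ($ 0 5 2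 10)))) ($ 4 7 6 8))) ($ 1 8 4 7))) ($ 1 8 7 9)))
  -- In this branch b 0 is adjacent to a 0 but to neither a 2 nor a 3, and b 2 is not adjacent to a
  -- 3. The edges a 2 a 3 and b 0 b 2 must not form an induced 2K2, so b 2 is adjacent to a 2.
  s154 = % 2 8 (% 0 2 (% 4 8 (new 2 false 10 (new 5 true 11 s136)) (% 3 8 (% 7 8 (! 22210 430000500) (% 3 9 (% 0 3 (! 2210 4305) (% 0 9 (% 4 6 (% 0 8 (! 10 400022305) (% 1 3 s138 s140)) (% 6 7 (% 1 3 s138 (% 0 8 (% 1 6 (! 22100 304000005) (% 2 6 (! 0 1304001205) (% 2 9 (! 210 4330005000) (% 1 9 (% 1 5 (! 32100 400005) (% 1 8 (! 0 1310124520) (% 5 9 (! 13210 4000000005) (% 8 9 (! 2100 4000303005) ($ 1 9 5 8))))) ($ 1 2 6 9))))) (% 1 8 (% 1 6 (! 32100 45) (% 1 9 (% 1 5 (! 32100 400005) (! 0 1310124520)) (% 2 6 (! 0 214020315) (% 2 9 (! 210 4330005000) ($ 1 2 6 9))))) ($ 0 1 3 8)))) ($ 4 7 6 8))) (% 5 9 (% 1 3 s138 (% 1 9 (% 4 6 (% 0 8 (! 10 400022305) s140) (% 6 7 (% 1 8 (! 0 1310124520) (% 0 8 s141 ($ 0 1 3 8))) ($ 4 7 6 8))) ($ 0 1 3 9))) ($ 0 5 3 9)))) (% 8 9 (% 0 3 (! 2210 4305) (% 1 3 s138 (% 0 8 (% 2 9 (! 10000 400202305) (% 3 6 (! 0 411202305)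 (% 2 6 (% 4 6 (! 0 3214300105) (% 6 7 (! 0 324002125) ($ 4 7 6 8))) ($ 2 3 6 9)))) (% 1 8 (% 4 6 s139 (% 6 7 (% 2 6 (! 0 134010235) (% 2 9 (! 0 4132100520) (% 3 6 (! 10000 204203035) ($ 2 3 6 9)))) ($ 4 7 6 8))) ($ 0 1 3 8))))) ($ 3 8 7 9)))) ($ 3 4 5 8))) (% 0 3 (% 4 8 s146 (% 3 8 (% 0 8 (! 10 320004502) (% 2 4 (! 32210 4500) ($ 0 4 2 8))) ($ 3 4 5 8))) ($ 0 5 2 3))) (% 3 8 (% 0 2 (% 1 5 (! 32100 400005) (% 1 8 s150 ($ 1 2 5 8))) (% 0 3 (% 8 9 (! 33210 400005000) (% 3 9 (% 1 8 s153 (% 1 5 (% 1 6 (! 10000 22300045) (% 2 6 (% 1 3 (! 21000 300045) (% 1 4 (% 4 6 (! 0 203041125) (% 4 8 (! 33210 400005000) ($ 1 4 6 8))) ($ 1 5 3 4))) ($ 1 2 6 8))) ($ 1 2 5 8))) (% 7 8 (% 1 5 (! 12100 30403005) (% 1 8 (% 0 7 (% 2 9 (! 32210 4500) (% 2 6 (new 2 false 10 (% 0 10 (! 0 10140302532) (% 5 10 (! 32100 400005) ($ 0 5 2 10)))) (% 3 6 (% 5 6 (! 32100 400005) (% 6 7 (! 0 234001125) ($ 3 6 5 7))) ($ 2 3 6 9)))) (% 0 9 (% 2 9 (! 32210 4500) (% 2 6 (% 3 6 (! 0 104203215) (% 4 9 s36 (% 4 6 (new 2 false 10 (% 5 10 (!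 21000 30000400035) (% 8 10 (% 0 8 (! 0 1314200205) (new 0 false 11 (% 2 11 (! 0 211240303501) (% 7 11 (! 210 300450003000) ($ 0 11 2 7))))) ($ 2 10 5 8)))) ($ 3 4 6 9)))) (% 3 6 (% 6 7 (! 0 1324015210) ($ 0 6 2 7)) ($ 2 3 6 9)))) ($ 0 3 7 9))) ($ 1 2 5 8))) ($ 3 8 7 9)))) ($ 0 5 2 3))) ($ 2 3 5 8))
  s155 = % 0 9 (! 210 4300005000) (% 1 3 (! 32100 400000050) ($ 0 1 3 9))
  s156 = % 0 3 (! 33210 400005000) s155
  s157 = % 1 9 (% 7 8 (% 1 3 (! 0 2010123451) (% 1 4 (! 0 101230452) (% 4 9 (new 5 true 10 (% 1 5 (! 32100 45) (% 1 10 (! 21000 3000300450) (% 0 10 (% 3 5 (! 22210 340005300) (% 3 10 (! 100 20200043035) (% 4 10 (! 2100 30000040035) ($ 3 4 5 10)))) ($ 0 1 5 10))))) (% 3 9 (% 2 9 (! 0 3010124521) (% 4 7 (! 0 2010234512) ($ 2 4 7 9))) ($ 1 9 3 4))))) (% 1 3 (% 3 6 (! 0 1002013452) (% 3 8 (! 32100 400000050) ($ 3 7 6 8))) (% 3 8 (% 1 4 (! 0 101023453) (% 4 9 (! 2100 43035) (% 3 9 (% 2 9 (! 0 3102024510) (% 4 7 (! 0 2011234502) ($ 2 4 7 9))) ($ 1 9 3 4)))) ($ 1 8 3 7)))) (% 2 9 (% 7 8 (% 4 6 (! 0 103241512) (% 3 6 (new 1 false 10 (% 1 5 (! 32100 45)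 (% 5 10 (! 0 11425312003) (% 7 10 (% 1 3 (! 0 121302453) (% 1 4 (! 0 101023453) (% 3 10 (! 0 10202134501) (% 4 10 (! 0 23042110135) ($ 1 10 3 4))))) ($ 1 10 5 7))))) (% 3 9 (% 3 5 (! 22110 34500) (% 3 8 (! 0 2430105120) (% 5 9 (! 0 3010224511) (% 8 9 (! 0 3120014520) ($ 3 9 5 8))))) (% 4 9 (new 1 false 10 (% 1 5 (! 32100 45) (% 5 10 (! 0 12421351003) (% 7 10 (% 1 3 (! 0 2010134521) (% 1 4 (! 21000 30450) (% 3 10 (! 0 21010234502) (% 4 10 (! 2100 3000040035) ($ 1 10 3 4))))) ($ 1 10 5 7))))) ($ 3 4 6 9))))) (% 8 9 (% 3 6 (% 1 3 (! 0 102013452) (% 3 8 (! 0 102034512) ($ 1 8 3 7))) (% 3 8 (% 3 9 s156 (% 4 6 (! 0 103241512) (% 4 9 (! 0 4302152100) ($ 3 4 6 9)))) ($ 3 7 6 8))) ($ 1 8 7 9))) ($ 1 2 7 9))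
  s158 = % 0 2 (! 0 2131120045) (% 2 4 (! 0 2031120145) ($ 0 4 2 5))
  s159 = % 2 7 (! 2110 30000045) ($ 0 7 2 8)
  s160 = % 5 6 (% 2 4 (! 2210 40500303) ($ 0 4 2 5)) ($ 0 6 2 5)
  s161 = % 1 7 (% 7 8 (! 21100 340000050) (% 4 9 (% 3 8 (! 2100 43035) (% 2 5 s158 (% 2 8 (% 0 8 (! 100 300042025) (% 2 7 (! 2110 30000045) (% 0 2 (% 2 9 (! 21000 345) (% 8 9 (! 100 4300052020) ($ 2 8 7 9))) ($ 0 7 2 8)))) (% 3 5 (% 0 3 (! 0 2131120045) (% 1 3 (new 2 false 10 (% 0 2 (! 0 30211245) (% 0 10 (! 0 2131120045) (% 6 10 (! 0 12032110145) ($ 0 6 2 10))))) ($ 0 1 3 5))) ($ 2 3 5 8))))) (% 4 7 (% 1 3 (% 2 5 s158 (% 3 5 (! 0 31021245) (% 3 8 (! 32100 400000050) (% 2 8 (% 0 2 (! 0 101022345) (% 0 8 (! 20100 300000045) s159)) ($ 2 3 5 8))))) (% 1 4 (% 2 5 s158 (% 3 5 (! 22210 30045000) (% 3 8 (! 0 21031145) (% 2 8 (% 0 2 (! 0 202031145) (% 0 8 (! 0 201031145) s159)) ($ 2 3 5 8))))) (% 3 9 (% 5 9 (! 12110 3040000050) (% 8 9 (! 0 3041025021) (% 3 5 (% 0 3 (! 0 2131120045) ($ 0 1 3 5)) (% 3 8 (% 2 5 s158 (new 2 false 10 (% 0 2 (! 0 3020031145) (% 0 10 (! 0 22031010145) (%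 6 10 (! 0 2304025111) ($ 0 6 2 10)))))) ($ 3 9 5 8))))) ($ 1 9 3 4)))) (% 8 9 (% 1 3 (! 0 2031021045) (% 1 4 (! 0 3241100152) (% 3 9 (! 0 3041025021) ($ 1 9 3 4)))) ($ 4 8 7 9))))) (% 2 5 (% 0 2 (% 7 8 (! 10000 242300035) (% 1 3 (% 2 9 (! 0 2001021345) (% 5 6 (! 21100 340500003) (% 5 9 (% 0 9 (! 12010 4030000005) (% 4 9 (new 5 true 10 (% 1 10 (! 32110 4000000050) (% 3 5 (! 0 3041221305) (% 3 10 (! 0 4023011352) ($ 1 3 5 10))))) ($ 0 4 5 9))) ($ 2 5 6 9)))) (% 3 8 (% 1 4 (! 0 202031145) (% 4 9 (! 2100 43035) (% 3 9 (% 2 9 (! 0 3021104502) (% 5 6 (! 21100 340500003) (% 5 9 (! 0 2043321105) ($ 2 5 6 9)))) ($ 1 9 3 4)))) ($ 1 8 3 7)))) s160) (% 2 7 (% 2 4 (! 32210 40000500) (% 7 8 (% 2 8 (! 22210 430000500) (% 3 8 (! 210 340005000) (% 3 5 (% 0 3 (! 0 131204025) (% 1 3 (new 2 false 10 (! 0 421301253)) ($ 0 1 3 5))) ($ 2 3 5 8)))) (% 2 8 (% 3 8 (! 10 230004502) (% 1 3 (new 2 false 10 (! 0 121103452)) ($ 1 8 3 7))) (% 4 7 (% 6 7 (% 1 3 (! 0 234005211) (% 3 8 (new 2 false 10 (! 0 124105313)) ($ 1 8 3 7))) ($ 2 7 6 8)) ($ 2 7 4 8))))) ($ 1 2 5 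7)))
  s162 = new 3 false 10 (! 0 10141203235)
  s163 = % 1 9 (% 3 6 (% 1 5 (! 32100 45) s161) (% 3 8 (% 4 6 (! 2100 43035) (% 4 9 (! 2100 43035) (% 3 9 (% 0 3 (! 33210 400005000) (% 0 2 (% 1 5 (! 32100 45) (% 1 7 (! 0 2030021145) (% 2 7 (! 3210 40000005) (% 2 5 (% 2 9 (! 0 3021114502) (% 5 6 (! 21100 340500003) (% 5 9 (! 0 4031225101) ($ 2 5 6 9)))) ($ 1 2 5 7))))) ($ 0 6 2 3))) ($ 3 4 6 9)))) (% 2 8 (% 7 8 (% 1 5 (! 32100 45) (% 1 7 (! 21100 340000050) (% 2 7 (! 22210 340000500) (% 2 5 (% 5 6 (! 21100 340500000) (% 0 2 (% 3 9 (% 2 9 (! 0 3010024521) (% 5 9 (! 0 2040321135) ($ 2 5 6 9))) (% 2 9 s162 ($ 2 3 6 9))) ($ 0 6 2 5))) ($ 1 2 5 7))))) (% 6 7 (% 1 7 (! 2110 30000045) (% 2 7 (% 0 2 (! 3210 40000005) (% 0 3 (! 22210 30004500) ($ 0 6 2 3))) ($ 1 2 6 7))) ($ 3 7 6 8))) ($ 2 3 6 8)))) (% 2 9 (% 1 5 (! 32100 45) (% 1 7 (! 10000 32200245) (% 2 7 (! 32210 40000500) (% 2 5 (% 5 6 (! 2210 40500303) (% 0 2 (% 7 8 (% 2 8 (% 3 6 (! 0 141302235) s162) (% 3 6 (% 2 4 (! 0 101143235) (% 4 9 (new 1 false 10 (% 1 3 (! 0 112102345) (% 6 10 (! 0 12334110025)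 (% 3 10 (% 3 5 (! 22210 340005300) (% 3 8 (! 2100 43035) (% 5 10 (! 0 11241320035) (% 8 10 (! 0 23141220035) ($ 3 10 5 8))))) ($ 1 10 3 6))))) (% 8 9 (new 1 false 10 (! 0 2123300415)) ($ 2 9 4 8)))) (% 3 8 (% 2 4 (! 0 101143235) (% 4 9 (! 2100 43035) (% 8 9 (! 2010 4350000000) ($ 2 9 4 8)))) ($ 2 3 6 8)))) (% 8 9 (% 1 3 (! 0 112102345) (% 3 8 (% 3 9 (% 0 3 (! 33210 400005000) (% 0 9 (! 210 4300005000) ($ 0 1 3 9))) (% 4 6 (! 2100 43035) (% 4 9 (! 2100 43035) (% 3 6 (new 1 false 10 (% 6 10 (! 0 3102032415) (% 3 10 (% 5 10 (! 0 11023312405) (% 7 10 (% 9 10 (! 0 32041021305) ($ 1 10 6 9)) ($ 1 10 5 7))) ($ 1 10 3 6)))) ($ 3 4 6 9))))) ($ 1 8 3 7))) ($ 1 8 7 9))) ($ 0 6 2 5))) ($ 1 2 5 7))))) ($ 1 2 6 9))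
  s164 = % 5 6 (! 10000 23200045) ($ 0 6 2 5)
  s165 = % 0 2 (! 0 102032145) (% 2 6 (! 20100 3000045) s164)
  s166 = new 0 false 10 (! 0 1212030145)
  s167 = new 2 false 10 (! 0 312402351)
  s168 = new 0 false 10 (! 0 1121030245)
  s169 = % 3 6 (% 1 6 (% 3 8 (! 0 2413125001) (% 2 5 s165 (% 2 8 (% 0 8 (! 0 102032145) (% 7 8 (new 0 false 10 (! 21100 340000035)) (% 8 9 (! 0 3214200151) (% 4 7 s166 (% 4 9 s166 ($ 4 8 7 9)))))) (% 3 5 (% 4 7 (! 22210 30045000) (% 8 9 (! 0 2013021145) (% 4 9 (new 2 false 10 (% 5 10 (! 32210 40500000) (% 8 10 (! 0 11212345003) ($ 2 10 5 8)))) (% 7 8 (% 1 7 (! 21100 30000045) (% 2 7 s167 ($ 1 2 7 8))) ($ 4 8 7 9))))) ($ 2 3 5 8))))) (% 2 8 (% 3 5 (% 2 7 (! 210 45303) (% 2 9 (! 32210 4500) (% 7 8 (! 20010 340500000) (% 8 9 (% 0 8 (! 100 2200030045) (% 0 2 (new 0 false 10 (! 0 11200021345)) ($ 0 7 2 8))) ($ 2 8 7 9))))) (% 5 6 (% 0 8 (! 100 2200030045) (% 7 8 (! 0 2342500111) (% 8 9 (! 0 2413500121) (% 4 7 s168 (% 4 9 (new 0 false 10 (! 0 2112030145)) ($ 4 8 7 9)))))) ($ 1 5 3 6))) (% 2 6 (% 3 5 (% 4 7 (! 22210 30045000) (% 4 9 (! 100 2002030045) (% 7 8 (! 20010 340500000)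 (% 8 9 (! 100 2002032045) ($ 4 8 7 9))))) (% 5 6 (% 4 7 (! 1000 3024230005) (% 4 9 (! 100 2002030045) (% 7 8 (! 0 1321400253) (% 8 9 (! 0 3201043251) ($ 4 8 7 9))))) ($ 1 5 3 6))) ($ 1 2 6 8)))) (% 2 6 (% 3 9 (! 11000 2232045) (% 4 9 (! 100 2002030045) ($ 3 4 6 9))) (% 0 2 (% 1 6 (! 0 102032145) (% 2 8 (% 2 9 (! 21100 40300305) (% 3 9 (! 11000 32245) ($ 2 3 6 9))) ($ 1 2 6 8))) ($ 0 6 2 3)))
  s170 = % 1 6 (% 1 7 (! 21100 30000045) (% 6 7 (! 20100 3000045) (% 3 6 (% 4 7 (% 2 9 (! 0 2031041025) (% 2 7 (% 2 5 s165 (% 3 5 (! 22210 30045000) (% 3 8 (! 0 21031245) (% 2 8 (new 1 false 10 (% 3 10 (! 0 21031245) (% 7 10 (% 6 10 (! 0 12013020145) (% 7 8 (! 22210 430000500) (% 8 10 (! 0 21415300123) ($ 6 8 7 10)))) ($ 1 10 3 7)))) ($ 2 3 5 8))))) ($ 1 2 7 9))) (% 4 9 (% 2 7 (% 2 6 (! 20100 3000045) (% 2 8 (new 1 false 10 (% 9 10 (! 3210 4000050000) (% 7 10 (% 4 10 (! 0 21012030145) (% 7 8 (! 22210 430000500) (% 8 10 (! 30210 400050000) ($ 4 8 7 10)))) ($ 1 10 7 9)))) (% 7 8 (% 2 5 (% 0 2 (! 0 102032145) s164) (% 3 8 (! 0 301245212) (% 3 5 s167 ($ 2 3 5 8))))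 ($ 2 7 6 8)))) (% 2 9 (% 2 5 s165 (% 5 9 (! 3210 4000050000) (% 8 9 (! 30210 400050000) (% 2 8 (% 0 2 (! 0 102032145) (% 0 8 (! 0 102032145) (% 7 8 (! 0 1012132045) ($ 0 7 2 8)))) ($ 2 9 5 8))))) ($ 1 2 7 9))) ($ 1 4 7 9))) ($ 1 6 3 7)))) (% 4 9 (% 5 9 (! 3210 4000050000) (% 5 6 (% 2 6 (% 1 7 (! 21100 30000045) (% 2 9 (! 1000 2024330005) (% 2 7 (% 3 5 (! 210 45303) (% 3 6 (% 2 5 (! 0 210312452) (% 3 8 (! 11000 2232045) (% 2 8 (new 1 false 10 (! 0 11201023453)) ($ 2 3 5 8)))) ($ 3 4 5 6))) ($ 1 2 7 9)))) (% 2 8 (% 2 9 (% 0 2 (! 2210 40300305) (% 0 8 (! 0 1302042115) (% 2 7 (! 32210 40000500) (% 7 8 (! 0 342502111) ($ 0 7 2 8))))) ($ 1 2 6 9)) ($ 1 2 6 8))) ($ 1 5 6 9))) ($ 1 4 6 9))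
  s171 = new 5 true 10 (! 0 1130240025)
  s172 = % 1 7 (! 0 1132000245) (% 4 7 s171 ($ 1 4 5 7))
  s173 = % 5 6 ($ 0 4 2 5) ($ 0 6 2 5)
  s174 = new 2 false 11 (! 0 102021034531)
  s175 = % 5 6 (! 2210 40500303) ($ 0 6 2 5)
  s176 = % 1 7 (% 1 6 (! 21100 30000045) (% 7 8 (% 0 2 (! 21100 430000005) (% 0 3 (! 21100 430000005) (% 2 6 (! 0 432002115) (% 3 6 (% 1 9 (% 5 9 (! 0 1421300035) (% 8 9 (% 1 3 (! 0 3321100145) (% 1 4 (! 0 3321100145) (% 3 9 (! 0 4230015210) (% 4 9 (% 2 5 s160 (new 2 false 10 (% 0 10 (! 0 1342010025) (% 6 10 (! 0 3103042125) ($ 0 6 2 10))))) ($ 1 9 3 4))))) ($ 1 9 5 8))) (% 2 9 (% 0 9 (! 0 4132200105) (% 2 4 (! 0 203141315) (% 4 9 (new 1 false 10 (% 1 3 (! 0 321103145) (% 1 4 (! 0 210031245) (% 4 10 (! 0 1210043235) (% 3 10 (% 9 10 (% 2 5 s173 s174) ($ 1 10 4 9)) ($ 1 10 3 4)))))) ($ 0 4 2 9)))) ($ 1 2 6 9))) ($ 0 6 2 3))))) (% 6 7 (% 3 6 (! 20100 304000005) (% 4 6 (! 0 1203141015) (% 4 9 (! 0 1302042115) (% 3 9 (% 0 2 (! 0 1302012415) (% 2 6 (! 2110 34000005) (% 0 3 (% 2 9 (! 32210 4500) (% 8 9 s83 ($ 2 8 7 9))) ($ 0 6 2 3)))) ($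 3 4 6 9))))) ($ 1 7 6 8)))) (% 2 5 (% 2 9 (% 0 2 (% 3 8 (! 20010 300004500) (% 6 7 (! 0 2301021405) (% 7 8 (! 10000 430200025) (% 3 6 (% 8 9 (! 0 1213300405) (% 4 7 (% 1 4 (! 0 30241125) (% 2 4 (! 0 200141315) ($ 1 2 4 7))) (% 4 9 (new 4 false 10 (! 0 10301022415)) ($ 4 8 7 9)))) ($ 3 7 6 8))))) (% 2 4 (% 2 6 (! 0 302042115) (% 5 6 (! 20010 300400500) ($ 0 6 2 5))) ($ 0 4 2 5))) (% 1 9 (% 7 8 (! 10000 430200025) (% 8 9 (% 0 2 (% 3 8 (! 10 320002405) (% 6 7 (! 0 312102405) (% 3 6 (% 2 6 (! 20100 304000005) (% 5 6 (! 21100 430300005) (% 5 9 (! 0 2310402501) ($ 2 5 6 9)))) ($ 3 7 6 8)))) (% 2 4 (% 2 6 (! 0 302042115) s175) ($ 0 4 2 5))) ($ 2 8 7 9))) ($ 1 2 7 9))) ($ 1 2 5 7))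
  s177 = % 1 4 (! 10 300045202) (% 2 4 (! 0 301042125) ($ 1 2 4 8))
  s178 = % 1 8 (% 1 6 (! 32100 45) (% 2 6 (% 5 6 (! 21000 4300035) (% 6 7 (! 2110 34000005) (% 2 5 (% 0 2 (% 7 8 (! 10000 242300035) (% 3 6 (% 1 3 (! 0 101022345) (% 1 7 (! 2110 345) (% 3 8 (! 0 104022315) ($ 1 8 3 7)))) (% 3 8 (% 4 6 (! 2100 43035) (% 4 9 (! 2100 43035) (% 3 9 (% 1 7 (! 2110 345) (% 1 9 (% 8 9 (! 2100 4000035030) (% 4 7 (% 2 4 (! 0 101043235) (% 2 7 (! 3210 40000005) ($ 2 6 4 7))) ($ 4 8 7 9))) (% 8 9 s156 ($ 1 8 7 9)))) ($ 3 4 6 9)))) ($ 3 7 6 8)))) (% 2 4 (% 1 7 (! 32110 450) (% 2 7 (! 32210 40000500) s157)) ($ 0 4 2 5))) (% 2 7 (% 7 8 (% 2 8 (! 22210 430000500) (% 3 8 (! 210 430005000) (% 3 5 (% 0 3 (! 10000 242300035) (% 1 3 (! 22110 403003050) (% 1 5 (! 32100 45) ($ 0 1 3 5)))) ($ 2 3 5 8)))) (% 3 8 (% 2 4 (! 32210 40000500) (% 2 8 (! 10 230004502) (% 4 7 (% 3 6 (! 0 31024521) (% 4 6 (! 2100 43035) (% 4 9 (! 2100 43035) (% 3 9 (new 2 false 10 (! 0 11030024521)) ($ 3 4 6 9))))) ($ 2 7 4 8)))) (% 3 6 (% 1 3 (! 0 112003452) (% 1 7 (! 2110 30000045) ($ 1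 8 3 7))) ($ 3 7 6 8)))) ($ 2 6 5 7))))) s163)) (% 1 5 (% 1 3 (! 32100 45) (% 1 4 (% 4 6 (! 22100 30045) (% 1 9 (% 0 3 (! 10 30224005) s169) s170)) (% 3 5 (% 2 4 (! 10 240305202) (% 2 8 (% 0 2 (! 21100 340500003) (% 0 8 (! 21100 400503003) (% 2 7 (! 22210 30004500) (% 7 8 (! 21100 340500000) ($ 0 7 2 8))))) ($ 1 2 4 8))) ($ 1 5 3 4)))) (% 0 8 (% 2 8 (% 2 7 (% 0 2 (! 3210 40000005) (% 0 3 (! 22210 30004500) (% 3 6 (% 1 6 (! 10000 304200025) (% 2 6 (! 20100 304000005) (% 2 9 (! 32210 40000500) (% 1 9 (% 8 9 (% 3 9 (! 0 4132205100) (% 1 3 (% 3 5 (! 22210 30004500) (% 3 8 (! 10 230004502) ($ 1 3 5 8))) (% 1 4 s172 (% 4 9 (new 5 true 10 (% 0 10 (! 20100 300040005) (% 4 10 (! 0 10301242125) ($ 0 4 5 10)))) ($ 1 9 3 4))))) (% 5 9 (% 3 5 (! 22210 30004500) (% 3 9 (! 10 2230004500) (% 2 5 s160 ($ 2 3 5 9)))) ($ 1 9 5 8))) ($ 1 2 6 9))))) (% 2 6 (% 3 8 (! 10 230004502) (% 6 7 (! 2110 34000005) (% 7 8 (! 210 400003503) ($ 3 7 6 8)))) ($ 0 6 2 3))))) s176) (% 2 5 (% 2 6 (% 3 6 (! 20100 304000005) (% 6 7 (! 2110 34000005) (% 7 8 (! 10000 430200025) (% 3 8 s177 ($ 3 7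 6 8))))) (% 1 6 (% 3 6 (! 10000 304200025) (% 3 8 s177 ($ 2 3 6 8))) ($ 1 2 6 8))) ($ 1 2 5 8))) ($ 0 1 5 8)))
  s179 = % 0 9 (! 0 23141100205) (% 2 4 (! 0 20310140235) (% 4 9 (! 0 2131040125) ($ 0 4 2 9)))
  s180 = % 8 10 (! 30210 40500000000) ($ 1 10 6 8)
  s181 = % 0 10 (% 0 2 (! 21100 340500003) (% 2 10 (% 6 10 (! 3210 40000000005) (% 2 6 (% 5 6 (! 0 10324100235) (% 9 10 (! 20100 30304000005) (% 5 9 (% 0 9 (! 1210 43000000305) (% 4 9 (! 2100 34000530000) ($ 0 4 5 9))) ($ 5 10 6 9)))) (% 2 9 s179 (% 9 10 (% 3 9 (! 22110 30000034500) (% 3 10 (! 22100 40000003035) (% 4 9 (! 2100 40000330005) (% 4 10 (! 0 10020143235) ($ 3 4 9 10))))) ($ 2 10 6 9))))) (% 3 10 (% 1 6 (! 22110 34530) (% 2 6 (! 0 20203014511) (% 2 9 s179 (% 1 9 (% 5 6 (! 0 20203405111) (% 5 9 (! 0 3141520021) (% 6 10 (! 3210 40000000005) (% 9 10 (! 22100 40000003035) ($ 5 10 6 9))))) ($ 1 2 6 9))))) ($ 0 10 2 3)))) (% 4 10 (% 5 6 (% 1 4 (! 0 10021230145) (% 2 4 (! 0 11032040215) (% 1 10 (% 1 6 (! 10000 23200045) (% 6 10 (! 0 30012410251) s180)) (% 2 10 (% 0 2 (! 0 10031120425) (% 2 6 (% 4 6 (! 22100 30000040035) (% 4 9 (! 0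 12031040125) (% 6 10 (! 20100 30004000035) (% 9 10 (% 0 9 (! 21000 4330005) (% 1 9 (! 0 2014023135) ($ 0 1 9 10))) ($ 4 10 6 9))))) (% 6 10 (% 1 6 (! 10000 23200045) (% 1 9 (! 0 32014120035) (% 2 9 (! 0 12031142025) ($ 1 2 6 9)))) ($ 0 6 2 10)))) ($ 1 2 4 10))))) (% 6 10 (% 2 6 (! 20100 30004000035) (% 6 7 (! 20100 30004000035) (% 7 10 (! 22210 30040003500) (% 2 10 (% 1 6 (! 10100 20003020245) (% 2 9 (! 10 23340500200) (% 1 9 (% 1 4 (! 0 10021230145) (% 4 9 (! 0 12031040125) (% 8 9 (! 0 31021041235) ($ 1 9 4 8)))) ($ 1 2 6 9)))) ($ 2 7 6 10))))) ($ 0 6 5 10))) ($ 0 4 5 10))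
  s182 = new 0 false 10 (! 20100 304000035)
  s183 = new 5 true 11 (% 0 11 (! 2100 304000530000) (% 4 11 (! 2100 4000350003) ($ 0 4 5 11)))
  s184 = % 2 7 (% 1 8 (! 32100 45) (% 2 8 (% 4 7 (new 5 true 10 s181) (new 4 false 10 (% 7 10 (! 22210 30340000500) (% 5 10 (% 2 10 (! 2210 30040500003) (% 2 4 (% 2 5 (! 20010 30400500) (new 2 false 11 (% 5 11 (! 32210 40500000) (% 10 11 (! 20010 30040500300) ($ 2 11 5 10))))) ($ 2 7 4 10))) ($ 4 10 5 7))))) (% 1 6 (% 2 6 (! 20100 3000045) (% 6 7 (! 20100 3000045) (% 7 8 (! 20010 340500000) ($ 2 7 6 8)))) (% 2 6 (% 7 8 (! 20010 340500000) (% 4 7 (% 1 4 (% 4 6 (! 22100 30045) (% 1 9 (% 0 8 s171 s182) (% 4 9 (new 1 false 10 (! 0 11021030245)) ($ 1 4 6 9)))) (% 2 4 (% 1 9 (! 0 2031042501) (% 5 9 (! 0 2031042125) (% 5 6 (new 1 false 10 (% 4 10 (! 0 11031040225) (% 8 10 (! 0 20304512011) ($ 1 10 4 8)))) ($ 1 5 6 9)))) ($ 1 2 4 8))) (% 2 4 (% 2 5 (! 20010 30400500) (new 2 false 11 (% 5 11 (! 32210 40500000) (% 8 11 (! 20010 340500300) ($ 2 11 5 8))))) ($ 2 7 4 8)))) ($ 1 2 6 8))))) (% 0 2 (% 2 9 (% 1 6 (! 0 213101245) (% 1 8 (! 32100 45) (% 2 6 (! 0 214101325) (% 2 8 (% 5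 6 (! 10000 204003235) (% 1 9 (% 8 9 (! 0 3401020521) (% 4 9 (% 0 8 (! 21100 400503003) (new 0 false 10 (% 3 10 (! 32210 4500) (% 5 10 (% 4 10 (! 0 24001053231) (% 9 10 (! 10 20230203405) (% 5 9 s183 ($ 4 9 5 10)))) ($ 0 10 3 5))))) (% 1 4 (% 3 9 (! 0 3001024521) (% 4 7 (! 0 2112100345) ($ 3 4 7 9))) ($ 1 9 4 8)))) (% 5 9 (% 0 9 (! 10 4230203500) (% 4 9 (! 10 4230203500) ($ 0 4 5 9))) ($ 1 5 6 9)))) ($ 1 2 6 8))))) (% 3 9 (% 1 9 (% 0 8 (! 21100 400503003) (% 2 8 (% 7 8 (! 20010 340500000) (% 8 9 (new 0 false 10 (% 8 10 (! 32100 400500000) (% 5 10 (% 5 6 (! 0 2104023135) (% 5 9 (! 0 2103405130) (% 6 10 (! 0 2104023135) (% 9 10 (! 20100 40300500003) ($ 5 10 6 9))))) ($ 0 10 5 8)))) ($ 2 8 7 9))) (% 1 6 (! 0 2003021145) (% 1 8 (! 32100 45) (% 2 6 (% 1 4 (! 33210 45000) (% 2 4 (! 0 1004013235) ($ 1 2 4 8))) ($ 1 2 6 8)))))) (% 1 7 (% 1 4 (! 33210 45000) (% 1 8 (! 32100 45) (% 2 4 (! 21100 345) (% 2 8 (! 11100 20002345) ($ 1 2 4 8))))) ($ 1 2 7 9))) ($ 2 3 7 9))) ($ 0 7 2 3))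
  s185 = % 4 7 (! 0 1030021245) ($ 1 7 3 4)
  s186 = % 1 3 (% 0 3 (! 100 2000023045) (% 2 7 (% 2 8 (! 11110 202003450) (% 6 7 (! 22110 303004050) (% 7 8 (% 3 9 (new 5 true 10 (% 0 10 (! 100 23000032045) (% 4 10 (! 0 10201324153) ($ 0 4 5 10)))) (% 4 7 (new 5 true 10 (! 0 12421300153)) (% 4 9 (new 4 false 10 (% 1 4 (! 2100 30045) (% 1 10 (! 1000 2020030345) (% 2 4 (! 21110 3450) (% 2 10 (! 22210 30340000500) ($ 1 2 4 10)))))) ($ 3 4 7 9)))) ($ 2 7 6 8)))) (% 0 2 (% 2 9 (! 0 1002012345) (% 3 9 (% 0 8 (! 20100 300000045) (% 2 8 (! 0 101022345) (% 2 5 (% 5 6 (! 0 2014315201) (% 5 9 (! 0 3012014251) ($ 2 5 6 9))) ($ 0 2 5 8)))) ($ 2 3 7 9))) ($ 0 7 2 3)))) (% 0 3 (% 1 4 (! 210 43005) (% 3 9 (% 1 7 s185 (% 2 5 (% 5 6 (! 21100 300405003) (% 0 2 (% 2 9 (! 0 1002013425) (% 5 9 (! 0 4012305201) ($ 2 5 6 9))) ($ 0 6 2 5))) (% 2 7 (% 6 7 (! 0 3104132015) (% 7 8 (! 10000 242300035) (% 2 8 (% 4 9 (! 100 2000043025) (% 4 7 (new 2 false 10 (% 2 9 (! 0 13001024521) (% 6 10 (! 0 2103124015) (% 9 10 (! 0 21010034532) ($ 2 10 6 9))))) (% 8 9 (new 2 false 10 (! 0 11023014532)) ($ 4 8 7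 9)))) ($ 2 7 6 8)))) ($ 1 2 5 7)))) (% 4 9 (% 5 9 (% 1 7 s185 (% 2 7 (% 4 7 (! 0 1022043115) (new 4 false 10 (! 0 14021053132))) (% 2 5 (% 2 4 (! 0 1021043215) (% 0 2 (% 2 9 (! 0 1002013425) ($ 2 3 7 9)) ($ 0 4 2 5))) ($ 1 2 5 7)))) ($ 1 9 3 5)) ($ 1 9 3 4)))) ($ 0 1 3 5))
  s187 = % 6 7 (! 20100 304000005) (% 7 8 (! 10000 432200005) ($ 1 7 6 8))
  s188 = % 1 7 s187 (% 2 5 (! 0 311402512) (% 2 7 (! 0 3142200105) ($ 1 2 5 7)))
  s189 = % 2 5 (! 0 401321235) (% 2 10 (! 0 20403111532) ($ 1 2 5 10))
  s190 = % 6 7 (! 20100 304000005) ($ 1 7 6 8)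
  s191 = % 2 4 (! 22110 34500) ($ 0 4 2 5)
  s192 = % 0 2 (! 0 401221305) s191
  s193 = % 2 9 (% 0 3 (% 0 2 (! 0 211203415) (% 2 4 (! 0 202034511) (% 4 9 (% 2 5 (! 0 311402512) (new 2 false 10 (% 0 10 (! 100 22000234005) (% 6 10 (! 0 1202134015) ($ 0 6 2 10))))) (% 0 9 s188 ($ 0 4 2 9))))) (% 1 3 (% 0 2 (! 0 400211325) (% 0 9 s188 (% 2 4 (! 0 301041225) (% 4 9 (% 2 7 (% 1 7 s187 (% 1 9 (% 8 9 (! 0 4312000521) (% 5 9 (% 2 5 (! 0 311402512) (new 2 false 10 (! 0 12032134501))) ($ 1 9 5 8))) (% 3 9 (% 8 9 (! 0 2133104500) ($ 0 8 3 9)) ($ 1 3 7 9)))) ($ 0 7 2 3)) ($ 0 4 2 9))))) ($ 0 1 3 5))) (% 1 9 (% 2 7 (% 1 4 s172 (% 4 9 (% 1 3 (% 5 9 (new 5 true 10 (% 1 10 (! 32110 4000000050) (% 0 10 (% 2 5 (! 0 1020324510) (% 2 10 (! 0 33140120205) ($ 1 2 5 10))) ($ 0 1 5 10)))) (% 8 9 (new 5 true 10 (% 0 10 (! 20100 300040035) (% 1 10 (! 20100 3300000045) ($ 0 1 5 10)))) ($ 1 9 5 8))) (% 0 3 (% 5 9 (new 5 true 10 (! 0 12432530011)) (% 3 9 (% 8 9 (new 5 true 10 (! 0 11200234015)) ($ 1 9 5 8)) ($ 1 9 3 5))) ($ 0 1 3 5))) (% 8 9 (% 1 3 (% 3 9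 (new 5 true 10 (% 1 10 (! 0 10102132345) s189)) (% 4 7 (new 5 true 10 (! 0 12241300135)) ($ 3 4 7 9))) (% 0 3 (new 5 true 10 (% 4 10 (! 0 10200134215) (% 0 10 (% 1 10 (! 3210 40000000005) (% 2 5 (! 0 122304501) (% 2 10 (! 0 33142100205) ($ 1 2 5 10)))) ($ 0 4 5 10)))) ($ 0 1 3 5))) ($ 1 9 4 8)))) (% 3 9 (% 7 8 (! 10000 432200005) (% 8 9 (% 1 7 s190 (% 2 5 s192 ($ 1 2 5 7))) ($ 2 8 7 9))) ($ 2 3 7 9))) ($ 1 2 6 9))
  s194 = new 3 false 11 (! 0 100102034532)
  s195 = % 1 8 (% 1 3 (! 22100 403003050) (% 1 9 (% 2 5 (% 0 2 (% 4 9 (! 0 2101143025) (% 4 7 (% 1 4 (! 210 43005) (% 1 7 (! 2110 345) (% 2 4 (! 0 1010043215) (% 2 7 (! 0 1010332405) ($ 1 2 4 7))))) (% 7 8 (% 2 7 (! 10000 242300035) (% 2 8 (! 0 100213425) ($ 2 3 7 8))) (% 8 9 (% 0 8 (! 0 100123425) (% 0 9 (! 10210 4000003005) (% 2 8 (! 0 100213425) (% 2 9 (! 0 102123415) ($ 0 2 8 9))))) ($ 4 8 7 9))))) (% 2 4 (% 2 9 (! 22110 34500) (% 4 7 (! 0 1131242005) (% 4 9 (! 0 2101143025) (% 2 7 (% 7 8 (! 10000 242300035) (% 8 9 (! 0 4023035211) ($ 4 8 7 9))) ($ 2 4 7 9))))) ($ 0 4 2 5))) (% 2 7 (% 4 9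 (! 0 2101143025) (% 7 8 (! 10000 242300035) (% 4 7 (new 2 false 10 (% 0 2 (! 0 1010023425) (% 2 4 (! 0 1010034225) (% 4 10 (! 22100 34005) (% 0 10 (% 8 10 (% 3 10 (! 0 30102104215) (% 8 9 (! 0 1012034532) (% 9 10 (! 0 1012034532) ($ 3 9 8 10)))) (% 2 8 (% 5 10 (! 21100 300405003) (% 0 8 s194 ($ 0 10 5 8))) ($ 2 10 4 8))) ($ 0 4 2 10)))))) (% 8 9 (% 2 4 (! 0 4023035211) (% 2 8 (% 0 8 s194 (new 0 false 10 (! 0 14102135032))) ($ 2 7 4 8))) ($ 4 8 7 9))))) (% 1 7 (% 1 4 (! 210 43005) s185) ($ 1 2 5 7)))) (% 8 9 (new 1 false 10 (% 1 6 (% 1 4 (! 33210 45000) ($ 1 6 3 4)) (% 6 10 (! 0 13204121035) (% 9 10 (! 0 24103135012) ($ 1 10 6 9))))) ($ 1 8 3 9)))) (% 0 8 (% 5 6 (! 21100 300405003) (% 6 7 (! 10000 324200005) (% 2 5 (% 1 4 (! 210 43005) (% 2 8 (! 0 422301501) (% 2 4 (% 4 7 (! 0 1130242005) (% 4 9 (! 0 1302142015) (% 7 8 (! 10000 432200005) (% 8 9 (! 0 102143205) ($ 4 8 7 9))))) ($ 1 2 4 8)))) (% 2 7 (% 2 8 (% 4 9 (! 0 1302142015) (% 7 8 (! 10000 432200005) (% 4 7 (new 2 false 10 (% 0 2 (! 0 1120203405) (% 2 4 (! 22110 34500) (% 4 10 (! 22100 34005) (% 0 10 (new 3 false 11 (%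 6 11 (! 20100 304000005) (% 8 11 (% 7 11 (! 0 100123304205) (% 8 9 (! 10010 22030004305) (% 9 11 (% 0 9 (! 0 3012024105) (% 0 11 (! 0 300123104502) (% 4 11 (! 33210 45000) ($ 0 4 9 11)))) ($ 7 9 8 11)))) ($ 3 11 6 8)))) ($ 0 4 2 10)))))) (% 8 9 (new 2 false 10 (% 0 2 (! 0 102123405) (% 0 10 (! 10010 22030004305) (% 2 4 (! 22110 34500) (% 4 10 (! 22100 34005) ($ 0 4 2 10)))))) ($ 4 8 7 9))))) ($ 1 2 5 8)) ($ 2 6 5 7))))) ($ 0 1 5 8))
  s196 = new 0 false 10 (! 0 10120134532)
  s197 = % 0 2 (! 0 102213405) s191
  s198 = % 0 10 (% 9 10 (! 10210 3300004005) ($ 2 10 6 9)) ($ 0 6 2 10)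
  s199 = % 1 8 (% 2 7 (% 4 9 (! 100 2000043025) (% 7 8 (! 22210 340000500) (% 4 7 (new 3 false 10 (% 6 10 (! 22210 403003500) (% 8 10 (% 9 10 (! 0 24050031132) (% 7 10 (new 5 true 11 (% 1 11 (! 0 112010032345) (% 2 5 (! 0 1010324235) (% 2 11 (! 0 10121304235) ($ 1 2 5 11))))) (% 8 9 (% 0 8 (% 2 5 s192 s174) (% 0 10 (new 0 false 11 (% 0 2 (! 0 101123425) (% 2 11 (! 0 30121104532) (% 8 11 (new 5 true 12 (% 1 12 (! 2100 303000000045) (% 2 5 (! 0 102314235) (% 2 12 (! 0 30121104532) ($ 1 2 5 12))))) ($ 0 11 2 8))))) ($ 0 7 8 10))) ($ 7 9 8 10)))) ($ 3 10 6 8)))) (% 8 9 (new 3 false 10 (% 6 10 (! 22210 403003500) (% 8 10 (% 0 8 (% 2 5 s192 (new 2 false 11 (% 0 2 (! 0 100123425) (% 6 11 (! 0 110213204305) (% 0 11 (% 9 11 (! 10210 3300004005) ($ 2 11 6 9)) ($ 0 6 2 11)))))) (% 0 10 (new 0 false 11 (new 4 false 12 (! 0 20211034531))) (% 7 10 (new 4 false 12 (! 0 1012040032315)) ($ 0 7 8 10)))) ($ 3 10 6 8)))) ($ 4 8 7 9))))) (% 7 8 (% 1 7 (! 0 1030221245) (% 2 5 s197 ($ 1 2 5 7))) (% 8 9 (% 2 5 s197 (% 1 7 (% 0 2 (! 0 2100012345) (% 0 8 (! 0 1200031345) ($ 0 7 2 8))) ($ 1 2 5 7))) ($ 2 8 7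 9)))) (% 0 8 (% 1 4 (! 33210 45000) (% 8 9 (% 2 5 s192 (% 1 7 (% 1 3 (! 0 1100032345) (% 4 7 (% 1 6 s133 (% 6 7 (! 0 4203025311) (% 7 8 (! 0 1420301035) ($ 1 7 6 8)))) ($ 1 7 3 4))) (% 2 7 (new 2 false 10 (% 0 2 (! 0 1120203405) (% 6 10 (! 0 1213204305) s198))) ($ 1 2 5 7)))) (% 4 9 (% 5 9 (! 11210 3000045000) ($ 1 9 5 8)) ($ 1 9 4 8)))) ($ 0 1 5 8))
  s200 = % 2 9 (% 0 2 (% 0 3 (% 0 8 (! 10000 400202305) (% 1 5 (! 22100 300405003) (% 1 8 (! 0 100214325) ($ 0 1 5 8)))) (% 5 6 (% 1 5 (% 4 6 (! 0 2103042125) (% 4 9 (% 5 9 (% 0 9 (! 10 4230203500) (! 10 4230203500)) (% 0 8 (! 22100 400503003) (new 0 false 10 (% 3 10 (! 32210 4500) (% 5 10 (% 4 10 (! 0 30110123425) (% 9 10 (! 10 20230203405) ($ 4 9 5 10))) ($ 0 10 3 5)))))) (% 3 9 (% 0 9 (! 10 3220204500) (% 1 3 (! 32100 45) (% 1 9 (! 0 3110124520) ($ 0 1 3 9)))) ($ 3 4 6 9)))) (% 1 3 (% 0 8 (! 22100 400503003) (% 1 8 (! 10000 2002345) ($ 0 1 5 8))) ($ 0 1 3 5))) ($ 0 6 3 5))) (% 0 3 (% 4 6 (! 210 43005) (% 4 9 (% 7 8 (! 22210 430003500) (% 0 8 (% 5 6 (! 22100 300405003) (% 5 9 (! 100 300242005)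 (% 3 9 (% 1 5 (! 22100 300405003) (% 1 7 (! 0 2100043125) (% 2 5 (! 10000 200304502) (% 2 7 (new 2 false 10 (! 0 13020114502)) ($ 1 2 5 7))))) ($ 3 5 6 9)))) (% 2 7 (% 1 5 (! 22100 300405003) (% 1 8 (% 3 9 (! 0 3010024521) (% 5 6 (! 22100 300405003) (% 5 9 s196 ($ 3 5 6 9)))) ($ 0 1 5 8))) ($ 0 7 2 8)))) (% 3 9 (% 2 4 (! 22110 34500) (% 0 9 (% 4 7 (! 0 4030121205) (% 7 8 (! 22210 430003500) (% 8 9 (! 22110 3000004500) ($ 4 8 7 9)))) ($ 0 4 2 9))) ($ 3 4 6 9)))) ($ 0 6 2 3))) (% 3 9 (% 0 3 (% 1 9 (% 1 5 (! 21100 300405003) s199) (% 1 6 (% 1 3 (! 32100 45) (% 1 5 (! 21100 300405003) (% 5 6 (! 21100 300405003) ($ 1 6 3 5)))) ($ 1 2 6 9))) (% 0 2 (% 5 6 (% 2 7 (! 21100 340500003) (% 7 8 (! 20010 340500000) (% 8 9 (% 1 5 (% 1 7 (% 1 4 (! 33210 45000) (% 1 8 (! 32100 45) (% 2 4 (! 21100 345) (! 11100 20002345)))) (% 1 9 (% 0 8 (! 21100 400503003) (new 0 false 10 (% 5 10 (! 0 11402031532) (% 8 10 (! 32100 400500000) ($ 0 10 5 8))))) ($ 1 2 7 9))) (% 1 3 (% 0 8 (! 21100 400503003) (% 1 8 (! 0 201021345) ($ 0 1 5 8))) ($ 0 1 3 5))) ($ 2 8 7 9)))) ($ 0 6 3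 5)) ($ 0 6 2 3))) ($ 2 3 6 9))
  s201 = % 3 6 (% 1 5 (% 0 3 (! 21100 300405003) s184) (% 1 8 (% 1 6 (! 32100 45) (% 2 6 (! 20100 405300003) (% 1 9 s186 (% 2 9 (% 0 3 (% 8 9 (% 0 2 (! 10000 2003425) (% 0 9 (% 3 9 (! 10210 4000003005) (% 4 7 (! 0 4132210005) (% 4 9 (! 100 2000243005) ($ 3 4 7 9)))) (% 4 9 (% 0 8 (! 100 300042025) (% 3 9 (! 100 2000043025) ($ 0 3 8 9))) (% 2 4 (% 0 8 (! 0 301042125) (% 3 9 (! 22110 34500) ($ 0 3 8 9))) ($ 0 4 2 9))))) (% 1 7 (% 1 3 (! 10000 3002345) (% 6 7 (! 20100 405300003) ($ 1 7 3 6))) (% 7 8 (% 2 7 (! 32210 40000500) (% 2 8 (! 22210 430003500) ($ 2 3 7 8))) ($ 1 8 7 9)))) (% 1 3 (% 0 2 (! 10000 2002345) (% 2 7 (! 21110 3450) ($ 0 7 2 3))) ($ 0 1 3 5))) ($ 1 2 6 9))))) (% 0 8 (% 1 6 (! 10000 304200025) (% 2 6 (! 20100 304000005) (% 2 8 s193 ($ 1 2 6 8)))) ($ 0 1 5 8)))) (% 2 6 (% 0 3 (% 4 6 (! 210 43005) (% 3 9 (% 1 5 (! 21100 300405003) s195) (% 4 9 (% 0 8 (! 0 1302142015) (% 1 5 (! 21100 300405003) (% 1 8 (% 5 6 (! 21100 300405003) (% 5 9 (% 0 9 (! 0 3102142015) (% 1 9 (% 1 7 (! 2110 4000030350) (%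 2 7 (% 2 4 (! 0 120143215) (% 4 7 (! 0 2031041125) (% 7 8 (! 10000 242300035) (% 2 8 s196 ($ 2 7 4 8))))) (% 2 5 (% 0 2 (! 0 110123425) (% 2 4 (! 0 120143215) ($ 0 4 2 5))) ($ 1 2 5 7)))) ($ 0 1 5 9))) ($ 3 5 6 9))) ($ 0 1 5 8)))) ($ 3 4 6 9)))) (% 5 6 (% 1 3 (! 21000 4300035) (% 1 5 (% 0 8 (! 20100 304000005) s182) ($ 0 1 3 5))) ($ 0 6 3 5))) (% 2 8 s200 ($ 2 3 6 8)))
  s202 = % 6 7 (! 20100 304000005) ($ 3 6 5 7)
  s203 = % 8 10 (% 0 2 (! 0 20300112415) (% 0 3 (! 22100 30000004005) (% 2 6 (! 0 30402102115) ($ 0 6 2 3)))) ($ 3 10 6 8)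
  s204 = % 9 10 (! 30210 40500000000) (% 0 9 (! 0 13040021125) (% 3 10 (! 33210 40500000000) (% 0 3 (% 3 8 (! 0 11210034530) ($ 0 3 5 8)) ($ 0 10 3 9))))
  s205 = % 3 8 (! 33210 400005000) ($ 0 3 5 8)
  s206 = % 1 3 ($ 1 3 5 7) ($ 0 1 3 9)
  s207 = % 0 3 s205 s206
  s208 = % 1 5 (% 1 3 (! 32100 45) (% 1 4 (% 2 9 (! 0 2031141025) (% 3 9 (! 0 21131245) (% 2 6 (% 1 6 (! 20100 3000045) (% 4 6 (! 22100 30045) (% 1 9 (% 3 6 s182 (% 4 9 (! 0 2012030145) ($ 3 4 6 9))) (% 4 9 (% 5 6 s182 (% 5 9 (! 3210 4000050000) ($ 1 5 6 9))) ($ 1 4 6 9))))) (% 3 6 (% 1 6 s166 (% 1 9 s168 ($ 1 2 6 9))) ($ 2 3 6 9))))) ($ 1 5 3 4))) (% 1 8 (% 1 7 (! 22110 300000450) (% 7 8 (! 22210 430000500) (% 1 9 (new 0 false 10 (% 0 2 (! 0 11030021425) (% 2 10 (% 1 4 (! 0 11020031245) (% 4 9 (! 0 22030041115) (% 3 9 (% 5 10 (% 4 10 (! 0 11020043235) (% 3 10 (% 1 3 (! 0 10102032345) (% 1 10 (! 0 23010032145) (% 3 8 (! 0 1210134530) (% 8 10 (! 33210 40500000000) ($ 1 8 3 10))))) ($ 3 4 5 10))) (% 8 10 s204 ($ 0 10 5 8))) (% 1 3 ($ 1 3 5 7) ($ 1 9 3 4))))) (% 8 10 (% 1 3 ($ 1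 3 5 7) (% 1 4 (! 0 11020031245) (% 3 9 s204 (% 4 9 (% 7 10 (! 0 20130042115) (% 8 9 (! 0 3410052120) (% 9 10 (! 30210 40500000000) ($ 7 9 8 10)))) ($ 1 9 3 4))))) ($ 0 10 2 8))))) (% 8 9 (% 1 6 (! 32100 45) (% 2 6 (new 0 false 10 (% 4 6 (! 0 213040125) (% 4 9 (! 0 3421050021) (% 3 6 (% 5 6 (! 21000 4300035) (% 6 7 (! 0 134010225) ($ 3 6 5 7))) (% 3 9 (% 1 3 ($ 1 3 5 7) (% 0 3 s205 (% 0 9 (new 1 false 11 (! 0 13140202125)) ($ 0 1 3 9)))) ($ 3 4 6 9)))))) (% 2 9 (% 0 9 (! 22110 4300000500) (% 4 9 (! 0 4320051120) (% 0 2 (% 3 6 (! 0 2142010305) (% 4 6 (! 10 4230020500) (% 3 9 s207 ($ 3 4 6 9)))) (% 2 4 (% 3 6 (! 0 2311040502) (% 3 9 s207 (% 4 6 (! 10 4230020500) ($ 3 4 6 9)))) ($ 0 4 2 9))))) ($ 1 2 6 9)))) ($ 1 8 7 9))))) ($ 0 1 5 8))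
  s209 = % 1 5 (! 21100 340500003) ($ 1 3 5 7)
  s210 = % 1 5 (! 32100 45) (% 1 6 (! 32100 45) (% 2 6 (! 21000 4300035) ($ 1 2 5 6)))
  s211 = % 2 5 (% 0 2 (% 7 8 (! 3210 40000005) (% 2 6 (% 1 4 (! 0 30241125) (% 2 4 (! 10000 42200305) (% 1 8 (% 1 7 (! 2110 345) (% 1 9 (% 4 9 (! 0 2131140025) (% 3 9 (% 3 8 s149 (% 5 9 (! 0 1041300235) (% 8 9 (% 0 8 (! 0 4153130022) (% 0 9 (! 0 4031200125) (% 2 9 (! 10000 42200305) ($ 0 2 8 9)))) ($ 3 9 5 8)))) (% 1 3 s209 ($ 1 9 3 4)))) (% 8 9 (% 2 9 (! 10000 42200305) (% 3 8 s149 (% 3 9 (% 0 3 (! 0 1010224305) (% 0 9 (! 0 4132210015) (% 1 3 s209 ($ 0 1 3 9)))) ($ 2 3 8 9)))) ($ 1 8 7 9)))) ($ 1 2 4 8)))) (% 6 7 (% 3 6 (! 10000 234200025) (% 3 8 s149 ($ 2 3 6 8))) ($ 2 7 6 8)))) (% 2 4 (% 5 6 (! 20010 30400500) (% 2 6 (% 1 5 (! 20010 30400500) (% 0 8 (% 0 3 (! 0 30242115) (% 3 8 (% 3 6 (! 20100 304000005) (% 3 9 (! 0 2230141015) (% 4 6 (! 22210 30040500) (% 4 9 (% 7 8 (! 32210 40000500) (% 8 9 (! 0 2132140005) ($ 3 8 7 9))) ($ 3 4 6 9))))) ($ 0 8 2 3))) (% 1 8 (% 1 7 (! 32110 450) (%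 7 8 (! 32210 40000500) (% 1 9 (new 0 false 10 (! 0 11030041225)) (% 8 9 (% 3 8 (% 0 3 (! 32210 4500) ($ 0 7 3 8)) (% 3 9 (% 0 3 ($ 0 3 5 8) (% 0 9 (! 0 1130242025) s206)) (% 2 9 (% 3 6 (! 0 3124010502) (% 4 6 (! 22210 30040500) (% 4 9 (! 0 2031040125) ($ 3 4 6 9)))) ($ 2 3 8 9)))) ($ 1 8 7 9))))) ($ 0 1 5 8)))) ($ 0 6 2 5))) ($ 0 4 2 5))) (% 3 8 (% 1 8 (% 4 6 (! 2100 43035) (% 4 9 (! 2100 43035) (% 3 6 (% 0 3 (! 33210 400005000) (% 7 8 (% 5 6 s210 (% 6 7 (% 1 6 (! 32100 45) (% 2 6 (! 2110 34000005) (% 2 9 (! 32210 40000500) (% 1 9 (% 1 3 (! 32100 400000050) (% 1 4 (! 0 1320041250) (% 3 9 (! 0 2314205100) ($ 1 9 3 4)))) ($ 1 2 6 9))))) ($ 3 6 5 7))) (% 0 8 (% 5 6 s210 s202) ($ 0 7 3 8)))) (% 3 9 (% 0 3 (! 33210 400005000) (% 2 6 (% 1 3 (! 32100 400000050) (% 1 9 (% 0 8 (new 2 false 10 (% 2 4 (! 0 201043135) (% 4 10 (! 2100 43035) (% 8 10 (% 0 2 (! 210 430003005) (% 0 10 (% 0 9 (! 0 13040021125) (% 3 10 (! 32100 40500000000) (% 9 10 (new 3 false 11 (! 0 110202034531)) ($ 0 10 3 9)))) ($ 0 4 2 10))) ($ 2 10 4 8))))) (% 7 8 (new 0 false 10 (%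 3 10 (! 210 30430005000) (% 8 10 (% 0 9 (! 210 33400005000) (% 9 10 (! 30210 40500000000) ($ 0 10 3 9))) ($ 0 10 3 8)))) ($ 0 7 3 8))) (% 0 9 (% 5 9 (! 0 3042021115) (% 8 9 (! 210 4300005000) (% 0 8 (% 1 7 (! 0 311020245) (% 7 8 (new 1 false 10 (! 12110 3040000530)) ($ 1 8 7 9))) ($ 0 9 5 8)))) ($ 0 1 3 9)))) (% 0 2 (% 0 8 (! 210 430003005) ($ 0 2 5 8)) ($ 0 6 2 3)))) ($ 3 4 6 9))))) (% 1 5 (% 0 3 (! 33210 400005000) (% 0 8 (! 21100 400003035) s52)) ($ 1 2 5 8))) ($ 2 3 5 8))
  s212 = % 1 3 (! 32100 45) (% 1 4 (! 0 11120345) ($ 1 5 3 4))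
  s213 = % 5 6 (! 21000 4300035) (% 6 7 (! 21010 4000305) ($ 3 6 5 7))
  s214 = % 1 3 (! 0 102012345) (% 1 9 (! 0 1010043235) ($ 0 1 3 9))
  s215 = new 0 false 10 (! 0 10120130425)
  s216 = % 1 8 (% 2 6 (% 1 4 (! 1000 220345) (% 1 7 (! 2110 345) (% 2 4 (% 3 8 (! 0 101043235) (% 5 9 (% 0 9 (! 0 1020041325) (% 4 9 (! 0 1031240205) ($ 0 4 5 9))) (% 8 9 (% 0 8 (! 0 1132242005) (% 0 9 (! 0 1020041325) (% 2 8 (! 0 1420031520) ($ 0 2 8 9)))) ($ 3 9 5 8)))) ($ 1 2 4 7)))) (% 5 9 (% 0 9 (% 1 4 (! 2100 3000000045) (% 1 7 (! 0 1030021245) (% 2 4 (! 0 1020041325) ($ 1 2 4 7)))) (% 4 9 (% 1 4 (! 32110 4000000050) (% 1 7 (! 0 1031042025) (% 2 4 (! 0 1020042315) ($ 1 2 4 7)))) ($ 0 4 5 9))) (% 5 6 (% 2 8 (! 0 421300521) (% 3 6 (% 2 4 (% 0 8 (! 0 322141015) (% 1 5 s212 (% 6 7 (! 0 232141015) s215))) (% 1 4 (% 3 8 (! 210 300045000) (% 8 9 (! 0 1212030045) ($ 3 9 5 8))) (% 1 7 (% 1 3 (! 0 2030011245) (% 1 6 (! 32100 45) (% 6 7 (! 21000 4300035) ($ 1 7 3 6)))) ($ 1 2 4 7)))) (% 3 8 (% 4 6 (! 2100 43035) ($ 3 4 5 6)) ($ 2 3 6 8)))) ($ 2 5 6 9))))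 (% 1 5 (% 1 3 (! 32100 45) (% 1 4 (% 1 6 (! 0 102032145) (% 2 6 (! 11000 2232045) (% 2 8 (! 0 21131245) ($ 1 2 6 8)))) ($ 1 5 3 4))) (% 0 8 (% 8 9 (% 2 8 (% 1 4 (! 10 300042205) (% 2 4 (! 0 201041315) (% 1 7 (% 2 6 (! 0 411300235) (% 5 6 (! 0 402112305) (% 5 9 (! 0 410120325) ($ 2 5 6 9)))) ($ 1 2 4 7)))) (% 1 4 (% 1 6 (! 0 201031245) (% 2 6 (! 0 1132242005) ($ 1 2 6 8))) (% 2 4 (% 2 6 (! 0 1132242005) (% 3 6 (! 0 322141015) (% 3 8 (! 100 3400025020) ($ 2 3 6 8)))) ($ 1 2 4 8)))) (% 5 9 (% 1 4 (% 0 9 (! 210 300040005) (% 4 9 (! 3210 4000050000) ($ 0 4 5 9))) (% 4 9 (% 0 3 (! 11210 3000045000) (% 0 9 (! 0 3021141005) (% 3 8 (! 0 1032242105) ($ 0 8 3 9)))) ($ 1 9 4 8))) ($ 1 9 5 8))) ($ 0 1 5 8)))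
  s217 = % 2 9 (% 0 2 (% 2 4 (% 3 8 (! 1010 32242005) (% 2 6 (% 0 8 (! 0 2231141005) (% 1 5 s212 (% 1 8 (% 4 6 (! 0 1032240105) (% 4 9 (! 0 2032140105) (% 3 6 s213 (% 3 9 (% 0 3 (! 22110 34500) (% 0 9 (! 0 1132242005) s214)) ($ 3 4 6 9))))) ($ 0 1 5 8)))) (% 2 8 (% 0 8 (! 0 200141315) (% 1 5 s212 (% 1 8 (% 4 6 (! 0 1032240105) (% 4 9 (! 0 3021040521) (% 3 6 (% 5 6 (! 0 421300521) (% 6 7 (! 0 131242025) ($ 3 6 5 7))) (% 3 9 (% 0 3 (! 22110 34500) (% 0 9 (! 0 2030142105) s214)) ($ 3 4 6 9))))) ($ 0 1 5 8)))) (% 3 6 (% 0 8 (! 0 322141015) (% 1 5 s212 (% 1 8 (% 6 7 (! 0 232141015) (% 5 6 s215 ($ 3 6 5 7))) ($ 0 1 5 8)))) ($ 2 3 6 8))))) (% 1 4 (% 1 8 (! 1000 220345) (% 0 8 (% 1 6 (! 0 2231141005) (% 2 6 (! 0 2231141005) (% 2 8 (! 0 300241125) ($ 1 2 6 8)))) (% 1 5 (% 1 6 (! 0 211301452) (% 1 9 (! 0 1012200345) (% 5 6 (! 0 210130245) (% 5 9 (! 0 210130245) ($ 1 5 6 9))))) ($ 0 1 5 8)))) (% 1 7 (% 1 8 (! 21000 345) (% 2 8 (% 0 8 (! 0 411301235) (% 1 5 (! 21100 345) ($ 0 1 5 8))) ($ 1 2 4 8))) ($ 1 2 4 7)))) (%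 2 4 (% 0 3 (% 3 8 (! 33210 400005000) (% 0 8 (% 2 6 (! 0 1322141005) (% 5 6 (! 21100 400303005) ($ 0 6 2 5))) ($ 0 3 5 8))) ($ 0 7 2 3)) ($ 0 4 2 5))) (% 3 9 (% 0 2 (% 1 9 s216 (% 1 7 (% 2 6 (% 2 4 (! 0 30142125) (% 4 6 (! 0 132240015) (% 6 7 (! 0 234100125) ($ 2 6 4 7)))) (% 1 6 (% 1 4 (! 0 102032145) (% 1 8 (! 32100 45) (% 2 4 (! 21100 345) (% 2 8 (! 0 112200345) ($ 1 2 4 8))))) ($ 1 2 6 9))) ($ 1 2 7 9))) (% 2 4 (% 0 3 (% 0 8 (! 0 1130242005) s205) ($ 0 7 2 3)) ($ 0 4 2 5))) ($ 2 3 7 9))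
  s218 = % 1 6 (! 21100 30000045) (% 1 8 (! 2110 345) (% 7 8 (! 0 340201125) ($ 1 7 6 8)))
  s219 = new 5 true 11 (% 0 11 (! 21000 330405) (% 4 11 (! 2100 304300050000) ($ 0 4 5 11)))
  s220 = % 8 9 s219 ($ 4 9 5 8)
  s221 = new 3 false 10 (! 0 11321402530)
  s222 = new 3 false 10 (! 0 11231204530)
  s223 = % 3 9 (% 1 9 (new 3 false 10 (% 6 10 (! 22100 304000005) (% 0 10 (% 1 5 (! 0 10230104532) (% 8 9 (! 100 3402025000) (% 1 8 (new 5 true 11 (% 1 11 (! 2110 300003000045) (% 0 11 (% 3 5 (! 0 120304521) (% 4 11 (! 0 110300223415) (% 3 11 (% 9 11 (! 0 304101225021) (% 5 9 (% 0 9 (! 0 3042201105) (% 4 9 (! 0 1231204530) ($ 0 4 5 9))) ($ 1 9 5 11))) ($ 3 4 5 11)))) ($ 0 1 5 11)))) (% 5 9 (% 0 9 (! 12010 3040000005) (% 4 9 (new 5 true 11 (% 3 5 (! 0 1401332025) (% 3 11 (! 0 102402335011) (% 4 11 (! 2100 4000350003) ($ 3 4 5 11))))) ($ 0 4 5 9))) ($ 1 9 5 8))))) ($ 0 6 3 10)))) (% 0 9 (% 2 7 (! 3210 40000005) (% 2 9 (! 12010 4030000005) (% 1 7 s218 ($ 1 2 7 9)))) (% 1 3 (% 1 7 s218 (% 2 7 (! 3210 40000005) (% 2 9 (new 1 false 10 (% 7 10 (! 0 2140301235) (% 9 10 (! 0 3012004521) ($ 1 10 7 9)))) ($ 1 2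 7 9)))) ($ 0 1 3 9)))) (% 4 6 (% 4 7 (% 1 4 (! 0 30241125) (% 1 7 s218 (% 2 4 (! 2010 30040005) (% 2 7 (! 3210 40000005) ($ 1 2 4 7))))) ($ 4 6 5 7)) (% 4 9 (% 1 7 s218 (% 2 7 (! 3210 40000005) (% 2 9 (% 5 9 (% 0 9 (! 21000 330405) (% 1 5 (! 21100 30300405) (% 1 9 (! 0 4122301510) ($ 0 1 5 9)))) s220) (% 1 9 (% 5 9 (% 8 9 (! 0 2433501110) (% 1 3 s221 (% 1 8 s222 ($ 1 9 3 8)))) (% 8 9 (% 2 4 (new 3 false 10 (% 6 10 (! 20100 304000005) (% 0 10 (% 1 3 (! 0 423105132) (% 1 10 (! 22100 400003035) (% 9 10 (% 2 10 (! 0 11423035002) (% 5 10 (! 21100 30300405) ($ 2 5 9 10))) ($ 1 9 3 10)))) ($ 0 6 3 10)))) ($ 2 5 4 9)) ($ 4 9 5 8))) ($ 1 2 7 9))))) ($ 3 4 6 9)))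
  s224 = % 1 6 (! 20100 3000045) (% 1 8 (! 32100 45) (% 4 6 (! 0 1304221015) ($ 1 4 6 8)))
  s225 = % 1 4 (! 2100 30045) ($ 1 8 4 7)
  s226 = % 2 5 (% 0 2 (% 3 6 (! 100 304002025) s223) (% 2 4 (% 2 7 (! 32210 40000500) (% 2 9 (% 3 6 (! 100 304002025) (% 4 6 (! 0 1314221005) (% 3 9 (% 0 9 (! 0 4132201005) (% 2 8 (! 0 2310104502) (% 8 9 (! 0 4230205101) ($ 0 8 2 9)))) (% 4 9 (% 5 9 (! 32110 4000000500) (% 8 9 (new 3 false 10 (% 6 10 (! 20100 304000005) (% 0 10 (% 2 10 (! 0 11423035002) (% 5 10 (! 2210 3030400500) ($ 0 10 2 5))) ($ 0 6 3 10)))) ($ 4 9 5 8))) ($ 3 4 6 9))))) (% 4 9 (% 1 7 (% 1 6 (! 21100 30000045) (% 1 8 (! 32110 450) (% 7 8 (! 10 340005202) ($ 1 7 6 8)))) (% 1 9 (% 8 9 (% 3 6 (! 100 304002025) (new 3 false 10 (% 6 10 (! 20100 304000005) (% 0 10 (% 2 10 (! 0 11423035002) (% 5 10 (! 0 20312304511) ($ 0 10 2 5))) ($ 0 6 3 10))))) (% 5 9 (% 3 9 (! 0 4131225001) (% 1 3 (% 3 6 (! 100 304002025) s221) (% 1 8 (% 3 6 (! 100 304002025) s222) ($ 1 9 3 8)))) ($ 4 9 5 8))) ($ 1 2 7 9))) (% 4 7 (% 4 6 (! 0 132241005) (% 7 8 (! 10 340005202) ($ 4 7 6 8))) ($ 2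 4 7 9))))) ($ 0 4 2 5))) (% 2 7 (% 2 8 (! 10 320004502) (% 1 5 (% 1 3 (! 32100 45) (% 3 5 (! 20210 30405000) (% 1 4 s224 ($ 1 5 3 4)))) (% 1 8 (% 1 7 (! 2110 30000045) (% 7 8 (! 210 340005000) (% 1 9 (% 3 6 (! 100 304002025) (% 3 9 (new 2 false 10 (% 5 10 (! 12110 40300530) (% 8 10 (! 0 22130104510) ($ 2 10 5 8)))) (% 4 9 (% 5 9 (% 2 9 (! 32210 40000500) (% 3 5 (! 0 3142502011) ($ 2 3 5 9))) (% 8 9 (new 2 false 10 (new 3 false 11 (% 0 11 (! 0 200131204521) (% 1 3 (! 0 1203113045) (% 1 11 (! 32100 45) ($ 0 1 3 11)))))) ($ 4 9 5 8))) (% 4 6 (% 1 3 (! 0 1203113045) (% 1 4 (! 2100 30045) ($ 1 9 3 4))) ($ 3 4 6 9))))) (% 8 9 (% 3 6 (! 100 304002025) (% 3 9 s155 (% 4 6 (% 4 7 s225 ($ 4 6 5 7)) (% 4 9 (% 1 4 (! 2100 30045) (% 2 4 (! 32210 40000500) (% 2 9 (! 32210 40000500) ($ 1 2 4 9)))) ($ 3 4 6 9))))) ($ 1 8 7 9))))) ($ 1 2 5 8)))) ($ 2 6 5 7))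
  s227 = % 2 8 (! 0 324002115) ($ 1 2 5 8)
  s228 = new 5 true 10 (! 0 12432510031)
  s229 = % 1 8 (% 1 9 (% 1 5 (! 32100 45) (% 1 7 (! 0 312001245) (% 2 5 (% 5 6 (! 0 304115202) (% 0 2 (% 1 3 (! 0 302011245) (% 1 4 (! 0 302011245) (% 3 9 (% 2 9 (! 0 3021104502) (% 5 9 (% 0 9 (! 12010 4030000005) (% 4 9 (! 0 1423502310) ($ 0 4 5 9))) ($ 2 5 6 9))) (% 4 9 (% 5 9 s228 (% 2 9 s220 ($ 2 5 6 9))) ($ 1 9 3 4))))) ($ 0 6 2 5))) (% 2 7 (% 2 8 (! 0 213004531) (% 6 7 (! 0 1204113035) (% 7 8 (! 10 340005202) ($ 2 7 6 8)))) ($ 1 2 5 7))))) (% 2 9 (% 1 7 (! 0 312001245) (% 7 8 (! 10 340005202) (% 8 9 (% 1 5 (! 32100 45) (% 2 7 (! 32210 40000500) (% 2 5 (% 0 2 (! 0 123104532) s175) ($ 1 2 5 7)))) ($ 1 8 7 9)))) ($ 1 2 6 9))) (% 2 8 (% 2 9 (% 0 2 (! 0 302014521) (% 2 4 (! 0 302014521) (% 0 9 (% 2 5 s173 (% 2 7 (! 0 312004521) (% 1 5 (% 1 3 (! 32100 45) (% 1 4 (! 1000 4030220205) (% 3 5 (! 32210 4500) ($ 1 5 3 4)))) (% 1 7 (% 6 7 (! 0 3124100105) (% 7 8 (! 10 240005303) ($ 1 7 6 8))) ($ 1 2 5 7))))) (% 4 9 (% 8 9 (! 20010 300004500) (% 5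 9 (% 1 5 (! 2010 3040500000) (% 1 9 (% 1 3 (! 0 1421300235) (% 3 9 (! 2210 3000004500) ($ 1 9 3 8))) ($ 0 1 5 9))) ($ 4 9 5 8))) ($ 0 4 2 9))))) (% 2 7 (! 0 312004521) (% 7 8 (! 10 240005303) (% 8 9 (% 1 5 (! 21100 400003035) (% 1 7 s190 (% 2 5 (% 0 2 (! 0 213301405) (% 2 4 (! 20010 300004500) ($ 0 4 2 5))) ($ 1 2 5 7)))) ($ 2 8 7 9))))) ($ 1 2 6 8))
  s230 = % 6 7 (! 22100 304000005) ($ 1 6 3 7)
  s231 = % 1 3 (! 32100 45) (% 1 7 (! 21100 30000045) s230)
  s232 = % 3 6 (% 1 6 (% 1 7 (! 21100 30000045) (% 6 7 (! 22100 304000005) (% 1 5 (% 1 3 (! 32100 45) (% 1 4 (! 0 203011245) (% 3 5 (! 0 324102015) ($ 1 5 3 4)))) (% 5 6 (% 2 5 (% 2 4 (! 0 314221005) (% 0 2 (% 2 7 (! 3210 40000005) (% 2 9 (! 21100 30300405) (% 1 9 (% 1 8 (! 32100 45) (% 5 9 (! 0 2413502001) (% 8 9 (! 21100 340300005) ($ 1 9 5 8)))) ($ 1 2 7 9)))) ($ 0 4 2 5))) (% 2 7 (% 1 8 (! 32100 45) s227) ($ 1 2 5 7))) ($ 1 6 5 7))))) s229) (% 0 2 (% 2 9 (% 1 5 (! 21100 40300305) (% 2 8 (! 10 320002405) (% 2 5 (% 1 6 (% 1 3 (! 32100 45) (% 1 7 (! 21100 345) s230)) (% 1 8 (% 1 7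 (! 21000 345) (% 7 8 (! 0 240301135) (% 1 9 (% 1 3 (! 0 1002012345) (% 1 4 (! 0 100221345) (% 3 9 (new 5 true 11 (% 1 11 (! 0 100200112345) (% 5 9 (! 0 2130104530) (% 9 11 (! 0 2131104530) ($ 1 9 5 11))))) (% 4 9 (% 5 9 (! 0 2131401530) s220) ($ 1 9 3 4))))) (% 8 9 (% 3 9 s155 (% 4 9 s219 (% 4 6 (% 1 4 (! 2100 30045) (% 2 4 (! 0 101143235) ($ 1 2 4 6))) ($ 3 4 6 9)))) ($ 1 8 7 9))))) ($ 1 2 6 8))) (% 1 8 (% 1 7 (! 21000 345) (% 2 7 (! 3210 40000005) ($ 1 2 5 7))) ($ 1 2 5 8))))) (% 3 9 (% 1 9 (% 2 8 (! 10 320002405) (% 1 8 (% 1 5 (! 32100 45) (% 2 7 (! 3210 40000005) (% 1 7 (new 5 true 11 (% 0 11 (! 0 202031100145) (% 1 11 (! 0 2230001145) ($ 0 1 5 11)))) (% 2 5 (% 5 6 (% 3 5 (! 20210 30405000) (% 4 6 (! 0 2314102205) ($ 3 4 5 6))) (% 5 9 (% 0 9 (! 12010 4030000005) (% 4 9 (new 7 true 12 (! 0 1002341305120)) ($ 0 4 5 9))) ($ 2 5 6 9))) ($ 1 2 5 7))))) (% 1 6 s231 ($ 1 2 6 8)))) (% 1 6 s231 ($ 1 2 6 9))) ($ 2 3 6 9))) ($ 0 6 2 3))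
  s233 = % 1 8 (! 32100 45) ($ 1 4 6 8)
  s234 = new 5 true 11 (% 1 11 (! 2110 300003000045) (% 2 11 (! 32210 40000500) ($ 1 2 5 11)))
  s235 = % 2 4 (% 4 6 (! 2210 34500) (% 6 7 (! 31210 4000500) (% 7 8 (! 0 341200125) ($ 4 7 6 8)))) ($ 0 4 2 5)
  s236 = % 2 5 (! 0 341200125) (% 2 8 (! 22210 430000500) (% 1 8 (% 1 7 (! 0 321002145) s234) ($ 1 2 5 8)))
  s237 = % 3 9 (% 0 9 (% 6 7 (! 110 324002005) (% 4 6 (% 1 5 (! 0 1304221015) (% 2 8 (! 0 2314200105) (% 1 8 (% 1 4 (! 2100 30045) (% 1 7 (! 0 231020145) (% 7 8 (! 0 2314200105) ($ 1 8 4 7)))) (% 2 5 (% 2 4 (! 2210 34500) ($ 0 4 2 5)) ($ 1 2 5 8))))) (% 7 8 (% 2 5 (! 0 341200125) (% 2 8 (! 22210 430000500) (% 1 5 (% 1 3 (! 32100 45) (% 1 4 (% 1 6 (! 20100 3000045) s233) (% 3 5 (! 10 2320405000) ($ 1 5 3 4)))) (% 1 8 s234 ($ 1 2 5 8))))) ($ 4 7 6 8)))) (% 1 3 (% 1 5 (! 32100 45) (% 1 8 (! 0 321002145) (% 2 8 (! 0 302024511) (% 2 5 s235 ($ 1 2 5 8))))) (% 1 9 (% 2 5 s235 (% 1 5 (% 1 4 s224 (% 3 5 (% 3 6 (! 0 2304221015) (% 5 6 (! 22100 304000005) ($ 0 6 3 5))) ($ 1 5 3 4))) (% 1 8 (%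 1 7 (! 0 321002145) (% 7 8 s234 (% 4 6 s225 (% 6 7 (! 0 324002115) ($ 4 7 6 8))))) (% 2 8 (% 6 7 (! 0 324002115) (% 7 8 (! 22210 430000500) (% 4 6 (% 5 9 (! 0 1304221015) (% 8 9 (! 0 403112512) ($ 1 9 5 8))) ($ 4 7 6 8)))) ($ 1 2 5 8))))) ($ 0 1 3 9)))) (% 7 8 (% 3 6 (! 0 314002125) (% 4 6 (% 1 5 (! 0 1304221015) s236) (% 4 9 (% 1 5 (! 0 1243301015) s236) ($ 3 4 6 9)))) (% 8 9 (% 4 6 (% 1 5 (! 21100 400003035) (% 2 5 (! 0 1314220005) (% 1 8 (% 1 7 (! 0 321002145) s225) (% 2 8 (new 2 false 10 (% 0 10 (! 0 11324000205) (% 2 4 (! 22210 30040500) (% 4 10 (% 3 6 (! 20100 304000005) (new 3 false 11 (! 0 213042105))) ($ 0 4 2 10))))) ($ 1 2 5 8))))) (% 6 7 (% 1 5 (! 21100 400003035) (% 1 8 (! 0 2134100025) (% 2 5 (! 0 2314120005) s227))) ($ 4 7 6 8))) ($ 3 8 7 9)))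
  s238 = new 5 true 10 (! 0 10302415021)
  s239 = % 2 8 (! 10 320002405) ($ 1 2 6 8)
  s240 = % 1 3 (% 1 6 (! 32100 45) (% 1 8 (! 0 402013251) (% 2 6 (! 0 120304521) s239))) (% 1 5 (% 3 6 s238 (% 5 6 (% 1 6 (! 0 203110245) (% 1 8 (! 32100 45) (% 2 6 (! 0 100324521) s239))) ($ 0 6 3 5))) ($ 0 1 3 5))
  s241 = % 1 9 (% 2 8 (! 10 320002405) (% 1 8 (% 1 4 (% 2 6 (! 0 102021345) (% 2 9 (! 0 100221345) (% 5 6 (! 0 302110245) (% 5 9 (% 0 9 (! 2100 3000000045) (% 4 9 (! 32110 4000000050) ($ 0 4 5 9))) ($ 2 5 6 9))))) (% 1 7 (% 2 6 (! 2110 345) (% 2 9 (! 21000 345) (% 5 6 (! 0 312100245) (% 5 9 (! 0 3140102052) ($ 2 5 6 9))))) (% 7 8 (% 2 4 (% 4 6 (! 2010 30040005) (% 2 6 (% 3 6 s213 (new 3 false 10 (! 0 10402035231))) ($ 2 4 6 8))) ($ 1 2 4 7)) ($ 1 8 4 7)))) (% 2 6 (% 2 4 (% 4 6 (! 0 102041305) (% 6 7 (! 21010 4000305) (% 7 8 (% 1 7 (! 0 342100125) ($ 1 2 7 8)) ($ 4 7 6 8)))) (% 4 6 (% 1 5 (! 0 1304221015) (% 5 9 (! 0 1304221015) (% 8 9 (! 0 304221105) ($ 1 9 5 8)))) (% 6 7 (% 1 4 (! 0 2314221005) (% 1 7 (! 0 234100125) ($ 1 2 4 7))) ($ 2 6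 4 7)))) (% 1 6 (% 8 9 (! 21100 400003035) (% 1 5 (% 1 3 (! 32100 45) (% 1 4 (% 2 9 (! 0 1120200345) (% 5 6 (! 0 203110245) (% 5 9 (! 0 3012400251) ($ 2 5 6 9)))) ($ 1 5 3 4))) (% 5 9 (% 1 7 (! 0 2230100145) (% 6 7 (! 22100 304000005) (% 5 6 (% 0 9 (! 0 1304221005) (% 4 9 (! 0 314221015) ($ 0 4 5 9))) ($ 1 6 5 7)))) ($ 1 9 5 8)))) ($ 1 2 6 8))))) (% 2 9 (% 0 9 (% 4 6 (! 0 4032210105) (% 7 8 (! 12010 4030000005) (% 6 7 (% 2 6 (! 0 4032210105) (% 3 6 (! 0 3214100205) ($ 2 3 6 7))) ($ 4 7 6 8)))) (% 1 3 (% 1 5 (! 32100 45) (% 1 7 (! 21000 345) ($ 1 3 5 7))) ($ 0 1 3 9))) (% 1 7 (% 1 6 (% 1 3 (! 32100 45) (% 1 8 (! 32100 45) (% 7 8 (! 21100 30000045) ($ 1 7 3 8)))) (% 2 6 (% 1 3 (! 2110 345) (% 1 8 (! 2110 345) (% 7 8 (! 0 342100125) ($ 1 7 3 8)))) ($ 1 2 6 9))) ($ 1 2 7 9)))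
  s242 = % 3 5 (% 1 5 (% 3 6 s238 (% 5 6 (% 1 6 (! 0 304221015) (% 1 8 (! 32100 45) (% 2 6 (! 22100 304000005) s239))) ($ 0 6 3 5))) (% 1 3 (% 1 8 (! 0 402013251) (% 2 8 (! 10 320002405) ($ 1 2 5 8))) ($ 0 1 3 5))) ($ 2 3 5 7)
  s243 = % 3 7 (% 2 6 (% 5 6 (! 22100 304000005) (% 6 7 (! 2110 34000005) s226)) s232) (% 2 7 (% 0 2 (! 210 430003005) (% 2 6 (% 4 7 s237 (% 3 5 (% 5 6 (! 22100 304000005) (% 3 6 (% 1 3 (! 0 223004511) (% 1 5 (! 0 1304112025) ($ 0 1 3 5))) ($ 0 6 3 5))) ($ 3 4 5 7))) (% 3 6 (% 3 5 (% 1 6 (! 0 324102015) (% 1 3 (% 1 8 (! 0 302011245) (% 2 8 (! 0 322004511) ($ 1 2 6 8))) (% 1 5 s238 ($ 0 1 3 5)))) (% 4 7 (% 6 7 (% 1 6 (! 22100 304000005) (% 2 8 (! 0 314002125) (% 1 8 (% 1 7 (! 0 312100245) (% 1 9 (! 0 1304112025) (% 7 8 (! 0 1234100015) (% 8 9 (! 20100 304000005) ($ 1 8 7 9))))) ($ 1 2 6 8)))) (% 5 6 (% 7 8 (! 0 341200125) (% 2 8 (% 1 5 (! 0 304221015) (% 1 6 (! 0 324002115) (% 2 5 (! 0 312400521) ($ 1 2 5 6)))) ($ 2 7 6 8))) ($ 3 6 5 7))) ($ 3 4 5 7))) ($ 0 6 2 3)))) (% 0 2 (% 3 9 (% 2 5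 (% 3 5 s240 (% 4 7 s241 ($ 3 4 5 7))) s242) (% 2 9 (% 2 5 (% 3 5 s240 (% 4 7 (% 7 8 (% 1 7 (! 0 340102125) (% 2 8 (! 10 320002405) (% 1 8 (% 1 4 (! 0 100221345) (% 2 4 (% 2 6 (! 0 1342021015) (% 4 6 (! 2010 30040005) ($ 2 4 6 8))) ($ 1 2 4 7))) ($ 1 2 7 8)))) (% 8 9 (% 4 9 s219 (% 4 6 (% 1 4 (! 0 1032241105) (% 1 6 (! 21100 400003035) (% 2 4 (! 0 1012240305) (% 2 6 (! 0 1014220305) ($ 1 2 4 6))))) (% 3 6 (% 6 7 (! 20100 304000005) ($ 4 7 6 8)) ($ 3 4 6 9)))) ($ 3 8 7 9))) ($ 3 4 5 7))) s242) ($ 2 3 7 9))) ($ 0 7 2 3)))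
  s244 = % 1 3 (! 21110 3450) (% 6 7 (! 0 1204023115) ($ 1 7 3 6))
  s245 = % 1 3 (! 21110 3450) ($ 1 7 3 6)
  s246 = % 0 9 (! 10010 4230000205) ($ 0 4 2 9)
  s247 = % 4 9 (% 5 9 (% 1 5 (% 2 5 (! 0 120324521) (new 2 false 10 (% 0 2 (! 10000 2003425) (% 2 4 (! 32110 4000000500) (% 4 10 (! 2100 4000350003) (% 0 10 (% 0 9 (! 31210 4000000005) (% 5 10 (! 32210 405000) (% 9 10 (! 2100 45000300003) ($ 0 10 5 9)))) ($ 0 4 2 10))))))) (% 0 9 (% 2 5 (! 0 120324521) (% 2 7 (! 0 4032201105) (% 1 7 (% 1 3 (! 21000 30345) (% 6 7 (! 0 3204121005) ($ 1 7 3 6))) ($ 1 2 5 7)))) (% 1 9 (% 2 5 (! 0 120324521) (% 1 7 s244 (% 2 7 (new 2 false 10 (% 0 2 (! 10210 3040003005) (% 0 10 (! 12210 3040003005) (% 2 6 (! 0 1203124015) (% 6 10 (! 0 1203124015) ($ 0 6 2 10)))))) ($ 1 2 5 7)))) ($ 0 1 5 9)))) (% 8 9 (% 1 5 (! 21100 300304005) (% 1 7 s244 (% 2 5 (! 0 122304521) (% 2 7 (new 2 false 10 (% 0 2 (! 10210 3040003005) (% 0 10 (! 0 23412000501) (% 2 6 (! 20100 304000005) (% 6 10 (! 0 1203014205) ($ 0 6 2 10)))))) ($ 1 2 5 7))))) ($ 4 9 5 8))) (% 3 9 (% 0 2 (! 10010 2200003405) (% 0 9 (! 10010 4200003205) (%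 2 4 (% 2 5 (% 2 6 (! 0 204023115) (% 5 6 (! 20010 304500) ($ 0 6 2 5))) (% 2 7 (new 2 false 10 (% 2 6 (! 0 203024115) (% 6 10 (! 0 2103024105) (% 0 10 (new 5 true 11 (% 5 6 (! 21110 3004005) (% 5 9 (! 10210 3300004005) (% 6 11 (! 0 100203024115) (% 9 11 (! 0 23012004501) ($ 5 11 6 9)))))) ($ 0 6 2 10))))) (% 4 7 (% 4 6 (! 22210 34500) (% 6 7 (! 0 3104032105) (% 7 8 (% 1 5 (! 0 342121005) (% 1 7 s245 ($ 1 2 5 7))) ($ 4 7 6 8)))) ($ 2 4 5 7)))) ($ 0 4 2 9)))) (% 4 7 (% 2 4 (% 4 6 (! 0 103042105) (% 6 7 (! 0 2104023105) (% 7 8 (% 1 5 (! 0 342121005) (% 1 7 s245 (% 2 5 (! 0 340210125) (% 2 7 (! 32210 40000500) ($ 1 2 5 7))))) ($ 4 7 6 8)))) (% 2 7 (% 0 2 (! 10210 3340000005) s246) (% 7 8 (% 0 2 (! 0 320102415) s246) ($ 2 8 4 7)))) ($ 3 4 7 9)))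
  s248 = % 6 7 (! 0 2231000145) ($ 1 7 3 6)
  s249 = % 4 6 (! 2100 30045) (% 6 7 (! 0 1301221045) (% 7 8 (! 0 310220145) ($ 4 7 6 8)))
  s250 = % 4 7 s249 ($ 1 4 5 7)
  s251 = % 1 8 (% 1 3 (% 1 5 (! 32100 45) (% 1 7 (! 0 122103045) (% 2 5 (% 2 4 (! 0 103012345) (% 0 2 (% 2 6 (! 0 1202113045) (% 5 6 (! 0 104312035) (% 5 9 (! 0 3012004251) ($ 2 5 6 9)))) ($ 0 4 2 5))) (% 2 7 (% 2 6 (! 0 1202113045) (% 2 8 (! 0 103012345) (% 6 7 (! 0 1202113045) (% 7 8 (! 0 1210203045) ($ 2 7 6 8))))) ($ 1 2 5 7))))) (% 1 4 (% 1 5 (! 32100 45) (% 1 7 (% 3 7 (! 0 2231110045) s248) s250)) ($ 1 8 3 4))) (% 2 8 (% 1 5 (% 7 8 (! 20210 340500000) (% 8 9 (! 21100 300304005) (% 2 7 (new 5 true 10 (% 5 6 (! 0 11003214025) (% 0 10 (% 5 9 (! 0 13001425021) (% 6 10 (! 3210 40000000005) (% 9 10 (% 2 10 (! 10 2230304500) (% 8 10 (! 21100 300304005) ($ 2 8 9 10))) ($ 5 10 6 9)))) (% 6 10 (% 4 10 (! 0 10203024115) ($ 0 4 5 10)) ($ 0 6 5 10))))) ($ 2 8 7 9)))) (% 8 9 (% 1 7 (% 6 7 (! 20100 304000005) (% 7 8 (! 0 1342010025) ($ 1 7 6 8))) (% 2 5 (% 0 2 (! 0 102213405) (% 2 4 (!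 0 122304521) ($ 0 4 2 5))) (% 2 7 (new 2 false 10 (% 0 2 (! 0 1120203405) (% 2 6 (! 20100 304000005) (% 6 10 (! 0 20103204125) s198)))) ($ 1 2 5 7)))) (% 5 9 (% 0 9 (! 10210 4000003005) (% 4 9 (% 2 4 (! 22110 34500) ($ 2 8 4 9)) ($ 0 4 5 9))) ($ 1 9 5 8)))) (% 2 6 (% 5 9 (! 11210 4003005000) (% 8 9 (! 20100 304000005) (% 1 5 (% 5 6 (! 22100 4003005) (% 6 7 (! 0 1124203005) (% 2 5 (% 0 2 (! 0 104012315) (% 2 4 (! 0 3004032115) ($ 0 4 2 5))) (% 2 7 (new 2 false 10 (! 0 11003014225)) ($ 2 6 5 7))))) ($ 1 9 5 8)))) ($ 1 2 6 8)))
  s252 = new 5 true 10 (% 0 10 (! 0 21100134205) (% 4 10 (! 2100 4000350003) ($ 0 4 5 10)))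
  s253 = new 5 true 10 (% 0 10 (! 20100 400330005) (% 1 10 (! 2100 30000030045) ($ 0 1 5 10)))
  s254 = % 4 6 (! 0 102043115) ($ 1 4 6 8)
  s255 = % 4 7 (! 0 4231210015) ($ 3 4 7 9)
  s256 = % 0 2 (! 0 104012315) (% 2 4 (! 0 203024511) ($ 0 4 2 5))
  s257 = % 1 9 (% 3 9 s251 (% 2 7 (% 3 7 (! 10 230004205) (% 4 9 (% 2 6 (! 0 1204123015) (% 1 8 (% 1 3 (! 100 200023045) (% 1 4 (! 2100 30045) ($ 1 8 3 4))) (% 2 8 (% 5 9 (% 2 4 s252 (% 8 9 (new 5 true 10 (! 0 13240510102)) ($ 2 8 4 9))) (% 8 9 (% 1 5 (! 21100 300304005) (% 1 3 s253 ($ 1 9 3 5))) ($ 4 9 5 8))) ($ 1 2 6 8)))) (% 4 7 (% 1 3 (% 2 6 (! 0 1204113025) (% 1 8 (% 1 4 s249 (% 1 7 (! 0 122003145) (% 7 8 (! 0 302101245) ($ 1 8 4 7)))) (% 2 8 (% 4 6 (! 0 204013125) (% 6 7 (! 0 1204113025) (% 7 8 (! 10 340002205) ($ 4 7 6 8)))) ($ 1 2 6 8)))) (% 1 4 (% 1 8 (% 1 5 (! 32100 45) (% 1 7 s248 s249)) s254) ($ 1 9 3 4))) ($ 3 4 7 9)))) (% 3 7 (% 1 5 (! 20210 40305000) (% 1 3 (% 1 7 (! 0 132204015) (% 2 5 (% 0 2 (! 0 1032204105) (% 2 6 (! 0 1204113025) (% 5 6 (! 20210 40305000) ($ 0 6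 2 5)))) ($ 1 2 5 7))) (% 5 9 (% 1 4 (% 1 8 (% 1 7 (! 0 2231110045) s250) s254) (% 4 9 (% 1 8 ($ 1 8 3 4) (% 2 6 (! 0 2124103005) (% 2 8 (% 2 4 s252 (% 8 9 (! 0 2140305201) ($ 2 8 4 9))) ($ 1 2 6 8)))) ($ 1 9 3 4))) ($ 1 9 3 5)))) ($ 2 3 7 9)))) (% 2 6 (% 2 7 (% 1 8 (! 100 2304220005) (% 2 8 (! 0 203024511) (% 1 5 (% 5 6 (! 22100 4003005) (% 5 9 (% 4 9 (! 0 1204123015) (% 0 9 (% 3 7 (! 0 130204125) (% 3 9 (! 0 2014003125) s255)) ($ 0 4 5 9))) ($ 1 5 6 9))) (% 2 5 s256 ($ 1 2 5 8))))) (% 1 7 (% 2 5 s256 (% 5 6 (! 22100 4003005) (% 6 7 (% 1 5 (! 0 234101025) (% 1 8 (! 100 2304220005) (% 2 8 (! 0 203024511) ($ 1 2 5 8)))) ($ 2 6 5 7)))) ($ 1 2 7 9))) ($ 1 2 6 9))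
  s258 = % 2 7 (% 3 7 (! 22210 30004500) (% 3 9 (% 0 9 (% 2 9 (! 10 3020204500) (% 1 6 (new 5 true 10 (% 4 10 (! 22110 34530) (% 0 10 (% 5 6 (! 0 10003425121) (% 5 9 (! 2210 4000305000) (% 6 10 (! 3210 40000000005) (% 9 10 (! 22110 3004005000) ($ 5 10 6 9))))) ($ 0 4 5 10)))) (% 1 9 (new 5 true 10 (% 5 6 (! 0 3204011125) (% 6 10 (! 0 3204011125) (% 0 10 (% 5 9 (! 2210 4000305000) (% 9 10 (! 2100 34000000005) ($ 5 10 6 9))) ($ 0 6 5 10))))) (% 2 6 (% 5 6 (! 0 3302014511) (% 5 9 (! 2210 4000305000) ($ 1 5 6 9))) ($ 1 2 6 9))))) ($ 0 8 3 9)) (% 4 7 (% 4 6 (% 1 4 (! 22100 30045) (% 1 6 (! 10100 3020245) (% 5 6 (% 2 4 (! 22210 30040500) (% 2 6 (new 5 true 10 (% 4 10 (! 22100 30000040035) (% 0 10 (% 0 2 (! 0 13102425) (% 2 10 (! 0 20014130532) (% 3 10 (! 0 10103024521) ($ 0 10 2 3)))) ($ 0 4 5 10)))) ($ 1 2 4 6))) ($ 1 5 4 6)))) (% 6 7 (% 1 6 (! 20100 3000045) (% 5 6 (! 10000 34200025) (% 5 9 (! 0 2134100025) (% 1 9 (% 1 3 (! 32100 45) (% 1 4 s233 (% 4 9 ($ 4 9 5 8) ($ 1 9 3 4)))) ($ 1 5 6 9))))) ($ 4 7 6 8))) (% 4 9 (% 5 9 (! 2210 3040500000) ($ 4 9 5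 8)) ($ 3 4 7 9))))) (% 2 9 (% 3 7 (! 32210 4500) (% 0 2 (% 3 9 (% 0 9 (! 0 3002014521) ($ 0 8 3 9)) (% 4 7 (% 2 4 (% 4 6 (! 0 301043215) (% 6 7 (! 0 1234020105) ($ 4 7 6 8))) ($ 2 8 4 7)) (% 4 9 (% 5 9 (! 10 4230203500) ($ 4 9 5 8)) ($ 3 4 7 9)))) ($ 0 7 2 3))) ($ 2 8 7 9))
  s259 = % 2 9 (% 3 7 (! 32210 4500) (% 0 2 (% 1 7 (! 21110 3450) (% 3 9 (% 8 9 (! 0 301211425) (% 0 9 (% 2 5 (! 0 4310103205) (% 2 7 (! 10210 4030000005) ($ 1 2 5 7))) ($ 0 8 3 9))) (% 1 9 (% 1 8 (! 10000 2002345) (% 8 9 (! 0 1302010425) (% 5 9 (% 0 9 (! 0 4120102305) (% 4 9 (! 0 1321405230) ($ 0 4 5 9))) ($ 1 9 5 8)))) ($ 1 3 7 9)))) (% 2 7 (% 1 7 (! 21110 3450) (% 3 9 (% 8 9 (! 0 3240201501) (% 0 9 (new 5 true 10 (% 1 10 (! 0 13112014520) (% 2 5 (! 0 1122304500) (% 2 10 (! 11110 23002004500) ($ 1 2 5 10))))) ($ 0 8 3 9))) (% 1 9 (% 1 8 (! 21110 3450) (% 8 9 (! 0 4312000521) (% 5 9 (% 0 9 (! 0 3240201501) (% 4 9 (% 4 7 (! 0 3040121520) (new 4 false 10 (% 5 10 (! 0 3140212501) (% 7 10 (! 32210 40000500) ($ 4 10 5 7))))) ($ 0 4 5 9))) ($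 1 9 5 8)))) ($ 1 3 7 9)))) ($ 0 7 2 3)))) (% 1 9 (% 1 8 (! 0 301021245) (% 8 9 (% 4 9 s253 (% 3 9 (% 2 7 (new 5 true 10 (% 1 10 (! 0 20203111345) s189)) (% 0 2 (% 2 5 (! 0 301221405) (% 1 7 (% 6 7 (! 20100 304000005) (% 7 8 (! 0 2132000145) ($ 1 7 6 8))) ($ 1 2 5 7))) (% 3 7 (% 1 7 (! 0 3042201250) (% 2 5 s160 ($ 1 2 5 7))) ($ 0 7 2 3)))) ($ 3 4 8 9))) (% 5 9 (% 2 7 (% 4 9 (% 2 4 (new 5 true 10 (% 1 10 (! 32110 4000000050) (% 2 5 (! 0 10200314521) (% 2 10 (! 2110 33000040500) ($ 1 2 5 10))))) ($ 2 8 4 9)) (% 0 9 (% 0 2 (! 0 2130102405) (% 3 9 (new 5 true 10 (! 0 13200415021)) ($ 0 9 2 3))) ($ 0 4 5 9))) (% 7 8 (% 0 9 (! 0 1340502102) (% 4 9 (! 0 1341220005) ($ 0 4 5 9))) ($ 2 8 7 9))) ($ 1 9 5 8)))) ($ 1 2 6 9))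
  s260 = % 5 9 s183 (% 8 9 (! 20100 304000005) ($ 4 9 5 8))
  s261 = % 4 6 (! 22100 30045) ($ 1 4 6 8)
  s262 = % 1 5 (% 1 8 (! 32100 45) (% 1 6 (% 1 7 (! 0 123102045) (% 2 9 (! 10000 3002245) (% 2 7 (% 2 6 (! 20100 3000045) (% 6 7 (! 20100 3000045) (% 7 8 (! 3210 40000005) ($ 2 7 6 8)))) (% 1 9 (% 3 9 (! 0 2003021145) (% 3 7 (% 1 3 (! 32100 45) (% 4 9 (! 0 2123110045) (% 1 4 (new 5 true 10 (% 0 10 (! 0 10203121045) (% 4 10 (! 2010 40330005) ($ 0 4 5 10)))) ($ 1 9 3 4)))) ($ 2 3 7 9))) ($ 1 2 7 9))))) (% 2 6 (% 1 7 (! 10110 20002345) (% 2 9 (! 10000 4002325) (% 2 7 (% 1 9 (% 1 3 (! 32100 45) (% 1 4 (! 10100 2020345) (% 3 9 (! 0 1013204502) (% 4 9 s260 ($ 1 9 3 4))))) (% 5 6 (% 3 7 (! 3210 40000005) (% 3 9 (! 0 1203024521) (% 4 7 (% 4 6 (! 0 14120325) (% 6 7 (! 1210 4000305) (% 7 8 (! 3210 40000005) ($ 4 7 6 8)))) (% 4 9 (% 1 4 (! 0 120121345) (% 2 4 (! 21010 4000305) ($ 1 2 4 9))) ($ 3 4 7 9))))) (% 5 9 (% 4 9 (! 2210 3040500000) (% 0 9 (% 3 7 (! 3210 40000005) (% 3 9 (! 0 1024002315) s255)) ($ 0 4 5 9))) ($ 1 5 6 9)))) (% 1 9 (% 3 9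 (% 0 9 (! 11210 4003005000) (% 8 9 (! 20100 304000005) ($ 0 8 3 9))) (% 1 3 (! 32100 45) (% 4 9 s260 (% 1 4 s261 ($ 1 9 3 4))))) ($ 1 2 7 9))))) ($ 1 2 6 8)))) (% 1 3 (% 1 6 (! 32100 45) (% 2 6 (! 0 203014521) (% 1 8 (% 2 9 (! 10000 2002345) (% 1 9 (% 2 7 (% 6 7 (! 0 221001345) (% 7 8 (! 0 312001245) ($ 2 7 6 8))) (% 3 7 (% 1 7 (! 0 231201045) (% 2 5 (% 5 6 (! 0 304221015) (% 5 9 (% 0 9 (! 12010 4030000005) (% 4 9 s228 ($ 0 4 5 9))) ($ 2 5 6 9))) ($ 1 2 5 7))) (% 3 9 (% 0 9 (! 0 3002011245) (% 8 9 (! 20100 300000045) ($ 0 8 3 9))) ($ 2 3 7 9)))) ($ 1 2 6 9))) ($ 1 2 6 8)))) ($ 0 1 3 5))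
  s263 = % 4 10 (! 22100 3040005) ($ 0 4 2 10)
  s264 = % 2 5 (% 2 4 (! 0 203042511) (% 0 2 (% 5 6 (! 0 120324521) (% 4 7 (% 1 4 (! 0 20143215) (% 1 7 (! 0 10123425) (% 2 7 (! 0 1030221405) ($ 1 2 4 7)))) (% 6 7 (% 1 9 (! 0 1034201205) (% 2 7 (! 0 1030221405) (% 2 9 (! 0 2210103405) (% 1 7 (% 1 3 (! 2110 345) (% 1 4 (! 0 10221345) (% 3 7 (! 2110 34000005) ($ 1 7 3 4)))) ($ 1 2 7 9))))) ($ 4 6 5 7)))) ($ 0 4 2 5))) (% 1 5 (% 1 4 (! 22100 30045) (% 1 6 (! 20100 3000045) (% 5 6 (% 1 9 (! 0 1201435032) (new 1 false 10 (! 0 11201435032))) ($ 1 5 4 6)))) (% 2 8 (% 2 7 (% 4 7 (new 2 false 10 (% 0 2 (! 0 1120203405) (% 2 4 (! 22210 34500) (% 4 10 (! 210 34005) (% 0 10 (new 3 false 11 (% 8 11 (! 0 304112215) (% 6 11 (% 5 6 (! 31210 4000005) (% 5 11 (! 21000 330004000005) (% 6 7 (! 0 100034102215) (% 7 11 (! 32110 400005000000) ($ 5 7 6 11))))) ($ 3 11 6 8)))) ($ 0 4 2 10)))))) (% 5 6 (new 2 false 10 (% 0 2 (! 0 1120203405) (% 0 10 (! 31210 4000005) (% 2 4 (! 22210 34500) s263)))) (% 6 7 (new 2 false 10 (new 3 false 11 (% 6 11 (! 22210 34003500) (% 8 11 (! 0 134102215) ($ 3 11 6 8))))) ($ 4 6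 5 7)))) (% 1 7 (% 1 6 (! 22210 34530) (% 7 8 (! 0 304221105) (% 6 7 (% 1 3 (! 22110 3450) (% 1 4 (! 0 2001043125) (% 3 7 (! 2110 34000005) (% 4 7 (! 0 234010125) ($ 1 7 3 4))))) ($ 1 7 6 8)))) ($ 1 2 5 7))) ($ 1 2 5 8)))
  s265 = % 0 10 (! 31210 4000005) s263
  s266 = % 0 9 (! 1210 3004000005) ($ 0 4 5 9)
  s267 = new 1 false 10 (! 0 12003011425)
  s268 = % 0 3 (% 4 9 (! 0 1203142015) (% 3 9 (% 1 8 (! 0 1304221015) s264) (% 3 7 (% 6 7 (! 2110 34000005) (% 7 8 (! 0 230104215) ($ 3 7 6 8))) (% 4 7 (% 1 4 (! 0 20143215) (% 2 4 (! 0 203042511) (% 2 7 (% 5 6 (% 1 8 (! 0 1304221015) (% 2 5 (! 0 210324521) (% 1 5 (new 2 false 10 (% 0 2 (! 0 10123425) s265)) (% 2 8 (new 2 false 10 (% 0 2 (! 0 210123405) s265)) ($ 1 2 5 8))))) (% 5 9 s266 ($ 3 5 6 9))) (% 1 7 (% 5 9 s266 (% 5 6 (% 1 6 (! 0 31120245) (% 1 8 (! 0 1304221015) (% 6 7 (! 0 243501021) (% 7 8 (! 0 1314220005) ($ 1 7 6 8))))) ($ 3 5 6 9))) ($ 1 2 4 7))))) ($ 3 4 7 9))))) (% 5 6 (% 1 3 (! 21000 4300035) (% 1 5 (% 0 2 (% 1 7 (! 10110 20002345) (% 1 9 (! 0 1104021325) (% 2 9 (! 21010 4000305) (% 2 7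 (% 3 7 (! 3210 40000005) (% 4 7 (! 0 14120325) (% 4 9 (! 0 1203142015) (% 3 9 s267 ($ 3 4 7 9))))) ($ 1 2 7 9))))) (% 2 8 (% 2 7 (% 3 7 (! 22210 30004500) (% 4 9 (! 0 1203142015) (% 3 9 (new 3 false 10 (% 1 10 (! 22210 34530) (% 0 10 (% 6 10 (! 10000 30024500032) (% 8 10 (! 0 304121215) ($ 3 10 6 8))) ($ 0 1 3 10)))) (% 4 7 (new 3 false 10 (% 1 10 (! 10100 20002030345) (% 0 10 (% 6 10 (! 10000 30024500032) (% 8 10 (! 0 304211125) ($ 3 10 6 8))) ($ 0 1 3 10)))) ($ 3 4 7 9))))) (% 3 7 (% 2 9 (! 32210 4500) (% 7 8 (! 20210 340500000) (% 8 9 (! 20100 304000005) ($ 2 8 7 9)))) ($ 0 7 2 3))) ($ 0 8 2 3))) ($ 0 1 3 5))) ($ 0 6 3 5))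
  s269 = % 3 6 (% 0 3 (% 1 6 (! 10000 4203025) (% 2 9 (% 2 8 (% 3 7 (! 32210 4500) s247) (% 1 8 (% 1 3 (! 10000 3002345) (% 1 4 (% 4 6 (! 2100 30045) (% 4 9 (! 2100 30045) (% 1 9 (% 0 2 (! 10000 2003425) (% 0 9 (! 2100 3000000045) (% 2 4 (! 0 102031245) ($ 0 4 2 9)))) ($ 1 4 6 9)))) ($ 1 8 3 4))) (% 2 6 (% 0 2 (! 0 104012315) (% 0 9 (! 10110 3224000005) (% 8 9 (! 20100 304000005) ($ 0 8 2 9)))) ($ 1 2 6 8)))) s257)) (% 2 8 (% 1 5 (% 7 8 (! 20210 340500000) (% 8 9 (! 21100 400503003) s258)) (% 1 3 (% 1 6 (! 32100 45) (% 2 6 (! 0 203024511) s259)) ($ 0 1 3 5))) (% 0 2 s262 ($ 0 8 2 3)))) (% 4 6 (% 2 6 s268 (% 2 8 (% 2 9 (% 0 3 (% 0 2 (! 10 200023405) (% 2 4 (! 10 200043205) (% 4 9 (! 210 43005) (% 0 9 (% 3 7 (! 32210 4500) (% 3 9 (! 10 3220024500) (% 4 7 (! 10100 4032200005) ($ 3 4 7 9)))) ($ 0 4 2 9))))) (% 0 2 (% 5 6 (% 1 4 (! 0 203142015) (% 2 4 (! 10 300043205) (% 1 6 (% 1 3 (! 32100 45) (% 1 5 (! 10000 2002345) ($ 0 1 3 5))) ($ 1 2 4 6)))) ($ 0 6 3 5)) ($ 0 6 2 3))) (% 3 9 (% 0 3 (% 1 6 (% 7 8 (! 110 304020205) (%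 8 9 (! 0 314210125) (% 2 7 (% 6 7 (! 10000 34200025) (% 1 3 (! 32100 45) (new 3 false 10 (% 1 10 (! 0 10103021245) (% 6 10 (% 2 10 (! 32110 40005000000) (% 7 10 (! 32110 40005000000) ($ 2 7 6 10))) ($ 1 6 3 10)))))) ($ 2 8 7 9)))) (% 2 4 (! 22210 34500) (% 1 4 (% 1 5 (! 22100 30045) (% 1 8 (! 2100 30045) ($ 1 4 5 8))) ($ 1 2 4 6)))) (% 0 2 (% 5 6 (% 2 7 (! 0 2230111405) (% 7 8 (! 10 320002405) (% 8 9 (! 21100 400503003) ($ 2 8 7 9)))) ($ 0 6 3 5)) ($ 0 6 2 3))) ($ 2 3 6 9))) ($ 2 3 6 8))) ($ 3 4 6 8))
  s270 = % 2 4 (! 32110 450) ($ 0 4 2 5)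
  s271 = % 0 2 (! 2110 345) s270
  s272 = % 3 7 (% 2 8 (! 22110 300000450) (% 2 5 s271 (% 3 5 (% 1 3 (! 22100 403003050) (% 1 5 (! 10000 322400050) (% 0 3 (% 3 6 (! 22100 405003030) (% 5 6 (! 20100 403500000) (% 5 9 (! 0 2014032315) (% 3 9 (% 3 8 (! 33210 400005000) (% 8 9 (! 0 3024021135) (% 1 9 (new 2 false 10 (% 0 2 (! 2110 345) (% 0 10 (! 0 12010032345) (% 2 4 (! 32110 450) (% 4 10 (! 0 12030045112) ($ 0 4 2 10)))))) ($ 1 8 3 9)))) ($ 3 5 6 9))))) ($ 0 1 3 5)))) (% 3 8 (new 2 false 10 (% 2 4 (! 32110 450) (% 4 10 (% 5 10 (! 0 130245212) (% 7 10 (% 8 10 (% 3 6 (! 0 134205210) (% 3 9 (! 0 22301045101) (% 4 6 (! 0 22413050010) (% 4 9 (% 1 4 (! 0 21031040152) (% 1 9 (! 0 13041020152) ($ 1 2 4 9))) ($ 3 4 6 9))))) ($ 2 10 5 8)) ($ 2 10 5 7))) (% 7 10 (% 8 10 (% 0 2 (! 2110 345) (% 0 10 (% 3 6 (! 0 134205210) (% 4 9 (! 2110 30345) (% 3 9 (% 0 3 (! 33210 400005000) (% 0 9 (! 0 33415200012) (% 1 3 (! 32100 400000050) (% 1 9 (! 0 12410032350) ($ 0 1 3 9))))) (% 4 6 (new 3 false 11 (! 0 132045210)) ($ 3 4 6 9))))) ($ 0 4 2 10))) ($ 2 10 4 8)) ($ 2 10 4 7))))) ($ 2 3 5 8)))))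 (% 3 9 (% 2 5 s271 (% 3 5 (% 3 6 (! 22100 405003030) (% 5 6 (! 20100 403500000) (% 0 3 (% 1 3 (! 22100 403003050) (% 3 8 (! 33210 400005000) (% 1 9 (new 2 false 10 (% 0 2 (! 2110 345) (% 0 10 (! 0 12010132345) (% 2 4 (! 32110 450) (% 4 10 (! 0 23040151123) ($ 0 4 2 10)))))) (% 8 9 (new 1 false 10 (% 9 10 (! 0 23145020012) (% 6 10 (new 2 false 11 (! 0 13402101253)) ($ 1 10 6 9)))) ($ 1 8 3 9))))) ($ 0 6 3 5)))) ($ 2 3 5 7))) ($ 2 3 7 9))
  s273 = % 2 6 (% 2 7 (! 11110 232000450) (% 2 9 (! 32110 450) s272)) (% 2 9 (% 2 7 (! 32110 450) (% 3 7 (! 21110 43000350) (% 3 6 (% 3 5 (! 22100 405003030) (% 2 5 (% 0 2 (! 21000 345) (% 5 6 (new 5 true 10 (! 0 2234510101)) ($ 0 6 2 5))) ($ 2 3 5 7))) ($ 2 3 6 7)))) (% 1 9 (% 3 6 (% 2 7 (% 2 8 (! 22110 300000450) (% 3 5 (! 22100 405003030) (% 2 5 s271 (% 3 8 (% 3 7 (! 0 143005212) (% 7 8 (! 21100 430000050) (% 8 9 (! 0 4312100250) (% 3 9 (new 2 false 10 (% 5 10 (! 0 11304205212) (% 8 10 (! 0 22304005111) ($ 2 10 5 8)))) ($ 3 8 7 9))))) ($ 2 3 5 8))))) (% 3 7 (% 3 5 (! 22100 405003030) (% 2 5 (% 0 2 (! 10000 422300053) (% 2 4 (! 21110 43000350)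 ($ 0 4 2 5))) (% 2 8 (% 7 8 (! 21100 430000050) (% 8 9 (! 0 4132100250) ($ 2 8 7 9))) (% 3 8 (% 1 3 (! 32100 400000050) (% 1 4 (! 0 2230045110) (% 3 9 (! 100 2403205000) (% 4 9 (! 2110 4030000050) ($ 1 9 3 4))))) ($ 2 3 5 8))))) (% 3 9 (% 3 5 (! 22100 405003030) (% 3 8 (! 100 2403205000) (% 5 9 (! 0 4131200052) (% 8 9 (! 100 3405202000) ($ 3 9 5 8))))) ($ 2 3 7 9)))) (% 3 9 (% 3 8 (% 0 3 (! 33210 400005000) (% 0 2 (% 0 9 (! 0 4032100251) (% 2 7 (! 2110 345) ($ 0 2 7 9))) ($ 0 6 2 3))) (% 2 8 (% 2 7 (! 22110 300000450) (% 7 8 (! 11110 432000250) (% 8 9 (! 0 4032101251) ($ 2 8 7 9)))) ($ 2 3 6 8))) ($ 2 3 6 9))) ($ 1 2 6 9)))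
  s274 = % 3 6 (% 1 4 (% 1 6 (! 11110 34020250) (% 4 6 (! 0 2031040152) (% 4 9 (! 0 2031040251) (% 1 9 (% 2 9 (! 0 2031042051) (% 3 7 (! 22210 30045000) (% 3 9 (! 33210 45000) ($ 2 3 7 9)))) ($ 1 4 6 9))))) (% 2 4 (% 3 7 (! 21110 3004500) (% 3 9 (! 11110 22034500) (% 2 9 (% 1 6 (! 11110 34020250) (% 1 9 (! 0 3012010452) (% 5 9 (! 0 2041053231) (% 5 6 (% 2 5 (! 0 10312452) (% 2 8 (! 0 231203451) (% 8 9 (! 0 4123020510) ($ 2 9 5 8)))) ($ 1 5 6 9))))) ($ 2 3 7 9)))) (% 2 8 (% 3 7 (! 0 43205112) (% 3 9 (! 22110 34530) (% 2 9 (% 1 6 (! 11110 34020250) (% 1 9 (! 0 3112200450) (% 5 6 (! 0 231203451) (% 5 9 (! 0 4123100520) ($ 1 5 6 9))))) ($ 2 3 7 9)))) ($ 1 2 4 8)))) (% 5 6 (% 3 7 (! 0 1140325120) (% 3 9 (% 1 4 (! 0 1130422150) (% 2 8 (! 22110 34530) (% 2 4 (% 0 3 (! 22100 3435000) (% 1 3 (! 22100 3435000) (% 1 9 (! 0 2231400051) (% 0 9 (% 0 8 (! 20100 403500000) (% 5 9 (! 2210 4000305000) (% 8 9 (! 0 2021043135) ($ 0 9 5 8)))) ($ 0 1 3 9))))) ($ 1 2 4 8)))) (% 2 9 (% 2 5 (! 0 32410152) (% 2 8 (! 0 3342500110) (% 5 9 (! 21210 4035000000) (% 8 9 (! 0 2143512000)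 ($ 2 9 5 8))))) ($ 2 3 7 9)))) (% 0 3 (% 3 9 (% 1 4 (! 110 32245) (% 2 8 (! 22110 34530) (% 2 4 (% 1 6 (! 11110 34020250) (% 5 9 (! 0 2021043125) (% 1 9 (% 4 9 (! 0 1001043225) (% 8 9 (! 0 1032031245) ($ 1 9 4 8))) ($ 1 5 6 9)))) ($ 1 2 4 8)))) (% 5 9 (% 4 6 (! 0 134250012) (% 4 9 (! 21210 4035000000) ($ 3 4 6 9))) ($ 3 5 6 9))) ($ 0 6 3 5)))
  s275 = % 0 2 (! 0 11220345) (% 2 4 (! 10000 200302452) ($ 0 4 2 5))
  s276 = % 0 2 (! 0 12232145) (% 0 3 (! 33210 45000) ($ 0 6 2 3))
  s277 = % 2 8 (% 2 9 (% 3 7 (! 21100 3453) (% 3 6 (% 2 5 (! 0 211301452) (% 2 7 (! 0 131202451) (% 3 5 (% 0 2 (! 21100 345) (% 0 9 (% 0 3 (! 0 2014213005) (% 3 9 (! 0 3014012025) (% 5 9 (! 0 3024011125) ($ 0 9 3 5)))) (% 2 4 (% 1 6 (! 11110 232003450) (% 1 9 (% 1 4 (! 0 3112020450) (% 4 9 (! 0 3010221450) (% 8 9 (! 0 2012013453) ($ 1 9 4 8)))) (% 5 6 (% 4 6 (! 0 34251012) ($ 2 4 5 6)) (% 5 9 (% 4 9 (! 32110 4000000500) ($ 0 4 5 9)) ($ 1 5 6 9))))) (% 4 9 (% 1 6 (! 11110 232003450) (% 1 9 (! 0 4032051012) (% 5 6 (! 0 3142513000) (% 5 9 (! 0 4032051112)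 ($ 1 5 6 9))))) ($ 0 4 2 9))))) ($ 2 3 5 7)))) (% 2 7 (% 0 2 (! 21100 345) (% 0 3 (! 0 131202451) ($ 0 6 2 3))) ($ 2 3 6 7)))) (% 3 6 (% 1 6 (% 2 7 (! 21110 43000050) (% 7 8 (! 10000 435200002) (% 8 9 (! 0 2143100250) ($ 2 8 7 9)))) (% 1 9 (% 7 8 (! 10000 435200002) (% 8 9 (! 0 3142100250) (% 2 7 (% 2 5 (! 0 1132400250) (new 2 false 10 (! 0 131202451))) ($ 2 8 7 9)))) ($ 1 2 6 9))) (% 3 9 (% 1 9 (% 4 9 (! 0 3040121250) (% 8 9 (! 0 3142100250) (% 1 4 s276 ($ 1 9 4 8)))) (% 1 6 (% 0 2 (! 20100 3000045) (% 0 3 (! 11110 42032350) ($ 0 6 2 3))) ($ 1 2 6 9))) ($ 2 3 6 9)))) (% 1 6 (% 2 7 (! 21110 43000050) (% 3 7 (! 21110 43000050) (% 3 6 (% 1 3 (! 32110 4000050) (% 3 5 (% 1 4 (! 0 31241052) (% 2 4 (% 3 9 (! 22100 4035030) (% 2 9 (% 2 5 (! 0 10312452) (% 5 9 (! 0 2012013453) (% 8 9 (! 0 2012013453) ($ 2 9 5 8)))) ($ 2 3 7 9))) ($ 1 2 4 8))) (% 1 4 (% 2 5 (! 0 131242050) ($ 2 3 5 7)) ($ 1 5 3 4)))) ($ 2 3 6 7)))) ($ 1 2 6 8))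
  s278 = % 7 8 (% 2 6 (! 11110 324000520) (% 2 7 (! 22210 340000500) (% 3 6 (% 1 6 (! 21110 43000050) (% 2 9 (% 0 2 (! 20100 304000005) (% 0 9 (! 0 3124020105) (% 2 4 (! 0 2431050102) (% 4 9 (! 0 4132050102) ($ 0 4 2 9))))) (% 1 9 (% 5 9 (! 0 2435101200) (% 8 9 (! 0 3425000011) ($ 1 9 5 8))) ($ 1 2 6 9)))) (% 3 7 (% 0 2 (! 0 312002415) (% 0 3 (% 2 9 (! 32210 4500) (% 3 9 (% 1 6 (! 21110 43000050) (% 1 9 (% 1 4 (! 33210 45000) (% 4 9 (! 0 210043215) (% 8 9 (! 0 3041025021) ($ 1 9 4 8)))) ($ 1 2 6 9))) ($ 2 3 6 9))) ($ 0 6 2 3))) ($ 2 3 6 7))))) (% 8 9 (new 5 true 10 (% 0 10 (% 3 6 (! 0 13214030105) (% 4 6 (! 0 123140125) (% 4 9 (! 0 22301141005) (% 3 9 (% 0 2 (! 0 1302002415) (% 2 6 (! 0 214130315) (% 0 3 (% 2 7 (! 22110 34530) (% 3 7 (% 2 9 (! 32210 4500) s84) ($ 2 3 6 7))) ($ 0 6 2 3)))) ($ 3 4 6 9))))) (% 1 10 (% 4 10 (% 1 6 (! 0 12134010250) (% 6 10 (! 20100 40305000030) s180)) ($ 0 4 5 10)) ($ 0 1 5 10)))) (% 0 9 (% 2 9 (% 0 2 (! 0 311201425) (% 2 6 (! 21210 4035000000) (% 3 6 (% 2 5 (! 0 2314210005) (% 2 7 (! 0 3124020105) (% 3 5 (!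 0 2314210005) (% 3 7 (% 0 3 (! 32210 4500) (% 3 8 (! 20010 300004500) ($ 0 8 3 7))) ($ 2 3 5 7))))) (% 0 3 (% 3 9 (% 2 7 (! 22110 34530) (% 3 7 (! 32210 4500) ($ 2 3 6 7))) (% 4 6 (! 0 213040115) (% 4 9 (! 0 4132052110) ($ 3 4 6 9)))) ($ 0 6 2 3))))) (% 2 7 (% 2 6 (! 0 314010225) (% 3 6 (! 0 2314010205) (% 3 9 (% 0 2 (! 0 312010425) (% 0 3 (! 22110 34530) ($ 0 6 2 3))) ($ 2 3 6 9)))) ($ 2 8 7 9))) ($ 0 8 7 9)))
  s279 = new 2 false 10 (! 0 314201521)
  s280 = % 1 6 (% 1 8 (% 3 5 (! 20010 400503030) (% 2 5 (% 0 2 (! 32100 45) (% 2 4 (% 2 7 (! 32110 450) (% 3 7 (! 10000 423200050) (% 2 9 (new 5 true 10 (% 0 10 (! 0 314211052) (% 1 5 (! 32010 400050) (% 1 10 (! 1000 20000320453) ($ 0 1 5 10))))) (% 3 9 (% 0 3 (! 0 22043115) (% 0 9 (! 0 412311053) (% 1 3 (! 20010 400303050) (% 1 9 (% 3 8 (! 0 413201251) (% 5 9 (! 0 4223100051) (% 8 9 (! 0 2413100250) ($ 3 9 5 8)))) ($ 0 1 3 9))))) ($ 2 3 7 9))))) ($ 0 4 2 5))) (% 2 7 (% 0 2 (! 32100 45) (% 2 6 (! 32110 4000050) ($ 0 6 2 7))) (% 3 7 (% 2 8 (% 2 9 (! 21100 3453) (% 7 8 (! 21100 430000050) (% 8 9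 (new 2 false 10 (! 0 11214300350)) ($ 2 8 7 9)))) (% 3 8 (new 2 false 10 (! 0 314201251)) ($ 2 3 5 8))) ($ 2 3 5 7))))) (% 1 5 (% 1 3 (! 32010 400050) (% 3 5 (! 10000 2403053) (% 1 4 (% 2 5 (! 0 123412050) (% 2 7 (! 10000 23400052) (% 3 7 (! 10000 23400052) ($ 2 3 5 7)))) ($ 1 5 3 4)))) (% 0 8 (% 2 5 (! 10000 423500002) (% 2 8 (% 3 5 (! 10000 403502002) (% 2 7 (% 0 2 (! 0 223100145) (% 2 6 (! 0 314200521) ($ 0 6 2 7))) (% 3 7 (% 0 3 (! 10000 223000045) (% 3 8 (! 0 423005112) (% 7 8 (new 2 false 10 (! 0 241301253)) ($ 0 8 3 7)))) ($ 2 3 5 7)))) ($ 1 2 5 8))) ($ 0 1 5 8)))) (% 1 8 (% 1 5 (! 21010 403500000) (% 2 5 (% 2 6 s271 (% 2 9 (% 0 2 (! 21000 345) (% 2 4 (% 1 3 (new 5 true 10 (% 1 10 (! 1000 20000320453) (% 3 5 (! 21010 403500000) (% 3 10 (! 0 11123452) ($ 1 3 5 10))))) (% 3 7 (new 5 true 10 (% 3 5 (! 21010 403500000) (% 3 10 (! 0 21134521) (% 4 10 (% 0 10 (! 21000 30000000345) (% 1 10 (! 2010 33040500000) ($ 0 1 5 10))) ($ 3 4 5 10))))) ($ 1 7 3 6))) ($ 0 4 2 5))) (% 1 9 (% 1 3 (% 0 2 (! 0 3124500312) (% 2 4 (% 2 7 (! 32110 450) (% 3 7 (! 0 2030045211)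 (% 3 9 (% 3 5 (! 21010 403500000) (% 3 8 (! 32100 400000050) (% 5 9 (! 0 3202104150) (% 8 9 (! 0 3210014250) ($ 3 9 5 8))))) ($ 2 3 7 9)))) ($ 0 4 2 5))) (% 3 7 (% 0 2 (! 10000 422300053) (% 2 4 (% 4 6 (! 0 314152020) (% 4 9 (! 0 4031120251) ($ 2 4 6 9))) ($ 0 4 2 5))) ($ 1 7 3 6))) ($ 1 2 6 9)))) (% 2 6 (% 2 8 (! 22110 300000450) (% 3 5 (! 21010 403500000) (% 3 8 (% 1 3 (! 32100 400000050) (% 3 7 (% 2 4 (! 32110 450) (% 2 7 (! 12110 30000450) (% 4 6 (! 0 130245212) ($ 2 6 4 7)))) ($ 1 7 3 6))) ($ 2 3 5 8)))) ($ 1 2 5 6)))) (% 7 8 (% 1 5 (! 10000 423500002) (% 2 5 (! 10000 423500002) (% 2 8 (% 2 6 (% 0 8 s279 ($ 0 1 5 8)) ($ 1 2 5 6)) ($ 1 2 5 8)))) ($ 1 7 6 8)))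
  s281 = % 3 5 (% 3 8 (! 32100 400500000) (% 2 6 (% 0 8 (! 20100 403500000) (% 1 8 (! 20100 403500000) (% 1 5 (% 1 6 (! 10000 4302052) (% 7 8 (! 10000 423500002) ($ 1 7 6 8))) ($ 0 1 5 8)))) (% 2 8 (% 2 9 (% 1 8 (! 11110 322002450) (% 7 8 (! 22210 430003500) (% 1 6 (% 0 8 (! 0 413502112) (% 1 5 (! 10000 3402052) ($ 0 1 5 8))) ($ 1 7 6 8)))) (% 3 9 (% 1 6 (% 0 8 (! 10000 403502002) (% 1 5 (! 10000 3402052) (% 1 8 (! 20010 400503030) ($ 0 1 5 8)))) (% 1 9 (% 1 8 (% 0 3 (% 2 5 s197 (% 1 5 (% 2 7 (! 22110 34530) (% 7 8 (! 0 1231400050) (% 8 9 (new 2 false 10 (! 0 13012403251)) ($ 2 8 7 9)))) ($ 1 2 5 6))) (% 0 2 (% 2 5 (! 10 2200304500) (% 2 7 (! 22110 34530) ($ 0 2 5 7))) ($ 0 6 2 3))) (% 7 8 (% 2 5 (! 0 2341500210) (% 1 5 (% 1 4 (! 33210 45000) (% 4 9 (! 0 2430151200) (% 8 9 (! 0 2031412051) ($ 1 9 4 8)))) ($ 1 2 5 6))) ($ 1 7 6 8))) ($ 1 2 6 9))) ($ 2 3 6 9))) ($ 2 3 6 8)))) (% 4 6 (% 2 6 (% 1 8 (% 2 5 s271 (% 2 8 (! 22110 300000450) (% 3 8 (new 3 false 11 (% 5 11 (! 20100 403500000) (% 6 11 (! 30210 405000000) ($ 3 11 5 6)))) ($ 2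 3 5 8)))) (% 1 5 (% 2 5 s275 (% 3 8 (! 20100 403500000) (% 2 8 (% 1 6 (! 11110 223000450) (% 7 8 (! 0 1431250002) ($ 1 7 6 8))) ($ 2 3 5 8)))) (% 0 8 (% 2 5 (! 10000 423500002) (% 2 8 s279 ($ 1 2 5 8))) ($ 0 1 5 8)))) (% 2 5 (% 7 8 (! 10 430252000) (% 1 6 (% 0 8 (! 10000 423500002) (% 1 5 (! 0 23410152) (% 1 8 (% 0 2 (! 32100 45) (% 0 3 (! 0 412310053) ($ 0 6 2 3))) ($ 0 1 5 8)))) (% 1 8 (% 2 9 (% 0 2 (! 21000 345) (% 2 4 (% 0 3 (! 0 120312453) ($ 0 6 2 3)) ($ 0 4 2 5))) (% 3 9 (% 2 8 (! 0 304252101) (% 3 8 (! 210 300045000) ($ 2 3 6 8))) ($ 2 3 6 9))) ($ 1 7 6 8)))) ($ 2 3 5 6))) ($ 3 4 5 6))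
  s282 = % 0 9 (! 210 4300005000) (% 1 3 (! 32100 400000050) (% 1 9 (! 0 4201003153) ($ 0 1 3 9)))
  s283 = % 2 4 (! 20010 300004500) ($ 2 8 4 7)
  s284 = % 2 6 (% 2 7 (! 11110 243000520) (% 3 5 (! 33210 400005000) (% 3 7 (% 2 9 (! 0 4135200210) (% 1 8 (% 3 6 (! 0 314005212) (% 3 9 s282 (% 4 6 (% 2 5 s271 (new 2 false 10 (% 9 10 (! 11210 3405000000) (% 7 10 (% 0 2 (! 2110 345) (% 0 10 (! 0 10312100245) (% 2 4 (! 32110 450) (% 4 10 (! 0 12134050002) ($ 0 4 2 10))))) ($ 2 10 7 9))))) (% 4 9 (% 1 4 (! 20100 403030050) (% 1 9 (! 0 4032010152) (% 2 4 (! 32110 450) ($ 1 2 4 9)))) ($ 3 4 6 9))))) (% 2 8 s283 (% 1 9 (% 1 5 (! 0 3142100052) (% 2 5 (% 0 2 (! 0 2314110025) (% 2 4 (% 4 9 (! 0 2314102530) ($ 2 4 8 9)) ($ 0 4 2 5))) ($ 1 2 5 8))) ($ 1 2 8 9))))) (% 2 5 (% 2 9 (! 0 4135200210) (% 3 9 (% 1 8 s271 (% 2 8 (! 0 2413100520) (% 1 9 (% 0 2 (! 0 1204002315) (% 2 4 (! 0 3415112002) ($ 0 4 2 5))) ($ 1 2 8 9)))) ($ 2 3 7 9))) ($ 2 3 5 7))))) (% 3 6 (% 1 3 (! 22100 304005000) (% 1 8 (% 1 6 (! 32110 4000050) (% 1 9 (! 0 4132100052) (% 2 9 (% 2 7 (!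 32110 450) (% 3 5 (! 33210 400005000) (% 3 7 (! 0 314005212) (% 2 5 (% 0 2 (! 21000 345) (% 5 6 (! 0 2143500210) ($ 0 6 2 5))) ($ 2 3 5 7))))) ($ 1 2 6 9)))) (% 3 7 (% 1 6 (! 21110 43000050) (% 2 8 (% 1 9 (! 0 2143105200) (% 2 9 (! 0 143205212) ($ 1 2 6 9))) ($ 1 2 6 8))) ($ 1 7 3 8)))) (% 0 2 (% 2 7 (% 1 6 (! 20100 304000005) (% 1 8 (! 2110 345) (% 2 8 (! 0 311200425) ($ 1 2 6 8)))) (% 3 7 (% 1 6 (! 20100 304000005) (% 2 8 s283 (% 1 8 (% 2 9 (! 21000 345) (% 3 9 s282 ($ 2 3 6 9))) ($ 1 2 6 8)))) ($ 2 3 6 7))) ($ 0 6 2 3)))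
  s285 = % 5 9 (! 2010 3040500000) ($ 1 5 6 9)
  s286 = new 3 false 10 (% 0 3 (! 210 300004005) (% 0 10 (! 0 10213001425) (% 6 10 (! 22100 304000005) ($ 0 6 3 10))))
  s287 = % 7 8 (% 1 6 (! 21110 43000050) (% 1 8 (! 11110 342000250) (% 2 6 (% 1 5 (! 0 435200211) (% 2 8 (! 11110 423000520) (% 2 5 (% 0 2 (! 0 324100125) (% 2 4 (% 3 6 (! 0 435102120) (% 4 6 (! 0 23140521) (% 3 9 (% 0 3 (! 0 2304201125) (% 0 9 (! 0 2304201115) (% 1 3 (! 32110 450) (% 1 9 (% 5 9 (! 12110 4035000000) (% 8 9 (! 0 3405102112) ($ 1 9 5 8))) ($ 0 1 3 9))))) (% 4 9 (% 5 9 (! 12110 4035000000) (% 8 9 (! 0 3124302510) ($ 4 9 5 8))) ($ 3 4 6 9))))) ($ 0 4 2 5))) ($ 1 2 5 8)))) (% 2 8 (% 2 7 (! 22210 340000500) (% 3 6 (% 3 5 (! 0 435201012) (% 3 7 (! 0 243005111) (% 2 5 (% 0 2 (! 0 1304002125) (% 5 6 (! 0 2341500210) ($ 0 6 2 5))) ($ 2 3 5 7)))) (% 3 7 (% 0 2 (! 0 213003415) (% 0 3 (! 23210 40005000) ($ 0 6 2 3))) ($ 2 3 6 7)))) ($ 1 2 6 8))))) (% 8 9 (% 0 3 (! 33210 400005000) s284) (% 0 9 (% 3 7 (% 1 6 (! 21110 43000050) (% 2 6 (% 1 8 (! 0 2314200015) (% 2 8 (! 0 1304021205) (% 1 5 (%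 1 9 (! 12110 4035000000) (% 5 6 (! 22100 403500000) s285)) (% 2 5 (% 0 2 (% 3 6 (! 0 132004513) s286) (% 2 4 (% 0 3 (! 0 311224005) (% 2 9 (! 12110 4035000000) (% 3 9 (% 5 9 (! 0 3124021005) ($ 0 9 2 5)) ($ 0 9 2 3)))) ($ 0 4 2 5))) ($ 1 2 5 8))))) (% 1 8 (% 1 9 (! 12110 4030000050) (% 2 9 (! 21110 43000350) ($ 1 2 6 9))) (% 2 8 (% 2 7 (! 10 2230004500) (% 2 9 (% 0 2 (! 10 320004502) (% 0 3 (! 32210 4500) (% 3 6 (! 0 1304002125) ($ 0 6 2 3)))) ($ 2 8 7 9))) ($ 1 2 6 8))))) (% 3 9 (% 3 6 (! 100 2304205000) (% 2 6 (% 1 8 (! 0 2314200015) (% 1 3 (% 2 7 (! 11110 243000520) (% 2 5 (% 0 2 s286 s270) (% 3 5 (% 0 3 (! 0 221003145) (% 5 6 (! 0 1304201025) ($ 0 6 3 5))) ($ 2 3 5 7)))) ($ 1 7 3 8))) (% 2 7 (% 1 6 (! 21110 43000050) (% 2 9 (! 210 4330005000) (% 1 9 (% 1 3 (! 0 3012010245) (% 1 8 (! 0 3012010245) ($ 1 7 3 8))) ($ 1 2 6 9)))) ($ 2 3 6 7)))) ($ 3 8 7 9))) ($ 0 8 7 9)))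
  s288 = % 2 8 (! 22210 430000500) ($ 1 2 5 8)
  s289 = % 2 8 (! 22110 300000450) ($ 0 8 2 7)
  s290 = % 1 6 (% 8 9 (% 0 2 (! 0 223100145) (% 0 3 (! 33210 400005000) (% 2 6 (% 1 5 (! 0 423501012) (% 1 8 (! 32110 4000050) (% 2 5 (! 10000 423500002) (% 2 8 (! 0 113002452) ($ 1 2 5 8))))) (% 3 6 (% 1 3 (! 20010 400305030) (% 1 8 (% 2 5 (! 10000 423500002) (% 2 7 ($ 0 6 2 7) (% 3 5 (! 0 423501012) (% 3 7 (! 0 314005212) ($ 2 3 5 7))))) (% 3 7 (% 1 5 (! 0 423501012) (% 2 5 (! 10000 423500002) (% 2 8 (! 0 324005112) ($ 1 2 5 8)))) ($ 1 7 3 8)))) ($ 0 6 2 3))))) (% 0 9 (% 1 3 (! 0 1003021245) (% 1 8 (! 0 302110145) (% 3 7 (% 1 5 (! 0 423501012) (% 2 8 (! 0 113020245) (% 2 5 (% 0 2 (! 0 223100145) (% 2 4 (! 0 1003042125) ($ 0 4 2 5))) ($ 1 2 5 8)))) ($ 1 7 3 8)))) ($ 0 8 7 9))) (% 1 8 (% 1 5 (! 0 2413500021) (% 2 6 (% 8 9 (% 2 5 s271 (% 3 5 (! 32100 400500000) (% 2 7 (% 0 2 (! 0 322100145) s289) (% 3 7 (% 0 3 (! 33210 400005000) (% 3 6 (! 0 324005112) ($ 0 6 3 7))) ($ 2 3 5 7))))) (% 0 9 (% 0 2 (! 0 322100145) (% 0 3 (! 0 310221245) (% 2 9 (! 32110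 450) (% 3 9 (% 2 5 s270 (% 2 7 s289 (% 3 5 (! 0 311220245) (% 3 7 (% 3 6 (! 0 2314105020) ($ 0 6 3 7)) ($ 2 3 5 7))))) ($ 0 9 2 3))))) ($ 0 8 7 9))) (% 2 5 (% 0 2 (! 0 322100145) (% 2 4 (% 0 3 (! 0 113242005) (% 3 6 (% 0 9 (! 0 113242025) (% 8 9 (! 0 413501212) ($ 0 8 7 9))) ($ 0 6 2 3))) ($ 0 4 2 5))) ($ 1 2 5 6)))) ($ 1 7 6 8))
  s291 = % 5 9 (! 0 3124100025) ($ 0 9 3 5)
  s292 = % 2 7 (% 1 3 (! 22110 3450) (% 0 3 (% 7 8 (! 0 2314210025) (% 8 9 (! 0 2314110025) (% 0 9 (% 1 6 (! 21110 43000050) (% 1 9 (! 0 3214110025) (% 2 6 (! 11110 34002520) (% 2 9 (new 1 false 10 (! 0 3124000125)) ($ 1 2 6 9))))) ($ 0 8 7 9)))) (% 1 5 (% 1 6 (! 21110 43000050) (% 2 6 (! 11110 34002520) (% 1 9 (% 0 9 (! 0 3012010245) (% 7 8 (! 0 3425300011) (% 8 9 (! 0 4123100350) ($ 0 8 7 9)))) (% 2 9 (% 5 6 (! 10000 42300052) (% 5 9 (! 0 4123100530) ($ 1 5 6 9))) ($ 1 2 6 9))))) ($ 0 1 3 5)))) (% 7 8 (% 2 9 (% 1 3 (! 21110 3450) (% 0 3 (% 0 9 (! 0 2314200015) (% 3 7 (! 32210 4500) (% 3 9 (! 0 2104003125) ($ 0 3 7 9)))) (% 1 5 (% 1 6 (!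 21110 43000050) (% 1 9 (! 0 4123300150) (% 5 6 (! 0 1342500110) s285))) ($ 0 1 3 5)))) (% 3 7 (% 0 3 (! 0 2314210025) (% 1 3 (! 21210 43005000) (% 1 5 (! 20210 340500000) ($ 0 1 3 5)))) (% 3 9 (% 1 6 (! 21110 43000050) (% 1 9 (! 0 2435101200) (% 2 6 (% 0 3 (! 0 324010125) (% 0 9 (! 0 2314200015) (% 1 3 (! 22110 3450) ($ 0 1 3 9)))) ($ 1 2 6 9)))) ($ 2 3 7 9)))) (% 2 4 (% 2 9 (% 0 3 (! 0 2104023105) (% 1 3 (! 21110 3450) (% 1 5 (% 0 9 (% 3 9 (! 0 3014012025) s291) (% 8 9 (% 3 9 (! 0 3012014520) (% 4 9 (! 0 4123102530) ($ 3 4 8 9))) ($ 0 8 7 9))) ($ 0 1 3 5)))) (% 8 9 (% 2 6 (! 0 314102512) (% 4 6 (! 0 43251012) (% 4 9 (! 0 3425010201) ($ 2 4 6 9)))) ($ 2 8 7 9))) ($ 2 8 4 7)))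
  s293 = % 1 3 (! 21000 345) (% 1 5 (! 21100 345) ($ 0 1 3 5))
  s294 = % 2 7 (! 11110 43020520) (% 2 9 (! 21210 3045000000) ($ 2 8 7 9))
  s295 = % 5 6 (! 0 2103042105) (% 6 7 (! 0 2103042105) ($ 0 6 5 7))
  s296 = % 2 4 (! 22210 34500) ($ 1 2 4 6)
  s297 = % 2 6 (% 5 6 (% 8 9 (! 20100 403500000) (% 7 8 (% 0 2 (! 0 314210025) (% 0 3 (! 0 314210025) (% 2 8 (% 1 3 (! 22110 3450) (% 1 5 (! 0 240311251) ($ 0 1 3 5))) ($ 0 8 2 3)))) (% 0 9 (% 5 9 (! 0 3224100015) (% 0 3 (% 1 8 (% 1 3 (! 0 201023145) (% 1 4 (! 0 102031245) ($ 1 8 3 4))) (% 1 6 (% 1 5 (! 0 112330045) (% 2 8 (! 0 112030345) (% 2 5 (% 0 2 (! 0 112001345) (% 2 9 (! 21110 3000450) ($ 0 9 2 5))) ($ 1 2 5 8)))) (% 6 7 (% 1 5 (! 0 3342500011) (% 2 5 (! 0 1042531300) (% 2 8 s294 ($ 1 2 5 8)))) ($ 1 7 6 8)))) (% 1 5 (% 1 6 (! 0 112330045) (% 1 8 (! 0 311220045) (% 6 7 (! 0 3342500011) ($ 1 7 6 8)))) (% 1 3 (% 0 2 (! 21000 4300035) (% 2 8 (! 22110 3450) ($ 0 8 2 3))) ($ 0 1 3 5))))) ($ 0 8 7 9)))) (% 0 3 (% 6 7 (% 7 8 (! 0 314220015) (% 8 9 (! 0 1304221005) (% 0 9 (% 5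 9 (! 0 3224110005) (% 1 8 (! 0 314220015) (% 2 8 s294 (% 1 5 (% 1 4 (! 0 2021030145) (% 1 6 (! 22210 40030350) ($ 1 5 4 6))) (% 2 5 (% 0 2 (! 0 14220315) (% 2 9 (! 21210 4035000000) ($ 0 9 2 5))) ($ 1 2 5 8)))))) ($ 0 8 7 9)))) ($ 0 6 5 7)) ($ 0 6 3 5))) (% 2 8 (% 2 9 (% 0 3 (% 1 4 (! 0 112030245) (% 1 6 (! 0 113020245) (% 2 4 s295 ($ 1 2 4 6)))) (% 0 2 s293 ($ 0 6 2 3))) (% 3 9 (% 0 3 (% 1 4 (! 0 112030245) (% 1 6 (! 0 113020245) s296)) (% 5 6 (% 0 2 (% 2 5 (! 0 1210324501) (% 2 7 (% 1 4 (! 0 2113040025) (% 1 6 (! 0 13210245) s296)) ($ 0 2 5 7))) ($ 0 6 2 3)) ($ 0 6 3 5))) ($ 2 3 6 9))) ($ 2 3 6 8))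
  s298 = % 3 8 (% 6 7 s287 (% 5 6 (% 7 8 (% 3 6 (% 1 5 (! 0 423501012) (% 1 6 (% 2 5 (! 0 413500212) (% 3 5 (! 0 423501012) (% 3 7 (! 0 314005212) (% 2 7 (% 1 8 (! 0 1431200052) s288) ($ 2 3 5 7))))) (% 2 5 (% 1 3 (! 0 304115202) (% 3 7 (! 0 304115202) ($ 1 7 3 6))) (% 2 6 (% 1 3 (! 0 324005211) (% 3 7 (% 1 8 (! 0 234005113) (% 2 8 (! 0 312004511) ($ 1 2 5 8))) ($ 1 7 3 6))) ($ 1 2 5 6))))) (% 3 5 (% 0 2 (! 10 320405200) (% 0 3 (! 12100 30405003) (% 2 6 (% 1 5 (! 22100 403500000) (% 1 3 (% 2 4 (! 10 320405200) (% 2 7 (! 12110 30000450) (% 4 6 (! 0 240311253) ($ 2 6 4 7)))) ($ 0 1 3 5))) ($ 0 6 2 3)))) (% 4 6 (% 2 6 (% 2 5 (% 0 2 (! 22100 304000005) (% 2 4 (% 2 7 (! 0 123400512) (% 2 9 (! 0 1213400520) (% 3 7 (! 0 1340225101) (% 3 9 (! 0 102341503) ($ 2 3 7 9))))) ($ 0 4 2 5))) (% 2 7 (% 1 5 (! 22100 403500000) (% 1 8 (! 12110 30000450) s288)) (% 3 7 (% 0 3 (! 23210 40005000) ($ 0 6 3 7)) ($ 2 3 5 7)))) (% 2 5 (% 0 2 (! 0 314210025) (% 0 3 (! 0 314210025) ($ 0 6 2 3))) ($ 2 3 5 6))) ($ 3 4 5 6)))) (% 4 6 s290 ($ 4 7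 6 8))) ($ 0 6 5 7))) (% 3 5 (% 3 6 (% 6 7 (% 2 8 s292 (% 0 3 (% 1 6 (! 10000 4203025) (% 1 8 (% 0 9 (! 0 2314200015) (% 7 8 (! 0 312001245) (% 8 9 (! 10000 204203005) ($ 0 8 7 9)))) (% 2 6 (% 8 9 (! 10000 204203005) (% 0 9 (% 1 5 (% 1 9 (! 0 3112200045) (% 5 6 (! 22100 4305000) (% 5 9 (! 0 3124100025) ($ 1 5 6 9)))) (% 2 5 (% 0 2 (! 0 104012315) (% 2 4 (! 0 214123015) ($ 0 4 2 5))) ($ 1 2 5 8))) (% 7 8 (% 2 7 (! 0 1204103215) (% 3 7 (! 0 2314210025) ($ 2 3 7 8))) ($ 0 8 7 9)))) ($ 1 2 6 8)))) (% 0 2 (% 2 7 (% 1 3 (! 2110 345) (% 1 5 (% 1 6 (! 21110 43000050) (% 1 8 (! 100 304002025) (% 2 6 (! 0 12210345) ($ 1 2 6 8)))) ($ 0 1 3 5))) (% 2 5 (% 2 9 s293 (% 0 9 (% 3 7 (! 0 2141305210) (% 3 9 (% 2 6 (! 0 2003014521) (% 5 6 (! 0 1143502120) (% 5 9 (! 0 4131205310) ($ 2 5 6 9)))) ($ 2 3 7 9))) ($ 0 2 7 9))) ($ 0 2 5 7))) ($ 0 8 2 3)))) (% 5 6 (% 1 8 (! 0 423501012) (% 1 6 (% 0 3 (! 10000 4203025) (% 1 3 (! 21110 3004050) (% 1 5 (! 10000 2403053) ($ 0 1 3 5)))) (% 7 8 (% 3 7 (! 20210 340500000) (% 1 3 (%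 1 5 (! 0 423502011) (% 2 5 (! 0 204325101) (% 2 8 (% 2 6 (! 22110 3450) ($ 1 2 5 6)) ($ 1 2 5 8)))) ($ 1 7 3 6))) ($ 1 7 6 8)))) ($ 0 6 5 7))) (% 4 6 s297 ($ 3 4 6 8))) ($ 3 4 5 8))
  s299 = new 2 false 10 (! 0 11321400253)
  s300 = % 4 9 (new 2 false 10 (! 0 13020012452)) ($ 0 4 2 9)
  s301 = % 0 8 (! 10000 403502002) (! 10000 3402052)
  s302 = % 2 5 (% 0 2 (% 0 9 (! 0 2010032145) (% 2 7 (! 0 210310452) (% 2 9 (! 0 3012200451) ($ 0 2 7 9)))) (% 2 4 (% 1 8 (! 21010 403500000) (% 2 8 (! 0 210310452) (% 2 6 (% 2 7 (! 22210 40030500) (% 2 9 (! 0 2201300451) (% 3 7 (! 0 2001032451) (% 3 9 (% 3 5 (! 33210 45000) (% 5 9 (! 0 2001302451) (% 8 9 (! 0 1021302452) ($ 3 9 5 8)))) ($ 2 3 7 9))))) (% 1 6 (% 2 9 (! 0 2201301450) (% 4 6 (! 0 14310252) (% 4 9 (! 21010 3300400050) ($ 2 4 6 9)))) ($ 1 2 6 8))))) ($ 0 4 2 5))) (% 2 8 (% 7 8 (! 0 1423500112) (% 8 9 (! 0 2413500121) (% 2 7 (% 6 7 (! 0 3342500111) (% 0 2 s299 (% 2 6 (% 0 8 s279 (new 0 false 10 (% 8 10 (! 20100 403500000) (% 2 10 (% 0 9 (! 0 1122030245) (% 7 10 (! 0 20310210453) (% 9 10 (! 10 23340020500) ($ 0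 10 7 9)))) ($ 0 10 2 8))))) ($ 0 6 2 7)))) (% 2 9 (% 3 5 (% 0 2 s299 (% 0 9 (% 0 8 (! 0 2100032145) (% 5 9 (! 0 1022031245) ($ 0 9 5 8))) (% 2 4 (% 2 6 (! 0 2001032451) (% 4 6 (! 0 1001023453) ($ 2 4 5 6))) s300))) (% 3 7 (% 0 3 (! 22210 30045000) (% 1 3 (% 0 2 s299 (% 0 9 (! 2110 4050030300) (% 2 4 (! 0 1010023450) s300))) ($ 0 1 3 7))) ($ 2 3 5 7))) ($ 2 8 7 9))))) (% 3 5 (% 1 6 s301 (% 1 8 (! 21010 403500000) (% 2 6 (new 2 false 10 (% 5 10 (! 21000 30004500003) (% 8 10 (! 20100 304500000) ($ 2 10 5 8)))) ($ 1 2 6 8)))) ($ 2 3 5 8)))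
  s303 = new 5 true 10 (% 0 10 (! 21000 330045) (% 4 10 (! 2100 34000050030) ($ 0 4 5 10)))
  s304 = new 7 true 11 (! 0 2130142510)
  s305 = new 3 false 10 (% 6 10 (! 33210 4050000) (% 8 10 (! 20100 304500000) ($ 3 10 6 8)))
  s306 = % 2 6 (% 1 8 (! 20100 403500000) (% 8 9 (! 100 2403502000) (% 1 4 (% 3 9 (! 33210 45000) (% 4 6 s305 (% 4 9 (% 3 7 (! 22210 30045000) (% 2 7 (new 3 false 10 (% 1 3 (new 5 true 11 (% 0 11 (! 21000 330045) (% 4 11 (! 2100 304000050030) ($ 0 4 5 11)))) (% 1 10 (! 21010 3300400050) (% 9 10 (! 0 3021041152) ($ 1 9 3 10))))) (% 2 9 (% 2 4 (! 0 2001031451) (% 6 7 (! 0 3021040251) ($ 2 6 4 7))) ($ 2 3 7 9)))) ($ 3 4 6 9)))) (% 4 9 (% 2 4 (% 2 7 s304 (% 2 9 (! 0 4213101520) (% 3 7 (! 0 3124513002) (% 3 9 (new 3 false 10 (! 22100 3435000)) ($ 2 3 7 9))))) (% 2 7 (% 2 8 (new 3 false 10 (% 6 10 (! 10 3024203500) (% 8 10 (! 0 3124213500) ($ 3 10 6 8)))) ($ 1 2 4 8)) ($ 1 2 4 7))) ($ 1 9 4 8))))) (% 2 8 (% 3 9 (% 1 4 (! 33210 45000) (% 2 4 (! 22110 34500) (% 2 7 (% 0 2 (% 1 8 (! 32100 45) (% 4 9 (! 10 2230304500) (% 8 9 (new 3 false 10 (% 6 10 (! 0 20011134532) (% 8 10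 (! 0 1213425300) ($ 3 10 6 8)))) ($ 1 9 4 8)))) (% 0 3 (% 6 7 (% 1 8 (! 20100 403500000) (% 4 9 (! 0 3021245001) (% 8 9 (! 0 2034121035) ($ 1 9 4 8)))) ($ 0 6 2 7)) ($ 0 6 2 3))) ($ 1 2 4 7)))) (% 2 9 (% 4 9 (% 0 2 (% 1 4 (! 0 1021030245) (% 2 4 (! 0 1021040325) (% 2 7 (! 10 3340502200) ($ 1 2 4 7)))) (% 0 3 (% 0 9 (! 0 3211040125) (% 3 7 s82 ($ 0 3 7 9))) ($ 0 6 2 3))) (% 4 6 (% 1 3 (! 0 120314251) (% 1 4 (% 0 2 (! 22100 30045) (% 0 3 (! 0 1002031245) ($ 0 6 2 3))) ($ 1 9 3 4))) ($ 3 4 6 9))) ($ 2 3 6 9))) ($ 2 3 6 8))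
  s307 = % 0 2 (! 22100 30045) (% 0 3 (! 1100 2000032045) ($ 0 6 2 3))
  s308 = % 1 3 s10 ($ 1 5 3 4)
  s309 = % 3 6 (% 1 4 (% 3 8 (! 21010 403500000) s302) (% 2 7 (% 1 6 (! 10000 24300052) (% 1 8 (! 21010 403500000) (% 2 8 (% 4 9 (% 1 3 s303 (% 3 5 (% 6 7 (! 0 3342511000) (% 0 2 (new 5 true 10 (! 0 14325210031)) (% 2 6 (new 5 true 10 (% 0 10 (! 21000 4330005) (% 4 10 (new 7 true 11 (! 0 113241023500)) ($ 0 4 5 10)))) ($ 0 6 2 7)))) ($ 1 5 3 4))) (% 8 9 (% 1 3 (! 0 2413500121) (% 3 9 (% 3 5 (! 0 1203405210) ($ 1 5 3 4)) ($ 1 9 3 4))) ($ 1 9 4 8))) (% 2 6 (% 2 4 (% 1 3 (! 0 1031242501) (% 3 5 s304 ($ 1 5 3 4))) ($ 1 2 4 8)) ($ 1 2 6 8))))) (% 2 4 (% 3 5 (% 1 3 (! 10000 2304052) (% 4 9 (% 3 7 (! 0 123415002) (% 3 9 (! 0 3212145000) (% 2 9 (% 2 5 (! 0 4215103230) (% 2 6 (! 0 3004012521) (% 4 6 (! 0 3004051212) ($ 2 4 5 6)))) ($ 2 3 7 9)))) (% 3 9 (% 1 8 (! 21010 403500000) (% 8 9 (! 0 4203105210) ($ 1 9 4 8))) ($ 1 9 3 4)))) (% 1 3 (% 1 8 (! 21010 403500000) (% 4 9 s303 (% 8 9 (% 1 6 (! 32010 400050) (% 2 8 (! 0 2413500121)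 (% 2 6 (% 2 5 (! 21000 300450) (% 3 8 (! 21010 403500000) ($ 2 3 5 8))) ($ 1 2 6 8)))) ($ 1 9 4 8)))) ($ 1 5 3 4))) ($ 1 2 4 7)))) (% 3 5 (% 3 8 (! 32100 400500000) s306) (% 4 6 (% 2 6 (% 1 8 (! 20100 403500000) (% 4 9 (! 100 4203050020) (% 8 9 (! 10210 3405000000) (% 1 4 (% 3 8 (! 20100 403500000) s305) ($ 1 9 4 8))))) (% 2 5 (% 1 6 (! 0 24310152) (% 1 4 s307 (% 2 4 s308 ($ 1 2 4 6)))) ($ 2 3 5 6))) ($ 3 4 5 6)))
  s310 = % 3 8 (! 32100 400000050) ($ 2 3 5 8)
  s311 = % 1 4 (% 4 9 (! 0 3021040251) (% 3 9 (% 3 5 (! 33210 45000) (% 3 8 (! 210 300045000) (% 5 9 (! 0 4135211002) (% 8 9 (! 0 3415212002) ($ 3 9 5 8))))) (% 3 6 (% 1 6 (! 22210 45030300) (% 3 5 (% 3 7 (! 22210 30045000) (% 2 7 (new 5 true 10 (% 2 5 (! 0 10312452) (% 2 10 (! 31210 4000500) (% 6 10 (! 11110 20034020520) ($ 2 6 5 10))))) (% 2 9 (% 0 2 (! 0 1004013235) (% 0 9 (! 0 2034010135) (% 2 4 (! 0 2001032451) ($ 0 4 2 9)))) ($ 2 3 7 9)))) (% 1 3 (% 3 8 (! 2100 3300040050) (% 2 5 (% 0 2 (! 32100 45) (% 2 4 (! 21000 300450) ($ 0 4 2 5))) (% 2 8 (% 2 7 (! 0 3342100511) (% 2 9 (!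 0 3112200451) (% 7 8 (! 0 1435200112) (% 8 9 (! 0 3425100211) ($ 2 8 7 9))))) ($ 2 3 5 8)))) ($ 1 5 3 6)))) (% 4 6 (% 2 7 (! 0 1034250012) (% 3 7 (! 2110 34050000) (% 2 9 (% 0 2 (! 22100 30045) (% 0 9 (! 21210 4035000000) (% 2 4 (! 0 2021030451) ($ 0 4 2 9)))) ($ 2 3 7 9)))) ($ 3 4 6 9))))) (% 2 7 (% 1 3 (% 2 4 (! 31210 4000500) (% 1 8 (% 2 5 (% 0 2 (! 32100 45) ($ 0 4 2 5)) (% 2 8 (! 0 2312100450) (% 3 5 (! 22100 403003050) s310))) (% 2 8 (% 1 6 (! 32110 4000050) (% 3 6 (! 0 3342100511) (% 3 8 (! 0 2413012500) ($ 1 3 6 8)))) ($ 1 2 4 8)))) (% 3 5 (% 3 9 (% 3 6 (! 11110 23024500) (% 0 3 (% 1 8 (! 10000 422300052) (% 4 9 (! 0 3021045201) (% 8 9 (! 0 2043012511) ($ 1 9 4 8)))) ($ 0 6 3 5))) (% 4 9 (% 2 4 (! 31210 4000500) (% 2 8 (! 0 2143012500) (% 1 8 s303 ($ 1 2 4 8)))) ($ 1 9 3 4))) ($ 1 5 3 4))) (% 2 4 (% 3 5 (% 1 3 (! 10000 200304250) (% 3 9 (% 3 6 (! 11110 22034500) (% 0 3 (% 1 8 (! 22100 403503000) (% 4 9 (! 0 4232151001) (% 8 9 (! 0 3415212002) ($ 1 9 4 8)))) ($ 0 6 3 5))) (% 4 9 (% 2 9 (! 0 4021030521) (% 3 7 (!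 11110 20034520) ($ 2 3 7 9))) ($ 1 9 3 4)))) (% 1 3 (% 2 5 (% 0 2 (! 32100 45) (! 21000 300450)) (% 3 7 (! 21110 34000530) ($ 2 3 5 7))) ($ 1 5 3 4))) ($ 1 2 4 7)))
  s312 = % 4 10 (! 2100 33000040050) ($ 0 4 5 10)
  s313 = new 5 true 10 (% 0 10 (! 0 22013110045) (% 4 10 (! 22100 30003040050) ($ 0 4 5 10)))
  s314 = new 5 true 10 (% 0 10 (! 0 3142050112) (% 4 10 (! 0 23042150011) ($ 0 4 5 10)))
  s315 = new 5 true 10 (% 0 10 (! 0 20300411251) (% 4 10 (! 0 20300411251) ($ 0 4 5 10)))
  s316 = % 2 8 (% 3 6 (% 1 3 (% 8 9 (! 0 3425100211) (% 1 4 (new 5 true 10 (% 0 10 (! 1000 33002200045) s312)) (% 1 8 (new 5 true 10 (% 0 10 (! 1000 33002200045) (% 6 10 (% 2 5 (! 0 120310452) (% 2 10 (! 0 1310212450) (% 3 5 (! 22100 303004050) (% 3 10 (! 0 20121003452) ($ 2 3 5 10))))) ($ 0 6 5 10)))) (% 4 9 s303 ($ 1 9 4 8))))) (% 1 4 (% 1 6 s313 (% 3 5 (new 5 true 10 (% 0 10 (! 0 23342500111) (% 6 10 (% 4 10 (! 3210 40000050000) ($ 0 4 5 10)) ($ 0 6 5 10)))) ($ 1 5 3 6))) (% 3 5 (% 4 9 s314 (% 3 9 (% 8 9 (! 0 4023015211) (% 1 8 s315 ($ 1 9 4 8))) ($ 1 9 3 4))) ($ 1 5 3 4)))) (% 3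 9 (% 1 4 s276 (% 3 5 (% 0 3 (% 1 8 s315 (% 4 9 (new 3 false 10 (! 0 13121045200)) (% 8 9 (new 3 false 10 (% 3 7 (% 2 4 (! 32210 4500) (! 22210 30004500)) (% 6 10 (! 22210 43003500) (% 7 10 (! 0 24213015300) ($ 3 10 6 7))))) ($ 1 9 4 8)))) ($ 0 6 3 5)) s308)) (% 2 9 (% 4 6 (! 0 4232010510) (% 4 9 (% 0 2 (! 0 4031020521) (% 0 3 (! 0 4132012500) ($ 0 6 2 3))) ($ 3 4 6 9))) ($ 2 3 6 9)))) (% 3 6 (% 1 8 (% 1 6 (! 32110 4000050) (% 1 3 (% 2 5 (! 0 1345200312) (% 3 5 (! 22100 303004050) s310)) (% 3 5 (% 4 9 s314 (% 1 4 (new 5 true 10 (% 0 10 (! 0 1301241052) s312)) (% 3 9 (new 5 true 10 (% 0 10 (! 1000 33002200045) (% 6 10 (% 4 10 (! 0 22101435030) ($ 0 4 5 10)) ($ 0 6 5 10)))) ($ 1 9 3 4)))) ($ 1 5 3 6)))) (% 1 6 (% 1 4 s313 (% 4 9 s314 (% 8 9 (! 0 3124200150) ($ 1 9 4 8)))) ($ 1 2 6 8))) (% 3 8 (% 1 3 s10 (% 3 5 (! 32100 400500000) (% 1 4 (% 0 2 (! 11000 2232045) (% 0 3 (! 33210 400005000) ($ 0 6 2 3))) ($ 1 5 3 4)))) ($ 2 3 6 8)))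
  s317 = % 0 2 (! 20100 3000045) ($ 0 6 2 5)
  s318 = % 0 3 (! 22210 30045000) ($ 0 1 3 7)
  s319 = % 1 8 (! 32100 45) (% 2 8 (% 1 3 (! 32100 45) (% 1 4 s261 (% 3 5 (! 10 320204500) ($ 1 5 3 4)))) ($ 1 2 6 8))
  s320 = % 1 6 (! 20100 3000045) s319
  s321 = % 0 9 (! 0 2013010145) (% 7 8 (! 0 2435100012) (% 8 9 (! 0 3124100052) ($ 0 8 7 9)))
  s322 = % 6 7 (% 2 6 (% 1 3 (% 1 6 (! 32110 4000050) (% 3 6 (! 100 2304225000) (% 3 7 (% 0 9 (! 12110 4035000000) (% 7 8 (% 1 4 (! 0 1340205211) (% 2 4 (! 21110 34000530) s63)) (% 8 9 (% 1 4 (! 2100 4300030050) (% 2 4 (! 21110 34000530) (% 2 7 (! 0 1043002512) ($ 1 2 4 7)))) ($ 0 8 7 9)))) ($ 1 3 6 7)))) (% 1 4 (% 1 6 (! 22210 45030300) (% 4 6 (! 0 1143251002) (% 1 8 (% 0 9 (! 0 2314211005) (% 7 8 (! 0 1435200012) (% 8 9 (! 0 3412200051) ($ 0 8 7 9)))) ($ 1 4 6 8)))) (% 3 5 (% 0 3 (! 10 320405002) (% 3 6 (! 100 2304205000) (% 5 6 (! 22100 403500000) ($ 0 6 3 5)))) ($ 1 5 3 4)))) (% 2 7 (% 3 9 (% 0 2 s320 (% 2 8 (% 0 3 (! 10 320004502) (% 3 6 (! 0 2314205100) ($ 0 6 2 3))) (% 7 8 (% 3 6 (! 0 2314205100) (%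 0 3 (% 1 6 (! 0 435100212) (% 1 8 (! 0 1302001245) ($ 1 2 6 8))) ($ 0 6 2 3))) ($ 0 8 2 7)))) (% 3 6 (% 0 9 (! 0 2304201015) (% 7 8 (% 1 6 (! 0 2435100012) (% 1 8 (! 0 1435200012) (% 2 8 (! 22210 430000500) ($ 1 2 6 8)))) (% 8 9 (% 1 3 (! 0 4123300152) (% 1 4 (! 0 4123300152) (% 3 5 (! 32100 400500000) ($ 1 5 3 4)))) ($ 0 8 7 9)))) (% 2 9 (% 0 2 s320 (% 0 3 (! 32210 4500) ($ 0 6 2 3))) ($ 2 3 6 9)))) (% 1 6 (% 0 2 (! 20100 3000045) (% 0 3 (! 0 1203001245) (% 3 6 s321 ($ 0 6 2 3)))) ($ 1 2 6 7)))) (% 5 6 (% 4 6 (% 0 9 (! 0 3224100015) (% 8 9 (! 0 2413500021) (% 7 8 (% 1 6 (! 0 1124300052) (% 1 8 (! 0 1421300052) (% 2 6 (! 22100 403500000) (% 2 8 (% 1 3 (! 0 1423500112) (% 1 4 (! 0 1423500112) (% 3 5 (! 0 2341512000) ($ 1 5 3 4)))) ($ 1 2 6 8))))) ($ 0 8 7 9)))) (% 7 8 (% 3 5 (! 0 2341512000) (% 3 6 (% 1 3 (! 0 1314225100) (% 1 8 (! 0 1421300052) (% 3 9 (! 0 1314225000) (% 8 9 (! 21010 403500000) ($ 1 9 3 8))))) ($ 3 4 5 6))) ($ 4 7 6 8))) ($ 0 6 5 7))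
  s323 = % 6 7 (% 1 6 s321 (% 2 7 (% 2 8 (% 0 9 (% 0 3 (! 0 3214010125) (% 3 9 (! 0 4123015210) (% 5 9 (! 2210 3040500000) ($ 0 9 3 5)))) (% 7 8 (% 3 9 (! 0 3425101300) (% 1 3 (% 1 8 (! 0 321001452) (% 3 7 (! 20210 340500000) ($ 1 3 7 8))) (% 1 4 (% 1 8 (! 0 1435200012) (% 4 6 (! 0 342053101) ($ 1 4 6 8))) (% 4 9 (% 5 9 (! 2010 3040500000) (% 8 9 (! 20010 340500000) ($ 4 9 5 8))) ($ 1 9 3 4))))) (% 8 9 (% 3 9 (! 0 4123015200) (% 4 9 (new 5 true 10 (! 0 13245210001)) ($ 3 4 8 9))) ($ 0 8 7 9)))) (% 0 2 (% 0 9 (! 0 3214110025) (% 7 8 (! 0 2314220015) (% 8 9 (! 20100 304000005) ($ 0 8 7 9)))) (% 7 8 (% 0 3 (! 0 2314220015) ($ 0 8 2 3)) ($ 0 8 2 7)))) (% 2 6 (% 1 4 (% 4 6 (! 0 1143251002) (% 1 8 (% 0 2 (! 32100 45) (% 0 3 (! 0 2004023115) (% 2 8 (! 0 1301002452) ($ 0 8 2 3)))) ($ 1 4 6 8))) (% 2 4 (% 0 2 (! 0 1004013235) (% 0 3 (! 0 1004013225) (% 2 8 (% 1 3 (! 21110 3004500) (% 4 9 (! 0 2241351003) (% 3 9 (% 0 9 (! 11210 4003005000) (% 8 9 (! 0 4123015200) ($ 0 8 3 9))) ($ 1 9 3 4)))) ($ 0 8 2 3)))) ($ 1 2 4 7)))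 ($ 1 2 6 7)))) (% 5 6 (% 0 9 (! 0 3224100015) (% 8 9 (! 0 2413500021) (% 7 8 (% 1 8 (! 0 2412300051) (% 2 7 (% 0 2 (! 0 1314210025) (% 2 6 (% 0 3 (! 10000 4203025) (% 2 8 (! 0 402103513) ($ 0 8 2 3))) ($ 0 6 2 7))) (% 3 7 (! 20210 340500000) (% 3 9 (! 0 1214325000) (% 2 9 (% 1 4 (% 1 6 (! 0 1124300052) (% 4 6 (! 0 413512002) ($ 1 4 6 8))) (% 2 4 (% 1 3 (! 10000 2304052) (% 4 9 (! 2210 4050300300) ($ 1 9 3 4))) ($ 1 2 4 7))) ($ 2 3 7 9)))))) ($ 0 8 7 9)))) ($ 0 6 5 7))
  s324 = % 4 9 (! 3210 4000050000) ($ 1 4 6 9)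
  s325 = % 1 6 (! 0 1124300152) (% 4 6 (! 10100 2030245) s324)
  s326 = % 5 6 (% 3 5 (% 3 8 (! 32100 400500000) (% 2 8 (% 8 9 (! 22110 3400000500) (% 5 9 (% 2 4 (! 10 4230203500) (% 2 7 (! 2210 3040500000) (% 1 4 (% 1 6 s301 (% 4 6 (! 0 4013512002) s324)) ($ 1 2 4 7)))) (% 0 8 (% 1 4 (! 0 302142015) (% 2 4 (! 0 1302042105) (% 2 7 (% 0 2 (! 0 302102415) (% 2 6 (! 20100 403500000) (% 6 7 (! 0 2314010205) ($ 0 6 2 7)))) ($ 1 2 4 7)))) ($ 0 9 5 8)))) (% 2 6 (% 0 8 (! 20100 403500000) (% 5 9 (! 1000 3004220005) (% 8 9 (! 100 2403502000) ($ 0 9 5 8)))) (% 3 6 (% 1 6 s301 (% 1 8 (! 21010 403500000) ($ 1 2 6 8))) ($ 2 3 6 8))))) (% 3 6 (% 3 8 (! 21010 403500000) (% 2 8 (% 1 4 s325 (% 1 3 (% 0 8 (! 0 1314200125) (% 8 9 (! 22110 3400000500) (% 5 9 (% 2 4 (! 10 4330202500) (% 2 7 (! 2210 3040500000) ($ 1 2 4 7))) ($ 0 9 5 8)))) ($ 1 5 3 4))) (% 2 5 (% 1 4 s325 (% 1 8 (! 21010 403500000) (% 2 4 (% 1 3 (% 0 8 (! 0 322141015) (% 5 9 (! 2210 3000400500) (% 8 9 (% 1 6 (! 32010 400050) (% 2 6 (! 21000 300450) ($ 1 2 6 8))) ($ 0 9 5 8)))) ($ 1 5 3 4)) ($ 1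 2 4 8)))) ($ 2 3 5 8)))) (% 4 6 (% 1 4 (! 10100 2030245) (% 1 3 (% 0 2 (! 32100 45) (% 0 3 (! 0 203141025) (% 2 6 (! 11110 3224000520) ($ 0 6 2 3)))) ($ 1 5 3 4))) ($ 3 4 5 6)))) (% 6 7 (% 2 6 (! 21210 4035000000) (% 2 7 (% 1 6 (! 11110 4235000200) (% 5 9 (! 2210 3040500000) ($ 1 5 6 9))) (% 1 6 (% 3 7 (! 2110 4035000000) (% 3 6 (% 2 5 s317 (% 3 5 (% 0 8 (! 0 2314210005) (% 5 9 (! 0 3024011125) (% 8 9 (! 11210 3405000000) ($ 0 9 5 8)))) ($ 2 3 5 7))) ($ 2 3 6 7))) ($ 1 2 6 7)))) ($ 0 6 5 7))
  s327 = % 9 10 (! 32110 4005000000) ($ 1 10 7 9)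
  -- Here a 0 is adjacent to neither b 0 nor b 2, while b 4 is adjacent to both a 0 and, if the
  -- first question is affirmed, a 2; otherwise `$ 1 2 7 9` forces a 2 to be adjacent to b 2.
  s328 = % 2 9 (% 4 8 s326 (% 0 8 (% 3 8 (% 5 6 (% 3 6 (! 0 304221015) (% 4 6 (! 0 1423501012) (% 3 5 (% 6 7 (! 22100 403500000) (% 7 8 (! 0 2341512000) ($ 4 7 6 8))) ($ 3 4 5 6)))) (% 6 7 (% 1 6 (! 0 4135210102) (% 2 6 (! 21210 4035000000) (% 2 7 (% 0 2 s319 (% 0 3 (! 32210 4500) (% 3 6 (! 0 4135210102) ($ 0 6 2 3)))) ($ 1 2 6 7)))) ($ 0 6 5 7))) (% 3 5 (% 3 6 (% 5 6 (% 0 3 (! 0 204325011) (% 3 9 (! 0 3104002125) (% 5 9 (! 0 3114220005) ($ 0 9 3 5)))) (% 6 7 (% 0 3 (! 0 3124010125) (% 3 9 (! 0 3104002125) s291)) ($ 0 6 5 7))) (% 4 6 (% 6 7 (! 21210 4035000000) (% 5 6 (% 1 4 (! 10100 2030245) (% 2 4 (! 0 2103042105) (% 2 7 (! 0 3114020205) ($ 1 2 4 7)))) ($ 0 6 5 7))) ($ 3 4 6 8))) ($ 3 4 5 8))) ($ 0 4 5 8))) (% 2 7 (% 2 6 (% 1 6 (! 10100 3020245) (% 5 9 (! 2210 3040500000) (% 5 6 (% 4 8 (% 0 8 (! 20100 403500000) (% 8 9 (% 1 8 (! 20100 403500000) (% 2 8 (! 0 2413100520) ($ 1 2 8 9)))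 ($ 0 9 5 8))) (% 0 8 (% 3 5 (% 0 3 (% 3 6 (! 0 204325011) (% 3 8 (! 0 1304221005) (% 4 6 (% 0 2 (! 0 110123425) (% 7 8 (! 0 1314220005) (% 2 8 (new 1 false 10 (% 7 10 (! 0 1210134532) s327)) ($ 0 8 2 7)))) ($ 3 4 6 8)))) (% 3 9 (% 3 8 (! 0 1304221005) (% 0 2 (% 3 6 (! 0 2003014521) (% 4 6 s267 ($ 3 4 6 8))) (% 2 8 (% 3 6 (! 0 3312104500) (% 4 6 (new 1 false 10 (% 7 10 (! 0 3120214531) s327)) ($ 3 4 6 8))) ($ 0 8 2 3)))) ($ 0 9 3 5))) (% 3 8 (% 0 2 (! 22100 304000005) (% 2 8 (! 0 413200521) (% 7 8 (! 0 1314220005) ($ 0 8 2 7)))) ($ 3 4 5 8))) ($ 0 4 5 8))) ($ 1 5 6 9)))) (% 1 6 (% 5 6 (! 10000 24300052) (% 6 7 (% 1 3 (! 32110 4000050) (% 1 4 (! 0 2013010245) (% 4 6 (! 10100 3020245) (% 3 6 (% 3 5 (% 0 2 (! 20100 3000045) (% 0 3 (! 10000 3202045) (% 3 9 (new 1 false 10 (! 0 12003011245)) ($ 0 9 2 3)))) ($ 1 5 3 4)) ($ 1 6 3 4))))) ($ 0 6 5 7))) ($ 1 2 6 9))) ($ 1 2 7 9))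
  s329 = % 1 9 (% 4 8 (% 5 6 s309 (% 6 7 (% 2 6 s311 (% 2 7 s316 (% 1 6 (% 3 6 (% 1 3 (! 32110 4000050) (% 1 4 (% 2 5 s317 (% 3 5 (% 3 7 (! 22210 30045000) (% 3 9 (! 33210 45000) (% 2 9 (% 0 2 (! 20100 3000045) (% 0 9 (! 22110 3004000050) (% 2 4 (! 0 2001031452) (% 4 9 (! 0 3002042151) ($ 0 4 2 9))))) ($ 2 3 7 9)))) (% 3 7 s318 ($ 2 3 5 7)))) (% 3 5 (% 2 4 (% 3 9 (! 22100 4035030) (% 4 9 (! 0 3024010251) ($ 1 9 3 4))) ($ 1 2 4 7)) ($ 1 5 3 4)))) (% 3 7 (% 1 3 (! 32110 4000050) (% 4 6 (! 0 34251012) (% 1 4 s318 ($ 1 6 3 4)))) ($ 2 3 6 7))) ($ 1 2 6 7)))) ($ 0 6 5 7))) (% 0 8 (% 3 8 s322 (% 3 5 (% 3 6 s323 (% 4 6 (% 2 6 (% 5 6 (% 0 9 (! 0 3224100015) (% 8 9 (! 20100 403500000) (% 7 8 (% 1 4 (! 0 2341512002) (% 2 4 (! 0 2341512002) (% 2 7 (% 0 2 (! 0 204102315) (% 0 3 (! 0 1314210025) (% 2 8 (! 0 430211521) ($ 0 8 2 3)))) ($ 1 2 4 7)))) ($ 0 8 7 9)))) (% 0 3 (% 1 4 (! 0 1002031245) (% 1 6 (! 0 1002031345) ($ 1 5 4 6))) ($ 0 6 3 5))) (% 2 8 (% 1 4 s307 (% 2 7 (% 2 4 (! 22210 30040500)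 (% 1 6 (% 0 2 (! 0 1122000345) (% 0 3 (! 0 1003021245) ($ 0 6 2 3))) ($ 1 2 4 6))) (% 2 4 (% 3 9 (! 22210 34500) (% 2 9 (% 0 2 (! 0 1120041325) (% 0 3 s295 ($ 0 6 2 3))) ($ 2 3 6 9))) ($ 1 2 4 7)))) ($ 2 3 6 8))) ($ 3 4 6 8))) ($ 3 4 5 8))) ($ 0 4 5 8))) (% 0 9 s328 ($ 0 1 7 9))
  -- The case in which a 0 and b 0 are not adjacent. Since b 0 is not adjacent to a 4, the edge a 0
  -- a 4 together with an edge from b 0 to b 2 or b 3 would be an induced 2K2 unless that vertex of
  -- b is adjacent to a 0 or a 4. The leaves `$ 0 4 5 7` and `$ 0 4 5 8` express this.
  s330 = % 0 7 (% 4 8 (% 3 7 s178 (% 3 5 (% 3 8 (! 33210 400005000) s201) (% 4 7 (% 2 7 (% 2 8 (% 0 8 (new 5 true 10 (% 0 10 (% 4 10 (! 0 10300242125) (% 3 10 (% 6 10 (! 3210 40000000005) (% 3 6 (% 5 6 (! 0 10304201125) s202) (% 3 9 (% 3 8 (% 0 2 (! 210 430003005) (% 0 3 (! 32100 400000005) (% 2 6 (! 0 10301024521) ($ 0 6 2 3)))) s203) (% 4 6 (! 210 300040005) (% 4 9 (% 3 8 (! 0 310042125) s203) ($ 3 4 6 9)))))) ($ 3 4 5 10))) (% 4 10 (% 0 2 (! 0 10300242125) (% 0 3 (! 0 130242105) (% 2 6 (! 0 130242125) (% 3 6 (! 0 12231040105) ($ 0 6 2 3))))) ($ 0 4 5 10))))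 s208) s211) (% 2 5 s217 ($ 2 3 5 7))) ($ 3 4 5 7)))) (% 0 8 (% 3 8 (% 0 3 (! 210 300004005) s243) (% 3 5 s269 ($ 3 4 5 8))) ($ 0 4 5 8))) (% 4 7 (% 1 7 (% 4 8 (% 6 7 (% 1 8 (% 1 6 (! 32110 4000050) s273) (% 1 5 (% 2 6 (% 2 7 (! 11110 243000520) (% 3 5 s274 (% 2 5 s275 (% 3 7 (% 1 4 (% 1 6 (! 11110 34020250) (% 4 6 (! 2110 34050000) (% 4 9 (! 0 2041030251) (% 1 9 (% 3 9 (! 0 2030045112) (% 3 6 (% 1 3 (! 0 20134151) (% 5 6 (! 10000 32400052) ($ 1 5 3 6))) ($ 3 4 6 9))) ($ 1 4 6 9))))) (% 1 3 (% 2 4 (! 32110 450) (% 2 8 (% 1 6 (! 11110 34020250) (% 3 6 (! 0 221003451) (% 3 8 (! 0 211003452) ($ 1 3 6 8)))) ($ 1 2 4 8))) ($ 1 5 3 4))) ($ 2 3 5 7))))) s277) (% 0 8 (% 2 8 s278 (% 2 5 (% 2 6 (% 0 9 (! 0 2314210005) (% 7 8 (! 10000 435200002) (% 8 9 (% 0 2 (! 0 2314010025) (% 2 4 (% 0 3 (! 0 2314010025) (% 3 8 (% 1 9 (! 0 3142152003) (% 2 9 (! 0 4123200510) ($ 1 2 8 9))) ($ 0 8 2 3))) ($ 0 4 2 5))) ($ 0 8 7 9)))) (% 1 6 (% 0 2 (! 20100 304000005) (% 5 6 (! 10000 432500003) ($ 0 6 2 5))) ($ 1 2 6 8))) ($ 1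 2 5 8))) ($ 0 1 5 8)))) (% 5 6 (% 3 6 s280 s281) ($ 0 6 5 7))) (% 0 8 s298 ($ 0 4 5 8))) (% 1 5 s329 ($ 0 1 5 7))) ($ 0 4 5 7))

  -- The assumed non-adjacency of b 0 and a 4 makes the p-parent of b 0 a vertex outside the walks,
  -- ready to be added by `new`. It also forces adjacencies: if b 0 is not adjacent to a 3 either,
  -- then every neighbour of b 0 has to be adjacent to a 3 or a 4, because a 3 and a 4 are adjacent.
  -- This gives the leaves `$ 3 4 5 7` and `$ 3 4 5 8`.
  switch-tree : Tree
  switch-tree = % 0 5 (% 3 5 (new 5 true 10 s35) (% 3 7 (% 3 8 s67 (% 4 8 (% 2 8 (% 3 6 s78 (% 7 8 (% 1 5 (! 20010 340500000) (% 2 5 (! 21100 340500000) (% 2 7 (! 22210 430000500) (% 1 7 (% 0 3 (% 2 9 (! 32210 4500) (% 2 6 (% 5 6 (! 21000 3400005) (% 6 7 (% 4 6 (! 0 203041125) (% 4 9 s79 (% 3 9 (% 5 9 (! 0 2413021520) (% 8 9 (! 0 3204031125) ($ 3 9 5 8))) ($ 3 4 6 9)))) ($ 2 6 5 7))) (% 3 9 (% 1 6 (! 21100 340000053) (% 1 9 (% 5 9 (! 0 3141025120) (% 8 9 (! 0 3240015210) ($ 3 9 5 8))) ($ 1 2 6 9))) ($ 2 3 6 9)))) (% 0 2 (% 2 9 s80 (% 0 7 (% 2 6 (% 5 6 (! 32100 400005) (% 6 7 (! 2110 34000005) ($ 2 6 5 7))) (% 3 9 (% 1 6 (! 21100 340000053)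 (% 1 9 (% 1 8 s66 (% 5 9 (! 12110 3040000305) (% 8 9 (! 0 3240015210) ($ 1 9 5 8)))) ($ 1 2 6 9))) ($ 2 3 6 9))) (% 0 9 (% 6 7 (% 2 6 (! 0 214200315) (% 3 9 s81 ($ 2 3 6 9))) ($ 0 6 3 7)) ($ 0 2 7 9)))) ($ 0 5 2 3))) ($ 1 2 5 7))))) (% 6 7 s85 ($ 3 7 6 8)))) (% 2 5 s93 ($ 2 3 5 8))) ($ 3 4 5 8))) (% 4 7 (% 2 5 s135 (% 2 7 s154 ($ 2 3 5 7))) ($ 3 4 5 7)))) s330

  n0 = % 1 4 (! 33210 4050000) ($ 1 9 3 4)
  n1 = % 2 7 (! 0 2030124521) (% 1 9 n0 (% 2 9 (new 1 false 11 (! 0 3024110521)) ($ 1 2 7 9)))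
  n2 = % 1 9 n0 (% 2 7 (! 0 3224511) (% 2 9 (! 21110 3004500) ($ 1 2 7 9)))
  n3 = % 2 7 (! 32210 40000500) ($ 1 2 4 7)
  n4 = % 4 8 (! 2100 43035) ($ 1 8 4 7)
  n5 = % 1 4 (! 2100 30045) n4
  n6 = % 8 9 (! 10210 304050000) ($ 2 9 4 8)
  n7 = % 5 6 (! 0 220131245) (% 5 9 (! 0 220131245) ($ 1 5 6 9))
  n8 = % 2 7 (% 2 9 (! 21210 3004000500) (% 0 2 (% 3 5 (! 0 1020321405) (% 3 8 (% 7 8 (! 1000 2020300405) (% 8 9 (% 1 8 n5 (% 1 9 (% 0 3 (! 2210 3405) (% 0 8 (! 0 1212300405) (% 1 3 (! 0 1121300425) ($ 0 1 3 8)))) ($ 1 2 8 9))) ($ 3 8 7 9))) (% 4 8 (% 0 8 (! 210 300040005) (% 1 8 (% 7 8 (! 21100 340500000) (% 1 9 (% 1 3 (! 0 1211200345) (% 1 4 (! 2100 30045) ($ 1 9 3 4))) (% 8 9 ($ 2 3 8 9) ($ 1 8 7 9)))) (% 1 6 (% 1 4 (! 33210 4050000) (% 2 4 (! 21000 300405) ($ 1 2 4 8))) ($ 0 1 6 8)))) ($ 3 4 5 8)))) (% 0 3 (% 3 5 (! 0 2010314205) (% 3 8 (% 8 9 (! 33210 400005000) (% 7 8 (% 0 8 (! 0 320401125) (% 1 6 (! 0 1240301521) (% 1 8 (new 0 false 10 (% 2 10 (! 0 20230401135) (% 6 10 (! 0 21425330011) ($ 0 10 2 6)))) ($ 0 1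 6 8)))) ($ 3 8 7 9))) (% 4 8 (% 0 8 (! 10000 322400025) (% 3 6 (% 1 8 (% 5 6 (! 20100 403500000) (% 6 7 (! 0 1123340025) ($ 3 6 5 7))) (% 1 6 (% 1 4 (! 33210 4050000) (% 2 4 (! 22210 30040500) ($ 1 2 4 8))) ($ 0 1 6 8))) ($ 0 3 6 8))) ($ 3 4 5 8)))) ($ 0 9 2 3)))) (% 2 9 (% 2 4 (! 21210 3004000500) (% 1 4 (% 1 6 (! 33210 4050000) (% 1 8 (% 1 9 (! 2110 3003040050) (% 7 8 (! 2210 4050030300) (% 8 9 (! 11210 3405000000) ($ 1 8 7 9)))) (% 0 8 (% 4 8 n6 (% 1 5 (% 1 9 (! 0 2110032145) n7) ($ 1 4 5 8))) ($ 0 1 6 8)))) ($ 1 2 4 7))) ($ 2 3 7 9))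
  n9 = % 6 7 (! 21210 3004000500) ($ 1 6 4 7)
  n10 = % 0 3 (! 210 300004005) (% 0 7 (! 1000 2030400205) (% 1 3 (! 0 120401325) ($ 0 1 3 7)))
  n11 = % 4 8 (% 0 2 (% 2 9 (! 21000 300405) (% 3 7 (% 1 8 (! 1000 20300425) (% 2 4 (! 21000 300405) (% 1 4 (% 0 3 (! 0 10223415) (% 0 7 (! 12110 3040500300) (% 1 3 (! 1000 20300425) ($ 0 1 3 7)))) ($ 1 2 4 8)))) (% 2 7 (% 2 4 (! 21000 300405) (% 7 8 (! 21100 340500000) (% 4 7 (% 0 8 (! 10000 322400025) (% 1 8 (% 4 9 (! 0 3121140025) (% 3 6 (% 3 5 (! 0 1020321405) (% 5 6 (! 32100 400005) (% 6 7 (! 10000 423500023) ($ 3 6 5 7)))) ($ 3 4 6 9))) (% 1 6 (% 1 5 (! 32100 400005) (% 5 6 (! 32100 400005) (% 6 7 (! 22210 43000500) ($ 1 6 5 7)))) ($ 0 1 6 8)))) ($ 2 7 4 8)))) ($ 2 3 7 9)))) (% 2 4 (% 4 9 (! 21000 3000400305) (% 3 6 (% 3 7 (% 0 3 (! 21110 3004500) (% 0 7 (! 1000 2030400205) (% 1 3 (! 0 102034512) ($ 0 1 3 7)))) (% 4 7 (% 0 3 (% 2 7 (! 0 2040132501) (% 2 9 (% 0 8 (! 0 311242015) (% 1 8 (! 22100 405003030) (% 1 6 (% 1 4 (! 0 3124100521) (% 6 7 (new 0 false 10 (! 0 13141253002)) ($ 1 6 4 7))) ($ 0 1 6 8))))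 ($ 2 3 7 9))) (% 2 9 (% 3 5 (% 1 3 (! 22100 304005030) (% 1 6 (% 1 4 (! 0 103012452) n9) ($ 0 1 3 6))) (% 5 6 (% 1 3 (! 0 3114200512) (% 1 6 (% 1 4 (! 0 22130451) n9) ($ 0 1 3 6))) ($ 0 5 3 6))) ($ 0 9 2 3))) ($ 3 4 7 9))) ($ 3 4 6 9))) ($ 0 4 2 6))) (% 0 8 (% 3 8 (% 0 2 (% 2 9 (! 21000 400305) (% 3 7 n10 (% 2 7 (% 7 8 (! 0 321400125) (% 8 9 (! 10210 3400000005) ($ 3 8 7 9))) ($ 2 3 7 9)))) (% 2 4 (% 4 9 (! 21000 3000400305) (% 3 6 (% 0 3 (! 21110 3004500) (% 3 5 (! 0 200314521) (% 5 6 (! 22100 403500000) ($ 0 5 3 6)))) ($ 3 4 6 9))) ($ 0 4 2 6))) (% 3 5 (% 3 6 (% 0 2 (% 0 3 (! 0 100412315) (% 1 3 (! 0 200314521) (% 1 6 (% 1 5 (! 32100 400005) (% 5 6 (! 32100 400005) (% 6 7 (% 1 9 (! 0 1020401325) (% 2 7 (! 0 2141302500) (% 2 9 (! 21000 400305) ($ 1 2 7 9)))) ($ 1 6 5 7)))) ($ 0 1 3 6)))) (% 0 3 (% 2 4 (! 0 2113214500) ($ 0 4 2 6)) ($ 0 8 2 3))) ($ 3 4 6 8)) ($ 3 4 5 8))) ($ 0 4 6 8))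
  n12 = % 7 8 (! 0 2341510002) (% 8 9 (! 20100 403500000) ($ 0 8 7 9))
  n13 = % 0 7 (! 1000 2030420005) ($ 0 4 7 9)
  n14 = % 1 8 (! 20100 403500000) ($ 0 1 6 8)
  n15 = % 4 8 (% 2 4 (% 5 9 (% 2 9 (! 21000 3000400503) (% 3 7 (% 0 7 (! 0 3142511002) (% 0 3 (% 3 6 (! 0 1221034520) ($ 0 3 6 9)) (% 1 3 (% 3 6 (! 0 201034521) (% 3 8 (! 2100 4300050030) (% 6 7 (! 0 3142511002) (% 7 8 (! 0 2341521001) ($ 3 7 6 8))))) ($ 0 1 3 7)))) (% 2 7 (% 4 7 (! 0 2040312501) (% 3 5 (% 0 8 (% 0 2 (! 21000 400305) (% 0 3 (! 0 1200143205) (% 3 8 (! 32100 400500000) ($ 0 8 2 3)))) (% 1 6 (% 1 3 (! 32110 450) (% 1 4 (! 3210 4000050000) (% 3 6 (% 1 5 (! 21110 3453) (% 6 7 (! 30210 4000500) (% 5 6 (new 0 false 10 (! 0 4202153031)) ($ 1 6 5 7)))) ($ 1 6 3 4)))) (% 1 8 (new 0 false 10 (% 0 7 (! 0 120143235) (% 7 10 (! 32210 40000500) (% 9 10 (! 0 14030252103) ($ 0 10 7 9))))) ($ 0 1 6 8)))) ($ 3 4 5 7))) ($ 2 3 7 9)))) (% 5 6 (% 2 7 (! 21010 4300500) (% 2 9 (! 21000 3000400503) (% 3 7 (% 0 8 (! 20100 403500000) (% 1 6 (! 0 124301521) n14)) ($ 2 3 7 9)))) ($ 0 5 6 9))) (%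 0 2 (% 5 6 (! 32100 400005) (% 5 9 (% 1 4 (! 3210 40005) (% 1 8 (% 2 9 (! 21000 400305) (% 3 7 (! 0 1021410325) (% 2 7 (% 4 7 (! 0 2040312501) (% 7 8 (! 0 1030411235) ($ 2 7 4 8))) ($ 2 3 7 9)))) ($ 1 2 4 8))) ($ 0 5 6 9))) ($ 0 4 2 6))) (% 0 8 (% 5 9 (% 3 8 (% 3 5 (! 2100 4300530000) (% 3 7 (% 0 2 n10 (% 2 4 (% 0 3 (! 0 2200143105) (% 0 7 (! 0 2131421005) (% 1 3 (% 7 8 (! 0 1341512002) (% 8 9 (! 0 1233214500) ($ 0 8 7 9))) ($ 0 1 3 7)))) ($ 0 4 2 6))) (% 4 7 (% 6 7 (! 0 3042510102) (% 7 8 (% 0 2 (! 0 1233401520) (% 2 4 (! 0 1233401520) ($ 0 4 2 6))) ($ 4 7 6 8))) ($ 3 4 5 7)))) (% 3 5 (% 0 3 (! 100 4203523000) (% 0 2 (% 3 6 (% 2 9 (! 21000 400305) (% 3 7 (! 0 1203124520) (% 2 7 (% 0 7 (! 0 1031410205) (% 7 8 (! 12110 3040000503) (% 8 9 (! 100 3402502000) ($ 0 8 7 9)))) ($ 2 3 7 9)))) ($ 3 4 6 8)) ($ 0 8 2 3))) ($ 3 4 5 8))) (% 8 9 (% 5 6 (! 20100 403500000) ($ 0 5 6 9)) ($ 4 9 5 8))) ($ 0 4 6 8))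
  n16 = % 4 6 (% 1 9 (% 5 6 (% 0 7 (! 32100 400005) (% 4 9 (! 21000 3004500003) (% 4 7 (% 1 4 (% 1 6 (! 33210 4050000) (% 1 8 (% 3 8 (! 22100 403500000) (% 4 8 (! 20100 403500000) (% 3 5 (% 1 3 (! 0 20134251) (% 5 9 (! 2110 3003040050) (% 1 5 (% 2 7 (! 0 10213453) (% 2 9 (! 21000 300450) (% 3 7 (! 1000 3042250003) ($ 2 3 7 9)))) ($ 1 9 3 5)))) ($ 3 4 5 8)))) (% 0 8 n12 ($ 0 1 6 8)))) (% 1 3 (% 0 8 n12 (% 1 6 (! 32110 4000050) (% 1 8 (% 2 4 (! 0 1123241500) (% 2 7 (! 0 2241312500) ($ 1 2 4 7))) ($ 0 1 6 8)))) ($ 1 9 3 4))) ($ 0 4 7 9)))) (% 5 9 (% 4 9 (! 32110 4005000000) (% 3 5 (% 4 7 (% 1 4 (% 1 6 (! 33210 4050000) (% 1 8 (% 1 3 (! 0 20134251) (! 2110 3003040050)) (% 0 8 (% 0 7 (! 0 1132241005) (% 7 8 (! 2110 3043050000) (% 8 9 (! 0 3421511002) ($ 0 8 7 9)))) ($ 0 1 6 8)))) (% 1 3 (% 2 4 (! 0 20134521) (% 2 7 (% 0 8 (! 0 2141312500) (% 1 6 (! 32110 4000050) (% 1 8 (! 0 2141312500) ($ 0 1 6 8)))) ($ 1 2 4 7))) ($ 1 9 3 4))) (% 3 7 n13 ($ 3 4 7 9))) ($ 3 4 5 9))) ($ 0 5 6 9))) (% 1 6 (% 0 7 (% 1 5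 (! 32100 400005) (% 5 6 (! 32100 400005) (% 6 7 (% 2 7 (! 21110 45300030) (% 2 9 (% 5 9 (! 0 3045110202) ($ 0 5 6 9)) ($ 1 2 7 9))) ($ 1 6 5 7)))) ($ 0 1 7 9)) ($ 0 1 6 9))) (% 4 9 (% 1 9 n15 (% 1 6 (% 0 7 (% 5 6 (! 32100 400005) (% 5 9 (% 1 5 (! 32100 400005) (% 6 7 (% 2 7 (! 0 3042510102) (% 2 9 (! 0 3012401502) ($ 1 2 7 9))) ($ 1 6 5 7))) ($ 0 5 6 9))) ($ 0 1 7 9)) ($ 0 1 6 9))) ($ 0 4 6 9))
  n17 = % 1 3 (! 21110 3004050) ($ 0 1 3 7)
  n18 = % 0 7 (! 32100 400005) n17
  n19 = % 7 8 (! 32210 40000500) ($ 2 7 6 8)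
  n20 = % 2 4 (! 32110 4000000500) ($ 1 2 4 8)
  n21 = % 1 4 (! 3210 4000050000) (% 1 8 (! 21000 30345) n20)
  n22 = % 0 8 (% 0 2 (! 21000 400305) (% 0 3 (% 1 5 (! 32210 405000) (% 5 6 (! 32210 405000) (% 6 7 (% 3 7 (! 2110 3045000000) (% 4 9 (! 100 2304235000) (% 4 7 (% 1 4 (! 0 1211423005) (% 2 4 (! 0 211423015) (% 2 7 (! 0 211324520) ($ 1 2 4 7)))) ($ 3 4 7 9)))) ($ 1 6 5 7)))) (% 3 8 (% 5 6 (! 0 302421015) (% 6 7 (! 100 2304205000) (% 1 5 (% 7 8 (! 0 301405212) (% 8 9 (! 32100 400500000) (% 3 7 n18 ($ 3 8 7 9)))) ($ 1 6 5 7)))) ($ 0 8 2 3)))) (% 4 6 (% 5 6 (% 4 9 (! 32110 4005000000) (% 3 7 (% 0 3 (! 32210 405000) n18) (% 4 7 (% 1 4 (new 0 false 10 (! 0 10201423035)) (% 2 4 (new 0 false 10 (% 0 2 (! 21000 400305) (% 0 3 (! 32210 405000) (% 3 10 (! 0 12112343005) (% 2 10 (new 6 true 12 (new 7 true 13 (% 0 7 (! 32100 400005) (% 0 13 (! 0 11000032240135) (% 1 13 (! 21110 30000000003450) ($ 0 1 7 13)))))) ($ 0 10 2 3)))))) (% 2 7 (% 6 7 (! 0 2043510102) n19) ($ 1 2 4 7)))) ($ 3 4 7 9)))) (% 2 4 (% 3 7 (! 2110 4030030500) (% 4 9 (! 32110 4005000000) (% 4 7 (% 6 7 (! 0 3142153001)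 (% 1 5 (new 0 false 10 (% 0 2 (! 21000 400305) (% 0 3 (! 32210 405000) (% 2 10 (! 21110 3453) (% 3 10 (! 0 12113342005) ($ 0 10 2 3)))))) ($ 1 6 5 7))) ($ 3 4 7 9)))) ($ 2 5 4 6))) (% 4 8 (% 4 9 n21 (% 2 4 (% 4 7 (% 6 7 (new 0 false 10 (! 0 12131342005)) (% 1 4 (% 1 5 (! 0 10123453) (% 5 6 (new 0 false 10 (! 0 10211423035)) ($ 1 6 5 7))) ($ 1 6 4 7))) (% 3 7 (% 7 8 (! 0 101234512) (% 8 9 (! 0 101234512) ($ 4 8 7 9))) ($ 3 4 7 9))) (% 8 9 (% 1 4 (! 210 3400053000) (% 1 8 (% 3 7 (! 0 3425011120) (% 4 7 (! 0 3425011120) ($ 3 4 7 9))) ($ 1 2 4 8))) ($ 2 9 4 8)))) ($ 0 4 6 8)))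
  n23 = % 1 10 (! 2010 30000430005) (% 4 10 (! 21000 340305) ($ 1 4 5 10))
  n24 = % 8 9 (! 0 2413501012) ($ 3 8 7 9)
  n25 = % 3 7 (% 0 3 (new 6 true 12 (new 7 true 13 (% 0 7 (! 12010 3040000005) (% 0 13 (! 0 11000032204135) (% 1 13 (! 21110 30000004003050) ($ 0 1 7 13)))))) (% 5 6 (% 0 7 (! 12010 3040000005) (% 1 3 (% 4 8 (! 0 223104152) (% 3 8 (% 0 8 (! 0 403225011) (% 8 9 (! 0 203104152) ($ 0 9 3 8))) ($ 3 4 5 8))) ($ 0 1 3 7))) ($ 0 5 3 6))) (% 4 7 (% 6 7 (% 4 8 (% 4 9 n21 (% 8 9 (! 11210 3405000000) (% 2 4 (% 5 6 (! 0 3342511001) (% 0 3 (new 5 true 10 (% 3 10 (! 22100 4035030) (% 4 10 (! 21000 340305) ($ 3 4 5 10)))) ($ 0 5 3 6))) ($ 2 9 4 8)))) (% 3 8 (% 8 9 (! 11210 3405000000) (% 7 8 (% 1 8 (! 32110 4000050) (% 2 7 (! 32210 40000500) ($ 1 2 7 8))) ($ 3 8 7 9))) ($ 3 4 5 8))) (% 5 6 (% 4 6 (% 2 7 n19 (% 1 4 (% 1 5 (! 21110 3400050) (% 1 8 (! 0 223140051) (% 4 8 (% 4 9 (! 3210 4000050000) (% 8 9 (! 0 203140251) (% 2 4 (new 5 true 10 n23) ($ 2 9 4 8)))) ($ 1 4 5 8)))) (% 2 4 (% 3 8 (% 7 8 (! 2010 30340005) n24) (% 4 8 (new 5 true 10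 (% 4 10 (! 21000 340305) (% 3 10 (% 7 10 (! 0 23342150001) (% 9 10 (! 32110 4000000500) ($ 3 10 7 9))) ($ 3 4 5 10)))) ($ 3 4 5 8))) ($ 1 2 4 7)))) (% 1 4 (% 7 8 (! 1000 2020430305) (% 4 8 (% 4 9 (! 3210 4000050000) (% 8 9 (! 0 2413511002) (% 2 4 (new 5 true 10 (% 1 5 (! 21110 3400050) n23)) ($ 2 9 4 8)))) ($ 4 7 6 8))) ($ 1 6 4 7))) ($ 3 6 5 7))) ($ 3 4 5 7))
  n26 = % 0 2 (! 21000 400305) (% 8 9 (% 0 3 (! 21100 300400005) (% 3 8 (! 0 2413501200) ($ 0 8 2 3))) ($ 0 8 2 9))
  n27 = % 3 8 (! 2100 4300530000) ($ 0 8 2 3)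
  n28 = % 0 2 (! 21000 400305) (% 8 9 (% 0 3 (! 0 211403215) n27) ($ 0 8 2 9))
  n29 = % 6 7 (! 32110 4000050) ($ 1 6 5 7)
  n30 = % 4 9 (% 5 6 (% 0 7 (! 32100 400005) (% 1 9 (% 4 6 (! 21000 3004500003) (% 4 8 (% 2 4 (! 21000 3000400503) (% 1 8 (% 3 7 (! 0 4223100150) (% 4 7 (! 0 4223100150) (% 3 5 (% 1 3 (! 20010 300304050) (% 1 5 (! 21110 3400050) (% 5 9 (! 0 1403512020) ($ 1 9 3 5)))) ($ 3 4 5 7)))) (% 1 4 (% 1 5 (! 21110 3400050) (% 4 7 (! 0 4223100152) ($ 1 4 5 7))) ($ 1 2 4 8)))) (% 0 8 n26 ($ 0 4 6 8)))) ($ 0 1 7 9))) (% 5 9 (% 3 5 (% 0 7 (% 0 2 (! 21000 400305) (% 0 3 (! 100 200423005) (% 2 7 (! 0 2041301501) (% 3 7 (! 12010 3040500000) ($ 0 7 2 3))))) (% 1 9 (% 4 6 (! 32110 4005000000) (% 0 8 n28 (% 4 8 (% 1 4 (! 3210 4000050000) (% 2 4 (! 32110 4000000500) (% 1 8 (% 1 5 (! 21010 300400050) n29) ($ 1 2 4 8)))) ($ 0 4 6 8)))) ($ 0 1 7 9))) (% 0 3 (% 3 7 (% 0 7 (! 12010 3040500000) (% 1 9 (% 6 7 (! 2110 4035000000) (% 1 5 (% 1 3 (! 21100 3045) (% 1 4 (! 3210 4000050000) ($ 1 5 3 4))) ($ 1 6 5 7))) ($ 0 1 7 9))) (% 0 7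 (% 4 7 (! 0 3142510002) ($ 3 4 5 7)) ($ 0 3 7 9))) ($ 0 5 3 6))) ($ 0 5 6 9))) (% 4 6 (% 0 2 (! 21000 400305) (% 2 4 (% 4 7 (% 5 6 (% 0 7 (! 32100 400005) (% 1 9 (% 1 3 (% 1 5 (! 21110 3400050) (% 3 5 (! 21110 3004050) (% 3 7 (! 0 1123452) ($ 1 3 5 7)))) (% 1 4 (% 1 5 (! 21110 3400050) (% 1 8 (! 0 1002230451) (% 4 8 (! 0 4223100152) ($ 1 4 5 8)))) ($ 1 9 3 4))) ($ 0 1 7 9))) (% 5 9 (% 0 7 (! 0 3224151003) (% 1 9 (% 1 5 (! 0 2010301451) (% 6 7 (! 0 2043151002) ($ 1 6 5 7))) ($ 0 1 7 9))) ($ 0 5 6 9))) (% 3 7 (% 0 7 (! 1000 3042230005) ($ 0 4 7 9)) ($ 3 4 7 9))) ($ 0 4 2 9))) ($ 0 4 6 9))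
  n31 = % 2 4 (! 2210 4030030500) ($ 1 2 4 6)
  n32 = % 5 6 (! 12100 30403005) (% 6 7 (! 11210 304005000) ($ 3 6 5 7))
  n33 = % 0 2 (! 21000 400305) (% 3 8 (! 0 300211245) ($ 0 8 2 3))
  n34 = % 1 4 (! 1010 232045) n31
  n35 = new 0 false 10 (% 6 10 (! 10000 402303052) (% 8 10 (! 32100 400000050) ($ 0 10 6 8)))
  n36 = % 4 8 n35 ($ 0 4 6 8)
  n37 = % 0 3 (% 3 5 (% 4 8 (% 2 4 (! 0 100143225) (% 4 9 (! 0 1020423105) (% 8 9 (% 3 7 (! 0 101432315) (% 4 7 (% 1 4 (! 0 200423115) (% 2 7 (! 0 2010413205) ($ 1 2 4 7))) ($ 3 4 7 9))) ($ 2 9 4 8)))) (% 0 8 (% 1 3 (! 0 210403215) (% 1 4 (! 0 200423115) (% 3 8 (! 0 200403115) ($ 1 8 3 4)))) (% 4 6 (% 1 4 (! 0 200423115) (% 2 4 (! 0 2001043215) ($ 1 2 4 6))) ($ 0 4 6 8)))) (% 3 7 (% 3 8 (% 0 8 (! 12010 4330000005) (% 4 8 (! 33210 400005000) (% 4 6 (% 1 4 (! 0 102243015) n31) ($ 0 4 6 8)))) (% 4 8 (% 7 8 (! 22210 340005300) (% 1 3 (% 1 9 (! 0 3001021245) (% 8 9 (! 0 101132345) ($ 1 8 7 9))) ($ 1 8 3 7))) ($ 3 4 5 8))) (% 4 7 (% 4 8 (% 6 7 (! 22100 405303000) (% 5 6 (% 7 8 (! 0 2342511100) (% 8 9 (!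 0 2413511200) (% 1 9 (% 1 4 (! 1000 3002020045) (% 2 7 (! 0 2241311500) (% 2 4 (% 1 3 (! 0 3010021245) (% 4 9 (! 32110 4000000500) ($ 1 9 3 4))) ($ 1 2 4 7)))) ($ 1 8 7 9)))) ($ 3 6 5 7))) (% 3 8 (% 8 9 (! 33210 400005000) (% 7 8 n32 ($ 3 8 7 9))) ($ 3 4 5 8))) ($ 3 4 5 7)))) (% 1 3 (% 1 5 (! 1000 320245) (% 3 5 (% 1 9 (% 0 8 n33 (% 4 6 (% 1 4 (! 0 1001043252) (% 2 4 (! 0 3002012451) ($ 1 2 4 6))) (% 4 8 (% 2 4 (! 0 3112012450) (% 8 9 (! 0 4312011250) (% 4 9 (new 0 false 10 (! 0 12010031345)) ($ 2 9 4 8)))) ($ 0 4 6 8)))) (% 3 7 (% 0 8 n33 (% 4 6 n34 n36)) ($ 1 3 7 9))) (% 3 7 (% 5 6 (% 4 6 n34 (% 4 8 (% 2 4 (! 0 2231431500) (% 8 9 (! 0 2413511200) (% 4 9 (% 7 8 (! 20010 340500000) (% 1 9 (% 4 7 (! 0 2314125300) (new 4 false 10 (! 0 12012145303))) ($ 1 8 7 9))) ($ 2 9 4 8)))) (% 0 8 (% 0 2 (! 21000 400305) (% 3 8 (! 0 1321400125) ($ 0 8 2 3))) ($ 0 4 6 8)))) ($ 0 5 3 6)) ($ 1 3 5 7)))) ($ 0 1 3 6))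
  n38 = % 3 7 (% 3 8 (! 33210 400005000) (% 7 8 (! 22210 340005300) ($ 1 8 3 7))) ($ 0 3 7 9)
  n39 = % 5 9 (! 3210 4000050000) (% 8 9 (! 0 3204051012) ($ 4 9 5 8))
  n40 = % 1 3 (! 32100 400000050) ($ 0 1 3 7)
  n41 = % 0 3 (! 33210 400005000) (% 0 7 (! 2100 43035) n40)
  n42 = % 0 3 (! 33210 400005000) (% 0 7 (! 12010 3040000005) n40)
  n43 = % 2 4 (! 32110 4000000500) (% 2 7 (! 210 4530003000) ($ 1 2 4 7))
  n44 = % 1 4 (! 2100 3000040050) (% 2 4 (! 0 3120142501) ($ 1 2 4 6))
  n45 = % 1 6 (% 0 8 (% 0 2 (! 21000 400305) (% 0 9 (% 1 3 (! 21000 30345) (% 1 4 (! 3210 4000050000) (% 4 6 (! 32110 4005000000) ($ 1 6 3 4)))) (% 8 9 (% 0 7 (! 21100 400003035) (% 1 9 (% 5 6 (% 3 5 (! 32100 400500000) (% 4 6 (! 0 3204051012) ($ 3 4 5 6))) (% 5 9 (% 6 7 (! 100 3405002020) (% 1 5 (% 1 4 (! 3210 4000050000) (% 3 5 (! 32100 400500000) (% 1 3 (new 3 false 10 (% 0 3 (! 21100 3045) (% 0 10 (! 21000 300045) (% 5 10 (! 32010 400050) ($ 0 5 3 10))))) ($ 1 5 3 4)))) ($ 1 6 5 7))) ($ 0 5 6 9))) ($ 0 1 7 9))) ($ 0 8 2 9)))) (% 4 6 (% 0 9 (% 1 3 (! 21000 30345) (% 1 4 (! 3210 4000050000) (! 32110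 4005000000))) (% 5 9 (! 32110 4005000000) (% 5 6 (% 0 7 (! 3210 40005) (% 1 9 (% 1 5 (! 21110 3400050) (% 8 9 (% 3 5 (! 32100 400500000) (! 0 3204051012)) (% 1 8 (% 4 8 (! 0 3402310150) ($ 4 9 5 8)) ($ 1 9 5 8)))) ($ 0 1 7 9))) ($ 0 5 6 9)))) (% 4 8 (% 1 3 (% 0 7 (! 32100 45) (% 0 9 (! 21000 30345) (% 1 9 (! 2100 4300050030) ($ 0 1 7 9)))) (% 1 4 (% 0 9 (! 3210 4000050000) (% 5 9 (! 3210 4000050000) (% 5 6 (% 3 5 (! 32100 400500000) ($ 3 4 5 6)) ($ 0 5 6 9)))) ($ 1 6 3 4))) ($ 0 4 6 8)))) (% 1 8 (% 1 9 (% 4 8 (% 3 5 (! 32100 400500000) (% 3 7 n41 (% 4 7 (% 8 9 (! 2100 3400050000) (% 7 8 (% 1 4 (! 2100 3000040050) (% 2 4 (! 0 2031140531) (% 2 7 (! 0 3041151202) ($ 1 2 4 7)))) ($ 3 8 7 9))) ($ 3 4 5 7)))) (% 5 9 (% 4 6 (! 3210 4000050000) (% 0 8 (% 0 2 (! 21000 400305) (% 0 9 (! 21000 430305) (% 8 9 (% 3 5 (! 2100 4300530000) (% 3 7 (% 0 3 (! 33210 400005000) (% 0 7 (! 0 3140501202) n40)) (% 4 7 (% 1 4 (! 32110 4000000050) (% 7 8 (! 0 3240510001) ($ 1 8 4 7))) ($ 3 4 5 7)))) ($ 0 8 2 9)))) ($ 0 4 6 8))) (% 8 9 (% 0 8 (%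 0 9 (% 3 5 (! 32100 400500000) (% 3 7 n42 (% 4 7 (% 1 4 (! 32110 4000000050) n43) ($ 3 4 5 7)))) (% 5 6 (% 3 5 (! 32100 400500000) (% 4 6 n44 ($ 3 4 5 6))) ($ 0 5 6 9))) (% 4 6 (% 0 9 (! 3210 4000050000) (% 5 6 (% 3 5 (! 32100 400500000) n44) ($ 0 5 6 9))) ($ 0 4 6 8))) ($ 4 9 5 8)))) (% 0 9 (% 1 4 (! 3210 4000050000) (% 8 9 (% 4 6 (! 3210 4000050000) (% 4 8 (! 2100 3400050000) (% 0 8 (% 3 5 (! 32100 400500000) (% 3 7 n42 (% 4 7 n43 ($ 3 4 5 7)))) ($ 0 4 6 8)))) (% 4 8 (% 7 8 (% 3 5 (! 32100 400500000) (% 3 7 n41 (% 4 7 (% 2 4 (! 32110 4000000500) n3) ($ 3 4 5 7)))) ($ 1 8 7 9)) ($ 1 8 4 9)))) ($ 0 1 6 9))) ($ 1 2 6 8))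
  n46 = % 1 6 (% 3 7 (% 1 3 (% 1 5 (! 0 1011320245) (% 6 7 (! 32110 4000050) (% 5 6 (% 0 3 (! 21100 3045) (% 0 8 (new 3 false 10 (% 0 10 (! 0 20312401015) (% 9 10 (! 0 24315211300) ($ 0 9 3 10)))) (% 8 9 (new 0 false 10 (! 21100 300004053)) ($ 0 9 3 8)))) ($ 1 6 5 7)))) (% 6 7 (% 0 7 (! 12010 3040000005) (% 0 3 (% 2 4 (new 3 false 10 (! 0 10001134225)) (% 5 6 (new 5 true 11 (% 3 5 (! 32210 405000) (% 4 11 (! 33210 45000) (% 3 11 (% 1 11 (! 22100 300004030050) (% 6 11 (! 2010 300000430005) ($ 1 6 3 11))) ($ 3 4 5 11))))) ($ 2 5 4 6))) ($ 0 1 3 7))) ($ 1 6 3 7))) (% 4 7 (% 2 4 (% 7 8 (! 2110 3030040500) (% 8 9 (% 5 6 (! 0 2413501012) (% 6 7 (! 0 2143152001) (% 1 5 (% 0 3 (! 0 2110043215) (% 0 8 (! 0 2310401215) (% 1 3 (! 0 1120034521) (% 1 8 (! 0 100312452) ($ 0 1 3 8))))) ($ 1 6 5 7)))) ($ 3 8 7 9))) (% 5 6 (% 7 8 (! 0 1423501021) n24) ($ 2 5 4 6))) ($ 3 4 7 9))) (% 1 8 (% 3 7 (% 0 7 (! 12010 3040000005) (% 1 3 n34 (% 0 3 (% 2 4 (! 2210 4030030500) (% 5 6 (% 1 4 (! 0 320431125) ($ 1 2 4 6)) ($ 2 5 4 6))) ($ 0 1 3 7)))) (% 4 7 (% 7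 8 (! 2210 4050030300) (% 8 9 (% 1 4 (% 2 4 (! 1000 230245) (% 5 6 (new 3 false 10 (! 0 2314511200)) ($ 2 5 4 6))) (% 2 4 (% 4 8 (new 3 false 10 (! 0 4213213500)) ($ 1 8 4 7)) ($ 1 2 4 6))) ($ 3 8 7 9))) ($ 3 4 7 9))) ($ 1 2 6 8))
  n47 = % 3 5 (! 22210 34500) ($ 3 4 5 9)
  n48 = % 5 9 n47 ($ 0 5 6 9)
  n49 = % 3 6 (% 1 6 (% 0 9 (% 3 5 n22 n25) n30) (% 1 8 (% 0 9 n37 (% 1 9 (% 4 9 (% 5 6 (% 0 8 n26 (% 4 8 (% 1 3 n35 (% 0 3 (% 0 7 (! 32100 400005) n38) ($ 0 1 3 6))) (% 4 6 n39 ($ 0 4 6 8)))) (% 5 9 (% 3 5 (% 0 8 n28 (% 4 6 (! 3210 4000050000) (% 4 8 (% 1 3 n35 (% 0 3 (% 0 7 (! 0 1020413205) n38) ($ 0 1 3 6))) ($ 0 4 6 8)))) (% 0 3 (% 6 7 (! 100 4305232000) (% 3 7 (% 0 8 (! 0 1322420015) (% 4 6 (! 3210 4000050000) (% 4 8 (% 1 3 n35 (% 3 8 (! 33210 400005000) (% 7 8 (! 0 1341225300) ($ 1 8 3 7)))) ($ 0 4 6 8)))) ($ 3 6 5 7))) ($ 0 5 3 6))) ($ 0 5 6 9))) (% 4 6 (% 0 2 (! 21000 400305) (% 2 4 (% 4 7 (% 1 3 (% 5 6 (! 0 1231423500) (% 5 9 (! 0 1231423500) ($ 0 5 6 9)))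 (% 1 4 (% 0 3 (! 0 1201032450) ($ 0 1 3 6)) ($ 1 9 3 4))) (% 3 7 (% 5 6 (! 2210 30430500) (% 5 9 n13 ($ 0 5 6 9))) ($ 3 4 7 9))) ($ 0 4 2 9))) ($ 0 4 6 9))) ($ 0 1 6 9))) ($ 1 2 6 8))) (% 3 8 (% 4 9 n45 (% 4 6 (% 0 2 (! 21000 400305) (% 0 9 n46 (% 2 4 (% 4 7 (% 1 6 (% 5 6 (% 0 3 (! 22210 34500) (% 0 8 (! 0 2413501012) (% 1 3 (! 0 1120034521) (% 1 8 (! 0 1423501021) ($ 0 1 3 8))))) n48) (% 1 8 (% 1 9 (% 5 9 n47 (% 5 6 (% 3 7 (! 2210 30340500) (% 7 8 (! 2210 30340500) (% 8 9 (! 0 3405120120) ($ 3 8 7 9)))) ($ 0 5 6 9))) ($ 0 1 6 9)) ($ 1 2 6 8))) (% 3 7 (% 5 6 (! 2210 30430500) n48) ($ 3 4 7 9))) ($ 0 4 2 9)))) ($ 3 4 6 9))) ($ 2 3 6 8))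
  n50 = % 4 9 (! 32110 4005000000) ($ 1 9 3 4)
  n51 = % 0 9 (% 0 2 (! 32100 400005) (% 0 3 (% 3 5 (! 32210 405000) (% 4 8 (% 1 8 (! 0 1423510021) (% 2 4 (! 11010 2000043205) (% 1 4 (% 4 7 (! 0 1120243105) (% 4 9 (! 11010 2000043205) (% 7 8 (! 0 1423510021) (% 8 9 (! 0 2413510012) ($ 4 8 7 9))))) ($ 1 2 4 8)))) (% 3 8 (% 0 8 (! 0 1403225001) (% 4 6 (% 1 9 (% 1 3 (! 21100 3045) (% 1 4 (! 0 2001132045) n50)) (% 2 7 (% 2 4 (! 32210 4500) (% 4 7 (% 7 8 (! 13210 40005000) (% 6 7 (new 0 false 10 (% 2 10 (! 0 1020334511) (% 7 10 (! 13210 40005000) ($ 0 10 2 7)))) ($ 2 7 6 8))) ($ 0 4 2 7))) ($ 1 2 7 9))) ($ 0 4 6 8))) ($ 3 4 5 8)))) ($ 0 9 2 3))) (% 1 9 (% 4 9 (% 5 9 (% 3 5 (% 0 3 (! 32210 405000) n17) (% 3 8 (! 0 4213521000) (% 4 8 (% 1 4 (! 3210 4000050000) (% 1 8 (! 0 4223100051) (% 2 4 (! 0 4223511001) ($ 1 2 4 8)))) ($ 3 4 5 8)))) (% 2 4 (% 4 6 (! 21000 3004500003) (% 4 8 (% 1 3 (! 0 223104152) (% 0 3 (% 1 5 (! 21110 3400050) (% 1 8 (! 0 1413210052) (% 8 9 (! 0 3412151002) ($ 1 9 5 8)))) ($ 0 1 3 7))) ($ 2 4 6 8))) ($ 2 5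 4 9))) (% 4 6 (% 1 4 (! 1000 3024520003) (% 1 3 (% 4 7 (% 3 5 (% 0 3 (! 32210 405000) (! 21110 3004050)) (% 4 8 (! 0 1032245101) (% 3 8 (% 1 5 (! 21110 3400050) (% 1 8 (! 0 413102051) (% 5 9 (! 1000 4023520000) (% 8 9 (! 20010 400305030) ($ 1 9 5 8))))) ($ 3 4 5 8)))) ($ 0 4 7 9)) ($ 1 9 3 4))) ($ 0 4 6 9))) ($ 0 1 7 9))
  n52 = % 0 3 (! 21110 4305030) ($ 0 9 2 3)
  n53 = % 5 6 (% 3 7 (% 0 7 (! 32100 400005) n51) (% 2 7 (% 4 7 (% 6 7 (% 0 8 (! 0 1243520001) (% 4 6 (% 0 7 (! 32100 400005) (% 0 9 (% 0 2 (! 32100 400005) (% 0 3 (% 3 5 (! 32210 405000) (% 4 8 (! 0 1134250002) (% 3 8 (% 7 8 (! 12100 30403005) (% 8 9 (! 33210 400005000) ($ 3 8 7 9))) ($ 3 4 5 8)))) ($ 0 9 2 3))) (% 1 9 (% 1 3 (! 32110 4000050) (% 1 4 (! 33210 4050000) (% 4 9 (! 0 2143510002) ($ 1 9 3 4)))) ($ 0 1 7 9)))) (% 4 8 (% 4 9 (! 0 2143510002) (% 0 9 (% 0 2 (! 32100 400005) (% 0 3 (! 0 3342510011) ($ 0 9 2 3))) ($ 0 4 6 9))) ($ 0 4 6 8)))) (% 7 8 (% 0 8 (! 0 1342520001) (% 4 8 (! 21100 340500000) (% 4 6 (% 0 7 (! 32100 400005) (% 1 8 (% 0 9 (! 1000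 2020430305) (% 1 9 (% 1 4 (! 0 2013140152) (% 4 9 n39 (% 1 3 (% 3 5 (! 21110 3004050) (% 3 8 (! 0 403102152) ($ 3 4 5 8))) ($ 1 9 3 4)))) ($ 0 1 7 9))) ($ 0 1 7 8))) ($ 0 4 6 8)))) ($ 2 7 6 8))) (% 4 9 (% 0 2 (! 32100 400005) (% 0 7 (! 32100 400005) (% 2 4 (% 4 6 (! 21000 3004500003) (% 7 8 (! 32210 40000500) (% 6 7 ($ 0 4 6 7) ($ 2 7 6 8)))) ($ 0 4 2 7)))) ($ 3 4 7 9))) ($ 2 3 7 9))) (% 5 9 (% 3 5 (% 1 9 (% 1 3 (! 21110 3004050) (% 4 9 (% 1 5 (% 4 6 (! 32110 4005000000) (% 0 8 (% 0 2 (! 32100 400005) (% 0 3 (! 32210 405000) n27)) (% 4 8 (% 1 4 (! 3210 4000050000) (% 1 8 (! 21010 300400050) (% 2 4 (% 2 7 (! 21110 3453) (% 3 7 (% 0 3 (! 32210 405000) (% 0 7 (! 32100 400005) ($ 0 1 3 7))) ($ 2 3 7 9))) ($ 1 2 4 8)))) ($ 0 4 6 8)))) (% 6 7 (% 4 6 (! 32110 4005000000) (% 4 7 (! 0 3241520001) (% 0 7 (% 2 7 (! 0 2030410125) (% 3 7 (! 2110 4035000000) ($ 2 3 7 9))) ($ 0 4 6 7)))) ($ 1 6 5 7))) (% 1 4 (% 6 7 (! 22110 4003000050) (% 1 5 (% 0 9 (! 0 2001311045) (% 4 6 (! 0 2003141052) ($ 0 4 6 9))) ($ 1 6 5 7)))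 ($ 1 9 3 4)))) (% 2 7 (% 0 7 (% 1 5 (! 32100 400005) (% 6 7 (! 21110 45300030) ($ 1 6 5 7))) (% 0 9 (% 0 2 (! 13210 4000000005) n52) ($ 0 1 7 9))) ($ 1 2 7 9))) (% 4 9 (% 0 3 (% 1 5 (! 21110 4303050) (% 6 7 (% 3 7 (! 12110 4035000000) (% 4 7 (! 0 3241520001) ($ 3 4 5 7))) ($ 1 6 5 7))) ($ 0 5 3 6)) ($ 3 4 5 9))) ($ 2 5 6 9))
  n54 = % 1 4 (! 0 1032245101) (% 2 4 (! 0 1032245100) ($ 1 2 4 6))
  n55 = % 1 3 (% 3 7 (% 0 9 (% 0 2 (! 32100 400005) n52) (% 4 6 (% 0 7 (! 32100 400005) (% 4 7 n54 (% 4 9 (% 1 4 (! 21000 4003000053) (% 2 4 (! 0 1203045210) ($ 1 2 4 6))) ($ 0 4 7 9)))) (% 4 9 (% 8 9 (! 0 2334115200) (% 4 8 (% 5 9 (! 0 4223511100) (% 2 4 (new 5 true 10 (% 4 10 (! 2100 34000050030) (% 9 10 (% 1 5 (! 0 11302412050) (% 1 10 (! 2100 34000030050) (% 3 5 (! 0 11203405210) (% 3 10 (! 100 32300024050) ($ 1 3 5 10))))) ($ 4 9 5 10)))) ($ 2 5 4 9))) (% 5 9 (% 3 5 (! 0 1203425010) (% 3 8 (! 2100 4300030050) ($ 3 4 5 8))) ($ 4 9 5 8)))) ($ 0 4 6 9)))) (% 2 7 (% 3 5 (! 0 2113415200) (% 4 7 (% 1 5 (% 4 8 (! 21010 300400050)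 (% 3 8 (% 0 8 (! 0 1312400251) (% 4 6 (! 0 1301224050) ($ 0 4 6 8))) ($ 3 4 5 8))) ($ 1 3 5 7)) ($ 3 4 5 7))) ($ 2 3 7 9))) (% 0 3 (% 0 7 (! 32100 400005) (% 3 7 (% 3 5 (! 32210 405000) (% 3 8 (% 0 8 (! 0 1321410025) (% 4 8 (! 33210 400005000) (% 4 6 (% 1 4 (! 0 2103045012) (% 4 9 n39 ($ 1 9 3 4))) ($ 0 4 6 8)))) (% 4 8 (% 7 8 (! 20010 340500000) ($ 1 8 3 7)) ($ 3 4 5 8)))) (% 0 9 (% 3 5 (! 32210 405000) (% 4 7 (% 1 4 (! 1000 3002020045) (% 3 8 (% 8 9 (! 33210 400005000) (% 7 8 (! 12100 30403005) ($ 3 8 7 9))) (% 4 8 (% 2 7 (% 4 9 (! 0 1231240035) ($ 1 9 3 4)) ($ 2 3 7 9)) ($ 1 8 3 4)))) ($ 3 4 5 7))) ($ 0 3 7 9)))) ($ 0 1 3 6))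
  n56 = % 3 5 (% 1 3 (% 3 7 (% 0 9 (% 0 2 (! 13210 4000000005) (% 0 3 (% 0 8 (! 0 3220100145) (% 4 6 (! 1000 3020420005) (% 4 8 (! 0 3120120245) ($ 0 4 6 8)))) ($ 0 9 2 3))) (% 4 6 (% 4 7 n54 (% 6 7 (! 0 2041325100) ($ 4 6 5 7))) (% 4 9 (% 0 8 (% 0 2 (! 0 322421015) (% 0 3 (! 0 1322420015) (% 3 8 (! 2100 4300030050) ($ 0 8 2 3)))) n36) ($ 0 4 6 9)))) (% 2 7 (% 4 7 (% 7 8 (% 0 9 (! 0 2031410135) (% 4 6 (! 0 2314215300) (% 4 9 (! 0 3241520101) ($ 0 4 6 9)))) (% 6 7 (% 1 4 (! 2110 4003030050) (% 4 8 (! 22100 303004050) ($ 1 8 4 7))) ($ 2 7 6 8))) (% 4 9 (% 0 2 (! 0 1002103452) (% 0 7 (! 0 3142510102) (% 2 4 (! 21110 3450) ($ 0 4 2 7)))) ($ 3 4 7 9))) ($ 2 3 7 9))) (% 0 3 (% 4 9 (% 0 7 (! 100 200423005) (% 0 9 (! 21000 3000400005) (% 3 7 (% 3 8 (! 2100 4300530000) (% 7 8 (! 0 2142315000) ($ 1 8 3 7))) ($ 0 3 7 9)))) (% 1 4 (% 1 5 (! 32210 405000) (% 4 7 (% 2 7 (! 0 2000423115) (% 3 7 (% 0 9 (! 0 3112120045) (% 4 6 (! 0 1223045110) ($ 0 4 6 9))) ($ 2 3 7 9))) ($ 1 4 5 7))) ($ 1 9 3 4))) ($ 0 1 3 6)))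 (% 4 9 (% 0 3 (% 6 7 (! 100 4305232000) (% 3 7 (% 0 8 (! 0 1322420015) (% 4 6 (! 3210 4000050000) (% 4 8 (% 1 3 n35 (% 3 8 (! 33210 400005000) (% 7 8 (! 0 3241521100) ($ 1 8 3 7)))) ($ 0 4 6 8)))) ($ 3 6 5 7))) ($ 0 5 3 6)) ($ 3 4 5 9))
  n57 = % 3 6 (% 0 3 (% 1 9 (% 1 5 (! 32210 405000) (% 1 3 (% 0 2 (! 0 3112010245) (% 0 7 (! 0 3221010145) (% 2 4 (! 21110 3450) (% 4 7 (% 1 4 (! 0 3112120045) (% 4 8 (% 2 6 (! 0 2112013450) (% 6 7 (! 22100 303004050) (% 7 8 (% 0 8 (! 0 3221010145) (% 3 7 (! 0 1010032345) (% 3 8 (! 32100 400000050) ($ 0 3 7 8)))) ($ 2 7 6 8)))) (% 7 8 (% 0 8 (! 0 3221010145) (% 3 7 (! 0 1210203045) (% 3 8 (! 0 1120403025) ($ 0 3 7 8)))) ($ 1 8 4 7)))) ($ 0 4 2 7))))) (% 5 9 (% 1 4 (! 0 3211210045) (% 4 9 (! 21000 3000400005) ($ 1 9 3 4))) ($ 1 9 3 5)))) (% 7 8 (% 1 6 (! 21110 4305030) (% 2 9 (! 32210 40000500) (% 2 6 (% 3 8 (! 0 1223014510) (% 4 8 (! 21100 340500000) (% 5 6 (! 32210 405000) (% 0 2 (% 1 3 (! 0 2113014520) (% 1 4 (! 0 102021345) ($ 1 8 3 4))) ($ 0 5 2 6))))) ($ 1 2 6 9)))) (% 8 9 (% 3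 8 (! 32100 400500000) (% 2 9 (% 2 6 (! 0 2113214500) (% 6 7 (! 22100 304305000) ($ 2 7 6 8))) ($ 2 3 8 9))) ($ 1 8 7 9)))) (% 1 3 (% 1 6 (! 21110 4003050) (% 2 6 (! 0 2113014520) (% 2 9 (! 21110 3450) (% 1 9 (% 0 2 (! 0 3112010245) ($ 0 9 2 3)) ($ 1 2 6 9))))) (% 1 6 (% 0 2 (! 32100 45) (% 2 9 (! 32110 450) ($ 0 9 2 3))) ($ 0 1 3 6)))) (% 2 6 (% 0 2 (% 5 6 (! 32100 400005) (% 5 9 (! 13210 4000000005) ($ 3 5 6 9))) (% 5 6 (% 0 3 (! 32210 405000) (% 2 9 (% 1 9 (! 12110 4005300030) (% 7 8 (! 32210 40000500) (% 8 9 (! 20100 403500000) ($ 1 8 7 9)))) ($ 0 9 2 3))) ($ 0 5 2 6))) (% 3 8 (% 2 9 (! 32210 4500) ($ 2 3 6 9)) ($ 2 3 6 8)))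
  n58 = % 1 6 (% 0 7 (! 32100 45) ($ 0 1 7 9)) ($ 0 1 6 9)
  n59 = % 1 9 (% 5 6 (% 0 7 (! 32100 400005) (% 4 7 (% 2 4 (! 22210 30040500) (% 2 6 (% 4 9 (! 21000 3004500003) (% 1 3 (% 4 8 (! 20100 403500000) (% 1 4 (new 2 false 10 (! 0 10020123451)) (% 7 8 (new 2 false 10 (% 0 2 (! 32100 400005) (% 0 10 (! 21000 3400035) (% 4 10 (! 2210 40050303) ($ 0 4 2 10))))) ($ 1 8 4 7)))) (% 1 4 (% 5 9 (! 2110 3003040050) (% 1 5 (new 2 false 10 (% 0 2 (! 32100 400005) (% 0 10 (! 21000 300045) (% 4 10 (! 0 10020123453) ($ 0 4 2 10))))) ($ 1 9 3 5))) ($ 1 9 3 4)))) (% 1 4 (% 1 6 (! 1000 2004030052) (% 1 5 (% 6 7 (! 0 2043150012) (% 7 8 (! 0 1312420050) ($ 2 7 6 8))) ($ 1 2 5 6))) (% 1 6 (% 4 9 (! 0 3114020250) (% 1 3 (% 2 9 (! 32110 450) (% 3 6 (! 21110 3004050) ($ 2 3 6 9))) ($ 1 9 3 4))) ($ 1 2 4 6))))) (% 4 9 (% 0 2 (! 32100 400005) (% 2 4 (% 1 5 (! 21110 3453) (% 1 6 (! 1000 3004020052) (% 2 6 (! 21000 3004500003) ($ 1 2 5 6)))) ($ 0 4 2 7))) ($ 0 4 7 9)))) (% 5 9 (% 6 7 (! 2110 4005030030) (% 4 7 (% 1 6 (! 12110 3004000050) (% 2 4 (! 22210 30040500) (% 1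 4 (% 2 6 (! 2110 3003040050) (% 7 8 (! 2110 3030040050) ($ 2 7 6 8))) (% 2 6 (% 4 9 (! 3210 4000050000) (% 1 3 (% 0 2 (% 4 8 (! 22100 403003050) (% 7 8 (! 0 3010232145) ($ 1 8 4 7))) ($ 0 5 2 6)) ($ 1 9 3 4))) ($ 1 2 4 6))))) ($ 4 6 5 7))) ($ 0 5 6 9))) n58
  n60 = % 1 8 (% 0 9 n57 (% 4 6 n59 (% 4 9 (% 1 9 (% 5 9 (% 4 8 (% 3 8 (! 32100 400500000) (% 2 6 (% 5 6 (! 20100 403500000) (% 0 2 (% 2 4 (! 21000 3000400305) (% 4 7 (new 2 false 10 (% 4 10 (! 0 13040122503) (% 8 10 (! 0 22431501130) ($ 2 10 4 8)))) (% 7 8 (new 2 false 10 (! 0 11020413235)) ($ 2 7 4 8)))) ($ 0 5 2 6))) (% 3 6 (% 6 7 (! 0 3142510102) (% 7 8 (! 0 3241520101) ($ 2 7 6 8))) ($ 2 3 6 8)))) (% 0 8 (% 3 8 (% 7 8 (! 0 410315202) (% 8 9 (! 32100 400500000) (% 0 7 (% 3 7 (! 0 1130402025) ($ 3 8 7 9)) ($ 0 8 7 9)))) (% 3 6 (% 0 2 (! 0 1322420015) (% 0 3 (! 0 1322420015) ($ 0 8 2 3))) ($ 3 4 6 8))) ($ 0 4 6 8))) (% 5 6 (% 4 8 (% 1 6 (! 20010 400503030) (% 2 6 (% 0 2 (! 32100 400005) (% 2 4 (% 1 3 (! 22100 403003050) (% 1 5 (! 21110 3453) ($ 1 9 3 5)))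 ($ 0 4 2 6))) (% 1 5 (% 6 7 (! 0 1423520010) (% 7 8 (! 20010 340500000) ($ 2 7 6 8))) ($ 1 2 5 6)))) (% 0 8 (% 0 2 (! 32100 400005) (% 0 3 (! 32210 405000) (% 3 8 (% 0 7 (! 32100 400005) (% 7 8 (! 0 410315202) ($ 0 8 2 7))) ($ 0 8 2 3)))) ($ 0 4 6 8))) ($ 0 5 6 9))) n58) ($ 0 4 6 9)))) (% 1 5 (% 1 6 (% 0 2 (! 32100 400005) (% 0 7 (! 32100 400005) (% 2 4 (! 21110 3453) (% 4 7 (% 2 9 (! 21110 3453) (% 3 6 (% 0 9 (% 0 3 (! 32210 405000) ($ 0 9 2 3)) (% 1 9 (% 5 6 (! 21110 4300050) (% 5 9 (% 4 6 (% 1 3 (! 21110 3004050) (% 1 4 (! 0 3112043150) n50)) (% 4 9 (% 1 4 (! 3210 4000050000) (% 6 7 (! 0 4123100052) ($ 1 6 4 7))) ($ 0 4 6 9))) ($ 0 5 6 9))) ($ 0 1 7 9))) (% 2 6 (% 5 6 (! 21110 4300050) ($ 0 5 2 6)) ($ 2 3 6 9)))) ($ 0 4 2 7))))) (% 0 2 (! 32100 400005) (% 0 8 (% 0 7 (! 32100 400005) (% 7 8 (% 0 3 (! 32210 405000) (% 3 8 (! 10 400305202) ($ 0 8 2 3))) ($ 0 8 2 7))) ($ 0 1 6 8)))) ($ 1 2 5 8))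
  n61 = % 0 2 (! 32100 400005) (% 0 3 (! 32210 405000) (% 2 9 (% 5 9 (% 4 9 (! 21000 3000400005) (% 3 6 (% 1 3 (! 10000 2304052) (% 1 6 (% 3 7 ($ 0 1 3 7) (% 4 7 (% 1 4 (% 0 8 (! 0 3221411005) (% 4 6 (! 0 1001232045) (% 4 8 (! 1010 232045) ($ 0 4 6 8)))) (% 2 4 (% 4 8 (% 4 6 (! 0 4335212001) (% 6 7 (! 0 3142512001) ($ 1 6 4 7))) ($ 2 4 5 8)) ($ 1 2 4 7))) ($ 3 4 7 9))) ($ 0 1 3 6))) (% 4 6 (% 3 7 (! 1000 3020420005) (% 4 7 (% 1 8 (! 1000 3002400025) (% 2 6 (% 2 4 (! 21210 3004000500) (% 1 4 (% 1 6 (! 33210 4050000) (% 0 8 (% 4 8 n6 (% 1 9 (! 0 2110032145) (% 5 6 (! 0 220131245) (! 0 220131245)))) ($ 0 1 6 8))) ($ 1 2 4 7))) (% 1 6 (% 3 8 (% 1 4 (! 1010 232045) (% 2 4 (! 22210 34500) ($ 1 2 4 7))) ($ 2 3 6 8)) ($ 1 2 6 8)))) ($ 3 4 7 9))) ($ 3 4 6 9)))) (% 8 9 (% 3 6 (% 1 3 (! 10000 2304052) (% 1 6 (% 3 8 (! 32100 400500000) (% 4 8 (% 3 7 ($ 0 1 3 7) (% 4 9 n21 (% 4 7 (% 1 4 (! 210 3400053000) (% 2 4 (% 4 6 (! 210 3400053000) (% 6 7 (! 0 2341352001) ($ 1 6 4 7))) ($ 1 2 4 7))) ($ 3 4 7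 9)))) (% 4 9 (% 4 6 (! 32110 4005000000) (% 0 8 ($ 0 8 2 3) ($ 0 4 6 8))) ($ 3 4 8 9)))) ($ 0 1 3 6))) (% 5 6 (% 3 8 (! 32100 400500000) (% 2 6 (% 0 8 ($ 0 8 2 3) (% 1 6 (! 21110 4300050) n14)) ($ 2 3 6 8))) ($ 3 5 6 9))) ($ 2 9 5 8))) ($ 0 9 2 3)))
  n62 = % 8 9 (! 32100 400500000) ($ 4 9 5 8)
  n63 = % 1 5 (% 0 2 (! 32100 400005) (% 0 3 (% 0 8 (! 10100 320402005) (% 1 6 (% 3 6 (! 21110 4303050) (% 0 9 (% 4 8 (! 33210 400005000) (% 4 6 (% 1 3 (! 21100 3045) (% 1 4 (! 1010 232045) ($ 1 5 3 4))) ($ 0 4 6 8))) ($ 0 3 6 9))) ($ 0 1 6 8))) ($ 0 5 2 3))) ($ 1 2 5 8)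
  n64 = % 2 9 (! 32210 40000500) (% 3 6 (% 8 9 (! 33210 400005000) n32) (% 2 6 (% 0 2 (! 210 430005003) (% 5 6 (! 12100 30403005) ($ 0 5 2 6))) ($ 2 3 6 9)))
  n65 = % 3 7 (% 1 8 (% 0 3 (% 7 8 (! 23210 40005000) (% 8 9 (! 33210 400005000) (% 1 9 (% 0 9 (% 4 8 (! 33210 400005000) (% 4 6 (% 1 5 (! 0 3012210145) (% 2 7 (% 2 6 (! 11210 3405003000) (% 6 7 (! 11210 3405003000) ($ 2 7 6 8))) ($ 1 2 5 7))) (% 0 8 (% 1 3 (! 0 201013145) (% 1 4 (! 1100 3220000045) (% 4 9 (% 5 9 (! 21000 3000400005) ($ 4 9 5 8)) ($ 1 9 3 4)))) ($ 0 4 6 8)))) (% 3 6 (% 4 9 (% 4 8 (! 33210 400005000) (% 5 9 (% 4 6 (! 33210 45000) (% 0 8 (% 0 7 (! 12010 3340000005) ($ 0 8 7 9)) ($ 0 4 6 8))) ($ 4 9 5 8))) (% 4 6 (% 6 7 (! 11210 304005000) (% 4 7 (% 1 4 (! 0 1032245001) (% 4 8 (! 33210 400005000) ($ 1 8 4 7))) (% 5 6 (% 0 7 (! 32100 400005) ($ 0 4 7 9)) ($ 4 6 5 7)))) ($ 0 4 6 9))) ($ 0 3 6 9))) ($ 1 8 7 9)))) (% 0 2 (% 1 5 (! 32100 45) (% 2 7 (% 5 6 (! 32100 400005) (% 5 9 (! 12210 3040000503) (% 0 9 (% 0 8 (! 210 430005003) (% 8 9 (% 0 7 (! 3210 40000005)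 n40) ($ 0 9 3 8))) ($ 0 5 6 9)))) ($ 1 2 5 7))) ($ 0 5 2 3))) n63) (% 2 7 (% 4 7 (% 1 8 (% 7 8 (% 1 6 (! 22210 453000300) (% 0 9 (% 0 3 n64 (% 0 2 (% 0 8 (% 2 9 (! 32210 40000500) (% 2 6 (% 3 6 (% 1 3 (! 0 101202345) ($ 0 1 3 6)) (new 3 false 11 (% 5 11 (! 32100 400005) (% 7 11 (! 0 200140301532) ($ 3 11 5 7))))) (% 3 6 (% 1 3 (! 0 302101245) ($ 0 1 3 6)) ($ 2 3 6 9)))) (% 2 6 (% 8 9 (% 4 6 (new 0 false 10 (! 2100 4300030005)) (% 4 8 (% 3 6 (! 0 3142203510) (% 4 9 (! 2100 43035) ($ 3 4 6 9))) ($ 0 4 6 8))) ($ 0 9 3 8)) ($ 0 2 6 8))) ($ 0 5 2 3))) (% 0 3 n64 (% 0 2 (% 5 6 (! 32100 400005) (% 5 9 (% 2 9 (! 32210 40000500) ($ 2 3 5 9)) ($ 0 5 6 9))) ($ 0 5 2 3))))) (% 8 9 (% 0 3 (! 33210 400005000) (% 0 2 (% 4 6 n5 (% 0 9 (% 0 8 (! 10210 3400000005) (% 4 8 (% 4 9 (! 2100 43035) (% 3 6 (% 5 6 (! 32100 400005) ($ 0 5 3 6)) ($ 3 4 6 9))) ($ 0 4 6 8))) (% 4 9 (% 1 4 (! 3210 40005) n4) ($ 0 4 6 9)))) ($ 0 5 2 3))) ($ 3 8 7 9))) n63) ($ 3 4 5 7)) ($ 2 3 5 7))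
  -- Here a 0 and b 0 are adjacent and no vertex of b is adjacent to the vertex of a one part back.
  -- These absent pairs supply part of the non-adjacencies in the `$` leaves; `$ 2 3 6 9`, for
  -- instance, uses that b 4 is not adjacent to a 3.
  n66 = % 2 5 (% 2 6 (% 0 9 (% 4 6 (% 4 9 (! 32110 4005000000) (% 3 7 (% 0 7 (! 1000 2030400205) (% 0 3 (% 3 8 (% 0 8 (% 2 7 (! 0 1131224500) (% 2 9 (! 12010 4330000005) (% 1 9 (% 1 5 (! 10100 320204005) (% 1 8 (! 11210 3405003000) (% 5 9 (! 12010 4330000005) (% 8 9 (! 33210 400005000) ($ 1 9 5 8))))) ($ 1 2 7 9)))) (% 1 6 (% 1 3 (! 32110 4000050) (% 6 7 n1 (% 3 6 n2 ($ 1 6 3 7)))) (% 1 8 (% 1 9 (! 11210 3405003000) (% 7 8 (! 23210 40005000) (% 8 9 (! 33210 400005000) ($ 1 8 7 9)))) ($ 0 1 6 8)))) (% 0 8 (% 4 8 (! 10000 322400025) (% 3 5 (% 4 7 (! 0 10324215) (% 5 6 (! 32210 405000) (% 6 7 (! 0 2141315200) ($ 4 6 5 7)))) ($ 3 4 5 8))) (% 3 6 (% 1 6 (% 1 3 (! 32110 4000050) (% 6 7 n1 n2)) (% 1 8 (% 2 7 (! 0 1131224500) (% 2 9 (! 21110 3004500) (% 1 9 (% 1 3 (! 0 1001023245) (% 1 4 (! 0 203045112) (% 4 8 (! 22100 405003030) ($ 1 8 3 4)))) ($ 1 2 7 9)))) ($ 0 1 6 8))) ($ 0 3 6 8)))) (%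 1 3 (% 0 2 (! 1000 20300425) (% 2 9 (% 5 6 (! 0 3014210512) (% 6 7 (! 21110 34000530) (% 4 7 (% 1 4 (! 1000 2023340005) (% 2 4 (! 2210 3030040500) n3)) ($ 4 6 5 7)))) ($ 0 9 2 3))) ($ 0 1 3 7)))) (% 4 7 n8 ($ 3 4 7 9)))) n11) n16) (% 2 9 n49 (% 3 6 (% 1 6 n53 (% 1 9 (% 1 8 (% 5 6 n55 (% 5 9 n56 ($ 2 5 6 9))) ($ 1 2 6 8)) ($ 1 2 6 9))) ($ 2 3 6 9)))) (% 3 5 (% 2 7 n60 (% 1 5 (% 0 7 (! 32100 400005) (% 0 9 n61 (% 1 9 (% 4 9 (% 5 9 (% 3 8 (! 2100 4300530000) (% 2 6 (% 0 2 (! 32100 400005) (% 5 6 (% 0 8 (! 100 3204520000) (% 1 6 (! 21110 4300050) (% 1 8 (! 1000 4002300052) ($ 0 1 6 8)))) ($ 0 5 2 6))) (% 3 6 (% 0 3 (! 32210 405000) (% 1 3 (! 0 1002314052) (% 1 6 (% 3 7 ($ 0 1 3 7) (% 2 9 (% 4 6 (! 3210 4000050000) (% 0 8 (% 0 2 (! 32100 400005) ($ 0 8 2 3)) (% 4 8 (% 1 4 (! 3210 4000050000) (% 1 8 (! 21010 400300050) n20)) ($ 0 4 6 8)))) ($ 2 3 7 9))) ($ 0 1 3 6)))) ($ 2 3 6 8)))) (% 5 6 (% 1 6 (! 21110 4300050) (% 2 6 (% 0 2 (! 32100 400005) (% 4 6 (! 21000 3004500003) (% 2 4 (% 4 8 (%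 0 8 (! 20100 403500000) (% 1 8 (! 21110 3453) ($ 0 1 6 8))) ($ 2 4 5 8)) ($ 0 4 2 6)))) (% 3 6 (% 0 3 (! 32210 405000) (% 1 3 (! 21110 3004053) ($ 0 1 3 6))) (% 3 8 (% 4 8 (! 32100 400500000) n62) ($ 2 3 6 8))))) ($ 0 5 6 9))) (% 4 6 (% 4 7 (% 3 7 (! 10 240325000) (% 2 9 (% 0 2 (! 32100 400005) (% 5 9 (% 1 3 (! 1000 4002300052) (% 1 4 (% 1 6 (! 0 2114032150) (% 1 8 (! 1000 4002300052) (% 2 6 (% 0 8 (! 0 4210301251) ($ 0 1 6 8)) ($ 1 2 6 8)))) ($ 1 9 3 4))) ($ 0 5 2 9))) ($ 2 3 7 9))) ($ 0 4 7 9)) ($ 0 4 6 9))) ($ 0 1 7 9)))) ($ 1 2 5 7))) (% 3 8 n65 ($ 2 3 5 8)))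
  n67 = % 2 4 (! 22210 30040500) ($ 0 4 2 5)
  n68 = new 5 true 10 (! 0 11202435031)
  n69 = % 0 3 (% 3 7 (! 0 140203125) (% 4 9 (! 210 43005) (% 4 7 (% 0 9 (% 1 5 (% 1 4 (! 0 20131245) (% 5 6 (% 1 9 (! 0 3141120025) (new 1 false 10 (! 0 13241510032))) (% 1 6 (% 5 9 (! 2100 4000330005) (% 3 6 (% 1 9 (! 0 3141120025) (new 1 false 10 (! 0 12112030345))) ($ 3 5 6 9))) ($ 1 5 4 6)))) (% 1 8 (% 1 3 (! 100 200023045) (% 1 4 (! 2100 30045) (% 3 8 (! 2100 3400300005) (% 4 8 (! 210 43005) ($ 1 8 3 4))))) (% 2 5 (% 0 2 (! 0 2010213405) n67) ($ 1 2 5 8)))) (% 3 6 (% 1 6 (% 1 8 (! 32110 4000050) (% 1 5 n68 (% 2 5 (% 5 6 (! 0 201324520) (% 6 7 (! 22210 34000500) ($ 1 6 5 7))) ($ 1 2 5 8)))) (% 1 9 (% 1 4 (! 0 1131240025) (% 1 3 (% 1 5 (! 0 1101332045) (% 1 8 (! 0 101032345) (% 2 5 (! 0 2103214510) ($ 1 2 5 8)))) ($ 1 9 3 4))) ($ 0 1 6 9))) ($ 0 3 6 9))) ($ 3 4 7 9)))) (% 1 5 (% 0 2 (% 1 4 (! 10100 2020345) (% 1 6 (! 10100 2020345) (% 5 6 (% 0 9 (% 5 9 (! 2100 4000330005) ($ 0 9 3 5)) (% 1 9 (% 1 3 (! 21000 3400053) (% 4 9 (% 4 8 (! 21100 430300005)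 (% 5 9 (! 32110 4005000000) (% 8 9 (! 21100 430300005) ($ 4 9 5 8)))) ($ 1 9 3 4))) ($ 0 1 6 9))) ($ 1 5 4 6)))) (% 3 8 (% 3 7 (! 20210 40305000) (% 4 9 (! 33210 45000) (% 4 7 (% 8 9 (! 32100 400500000) (% 7 8 (% 3 6 (! 11110 3024520) (% 5 9 (! 0 2410315202) (% 5 6 (% 0 9 (! 0 413220135) (% 1 6 (! 22210 34530) (% 1 9 (! 0 2341502100) ($ 0 1 6 9)))) ($ 3 5 6 9)))) ($ 3 8 7 9))) ($ 3 4 7 9)))) ($ 0 8 2 3))) (% 1 3 (% 1 6 (! 32110 4000050) (% 1 9 (% 1 8 (% 3 8 (! 11110 220003450) (% 0 2 (% 3 6 (! 0 101022345) (% 5 9 (! 2110 4005030030) (% 5 6 ($ 0 1 5 6) ($ 3 5 6 9)))) ($ 0 8 2 3))) (% 2 5 (% 3 6 (! 0 1203104520) (% 5 6 ($ 0 1 5 6) (% 5 9 (! 2110 4005030030) ($ 3 5 6 9)))) ($ 1 2 5 8))) (% 3 6 (% 3 7 (! 11110 3024520) ($ 1 3 7 9)) ($ 1 3 6 9)))) ($ 0 1 3 5)))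
  n70 = % 2 9 (! 32210 40000500) ($ 0 9 2 3)
  n71 = % 0 2 (! 3210 40000005) (% 0 3 (! 210 400003005) n70)
  n72 = % 1 4 (! 33210 4050000) ($ 1 5 3 4)
  n73 = % 0 2 (! 3210 40000005) (% 2 4 (! 32210 40000500) ($ 0 4 2 5))
  n74 = % 1 3 (! 32110 4000050) n72
  n75 = % 4 10 (! 21000 3340050) ($ 0 4 5 10)
  n76 = new 5 true 10 (% 0 10 (! 2100 30045) n75)
  n77 = new 5 true 10 (% 5 9 (! 0 2103342051) (% 6 10 (! 22110 30004050030) (% 9 10 (! 20100 4003000053) ($ 5 10 6 9))))
  n78 = % 2 5 (% 0 2 (! 210 430003005) n67) ($ 1 2 5 8)
  n79 = % 3 7 (% 0 9 n71 (% 1 6 (% 1 3 (! 32110 4000050) (% 1 5 n72 (% 1 8 (! 32110 4000050) (% 2 5 n73 ($ 1 2 5 8))))) (% 1 9 (% 2 5 n73 (% 1 8 (% 1 3 (! 0 310204251) (% 4 9 (! 210 45303) (% 1 4 (% 4 7 (new 2 false 10 (% 0 2 (! 3210 40000005) (% 0 10 (! 2100 30045) (% 2 4 (! 32210 40000500) (% 4 10 (! 210 45303) ($ 0 4 2 10)))))) (% 1 5 (% 5 6 (! 21000 3400053) (% 6 7 (! 0 3425300112) ($ 4 6 5 7))) ($ 1 4 5 7))) ($ 1 9 3 4)))) (% 1 5 (% 1 3 (% 5 6 (! 21000 3400053) (% 1 4 (% 4 7 (! 0 10143252) (% 6 7 (! 0 1101043252) ($ 4 6 5 7))) ($ 1 5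 4 6))) (% 1 4 (% 8 9 (% 5 6 (! 0 3231400251) (% 6 7 (! 0 4123200153) (% 4 7 (new 2 false 10 (! 0 11120203453)) ($ 4 6 5 7)))) ($ 1 9 3 8)) ($ 1 5 3 4))) ($ 1 2 5 8)))) ($ 0 1 6 9)))) (% 4 7 (% 7 8 (% 0 9 n71 (% 1 6 (% 1 8 (! 32110 4000050) (% 1 5 n74 (% 2 5 (% 5 6 (! 0 231400521) (% 6 7 (! 11210 435000000) ($ 1 6 5 7))) ($ 1 2 5 8)))) (% 1 9 (% 1 8 (% 1 3 (% 1 5 (% 5 6 (! 21000 3400053) (% 1 4 (new 5 true 10 (! 0 310214250)) ($ 1 5 4 6))) ($ 1 3 5 7)) (% 1 4 (new 5 true 10 (% 0 10 (! 2100 30045) (% 1 5 (! 0 3415310220) (% 1 10 (! 22110 30003040050) ($ 0 1 5 10))))) (% 4 9 (% 4 8 (! 20210 430050000) (% 5 9 (! 32110 4005000000) (% 8 9 (! 0 3415020120) ($ 4 9 5 8)))) ($ 1 9 3 4)))) (% 1 3 (% 1 5 (% 5 6 (! 21000 3400053) (% 1 4 n76 ($ 1 5 4 6))) ($ 1 3 5 7)) (% 8 9 (% 2 5 (! 0 4351200120) (% 1 5 (% 1 4 (! 0 4253100113) ($ 1 5 3 4)) ($ 1 2 5 8))) ($ 1 9 3 8)))) ($ 0 1 6 9)))) (% 8 9 (% 0 9 (! 22110 3405000000) (% 1 9 (% 1 5 (% 1 6 n74 (% 5 6 (! 20100 403500000) (% 1 4 n77 ($ 1 5 4 6)))) (%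 1 8 (% 1 4 (! 0 3412100152) (% 4 8 (% 1 3 (! 32100 400000050) (% 4 9 (! 32010 400050000) ($ 1 9 3 4))) ($ 1 8 4 7))) n78)) (% 1 6 (% 1 5 n74 (% 1 8 (! 32110 4000050) n78)) ($ 0 1 6 9)))) ($ 3 8 7 9))) ($ 3 4 5 7))
  n80 = % 1 6 (! 22210 34000500) ($ 0 1 3 6)
  n81 = % 2 5 (! 0 2130402501) ($ 1 2 5 8)
  n82 = % 4 9 (% 0 2 (% 3 8 (! 210 430003005) (% 3 5 (% 3 6 (% 3 7 (! 3210 40000005) (% 0 3 (% 1 4 (! 210 43005) (% 2 4 (! 0 1203124510) (% 2 9 (! 10210 3340000005) (% 1 9 (% 4 8 (! 0 1202143015) (% 8 9 ($ 2 3 8 9) (% 5 9 (% 0 9 (! 0 3042101205) (% 2 5 (! 0 2103214510) ($ 0 2 5 9))) ($ 4 9 5 8)))) ($ 1 2 4 9))))) (% 6 7 (% 1 3 (! 0 1042020315) n80) ($ 0 7 3 6)))) (% 4 8 (% 2 4 (! 100 322042005) (% 4 7 (! 0 1322140015) (% 7 8 (! 3210 40000005) ($ 2 7 4 8)))) ($ 3 4 6 8))) (% 4 8 (% 2 5 (% 3 7 (! 3210 40000005) (% 4 7 (! 0 1322140015) ($ 3 4 5 7))) ($ 2 3 5 8)) ($ 3 4 5 8)))) (% 2 4 (% 4 8 (% 3 8 (% 3 5 (! 32210 4500) (% 3 7 (! 32210 40000500) (% 4 7 (% 7 8 (! 32210 40000500) (% 8 9 (% 1 5 (! 0 2031040521)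 (% 1 8 (! 0 2031040521) (% 2 5 (! 0 3142150002) ($ 1 2 5 8)))) ($ 3 8 7 9))) ($ 3 4 5 7)))) (% 0 3 (% 3 5 (! 0 1302142015) (% 3 7 (! 32210 40000500) (% 4 7 (! 110 322040005) ($ 3 4 5 7)))) ($ 0 8 2 3))) (% 2 5 (% 3 8 (% 3 7 (! 32210 40000500) (% 7 8 (! 32210 40000500) (% 3 5 (! 32210 4500) (% 4 7 (% 6 7 (! 31210 4000500) ($ 4 7 6 8)) ($ 3 4 5 7))))) (% 3 5 (% 0 3 (% 3 6 (! 0 1203124500) ($ 3 4 6 8)) ($ 0 8 2 3)) ($ 3 4 5 8))) ($ 2 4 5 8))) ($ 0 4 2 6))) (% 0 9 (% 3 6 (% 3 7 (% 0 2 (! 3210 40000005) (% 2 4 (! 32210 40000500) ($ 0 4 2 6))) (% 4 7 (% 0 3 (% 3 8 (! 210 400003005) (% 3 5 (% 0 2 (% 7 8 (! 1100 3420300005) (% 4 8 (% 1 5 (! 20100 403000035) (% 1 8 (! 0 101023425) n81)) (% 6 7 (% 1 5 (! 0 1203024521) (% 1 8 (! 0 141202305) n81)) ($ 4 7 6 8)))) (% 2 4 (% 4 8 (! 0 2010143205) (% 6 7 (! 31210 4000500) (% 7 8 (! 1100 3420300005) ($ 4 7 6 8)))) ($ 0 4 2 6))) (% 2 5 (% 4 8 (% 0 2 (! 100 422303005) (% 2 4 (! 0 311242005) ($ 0 4 2 6))) ($ 3 4 5 8)) ($ 2 3 5 8)))) (% 6 7 (% 1 3 (! 11110 2034000520)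 n80) ($ 0 7 3 6))) ($ 3 4 7 9))) ($ 3 4 6 9)) ($ 0 4 6 9))
  n83 = % 0 2 (! 3210 40000005) n70
  n84 = % 3 6 (% 0 3 (! 210 400003005) (% 3 7 (% 7 8 (! 210 340005000) (% 6 7 (% 1 8 (! 32110 4000050) (% 2 5 n73 (% 1 5 (% 1 3 (! 32110 4000050) (% 3 5 (! 21210 43005000) (% 1 4 (% 0 9 n83 (% 4 6 (! 33210 4050000) (% 4 9 (% 4 8 (! 0 301045212) (% 5 9 (! 3210 4000050000) (% 8 9 (! 0 3204011253) ($ 4 9 5 8)))) ($ 0 4 6 9)))) ($ 1 5 3 4)))) ($ 1 2 5 8)))) ($ 2 7 6 8))) (% 6 7 (% 4 7 (% 1 8 (! 32110 4000050) (% 1 5 (% 7 8 (% 1 3 (! 32110 4000050) (% 3 5 (! 2010 40503003) (% 1 4 (% 0 9 n83 (% 4 6 (! 33210 4050000) (% 4 9 (% 5 9 (! 3210 4000050000) (% 8 9 (! 0 3214100253) (% 4 8 (new 5 true 10 (! 0 3212340150)) ($ 4 9 5 8)))) ($ 0 4 6 9)))) ($ 1 5 3 4)))) (% 8 9 (% 1 3 (! 32110 4000050) (% 1 4 (! 0 3214100253) (% 3 5 (! 32100 400500000) ($ 1 5 3 4)))) ($ 3 8 7 9))) (% 2 5 (% 0 2 (! 210 430003005) (% 2 4 (% 4 6 (! 22210 30040500) (% 4 8 (% 7 8 (! 32210 40000500) (% 8 9 (! 0 2041132501) ($ 3 8 7 9))) ($ 2 4 6 8))) ($ 0 4 2 5)))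 ($ 1 2 5 8)))) (% 4 9 (% 3 5 (! 22110 4035030) ($ 3 4 5 7)) ($ 3 4 7 9))) ($ 0 7 3 6)))) (% 2 9 (% 3 7 (! 32210 40000500) (% 7 8 (! 32210 40000500) (% 8 9 (% 6 7 (% 3 5 (! 32210 4500) (% 4 7 (% 0 9 (! 11210 3405000000) (% 4 9 (! 0 3041021520) (% 4 6 (% 0 2 (! 210 430003005) (% 2 4 (! 22210 40030500) ($ 0 4 2 9))) ($ 0 4 6 9)))) ($ 3 4 5 7))) ($ 2 7 6 8)) ($ 3 8 7 9)))) ($ 2 3 6 9))
  n85 = % 0 9 (! 0 3112000245) ($ 0 2 6 9)
  n86 = % 1 6 (% 3 5 (% 1 3 (! 21110 3004050) (% 0 3 (% 6 7 (% 3 7 (! 0 142003125) (% 4 9 (% 4 8 (! 22100 403003005) (% 5 9 (! 0 4135210021) (% 8 9 (! 22100 403003005) ($ 4 9 5 8)))) (% 4 7 (% 0 9 (% 1 8 (! 32110 4000050) (% 1 5 (new 5 true 10 (! 0 13241510032)) (% 2 5 (% 0 2 (! 0 2140302501) (% 2 4 (! 0 2140302511) ($ 0 4 2 5))) ($ 1 2 5 8)))) (% 4 6 (% 1 8 (! 32110 4000050) (% 1 5 n68 (% 2 5 (% 0 2 (! 0 1040221305) (% 2 4 (! 22210 40030500) ($ 0 4 2 5))) ($ 1 2 5 8)))) ($ 0 4 6 9))) ($ 3 4 7 9)))) (% 7 8 (% 5 6 (! 0 1431210025) (% 1 5 (% 0 9 (! 10010 3420300005) (% 4 6 (! 0 1431220015)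 (% 4 9 (! 0 1431220015) ($ 0 4 6 9)))) ($ 1 6 5 7))) ($ 2 7 6 8))) (% 1 5 (% 0 2 (% 3 7 (! 3210 40000005) (% 6 7 (% 2 9 (! 10000 22000345) (% 0 9 (% 5 9 (! 0 3142100025) ($ 0 9 3 5)) ($ 0 2 6 9))) ($ 0 7 3 6))) ($ 0 8 2 3)) ($ 0 1 3 5)))) (% 2 5 (% 3 7 n73 (% 4 7 (% 4 8 (% 0 2 (! 10000 422300035) (% 0 3 (! 10000 422300035) ($ 0 8 2 3))) ($ 3 4 5 8)) ($ 3 4 5 7))) ($ 2 3 5 8))) (% 1 8 (% 3 5 (% 0 3 (% 1 9 (% 3 7 (! 10 240003205) (% 4 9 (% 1 5 (! 0 1311220045) (% 1 3 (% 6 7 (! 0 2301221045) (% 7 8 (! 0 1312020245) ($ 2 7 6 8))) (% 5 9 (% 1 4 (! 2100 3000040050) (% 4 8 (% 6 7 (! 0 1201243015) (% 7 8 (! 0 1431210025) ($ 2 7 6 8))) ($ 1 8 3 4))) ($ 1 9 3 5)))) (% 4 7 (% 1 4 (! 0 1311220045) (% 1 3 (% 0 9 (! 0 3141210025) (% 4 6 (! 0 2010023145) ($ 0 4 6 9))) ($ 1 9 3 4))) ($ 3 4 7 9)))) (% 0 9 (% 7 8 (! 10010 2430200005) (% 8 9 (! 10210 3400000005) ($ 1 8 7 9))) ($ 0 1 6 9))) (% 1 3 (% 2 9 (! 21110 3450) (% 1 9 (% 0 2 n85 ($ 0 8 2 3)) ($ 1 2 6 9))) ($ 0 1 3 6)))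 (% 4 8 (% 2 5 (% 3 7 n73 (% 4 7 (% 0 3 (% 6 7 (! 10000 242300035) (% 7 8 (! 21100 430000005) ($ 2 7 6 8))) (% 6 7 (% 0 2 (! 0 142100325) ($ 0 8 2 3)) ($ 0 7 3 6))) ($ 3 4 5 7))) ($ 2 3 5 8)) ($ 3 4 5 8))) ($ 1 2 6 8))
  n87 = % 5 6 (! 21000 3400053) ($ 1 5 4 6)
  n88 = % 1 3 (% 0 9 (! 2100 3000000045) (% 4 6 (% 1 4 n76 (% 1 6 (% 2 6 (! 32110 4000050) (% 3 6 (! 0 204113052) (% 2 9 (% 0 2 (! 21000 345) (% 8 9 (! 0 3104021250) ($ 0 8 2 9))) ($ 2 3 6 9)))) (% 2 6 n87 (% 2 4 (% 1 8 (! 0 402013251) ($ 1 2 6 8)) ($ 1 2 4 6))))) (% 4 9 (% 1 8 (! 2100 4300030050) (% 2 6 (% 0 2 (% 2 5 (! 0 100221345) (% 5 6 (! 21000 3400053) (% 6 7 (! 0 1101022345) ($ 2 6 5 7)))) (% 6 7 (% 2 4 (! 21110 34000530) ($ 0 4 2 6)) ($ 0 7 2 6))) (% 1 6 (% 2 9 (% 0 2 (! 21000 345) (% 8 9 (new 5 true 10 (% 5 6 (! 32010 400050) (% 5 9 (! 2010 3040500000) (% 6 10 (! 0 12304011350) (% 9 10 (! 2100 34000000053) ($ 5 10 6 9)))))) ($ 0 8 2 9))) (% 3 6 (% 5 9 (! 2010 3040500000) (% 8 9 (! 0 3214001250) (% 4 8 (% 1 4 (! 2100 3000040050) (% 2 4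 (! 0 1304012350) ($ 1 2 4 8))) ($ 4 9 5 8)))) ($ 2 3 6 9))) ($ 1 2 6 8)))) ($ 0 4 6 9)))) (% 1 4 (% 1 8 (% 0 9 (! 2100 3000000045) (% 4 9 (! 2100 3000040050) (% 4 6 (% 2 6 (% 0 2 (! 0 201032145) (% 6 7 (% 2 5 (! 0 1411300252) (new 2 false 10 (! 0 12415300321))) ($ 0 7 2 6))) (% 2 9 (% 0 2 (! 21000 345) (% 8 9 (% 2 4 (! 0 2100031452) ($ 0 4 2 9)) ($ 0 8 2 9))) (% 3 6 (% 0 3 (! 210 400003005) (% 1 6 (! 0 304112052) ($ 0 1 3 6))) ($ 2 3 6 9)))) ($ 0 4 6 9)))) (% 8 9 (% 4 8 (! 10 300045202) (% 4 6 (% 2 6 (% 1 6 (! 33210 4050000) (% 5 6 (! 20100 403500000) n77)) (% 1 6 (% 3 6 (! 0 104232051) (% 6 7 (! 33210 4050000) ($ 1 6 3 7))) ($ 1 2 6 8))) (% 1 6 (% 0 9 (! 100 3400002025) (% 4 9 (% 3 6 (! 0 3204011250) (% 6 7 (! 20100 304030050) ($ 1 6 3 7))) ($ 0 4 6 9))) ($ 1 4 6 8)))) ($ 1 9 3 8))) ($ 1 5 3 4))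
  n89 = % 1 8 (! 0 430102125) ($ 1 2 7 8)
  n90 = % 7 8 n89 ($ 3 7 6 8)
  n91 = % 0 2 n90 ($ 0 7 2 6)
  n92 = % 4 7 (! 0 1131240025) ($ 1 4 5 7)
  n93 = % 3 6 (% 3 5 (! 0 2103214510) (% 3 8 (! 0 1203114520) (% 4 8 (% 1 3 (! 0 1203114520) (% 1 6 (! 10000 422300035) (% 0 3 (% 1 4 (! 210 300040005) (% 4 9 (! 0 1040223105) ($ 1 9 3 4))) ($ 0 1 3 6)))) ($ 3 4 5 8)))) (% 4 6 (% 7 8 n89 (% 3 8 (% 1 3 (% 1 8 (! 0 301022145) (% 5 9 (! 22110 4305000030) (% 8 9 (% 5 6 (! 0 1214300521) (% 6 7 (! 0 2241300135) (% 4 7 (% 1 4 (! 2100 4300030050) (% 2 4 (! 2010 30040005) ($ 1 2 4 7))) ($ 4 6 5 7)))) ($ 1 9 5 8)))) (% 1 8 (% 1 4 (! 0 201032145) (% 4 9 (% 4 7 (! 2010 30040005) (% 5 6 (! 0 1214301502) (% 6 7 (! 0 2014230531) ($ 4 6 5 7)))) ($ 1 9 3 4))) (% 8 9 (% 4 9 (! 0 3405221110) (% 1 4 n92 ($ 1 9 3 4))) ($ 1 9 3 8)))) (% 6 7 (% 1 4 n92 (% 4 9 (! 2110 4035000000) (% 1 3 (% 1 8 (! 0 2010221345) (% 5 9 (! 12110 4035000000) (% 8 9 (! 0 3415220021) ($ 1 9 5 8)))) ($ 1 9 3 4)))) ($ 3 7 6 8)))) (% 4 9 (% 3 8 (% 5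 9 (% 8 9 (! 0 2433501110) (% 1 3 (new 3 false 10 (! 0 11321402530)) (% 1 8 (new 3 false 10 (! 0 11231204530)) ($ 1 9 3 8)))) (% 8 9 (% 2 4 (new 3 false 10 (% 6 10 (! 0 10233102415) (% 9 10 (% 2 10 (! 0 22403135110) (% 5 10 (! 21100 30300405) (% 2 9 (new 5 true 11 (! 0 1412335200)) ($ 2 5 9 10)))) ($ 3 10 6 9)))) (% 2 9 (new 5 true 11 (% 0 11 (! 21000 330405) (% 1 11 (! 0 100401213235) ($ 0 1 5 11)))) ($ 2 5 4 9))) (% 1 8 (% 4 8 (new 3 false 10 (! 0 11202134530)) ($ 4 9 5 8)) ($ 1 9 5 8)))) (% 6 7 (! 2110 4035000000) n90)) ($ 3 4 6 9)))
  n94 = % 2 9 (! 12010 3040000005) (% 5 9 (! 12010 3040000005) (% 5 6 (% 1 6 (% 1 8 (! 2100 3000000045) (% 8 9 (! 21100 430300005) ($ 1 9 5 8))) ($ 0 1 5 6)) ($ 2 5 6 9)))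
  n95 = % 0 2 (% 2 6 n93 (% 3 6 (% 0 9 n94 (% 2 9 (% 1 6 (% 1 8 (! 21000 345) (% 5 9 (! 12010 3040500000) (% 8 9 (! 10000 422300035) ($ 1 9 5 8)))) (% 1 8 (% 0 3 (! 0 1002014325) (% 1 3 (! 0 1002013452) ($ 0 1 3 6))) ($ 1 2 6 8))) ($ 0 2 6 9))) (% 3 8 (% 0 9 n94 (% 2 9 (% 4 9 (% 1 8 (% 5 9 (! 0 4121301520) (% 4 8 (new 3 false 10 (% 0 3 (! 32100 400000005) (% 0 10 (! 2100 43035) (% 1 3 (! 32100 400000050) (% 1 10 (! 21000 345) ($ 0 1 3 10)))))) (% 8 9 (new 3 false 10 (% 0 3 (! 32100 400000005) (% 1 3 (! 32100 400000050) (% 1 10 (! 21000 345) (% 0 10 (new 5 true 11 (% 0 11 (! 21000 330405) (% 1 11 (! 2100 300000030045) ($ 0 1 5 11)))) ($ 0 1 3 10)))))) ($ 4 9 5 8)))) (% 1 6 (% 1 3 (! 21000 345) (% 6 7 (! 0 4135201120) ($ 1 6 3 7))) ($ 1 2 6 8))) (% 4 6 (% 2 4 (! 10 200042305) (% 5 6 (! 21100 40300305) ($ 2 5 4 6))) ($ 0 4 6 9))) ($ 0 2 6 9))) ($ 2 3 6 8)))) (% 2 4 (% 3 8 (% 2 6 (% 6 7 (% 1 3 (! 21110 34000530) (% 1 8 (! 21110 34000530) (% 8 9 (% 0 9 (! 12110 4035000000) (% 4 9 (! 0 3425102110) (% 4 6 (% 1 4 (! 0 1204031520) ($ 1 9 3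 4)) ($ 0 4 6 9)))) ($ 1 9 3 8)))) ($ 0 7 2 6)) (% 2 9 (% 8 9 (% 4 6 (% 4 7 (! 10 2020034500) (% 5 6 (! 21100 40500303) (% 6 7 (! 0 3425112010) ($ 4 6 5 7)))) (% 4 8 (% 3 6 (! 0 102234512) (% 4 9 (! 2100 4300050000) ($ 3 4 6 9))) ($ 2 4 6 8))) (% 0 9 (% 1 4 (! 2210 4030030500) (% 4 9 (! 32110 4000000500) (% 1 3 (% 3 6 (! 0 4213301520) (% 4 6 (! 2210 4030030500) ($ 3 4 6 9))) ($ 1 9 3 4)))) ($ 0 8 2 9))) (% 3 6 (% 5 6 (! 21100 40500303) (% 5 9 (% 4 9 (% 0 3 (! 210 400003005) (% 1 3 (! 0 4213501320) (% 1 6 (% 6 7 (! 12110 4035000000) ($ 1 6 5 7)) ($ 0 1 3 6)))) (% 4 6 (% 4 7 (! 0 2031145200) ($ 2 4 7 9)) ($ 2 4 6 9))) ($ 2 5 6 9))) ($ 2 3 6 9)))) (% 0 3 (% 2 6 (% 0 9 (! 1000 3042220005) (% 3 6 (! 21110 3004500) ($ 0 3 6 9))) (% 4 6 (! 10 200043205) (% 4 8 (% 0 9 (! 0 1040223105) (% 4 9 (% 2 9 (! 0 1010234502) (% 5 6 (! 21100 40500303) (% 5 9 (! 100 300242005) ($ 2 5 6 9)))) ($ 0 4 6 9))) ($ 2 4 6 8)))) ($ 0 8 2 3))) ($ 0 4 2 5))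
  n96 = % 6 7 (! 12110 4035000000) ($ 0 7 2 6)
  n97 = new 1 false 10 (! 0 3245100112)
  n98 = % 1 5 (! 21100 40300305) (% 5 6 (! 21100 40300305) ($ 1 6 5 7))
  n99 = % 4 6 (% 2 5 (% 0 2 (% 1 5 (! 21100 40300305) (% 5 6 (! 21100 40300305) (% 6 7 (% 2 4 (! 10 200042305) (% 2 6 (% 3 5 (! 22210 34530) (% 4 8 (! 100 2403050002) (% 3 8 (new 1 false 10 (! 0 2141300235)) ($ 3 4 5 8)))) ($ 2 5 4 6))) ($ 1 6 5 7)))) (% 2 4 (% 0 3 (! 22210 34500) (% 3 8 (% 8 9 (% 1 3 (! 0 101123452) (% 3 6 (! 0 1314225001) (% 6 7 n97 ($ 1 6 3 7)))) ($ 0 8 2 9)) ($ 0 8 2 3))) ($ 0 4 2 5))) (% 1 5 (% 0 2 (! 21100 40300305) (% 8 9 (% 0 3 (! 21100 400303005) (% 3 8 (% 3 6 (! 0 304225111) (% 6 7 n97 (% 1 3 (% 2 4 (! 0 403115322) (% 4 9 (% 1 4 n76 (% 5 9 (! 2010 3040500000) ($ 1 5 4 9))) ($ 0 4 2 9))) ($ 1 6 3 7)))) ($ 0 8 2 3))) ($ 0 8 2 9))) ($ 1 2 5 7))) (% 4 9 (% 2 5 (% 6 7 (! 2110 4035000000) (% 3 6 (% 0 2 n98 (% 8 9 (% 2 4 (% 0 3 (! 0 1413232005) (% 3 8 (! 0 2423115010) ($ 0 8 2 3))) ($ 0 4 2 5)) ($ 0 8 2 9))) (% 1 3 (% 2 6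 (! 32110 450) (% 3 8 (% 0 2 n98 (% 8 9 (% 2 4 (! 0 102123451) ($ 0 4 2 5)) ($ 0 8 2 9))) ($ 2 3 6 8))) ($ 1 6 3 7)))) (% 1 5 (% 0 2 (! 21100 40300305) (% 8 9 (% 0 3 (! 21100 400303005) (% 3 8 (% 5 9 (! 2010 3040500000) (% 1 4 (% 1 3 (! 22100 34050) (% 6 7 (! 2110 4035000000) (% 3 6 (new 1 false 10 (% 3 10 (! 0 22304011350) (% 7 10 (! 0 24253100113) ($ 1 10 3 7)))) ($ 1 6 3 7)))) ($ 1 5 4 9))) ($ 0 8 2 3))) ($ 0 8 2 9))) ($ 1 2 5 7))) ($ 0 4 6 9))
  n100 = % 1 9 (% 1 5 (% 3 8 (% 3 5 (! 20210 30405000) n88) (% 3 6 (% 3 5 (% 0 3 (! 20210 30405000) (% 0 2 (% 0 9 (! 10 2230405200) (% 2 9 (! 21100 40300305) (% 2 6 (% 4 9 (! 10 2230405200) (% 4 6 (% 1 3 (! 0 210304251) (% 1 6 n0 ($ 0 1 3 6))) ($ 0 4 6 9))) ($ 0 2 6 9)))) ($ 0 8 2 3))) (% 2 5 (% 2 4 (! 2210 40500303) (% 0 2 (% 4 8 (! 21100 430300005) ($ 3 4 5 8)) ($ 0 4 2 5))) ($ 2 3 5 8))) (% 2 6 (% 4 6 (% 6 7 (% 4 9 (! 2110 4035000000) (% 1 4 (% 0 2 (! 0 2201032145) (% 0 3 (! 0 2101032145) ($ 0 8 2 3))) (% 1 3 (% 0 2 (! 0 1201012345) (% 0 3 (! 0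 2101023145) ($ 0 8 2 3))) ($ 1 9 3 4)))) n91) (% 4 9 (% 6 7 (! 2110 4035000000) n91) ($ 3 4 6 9))) ($ 2 3 6 8)))) (% 2 5 n95 ($ 1 2 5 7))) (% 2 9 (% 0 9 (% 0 2 (! 12010 3040000005) (% 3 8 (% 2 5 (% 2 4 (% 4 6 (! 2210 4030030500) (% 4 9 (! 32110 4000000500) (% 3 6 (% 2 6 n96 (% 4 8 (% 4 7 (! 0 322041015) (% 7 8 (! 0 102234512) (% 8 9 (! 0 102234512) ($ 4 8 7 9)))) ($ 2 4 6 8))) ($ 3 4 6 9)))) ($ 0 4 2 5)) (% 1 5 (% 5 9 (! 2010 3040500000) (% 8 9 (% 1 4 (! 0 3410221205) (% 3 5 (! 20210 30405000) (% 1 3 (% 4 6 (! 0 3410221205) (% 4 9 (! 100 3400220005) (% 3 6 (% 1 6 (! 22110 3405000000) (% 1 8 (! 32100 400000050) (% 2 6 n96 ($ 1 2 6 8)))) ($ 3 4 6 9)))) ($ 1 5 3 4)))) ($ 2 9 5 8))) ($ 1 2 5 7))) (% 0 3 (% 2 5 (% 2 4 (% 2 6 (! 1000 3042220005) (% 4 6 (! 2110 4030030500) (% 4 8 (! 0 1040223105) ($ 2 4 6 8)))) ($ 0 4 2 5)) (% 1 5 (% 3 5 (! 20210 30405000) ($ 2 3 5 8)) ($ 1 2 5 7))) ($ 0 8 2 3)))) (% 1 6 n99 ($ 0 1 6 9))) ($ 1 2 7 9))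
  n101 = % 2 6 (! 0 3142151002) ($ 1 2 6 8)
  n102 = % 3 5 (% 0 9 (! 1000 4000220305) (% 1 6 (% 1 3 (! 21000 345) (% 1 5 (% 2 6 (! 0 3124110520) (% 3 8 (! 0 11221345) (% 3 6 (% 0 3 (! 0 10324521) (% 6 7 (! 1110 20200345) ($ 0 7 3 6))) ($ 2 3 6 8)))) (% 0 3 (% 3 6 (% 4 8 (! 11010 2000043205) (% 5 9 (! 0 3201421520) (% 8 9 (! 0 211204315) ($ 4 9 5 8)))) ($ 0 3 6 9)) ($ 0 1 3 5)))) (% 1 9 (% 1 8 (% 1 3 (! 0 120102345) (% 1 5 (! 21000 345) (% 5 9 (% 0 3 (! 0 3102412510) ($ 0 1 3 5)) ($ 1 9 3 5)))) (% 2 6 (% 3 6 (! 0 3124102510) (% 5 6 (! 21010 4300500) (% 5 9 (% 0 3 (! 0 3102412510) (% 1 3 (! 0 1020314520) (% 1 5 (! 2210 3000400500) ($ 0 1 3 5)))) ($ 3 5 6 9)))) ($ 1 2 6 8))) ($ 0 1 6 9)))) (% 4 7 (% 4 8 (% 0 9 (! 1000 4000220305) (% 1 6 (! 0 322141015) (% 1 9 (% 1 8 (% 1 4 (! 2100 3000040050) (% 2 4 (! 0 300142125) ($ 1 2 4 7))) (% 2 6 (% 1 5 (! 1010 320240005) (% 5 9 (! 0 3040252101) (% 8 9 (! 0 1322040015) ($ 1 9 5 8)))) ($ 1 2 6 8))) ($ 0 1 6 9)))) (% 3 8 (% 7 8 (% 1 8 (% 1 4 (! 2010 30040005) (% 2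 4 (! 0 2030140125) ($ 1 2 4 7))) ($ 1 2 7 8)) (% 8 9 (% 0 9 (! 1000 4000220305) (% 1 6 (% 1 4 (! 0 11221345) (% 2 4 (! 0 3021141520) ($ 1 2 4 7))) (% 1 9 (% 1 4 (% 1 8 (! 2100 3000040050) n101) (% 2 4 (% 1 8 (! 0 2031040531) n101) ($ 1 2 4 7))) ($ 0 1 6 9)))) ($ 3 8 7 9))) ($ 3 4 5 8))) ($ 3 4 5 7))
  n103 = % 0 2 (% 4 9 n102 (% 4 7 (% 4 6 (% 2 4 (% 0 9 (! 0 2030142105) (% 1 6 (% 1 5 (! 0 1120241305) (% 5 6 (! 0 1120241305) (% 6 7 (! 0 232141015) ($ 1 6 5 7)))) (% 1 9 (% 1 8 (! 0 1012040325) (% 2 6 (% 1 3 (! 0 1012040325) (% 1 4 (% 1 5 (! 0 1012040325) (% 4 8 (! 0 3214010520) ($ 1 4 5 8))) ($ 1 9 3 4))) ($ 1 2 6 8))) ($ 0 1 6 9)))) (% 1 4 (% 1 5 (! 10100 2030245) (% 1 8 (! 0 200112345) (% 4 8 (% 1 6 (! 0 311240025) (% 2 6 n6 ($ 1 2 6 8))) ($ 1 4 5 8)))) ($ 1 2 4 7))) (% 3 6 (% 0 9 (% 6 7 (% 2 6 (! 21210 4035000000) (% 1 6 (% 2 4 (! 0 4012120305) (% 1 4 (% 1 5 (! 0 2010120345) (% 1 8 (! 32110 4000050) (% 4 8 (! 210 300040005) ($ 1 4 5 8)))) ($ 1 2 4 7))) ($ 1 2 6 7))) (% 0 3 (% 7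 8 (! 12010 3040000005) (% 4 8 (% 1 4 (! 210 300040005) (% 2 4 (! 0 311242005) ($ 1 2 4 7))) ($ 4 7 6 8))) ($ 0 7 3 6))) ($ 0 4 6 9)) ($ 3 4 6 9))) ($ 3 4 7 9))) (% 2 4 (% 0 3 (% 0 9 (% 4 9 (! 32110 4000000500) (% 4 7 (% 4 6 (! 0 1030242105) (% 3 6 (% 4 8 (! 0 1030242105) (% 2 6 (% 6 7 (! 21210 3004000500) ($ 0 7 2 6)) ($ 2 4 6 8))) ($ 3 4 6 9))) ($ 3 4 7 9))) (% 3 6 (% 8 9 (% 3 8 (! 210 400003005) (% 3 5 (% 2 6 (! 0 2103214500) (% 4 6 (! 0 201043215) (% 4 8 (! 0 2100134502) ($ 2 4 6 8)))) (% 4 8 (% 4 7 (! 0 322141005) ($ 3 4 5 7)) ($ 3 4 5 8)))) ($ 0 8 2 9)) ($ 0 3 6 9))) ($ 0 7 2 3)) ($ 0 4 2 5))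
  n104 = % 7 8 (! 2010 40503003) ($ 3 8 7 9)
  n105 = % 2 7 (% 2 6 (% 4 6 (% 3 5 n69 (% 3 8 n79 (% 2 5 (% 3 7 n73 (% 4 7 (% 2 4 (! 22210 30040500) (% 0 2 (% 4 8 (! 0 2231140015) ($ 3 4 5 8)) ($ 0 4 2 5))) ($ 3 4 5 7))) ($ 2 3 5 8)))) n82) (% 3 8 (% 1 6 n84 (% 1 8 (% 1 9 (% 3 6 (% 0 3 (! 210 400003005) (% 1 3 (% 6 7 (! 0 1203114053) (% 3 7 (% 7 8 (! 210 340005000) ($ 2 7 6 8)) ($ 0 7 3 6))) ($ 0 1 3 6))) (% 2 9 (% 3 7 (! 32210 40000500) (% 7 8 (! 32210 40000500) (% 8 9 (% 3 5 (! 32210 4500) (% 4 7 (% 1 3 (! 21100 3450) (% 1 4 (! 0 4310200251) (% 4 9 (! 210 4530003000) ($ 1 9 3 4)))) ($ 3 4 5 7))) ($ 3 8 7 9)))) ($ 2 3 6 9))) (% 0 9 (% 2 9 (% 7 8 (! 32210 40000500) (% 8 9 (! 210 4530003000) ($ 1 8 7 9))) ($ 1 2 6 9)) ($ 0 1 6 9))) ($ 1 2 6 8))) (% 3 6 n86 ($ 2 3 6 8)))) (% 3 7 n100 (% 2 9 (% 2 5 n103 (% 3 5 (% 1 5 (% 8 9 (! 21100 400503003) (% 5 9 (% 0 9 (% 4 6 (! 2100 4000330005) (% 4 8 (! 21100 400503003) (% 3 6 (% 0 3 (% 4 7 (% 1 4 (! 2100 4000330005) (% 2 4 (! 0 3042121005)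 ($ 1 2 4 7))) (% 4 9 (% 1 8 (! 21000 30345) (% 2 6 (! 11110 3024002500) (% 1 6 (new 2 false 10 (% 5 10 (! 32210 405000) (% 7 10 (! 0 13241201005) ($ 2 10 5 7)))) ($ 1 2 6 8)))) ($ 3 4 7 9))) (% 0 2 (% 6 7 (! 0 3021002415) ($ 0 7 3 6)) ($ 0 7 2 3))) (% 3 8 n104 ($ 3 4 6 8))))) (% 4 9 (% 0 2 (% 3 8 n104 (% 4 6 (! 3210 4000050000) (% 4 8 (! 21100 400503003) (% 3 6 (% 1 8 (! 21000 345) (% 2 6 (! 0 3224101520) (% 1 6 (% 0 3 (! 10000 2002345) (% 6 7 (new 2 false 10 (! 0 14131202530)) ($ 0 7 3 6))) ($ 1 2 6 8)))) ($ 3 4 6 8))))) ($ 0 8 2 9)) ($ 0 4 5 9))) ($ 2 9 5 8))) ($ 1 2 5 7)) ($ 2 3 5 7))) ($ 2 3 7 9)))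
  n106 = % 3 8 (! 32100 400000050) ($ 2 3 5 8)
  n107 = % 1 9 (% 2 5 (% 0 2 (% 2 6 (% 1 3 (! 0 2010221345) (% 1 4 (! 0 1010221345) (% 4 9 (% 2 4 (! 0 1010143235) (% 5 9 (! 0 2342501110) (% 2 9 (new 0 false 10 (% 5 10 (! 0 11241320035) (% 8 10 (! 21100 340000305) ($ 0 10 5 8)))) ($ 2 5 4 9)))) ($ 1 9 3 4)))) ($ 0 2 6 8)) (% 2 4 (% 2 6 (% 6 7 (! 21110 34000530) ($ 0 7 2 6)) (% 2 9 (% 1 4 (! 0 3021120451) (% 4 9 (% 3 8 (! 0 1210034520) (% 3 6 (% 0 3 (! 22210 340005300) (% 1 3 (! 0 102213452) (% 1 6 (! 0 1213302450) ($ 0 1 3 6)))) ($ 2 3 6 8))) (% 1 3 (% 3 6 (! 0 102213452) (% 3 8 (! 32100 400000050) ($ 2 3 6 8))) ($ 1 9 3 4)))) (% 3 6 (% 5 6 (! 21100 340500000) (% 5 9 (% 0 3 (! 22210 340005300) (% 1 3 (! 0 1342500212) (% 1 6 (! 11110 2324000050) ($ 0 1 3 6)))) ($ 2 5 6 9))) ($ 2 3 6 9)))) ($ 0 4 2 5))) (% 1 5 (% 3 5 (! 21100 340500000) (% 3 8 (% 1 3 (! 32100 400000050) (% 1 4 (! 100 2300042050) ($ 1 5 3 4))) ($ 2 3 5 8))) ($ 1 2 5 7))) (% 2 9 (% 3 5 (! 22210 340005300) (% 2 5 (% 2 4 (% 0 9 (% 4 6 (! 2110 4030030500) (% 4 9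 (! 32110 4000000500) (% 3 6 (% 5 9 (! 12010 3040500000) (% 8 9 (! 0 4253301110) ($ 0 9 5 8))) ($ 3 4 6 9)))) (% 1 6 (% 1 5 (! 0 341502121) (% 5 6 (! 0 342501112) n29)) ($ 0 1 6 9))) (% 0 2 (% 0 9 (! 12010 3040000005) (% 1 6 (! 21000 345) ($ 0 1 6 9))) ($ 0 4 2 5))) (% 3 8 (% 1 5 (! 10 430205200) ($ 1 2 5 7)) ($ 2 3 5 8)))) ($ 1 2 7 9))
  n108 = % 2 7 (% 4 7 (% 1 9 (% 3 6 (% 1 3 (% 3 5 (! 22100 303004050) (% 3 8 (! 32100 400000050) (% 2 5 (% 2 6 (! 0 3124300511) (% 2 9 (! 0 3112200452) (% 5 6 (! 0 2143500211) (% 5 9 (! 22110 4303000050) ($ 2 5 6 9))))) ($ 2 3 5 8)))) (% 0 3 (% 3 8 (! 33210 400005000) (% 3 5 (% 1 4 (! 0 1020031245) (% 4 9 (! 0 4123150013) ($ 1 9 3 4))) ($ 0 3 5 8))) ($ 0 1 3 6))) (% 4 9 (% 2 6 (% 0 2 (! 0 2030141215) (% 2 4 (! 31210 4000500) (% 4 6 (! 0 1024050313) ($ 0 4 2 6)))) (% 3 8 (% 0 3 (! 33210 400005000) (% 3 7 (% 2 9 (! 32210 40000500) ($ 2 3 6 9)) ($ 0 7 3 8))) ($ 2 3 6 8))) (% 4 6 (% 2 6 (! 11110 34020520) (% 2 9 (! 0 4235010210) ($ 2 3 6 9))) ($ 3 4 6 9)))) (% 0 9 (% 2 6 (! 11110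 2034000520) (% 2 9 (! 11110 4032000520) ($ 1 2 6 9))) ($ 0 1 6 9))) (% 2 4 (% 3 7 (! 32210 40000500) (% 4 9 (% 0 9 (! 11210 4003050300) (% 1 9 (% 2 6 (! 31210 4000500) (% 2 9 (! 0 4131201520) (% 3 6 (% 3 5 (% 1 3 (! 21110 3450) (% 0 3 (% 5 9 (! 0 1043012532) (% 1 5 (new 0 false 10 (! 0 13101223045)) ($ 1 9 3 5))) ($ 0 1 3 6))) ($ 3 4 5 7)) ($ 2 3 6 9)))) ($ 0 1 6 9))) ($ 3 4 7 9))) ($ 2 7 4 8))) (% 2 6 (% 3 7 (% 2 9 (! 21110 34000530) (% 1 9 (% 0 9 (! 2110 4035000000) (% 4 9 (% 2 4 (! 21110 34000530) (% 4 6 (! 10210 304050000) (% 0 2 (% 2 5 (% 5 9 (! 12110 4035000000) ($ 2 5 4 9)) ($ 0 2 5 8)) ($ 0 4 2 6)))) (% 4 6 (% 1 4 (! 10210 304050000) (% 1 3 (% 1 5 n87 (% 2 5 (% 0 2 (! 0 2010221345) (% 2 4 (! 21110 34000530) ($ 0 4 2 5))) ($ 1 2 5 7))) ($ 1 9 3 4))) ($ 0 4 6 9)))) ($ 1 2 7 9))) (% 2 9 (% 8 9 (! 0 3415200210) (% 1 9 (% 4 9 (% 4 7 (! 0 3040151212) (% 3 5 (% 3 6 (! 22110 405003030) (% 4 6 (! 10210 304050000) ($ 3 4 6 7))) ($ 3 4 5 7))) (% 4 7 (% 0 9 (! 21210 4035000000) (% 4 6 (! 0 4035020121) ($ 0 4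 6 9))) ($ 3 4 7 9))) ($ 1 8 7 9))) ($ 2 3 7 9))) ($ 1 2 6 7))
  n109 = % 7 8 (% 2 7 (% 2 9 (! 32210 40000500) (% 2 6 (% 0 2 (! 3210 40000005) (% 2 4 (! 32210 40000500) (% 4 6 (% 6 7 (! 11210 435000000) (% 4 7 (% 1 6 (! 22210 453000300) (% 0 9 (% 0 3 (! 0 1342051210) ($ 0 9 2 3)) (% 1 9 (% 1 4 (! 0 1321040250) (% 4 9 (! 20210 340050000) (% 1 3 (% 1 5 n87 (% 3 5 (! 22110 403003050) (% 3 7 (% 2 5 ($ 0 4 2 5) n106) ($ 1 3 5 7)))) ($ 1 9 3 4)))) ($ 0 1 6 9)))) (% 5 6 (% 1 5 (! 21000 3400053) (% 1 6 (! 22210 453000300) ($ 0 1 5 6))) ($ 4 6 5 7)))) ($ 0 4 2 6)))) (% 3 6 (% 1 6 (! 22210 453000300) (% 1 9 (% 0 3 (% 3 8 (! 33210 400005000) (% 3 5 (% 1 3 (! 100 2000023045) (% 1 5 (! 21100 300405003) (% 5 9 (new 0 false 10 (! 0 12141320035)) ($ 1 9 3 5)))) ($ 0 3 5 8))) (% 1 3 (% 3 7 (% 2 5 n73 (% 3 8 (! 32100 400000050) (% 3 5 (new 0 false 10 (% 0 2 n85 (% 2 10 (! 22210 30004500) (% 3 10 (! 13210 40005000) ($ 0 10 2 3))))) ($ 2 3 5 8)))) (% 6 7 (% 3 5 (! 22110 303004050) (% 4 7 (% 2 5 (! 0 2413200351) n106) ($ 3 4 5 7))) ($ 0 7 3 6)))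 ($ 0 1 3 6))) ($ 1 2 6 9))) ($ 2 3 6 9)))) (% 3 7 n107 (% 2 9 (% 3 8 (% 3 5 (! 33210 400005000) (% 2 5 (% 0 3 (! 33210 400005000) (% 0 2 (% 4 7 (% 1 4 (! 0 300241152) (% 2 4 (! 1000 30242025) ($ 1 2 4 7))) ($ 3 4 5 7)) ($ 0 7 2 3))) ($ 2 3 5 7))) ($ 2 3 7 8)) ($ 2 3 7 9)))) (% 6 7 (% 1 6 (! 32110 4000050) n108) ($ 0 7 6 8))
  n110 = % 0 3 (! 1010 232045) (% 1 3 (! 22100 34050) ($ 0 1 3 8))
  n111 = new 0 false 10 (! 20100 304000053)
  n112 = % 2 6 (% 4 6 (% 1 6 (! 33210 4050000) (% 1 8 (! 10210 304050000) (% 0 8 (% 0 3 (! 100 2304252000) (% 3 8 (% 1 3 (! 2100 3300040050) (% 8 9 (! 10210 304050000) ($ 1 9 3 8))) (% 0 2 (% 2 5 (! 0 1120301452) (% 3 5 (! 21100 400503003) ($ 2 3 5 8))) ($ 0 8 2 3)))) ($ 0 1 6 8)))) (% 2 4 (% 4 9 (% 2 7 (! 22210 40030500) (% 2 9 (! 0 2010031451) (% 3 7 (! 1000 4032250002) ($ 2 3 7 9)))) (% 0 9 (% 2 7 (! 22210 40030500) (% 2 9 (! 0 3010012452) (% 3 7 (! 2110 3040050300) ($ 2 3 7 9)))) ($ 0 4 6 9))) (% 0 2 (% 0 9 (! 0 2010032145) (% 4 9 (! 0 3012040152) ($ 0 4 6 9))) ($ 0 4 2 6)))) (% 3 6 (%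 1 6 (% 0 9 (! 11110 3224000250) (% 4 6 (% 3 8 (! 0 1104232050) (% 3 5 (% 2 7 (! 22210 43050300) (% 2 9 (! 0 2104032150) (% 3 7 (! 22210 30045000) ($ 2 3 7 9)))) (% 2 5 (% 5 6 (% 2 7 (! 22210 43050300) (% 2 9 (! 0 3214100250) (% 3 7 (! 0 2214130050) ($ 2 3 7 9)))) (% 2 4 (% 2 9 (! 0 3214010250) (% 5 9 (! 0 2204131050) ($ 2 5 6 9))) ($ 2 5 4 6))) ($ 2 3 5 8)))) (% 4 9 (% 3 5 (! 21010 3300400050) (% 3 7 (! 1000 4032250002) (% 5 6 (! 21010 3300400050) (% 6 7 (! 100 3204020050) ($ 3 6 5 7))))) ($ 0 4 6 9)))) (% 1 8 (% 5 6 (! 21010 403500000) (% 3 5 (% 1 3 (! 21010 400300050) (% 0 3 (% 0 9 (! 0 402131052) (% 3 7 (! 22210 30045000) ($ 0 3 7 9))) ($ 0 1 3 6))) (% 1 3 (% 3 8 (! 100 2400032050) (% 2 5 (% 5 9 (! 12010 4000300050) (% 2 9 (% 0 2 (! 21000 300450) (% 2 4 (% 0 9 (% 2 7 (! 22210 40030500) (! 0 3010012452)) (% 4 6 (! 0 1304252010) (% 4 9 (! 2100 3000040050) ($ 0 4 6 9)))) ($ 0 4 2 5))) ($ 2 5 6 9))) ($ 2 3 5 8))) ($ 1 5 3 6)))) ($ 1 2 6 8))) (% 3 8 (% 2 9 (% 1 3 (! 2100 3300040050) (% 1 8 (! 100 2400032050) (% 8 9 (% 0 3 (! 33210 45000)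 (% 0 8 (% 4 9 (! 32010 400050000) (% 1 6 (% 4 6 (! 0 1214030250) ($ 3 4 6 9)) ($ 1 2 6 8))) ($ 0 1 3 8))) ($ 1 9 3 8)))) ($ 2 3 6 9)) ($ 2 3 6 8)))
  n113 = % 6 7 (% 1 6 (! 32110 4000050) ($ 0 1 6 7)) ($ 3 6 5 7)
  n114 = % 1 8 (% 4 9 (% 2 7 (% 3 5 (% 2 6 (% 5 9 (! 2210 3040500000) (% 3 6 (% 0 2 (! 10000 402302052) (% 4 6 (! 0 2304251010) (% 2 4 (% 0 3 (! 0 2112134500) (% 1 3 (! 22100 303004050) (% 1 6 (! 32110 4000050) ($ 0 1 3 6)))) ($ 0 4 2 6)))) (% 5 6 (% 4 6 (! 0 3214150020) ($ 0 4 5 6)) ($ 3 5 6 9)))) (% 7 8 (! 20010 340500000) (% 6 7 (% 1 6 (! 21010 400300050) ($ 0 1 6 7)) ($ 2 7 6 8)))) (% 1 3 (% 3 8 (! 32100 400000050) (% 2 5 (% 0 2 (! 10 2230402500) (% 2 4 (! 21000 300450) ($ 0 4 2 5))) ($ 2 3 5 8))) ($ 1 5 3 4))) (% 2 4 (% 3 5 (% 3 7 (! 10 2240305200) (% 2 9 (% 2 5 (! 0 3221102450) (% 5 9 (! 32110 4000000500) (% 8 9 (! 0 2411302150) ($ 2 9 5 8)))) ($ 2 3 7 9))) (% 1 3 (% 3 8 (! 32100 400000050) (% 2 5 (% 2 9 (! 0 3020012451) (% 3 7 (! 2210 3040500300) ($ 2 3 7 9))) ($ 2 3 5 8))) ($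 1 5 3 4))) ($ 1 2 4 7))) (% 1 3 (% 3 5 (! 21010 400300050) (% 3 8 (! 32100 400000050) (% 2 5 (% 2 6 (% 2 4 (! 21000 300450) (% 2 7 (% 0 2 (! 10000 422300052) (% 4 6 (! 100 2304252000) ($ 0 4 2 6))) ($ 1 2 4 7))) (% 3 6 (% 2 4 (% 3 7 (! 0 2031145201) (% 5 6 (! 21010 400300050) n113)) (% 2 7 (% 0 2 (! 10000 422300052) ($ 0 4 2 5)) ($ 1 2 4 7))) ($ 2 3 6 8))) ($ 2 3 5 8)))) ($ 1 9 3 4))) (% 2 4 (% 4 9 (% 2 6 (% 3 5 (% 3 7 (! 1000 4032250002) (% 2 7 (% 1 6 (! 0 2113102450) (% 0 8 (% 0 9 (! 11110 3040023500) (% 7 8 (! 32210 40000500) (% 8 9 (! 10 3240503200) ($ 0 8 7 9)))) ($ 0 1 6 8))) (% 2 9 (% 3 6 (! 0 4213101520) (% 5 6 (! 0 4213101520) (% 5 9 (! 32110 4000000500) ($ 3 5 6 9)))) ($ 2 3 7 9)))) (% 1 3 (% 2 5 (! 21000 300450) (% 3 8 (! 2100 4300050030) ($ 2 3 5 8))) ($ 1 5 3 4))) (% 1 6 (% 3 5 (% 3 8 (! 32100 400500000) (% 3 6 (% 2 9 (! 0 4201031520) (% 3 7 (! 1000 4032250002) (% 2 7 (% 4 6 (! 22210 40030500) (% 6 7 (! 0 4032050112) ($ 1 6 4 7))) ($ 2 3 7 9)))) ($ 2 3 6 8))) (% 1 3 (% 4 6 (! 1000 3004220050) (% 6 7 (!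 32110 4000050) ($ 1 6 4 7))) ($ 1 5 3 4))) ($ 1 2 6 8))) (% 1 3 (% 8 9 (% 2 9 (% 2 5 (! 0 3102201450) (% 3 5 (! 0 3021012451) (% 3 8 (! 0 3021012451) ($ 2 3 5 8)))) (% 3 8 (% 3 6 (! 0 1322045100) (% 2 6 (% 3 7 (! 0 1322045100) (% 2 7 (% 0 8 (! 0 1141232500) (% 1 6 (! 32110 450) ($ 0 1 6 8))) ($ 2 3 7 9))) ($ 2 3 6 9))) ($ 2 3 8 9))) ($ 1 9 4 8)) ($ 1 9 3 4))) ($ 1 2 4 8))
  n115 = % 2 7 (% 7 8 (% 2 9 (! 32210 40000500) (% 2 6 (% 3 6 (! 0 2314225100) (% 4 6 (% 1 6 (! 32110 4000050) (% 5 6 (! 0 1342500211) (% 1 4 (new 3 false 10 (% 6 10 (! 33210 4050000) (% 9 10 (! 0 1112023450) ($ 3 10 6 9)))) ($ 1 5 4 6)))) (% 4 9 (% 2 4 (! 32210 40000500) (% 0 2 (% 5 9 (! 2010 3040500000) (% 8 9 (! 0 3132201450) ($ 4 9 5 8))) ($ 0 4 2 6))) ($ 3 4 6 9)))) (% 3 6 (% 0 9 (! 11110 4352000230) (% 4 6 (! 0 2314215200) (% 4 9 (% 3 5 (! 10 2340502000) (% 3 7 (! 210 340005000) (% 5 6 (! 0 1314215200) n113))) ($ 0 4 6 9)))) ($ 2 3 6 9)))) (% 0 2 (% 0 9 (! 2100 3000000045) (% 8 9 (% 2 6 (% 4 6 (% 1 6 (! 32110 4000050) (% 5 6 (! 21000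 3400053) (% 1 4 (% 3 6 (! 0 102203451) (new 3 false 10 (! 0 10020123451))) ($ 1 5 4 6)))) (% 4 9 (% 6 7 (! 0 4312201350) ($ 4 7 6 8)) ($ 0 4 6 9))) (% 2 9 (% 1 6 (! 32110 450) (% 1 8 (! 32100 400000050) ($ 1 2 6 8))) ($ 0 2 6 9))) ($ 0 8 7 9))) ($ 0 8 2 7))) (% 3 7 (% 1 4 (% 4 9 (! 2100 3000040050) (% 4 6 (% 8 9 (! 2100 4300030050) (% 0 9 (% 0 2 (! 2100 30045) (% 0 3 (! 0 1001032145) (% 2 9 (! 0 1010043252) ($ 0 9 2 3)))) (% 7 8 (% 2 6 (! 0 1340205211) (% 2 9 (! 10 340205200) (% 3 6 (! 0 132245001) ($ 2 3 6 9)))) ($ 0 8 7 9)))) (% 0 9 (% 3 6 (% 1 6 (! 11110 3224000250) (% 2 6 (! 12110 4030000350) (% 1 8 (% 6 7 (! 22110 4003030050) (% 7 8 (! 0 1413032050) ($ 4 7 6 8))) ($ 1 2 6 8)))) ($ 3 4 6 9)) ($ 0 4 6 9)))) (% 2 4 (% 2 5 (% 0 9 (! 2210 3040500300) (% 4 6 (! 0 2131145200) (% 4 9 (! 0 2231145100) ($ 0 4 6 9)))) ($ 2 4 5 8)) ($ 1 2 4 7))) (% 2 9 (% 8 9 (% 1 4 (! 2100 4300030050) (% 2 4 (% 2 5 (! 0 3102102450) (% 3 5 (! 32100 400500000) ($ 2 3 5 7))) ($ 1 2 4 7))) (% 7 8 (% 1 8 (% 2 5 (! 0 1412300250) (% 3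 5 (! 10 320405200) ($ 2 3 5 7))) ($ 1 2 7 8)) ($ 3 8 7 9))) ($ 2 3 7 9)))
  n116 = % 3 5 (! 10010 2400302050) ($ 2 3 5 7)
  n117 = % 3 6 (% 0 3 (% 0 9 (% 1 6 (! 0 3112020145) (% 1 8 (! 0 3221010145) (% 2 6 (% 1 4 (! 0 3112020145) (% 4 9 (! 100 2304235000) (% 1 3 (% 2 4 (! 21110 3004500) (% 2 7 (! 0 120304152) ($ 1 2 4 7))) ($ 1 9 3 4)))) ($ 1 2 6 8)))) (% 3 7 (% 7 8 (! 20210 40305000) (% 8 9 (% 4 9 (% 4 6 (! 22210 30045000) (% 6 7 (! 22100 304305000) ($ 4 7 6 8))) ($ 3 4 8 9)) ($ 0 8 7 9))) ($ 0 3 7 9))) (% 0 2 (% 8 9 (! 21100 400503003) (% 0 9 (% 1 3 (! 2100 3000000045) (% 1 6 (% 5 9 (! 0 3224101250) ($ 0 9 3 5)) ($ 0 1 3 6))) (% 7 8 (% 3 7 (! 20210 340500000) (% 2 7 (% 2 9 (! 32210 40000500) (% 2 6 (% 1 3 (! 11110 203004520) (% 1 6 (% 1 4 (! 22210 43030500) (% 4 9 (! 0 2113102450) ($ 1 9 3 4))) ($ 0 1 3 6))) ($ 0 2 6 9))) ($ 2 3 7 8))) ($ 0 8 7 9)))) ($ 0 8 2 3))) (% 4 6 (% 2 6 (% 5 6 (% 0 2 (% 2 7 (% 1 3 (! 21000 3400053) (% 1 4 (! 0 2231410053) (% 4 9 (! 0 4223150011) ($ 1 9 3 4)))) (% 2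 5 (% 1 4 (! 0 20311452) (% 2 4 (! 21010 3400500) ($ 1 2 4 7))) ($ 0 2 5 7))) (% 0 3 (% 0 9 (% 1 3 (! 10000 2304052) (% 1 4 (! 0 2112030145) (% 4 9 (! 100 2304253000) ($ 1 9 3 4)))) ($ 0 3 6 9)) ($ 0 8 2 3))) (% 5 9 (% 1 3 (! 2110 4005030030) (% 4 9 (! 32110 4005000000) (% 1 4 (% 0 9 (! 0 4110302152) ($ 0 4 5 9)) ($ 1 9 3 4)))) ($ 3 5 6 9))) ($ 2 3 6 8)) ($ 3 4 6 8))
  n118 = % 0 8 (% 3 8 (% 1 3 n115 (% 1 4 (% 1 8 (% 4 9 (! 2100 3000040050) (% 4 6 (% 3 7 (% 0 3 (% 0 9 (! 0 101232045) (% 7 8 (! 23210 40005000) (% 8 9 (! 33210 400005000) ($ 0 8 7 9)))) ($ 0 1 3 7)) (% 2 7 (% 7 8 (% 2 9 (! 32210 40000500) (% 2 6 (new 5 true 10 (% 0 10 (! 0 240352113) n75)) (% 3 6 (% 0 3 (! 0 2304215210) (% 1 6 (! 22210 43050300) ($ 0 1 3 6))) ($ 2 3 6 9)))) (% 8 9 (% 0 2 (! 0 3421000152) ($ 0 8 2 7)) ($ 3 8 7 9))) (% 2 9 (% 2 5 (! 0 1412300251) n116) ($ 2 3 7 9)))) (% 0 9 (% 0 2 (! 2100 3000000045) (% 0 3 (! 10 300224005) (% 2 9 (% 3 7 ($ 0 1 3 7) (% 8 9 (! 22110 3400000050) (% 7 8 (% 2 5 (! 0 1412300250) (% 2 7 (!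 12110 3000000450) n116)) ($ 3 8 7 9)))) ($ 0 9 2 3)))) ($ 0 4 6 9)))) (% 8 9 (% 4 6 (% 1 6 (! 11010 3204200050) (% 2 6 (% 5 6 (! 20100 403500000) (% 6 7 (! 0 2134151002) (% 2 7 (% 7 8 (! 0 4253300111) (% 0 2 n77 ($ 0 8 2 7))) (% 2 5 (% 0 2 n77 (% 2 4 (% 2 9 (! 0 3120102452) (% 3 7 (! 0 1203041520) ($ 2 3 7 9))) ($ 0 4 2 5))) ($ 2 6 5 7))))) ($ 1 2 6 8))) (% 1 6 (% 3 6 (! 11010 3204200050) (% 4 9 (% 6 7 (! 100 3204020050) (% 7 8 (! 0 4132251002) ($ 4 7 6 8))) ($ 3 4 6 9))) ($ 1 4 6 8))) ($ 1 9 3 8))) (% 4 9 (% 3 5 (% 5 9 (! 2100 4300530000) n62) ($ 1 5 3 4)) ($ 1 9 3 4)))) (% 3 5 n117 ($ 3 4 5 8))) ($ 0 4 5 8)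
  n119 = % 3 6 (! 22110 3405000000) (% 4 6 (! 22110 3405000000) ($ 3 4 6 9))
  n120 = new 1 false 10 (% 7 10 (! 11110 2032040530) (% 9 10 (! 32110 4000000500) ($ 1 10 7 9)))
  n121 = % 1 4 (% 4 9 (! 3210 4000050000) (% 1 6 (% 8 9 n119 (% 2 4 (% 2 5 (% 5 9 (! 0 3120412501) (% 0 8 (% 0 2 (! 210 300040005) (% 0 3 (! 0 100232145) (% 3 8 (! 0 100123453) ($ 0 8 2 3)))) ($ 0 9 5 8))) (% 5 9 (% 2 7 (! 22110 30450) (% 3 7 (! 2110 4050030300) (% 3 5 (% 2 6 (! 11110 3024000520) (% 3 6 (! 0 1011023453) (% 3 8 (! 32100 400500000) ($ 2 3 6 8)))) ($ 2 3 5 7)))) ($ 2 9 5 8))) ($ 2 9 4 8))) (% 4 6 (% 2 6 (! 11110 3224000520) (% 1 8 (% 8 9 (% 5 6 (! 0 1412300152) (% 5 9 (! 0 1422300152) ($ 1 5 6 9))) (% 7 8 (% 2 4 (! 2110 3030040500) ($ 2 9 4 8)) ($ 1 8 7 9))) ($ 1 2 6 8))) ($ 1 4 6 9)))) (% 1 8 (% 8 9 (% 3 5 (% 1 6 (! 21010 400300050) (% 5 9 (% 2 6 (! 100 3402502000) (% 3 8 (! 32100 400500000) (% 3 6 (% 0 3 (! 0 2433511100) (% 1 3 (! 21010 400300050) ($ 0 1 3 6))) ($ 2 3 6 8)))) (% 5 6 (% 4 6 (! 210 3400053000) ($ 0 4 5 6)) ($ 1 5 6 9)))) (% 1 3 (%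 3 7 (% 2 4 (! 2210 4050300300) n3) ($ 1 3 7 9)) ($ 1 5 3 4))) (% 7 8 (% 2 4 (! 2210 4050300300) (% 4 9 n3 ($ 2 9 4 8))) ($ 1 8 7 9))) (% 2 4 (% 1 3 (% 3 7 (! 2210 4050300300) ($ 1 3 7 9)) (% 3 5 (% 5 9 (% 1 6 (% 6 7 (! 0 3142512001) (% 4 6 (% 2 6 (! 0 3224102510) (% 3 8 (! 32100 400500000) (% 3 6 n120 ($ 2 3 6 8)))) ($ 1 6 4 7))) (% 2 6 (% 3 6 (! 0 3224101520) (% 4 6 (! 21210 3004000500) (% 4 9 (! 32110 4000000500) ($ 3 4 6 9)))) ($ 1 2 6 8))) (% 0 3 (% 3 8 (! 32100 400500000) (% 3 6 (% 8 9 (! 0 1022043125) (% 0 8 (% 2 5 (! 0 311242015) ($ 2 9 5 8)) ($ 0 9 5 8))) (% 0 8 (% 2 6 (! 22100 403503000) ($ 2 3 6 8)) ($ 0 3 6 8)))) ($ 0 9 3 5))) ($ 1 5 3 4))) ($ 1 2 4 8)))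
  n122 = % 2 5 (! 0 200324511) ($ 2 4 5 8)
  n123 = % 3 8 (% 2 5 (% 0 2 (! 10 2230403500) (% 2 4 (! 10 2230403500) ($ 0 4 2 5))) (% 5 9 (% 3 7 (! 2010 3040500000) (% 7 8 (! 2010 3040500000) (% 8 9 (! 10 3420502000) ($ 3 8 7 9)))) (% 8 9 (% 2 4 (! 10 4520302300) (% 2 7 (! 210 4530003000) (% 1 4 (% 4 9 (! 3210 4000050000) (% 1 8 (% 5 6 (! 10000 402300250) (% 1 6 n119 ($ 1 5 6 9))) ($ 1 4 8 9))) ($ 1 2 4 7)))) ($ 2 9 5 8)))) (% 3 5 (% 3 6 (% 0 3 (% 1 6 (% 1 4 (% 5 9 (! 0 4223131005) (% 8 9 (! 0 3412121005) (% 2 5 (% 0 2 (! 0 2001021345) (% 2 4 (! 0 102032145) ($ 0 4 2 5))) ($ 2 9 5 8)))) (% 4 6 (% 2 4 n120 (% 2 7 (% 2 5 (% 0 2 (! 0 2010213405) ($ 0 4 2 5)) (% 5 9 (! 0 4220131305) (% 8 9 (! 0 3412101025) ($ 2 9 5 8)))) ($ 1 2 4 7))) (% 6 7 (% 2 7 (! 0 4235010211) (% 2 4 n122 ($ 1 2 4 7))) ($ 1 6 4 7)))) (% 5 9 (% 2 4 n122 (% 2 7 (! 0 3241511200) (% 1 4 (% 4 6 (! 0 220131245) (% 6 7 (! 0 3142512100) (% 7 8 (! 2010 3040500000) ($ 4 7 6 8)))) ($ 1 2 4 7)))) (% 5 6 (% 4 6 (! 0 104325021) ($ 0 4 5 6))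 ($ 1 5 6 9)))) (% 5 9 (% 0 2 (% 2 5 (! 2210 3000400500) (% 2 7 (! 2210 3040500000) ($ 0 2 5 7))) ($ 0 8 2 3)) ($ 0 9 3 5))) (% 4 6 (% 2 6 (% 2 4 (! 21210 3004000500) (% 2 7 (! 21210 3004000500) (% 1 4 (% 0 2 (! 0 3021010425) (% 0 3 (% 1 6 (! 33210 4050000) n7) ($ 0 8 2 3))) ($ 1 2 4 7)))) ($ 2 3 6 8)) ($ 3 4 6 8))) ($ 3 4 5 8))
  n124 = % 2 6 (% 3 8 (% 0 2 (% 1 6 (! 10100 2020345) (% 5 9 (! 2210 3040500000) (% 5 6 (% 3 7 (! 210 430005003) (% 7 8 (! 0 2341502120) (% 8 9 (! 20100 403500000) ($ 3 8 7 9)))) ($ 1 5 6 9)))) (% 7 8 (% 2 4 (! 32210 40000500) (% 4 6 (% 0 3 (! 0 2310214205) ($ 0 9 2 3)) ($ 0 4 2 6))) ($ 0 8 2 7))) (% 3 5 (% 5 9 (! 2210 3040500000) (% 0 3 (% 4 6 (% 5 6 (% 0 2 (! 0 110123425) (% 7 8 (! 0 1342520011) ($ 0 8 2 7))) (% 1 6 (% 3 6 (% 0 2 (! 10100 2020345) (% 7 8 (! 10100 202030345) ($ 0 8 2 7))) ($ 3 5 6 9)) ($ 1 5 6 9))) (% 3 6 (% 2 4 (! 0 1213124500) (% 0 2 (% 1 6 (! 0 103024521) (% 5 6 ($ 0 4 5 6) ($ 1 5 6 9))) ($ 0 4 2 6))) ($ 3 4 6 8))) ($ 0 9 3 5)))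 ($ 3 4 5 8))) (% 3 6 (% 1 6 (% 6 7 (% 3 5 (% 5 9 (! 2210 3040500000) (% 0 3 (% 7 8 (! 0 3425310011) (% 0 2 (new 1 false 10 (% 9 10 (! 10210 34300000005) (% 7 10 (% 0 10 (! 0 23124010351) (% 8 10 (! 20100 303000045) ($ 0 8 7 10))) ($ 1 10 7 9)))) ($ 0 8 2 7))) ($ 0 9 3 5))) (% 3 8 (% 1 3 (! 32110 4000050) (% 1 4 (% 7 8 (! 0 3425300111) (% 8 9 (! 22110 3405000000) (% 3 7 (% 0 3 (! 0 301224015) ($ 0 1 3 7)) ($ 3 8 7 9)))) ($ 1 5 3 4))) ($ 3 4 5 8))) (% 7 8 (% 3 5 (% 5 9 (! 2210 3040500000) (% 0 3 (% 1 4 (new 1 false 10 (! 0 11412330025)) (% 4 6 (new 1 false 10 (! 0 11212330045)) ($ 1 6 4 7))) ($ 0 9 3 5))) (% 3 8 (% 3 7 (! 210 340005000) (% 5 6 (% 0 2 (! 0 2341502120) (% 0 3 (! 0 302114025) ($ 0 9 2 3))) ($ 3 6 5 7))) ($ 3 4 5 8))) ($ 2 7 6 8))) ($ 1 2 6 9)) ($ 2 3 6 9))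
  -- Here a 0 and b 0 are not adjacent. The neighbours of b 0 on its walk are b 2 and b 3, and
  -- whichever of them is not adjacent to a 0 must be adjacent to a 4, since b 0 is not. If a 0 is
  -- not adjacent to b 2, then a 1 must also be adjacent to b 0, because b 2 is not adjacent to a 1.
  n125 = % 0 7 (% 0 8 n105 (% 4 8 (% 1 8 n109 (% 1 6 (% 1 5 (% 1 4 (% 7 8 (% 2 5 (! 20010 340500000) (% 3 5 (! 20010 340500000) (% 3 8 n110 ($ 2 3 5 8)))) (% 6 7 (% 4 6 (! 33210 4050000) (% 3 6 n111 (% 4 9 (% 3 8 n110 (% 2 6 (% 0 2 (! 0 2010131245) (% 2 4 (! 22110 30450) ($ 0 4 2 6))) ($ 2 3 6 8))) ($ 3 4 6 9)))) ($ 0 7 6 8))) (% 2 4 (% 3 5 (% 3 8 (! 32100 400500000) (% 3 6 (% 0 3 (! 22100 300405003) (% 6 7 n111 (% 3 7 (% 7 8 (! 22210 340005300) ($ 0 7 6 8)) ($ 0 7 3 6)))) (% 2 6 (% 0 2 (! 10000 22000345) (% 6 7 (! 10000 203002452) (% 2 7 (% 7 8 (! 32210 40000500) ($ 0 7 6 8)) ($ 0 7 2 6)))) ($ 2 3 6 8)))) (% 1 3 (% 6 7 (! 32110 4000050) (% 7 8 (% 2 7 (! 32110 450) ($ 1 2 7 8)) ($ 0 7 6 8))) ($ 1 5 3 4))) ($ 1 2 4 8))) ($ 0 1 5 8)) ($ 0 1 6 8))) ($ 0 4 5 8))) (% 1 5 (% 4 7 (% 1 9 (% 4 8 (% 1 4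 n112 n114) n118) (% 0 9 (% 4 8 (% 2 9 n121 (% 2 7 (% 2 6 (% 0 2 (% 2 5 (! 10 2230402500) (% 0 8 (% 1 6 (! 10100 2020345) (% 5 6 (! 20100 403500000) (% 5 9 (! 2210 3040500000) ($ 1 5 6 9)))) ($ 0 2 5 8))) (% 0 3 (% 3 7 (! 11110 30024520) (% 3 5 (% 0 8 (! 21100 430500003) (% 3 8 (! 33210 400005000) (% 5 9 (! 2210 3040500000) (% 8 9 ($ 2 3 8 9) ($ 0 9 5 8))))) ($ 0 3 5 7))) ($ 0 9 2 3))) (% 1 6 (% 3 6 (% 5 9 (! 2210 3040500000) (% 8 9 (! 22110 3405000000) (% 0 8 (% 0 2 (% 1 4 (! 210 300040005) (% 1 8 (! 10000 403202050) (% 2 4 (! 10100 2020345) ($ 1 2 4 8)))) (% 7 8 (% 0 3 (! 10100 203030245) ($ 0 9 2 3)) ($ 0 8 2 7))) ($ 0 9 5 8)))) ($ 2 3 6 9)) ($ 1 2 6 9))) ($ 1 2 7 9))) (% 0 8 (% 2 9 n123 (% 2 7 n124 ($ 1 2 7 9))) ($ 0 4 5 8))) ($ 0 1 7 9))) ($ 0 4 5 7)) ($ 0 1 5 7))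

  -- As every b i misses the vertex of a in the part behind it, the p-parent of b i lies outside
  -- both walks. The tree can bring in such parents in any branch where no other named candidate is
  -- in the way, and the five missing adjacencies restrict the rest through 2K2-freeness.
  none-tree : Tree
  none-tree = % 0 5 n66 n125

  q0 = % 2 10 (% 4 8 (% 0 3 (! 11100 20032345) (% 3 10 (! 100 32300245000) (% 9 10 (! 100 32200453000) (% 0 9 (% 3 5 (! 22100 345000) (% 5 9 (% 8 9 (! 100 2300452000) (% 2 9 (% 1 3 (! 0 21120023451) (% 1 4 (! 0 10222130045) (% 3 7 (! 21100 3453) (% 4 7 (! 0 10322140035) ($ 1 7 3 4))))) ($ 0 9 2 8))) ($ 3 9 5 10))) ($ 0 10 3 9))))) (% 2 4 (% 0 3 (! 0 11000143225) (% 3 10 (! 21100 3453) (% 9 10 (% 0 9 (! 0 12000243135) (% 1 3 (! 0 21120023451) (% 1 9 (% 0 7 (! 20010 40030500300) (% 4 9 (! 100 32200453000) (% 4 7 (% 3 8 (! 21100 3453) (% 4 6 (! 10 30030242500) (% 3 6 (% 2 9 (! 10 34000202500) (% 2 6 (% 1 6 (! 20010 30000300450) (% 3 7 (! 21100 3453) (% 6 7 (% 2 5 (! 20010 30000400500) (% 2 7 (! 31210 4000500) (% 3 5 (! 100 4203025020) ($ 2 3 5 7)))) ($ 1 7 3 6)))) ($ 2 4 6 9))) ($ 3 4 6 8)))) ($ 0 4 7 9)))) ($ 0 1 3 9)))) (% 0 9 (% 2 6 (! 0 21100143235) (% 3 6 (% 2 9 (! 0 21000143235) (% 1 6 (! 0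 10013221045) (% 1 9 (% 1 3 (! 0 21120023451) (% 3 7 (! 21100 3453) (% 6 7 (% 4 6 (! 22100 3450000) (% 4 9 (! 0 1132030245) ($ 2 4 6 9))) ($ 1 7 3 6)))) ($ 1 2 6 9)))) ($ 0 6 2 3))) ($ 0 10 3 9))))) ($ 0 4 2 8))) (% 8 10 (% 4 8 (! 32100 400500000) (% 2 4 (% 0 3 (! 0 21000143215) (% 3 10 (! 21100 3453) ($ 0 10 2 3))) ($ 0 4 2 8))) ($ 0 10 2 8))
  q1 = % 0 2 (! 11100 20002345) (% 2 7 (! 21100 30000045) (% 7 8 (! 21100 30000045) ($ 0 7 2 8)))
  q2 = % 5 9 (% 4 9 (! 2100 3000450000) (% 0 9 (% 1 6 (! 0 10123120045) (% 1 9 (! 0 13000221145) (% 2 6 (% 1 3 (! 2110 30345) (% 1 4 (! 0 12000231145) (% 3 7 (! 1000 3042520000) (% 4 7 (% 2 7 (! 2210 3040500000) (% 3 5 (! 2210 4000305000) (% 2 5 (% 2 4 (! 0 21000143235) (% 4 8 (! 0 21200143235) (% 7 8 (! 1000 3042520000) ($ 2 8 4 7)))) ($ 2 3 5 7)))) ($ 1 7 3 4))))) (% 2 9 (% 1 3 (! 0 21000132345) (% 1 4 (! 0 12000231145) (% 3 7 (! 1000 3042520000) (% 4 7 (% 2 5 (! 10 2030403500) (% 2 7 (! 2210 3040500000) (% 3 5 (! 2210 4000305000) ($ 2 3 5 7)))) ($ 1 7 3 4))))) ($ 1 2 6 9))))) (% 4 7 (% 9 10 (% 0 2 (! 11100 20020002345)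 (% 2 10 (! 10 43020500200) (% 8 10 (! 32100 40000500000) ($ 0 10 2 8)))) (% 7 10 (% 2 10 (! 10 32040500200) (% 8 10 (! 10 32240500000) (% 0 2 (% 0 3 (! 0 11110024325) (% 1 3 (! 32100 45) (% 1 9 (! 1000 3042520000) ($ 0 1 3 9)))) ($ 0 10 2 8)))) ($ 0 10 7 9))) ($ 0 4 7 9)))) (% 1 9 (% 4 6 (% 9 10 (% 0 9 (! 2110 3040005) (% 4 9 (! 22010 30000453000) (% 4 7 (% 8 10 (! 32100 40000500000) (% 0 2 (% 2 7 (! 21100 30030000045) (% 2 9 (! 21100 345) ($ 0 2 7 9))) (% 2 10 (% 2 4 (! 10 30030242500) (% 4 8 (! 22010 30000453000) ($ 0 4 2 8))) ($ 0 10 2 8)))) ($ 0 4 7 9)))) (% 0 9 (! 2110 3040005) (% 7 10 (% 4 7 (! 1000 2043250000) (% 4 9 (! 1000 4023250000) ($ 0 4 7 9))) ($ 0 10 7 9)))) (% 4 9 (% 9 10 (! 100 32200453000) (% 0 9 (! 0 13010021245) (% 0 3 (! 0 11120032345) (% 3 10 (! 2100 33000450000) ($ 0 10 3 9))))) ($ 4 5 6 9))) (% 1 6 (% 1 3 (! 32110 4000050) (% 3 5 (% 0 3 (! 0 10123120045) (% 0 9 (! 0 10123120045) ($ 0 1 3 9))) ($ 1 5 3 9))) ($ 1 5 6 9)))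

  -- Vertex 10 is the q-parent of a 0, added at the root before this tree starts. It lies in the
  -- class of b 3 but differs from it. The tree adds no other vertex and relies on the adjacencies
  -- of b i with a (i - 1), which hold at all five positions.
  q-tree : Tree
  q-tree = % 0 5 (% 0 2 (% 1 4 (! 3210 40005) (% 1 5 (! 32100 400005) (% 2 4 (! 2110 40305) (% 2 5 (% 0 7 (! 0 11120402305) (% 2 7 (! 11000 420325) (% 2 9 (! 21000 400305) (% 0 9 (% 7 8 (! 0 12210401305) (% 8 9 (% 1 6 (! 0 112012345) (% 2 6 (! 0 122400315) (% 1 9 (% 4 9 (! 0 11100342205) (% 5 9 (! 13210 4000000005) ($ 1 9 4 5))) ($ 1 2 6 9)))) ($ 2 8 7 9))) ($ 0 2 7 9))))) ($ 1 2 4 5))))) (% 2 4 (% 0 3 (! 1110 43225) (% 3 5 (% 2 6 (! 0 10100342125) (% 3 6 (% 3 10 (! 32210 4500) (% 2 10 (% 0 9 (! 0 1100342125) (% 9 10 (% 1 3 (! 21110 3450) (% 1 9 (% 1 4 (! 1110 2030245) (% 3 7 (! 1110 2043235) (% 4 7 (% 1 6 (! 0 12113020045) (% 6 7 (! 100 3204025020) ($ 1 7 3 6))) ($ 1 7 3 4)))) ($ 0 1 3 9))) ($ 0 10 3 9))) ($ 0 10 2 3))) ($ 0 6 2 3))) (% 2 5 (% 0 9 (! 0 12100341205) (% 5 9 (% 1 3 (! 0 11000341225) (% 1 9 (! 0 11000341225) ($ 0 1 3 9))) ($ 0 5 3 9))) ($ 0 5 2 3)))) (% 4 8 (% 0 3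 (! 0 11100243205) (% 3 5 (! 22100 345000) (% 2 5 (% 0 9 (! 0 12200341105) (% 5 9 (% 3 10 (! 100 23300245000) (% 9 10 (! 100 24300523000) ($ 0 10 3 9))) ($ 0 5 3 9))) ($ 0 5 2 3)))) ($ 0 4 2 8)))) (% 1 5 (% 5 10 (% 5 6 (% 0 2 (% 0 7 (! 11100 20002345) (% 2 5 (! 0 10220120345) (% 2 7 (! 0 10120120345) ($ 0 2 5 7)))) q0) (% 0 7 q1 (% 6 7 q2 ($ 0 6 5 7)))) (% 8 10 (% 0 7 q1 (% 7 10 (% 0 2 (! 11100 20020002345) (% 0 3 (! 11100 30020002345) (% 3 10 (% 2 4 (! 21100 3453) (% 4 8 (! 33210 40500000000) ($ 0 4 2 8))) (% 2 10 (% 4 8 (! 22210 30400000500) (% 0 9 (! 10 42230003500) (% 9 10 (% 3 8 (! 33210 40500000000) (% 4 10 (! 2100 43000350000) ($ 3 4 8 10))) ($ 0 10 3 9)))) ($ 0 10 2 3))))) ($ 0 10 5 7))) ($ 0 10 5 8))) (% 1 8 (% 0 2 (! 0 211021345) (% 4 8 (% 1 4 (! 0 311041252) (% 2 4 (! 0 311021452) (% 2 5 (% 2 6 (! 22110 300000450) (% 5 6 (% 2 10 (% 0 3 (! 11110 322002450) (% 3 6 (% 5 10 (! 21010 403500000) (% 8 10 (! 10 20420300500) ($ 0 10 5 8))) ($ 0 6 2 3))) (% 5 10 (% 8 10 (! 32100 400500000) ($ 0 10 2 8)) ($ 0 10 2 5))) ($ 0 6 2 5))) ($ 1 2 4 5))))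 (% 2 4 (% 1 4 (! 0 211031452) (% 3 8 (! 0 311012452) (% 1 3 (% 0 3 (! 21110 3450) (% 3 10 (! 21100 3450) (% 2 10 (% 8 10 (! 11110 20320000450) (% 5 10 (% 3 5 (! 21110 3450) (% 1 10 (% 9 10 (! 10000 30000002452) (% 0 9 (% 5 9 (! 0 21300230145) ($ 3 9 5 10)) ($ 0 10 3 9))) ($ 1 3 5 10))) ($ 0 10 5 8))) ($ 0 10 2 3)))) ($ 1 8 3 4)))) ($ 0 4 2 8)))) ($ 0 1 5 8)))


  -- With all adjacencies along the parent directions present, each of the ten vertices has a
  -- neighbour of a one part back and a neighbour of b two parts back. The walks thus repeat the
  -- domination pattern of the whole graph among themselves, and the tree names no vertex outside
  -- them. In its leaves all vertices outside the walks have label 0.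
  last-tree : Tree
  last-tree = % 7 8 (% 0 5 (! 0 2341510002) (% 2 6 (! 0 1423102500) (% 5 6 (! 0 2341500210) (% 0 2 (% 0 7 (! 0 412001325) (% 6 7 (! 0 1345202100) ($ 0 6 5 7))) ($ 0 6 2 5))))) (% 8 9 (% 1 6 (! 0 3425100012) (% 6 7 (! 0 3145212000) (% 1 8 (% 0 2 (! 0 2311020045) (% 0 5 (! 0 2411320005) (% 2 6 (! 0 3415202100) (% 5 6 (! 0 2413520001) ($ 0 6 2 5))))) ($ 1 7 6 8)))) (% 0 7 (% 1 4 (! 0 21130145) (% 1 5 (! 0 31120245) (% 4 9 (! 0 31142125) (% 5 9 (% 1 6 (! 0 31120245) (% 1 8 (! 0 310120245) (% 6 7 (! 0 3024031015) ($ 1 7 6 8)))) ($ 1 9 4 5))))) (% 0 9 (% 1 6 (! 0 223011145) (% 1 8 (! 0 311021245) (% 6 7 (! 0 3145200012) ($ 1 7 6 8)))) ($ 0 8 7 9))))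

open CycleTrees

-- Two closed walks of length five and the rotation of the circle

module Cycles where

  pattern 0F = zero
  pattern 1F = suc zero
  pattern 2F = suc (suc zero)
  pattern 3F = suc (suc (suc zero))
  pattern 4F = suc (suc (suc (suc zero)))

  next : Fin 5 → Fin 5
  next 0F = 1F
  next 1F = 2F
  next 2F = 3F
  next 3F = 4F
  next 4F = 0F

  -- Rotation commutes with passing to the class of a parent, which is why a rotated configuration
  -- is again of the same form.
  next-shift : ∀ f i → next (shift f i) ≡ shift f (next i)
  next-shift true 0F = refl
  next-shift true 1F = refl
  next-shift true 2F = refl
  next-shift true 3F = refl
  next-shift true 4F = refl
  next-shift false 0F = refl
  next-shift false 1F = refl
  next-shift false 2F = refl
  next-shift false 3F = refl
  next-shift false 4F = refl

  next-prev : ∀ i → next (prev i) ≡ i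
  next-prev 0F = refl
  next-prev 1F = refl
  next-prev 2F = refl
  next-prev 3F = refl
  next-prev 4F = refl

  aV bV : Fin 5 → Vtx
  aV 0F = vtx 0 true 0F
  aV 1F = vtx 1 true 1F
  aV 2F = vtx 2 true 2F
  aV 3F = vtx 3 true 3F
  aV 4F = vtx 4 true 4F
  bV 0F = vtx 5 false 0F
  bV 1F = vtx 6 false 1F
  bV 2F = vtx 7 false 2F
  bV 3F = vtx 8 false 3F
  bV 4F = vtx 9 false 4F

  around : ∀ {X : Set} → (Fin 5 → X) → List X
  around h = h 0F ∷ h 1F ∷ h 2F ∷ h 3F ∷ h 4F ∷ []

  around⁺ : ∀ {X : Set} {P : X → Set} (h : Fin 5 → X) → (∀ i → P (h i)) → All P (around h)
  around⁺ h p = p 0F ∷ p 1F ∷ p 2F ∷ p 3F ∷ p 4F ∷ []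

  cycles : List Vtx
  cycles = around aV ++ around bV

  -- The vertex a (i - 1) lies in the class of the p-parent of b i, and b (i - 2) in the class of
  -- the q-parent of a i, though they may differ from these parents. If such a pair is not adjacent,
  -- they do differ, and the parent is a vertex outside the walks.
  cycle-edges p-edges q-edges : List (Vtx × Vtx)
  cycle-edges = around (λ i → aV i , aV (prev i)) ++ around (λ i → bV i , bV (prev (prev i)))
  p-edges = around (λ i → bV i , aV (prev i))
  q-edges = around (λ i → aV i , bV (prev (prev i)))

  -- Up to rotation the four situations are exhaustive: a missing pair of `p-edges` is followed by a
  -- present one, or all of them are missing, or all are present and one of the `q-edges` is
  -- missing, or everything is present.
  state-switch state-none state-2 state-3 : State
  state-switch = state cycles (cycle-edges ++ (bV 1F , aV 0F) ∷ []) ((bV 0F , aV 4F) ∷ [])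
  state-none = state cycles cycle-edges p-edges
  state-2 = state cycles (cycle-edges ++ p-edges) ((aV 0F , bV 3F) ∷ [])
  state-3 = state cycles (cycle-edges ++ p-edges ++ q-edges) []

  check-switch : check state-switch switch-tree ≡ true
  check-switch = refl

  check-none : check state-none none-tree ≡ true
  check-none = refl

  -- The q-parent of a 0 can be added at the root: b 3 is the only named q-parent in its class, and
  -- it is assumed not to be adjacent to a 0.
  check-2 : check state-2 (new 0 false 10 q-tree) ≡ true
  check-2 = refl

  check-3 : check state-3 last-tree ≡ true
  check-3 = refl

  module _ {n} (G : Graph n) (par : Bool → Fin n → Fin n)
    (par-adj : ∀ f v → Adj G (par f v) v)
    (par-disj : ∀ x y → par true x ≢ par false y)
    (2K2-free : TwoK2Free G) (no6 : ¬ UpperDomaticPartition G 6) where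

    -- The classes are a parameter of the record while the parents are fixed outside it, since a
    -- rotation renames the classes and keeps the parents.
    record Cycles (cls : Fin n → Fin 5) (a b : Fin 5 → Fin n) : Set where
      field
        par-cls : ∀ f v → cls (par f v) ≡ shift f (cls v)
        a-cls : ∀ i → cls (a i) ≡ i
        b-cls : ∀ i → cls (b i) ≡ i
        a-par : ∀ i → par true (a i) ≡ a (prev i)
        b-par : ∀ i → par false (b i) ≡ b (prev (prev i))

    -- Position 0 after the rotation is position 4 before it. The trees treat position 0 only, and
    -- repeated rotation carries their conclusions to the other positions.
    rotate : ∀ {cls a b} → Cycles cls a b → Cycles (next ∘ cls) (a ∘ prev) (b ∘ prev)
    rotate {cls} C = record
      { par-cls = λ f v → trans (cong next (par-cls f v)) (next-shift f (cls v))
      ; a-cls = λ i → trans (cong next (a-cls (prev i))) (next-prev i)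
      ; b-cls = λ i → trans (cong next (b-cls (prev i))) (next-prev i)
      ; a-par = a-par ∘ prev
      ; b-par = b-par ∘ prev }
      where open Cycles C

    module _ {cls a b} (C : Cycles cls a b) where
      open Cycles C

      private
        ρ : ℕ → Fin n
        ρ 0 = a 0F
        ρ 1 = a 1F
        ρ 2 = a 2F
        ρ 3 = a 3F
        ρ 4 = a 4F
        ρ 5 = b 0F
        ρ 6 = b 1F
        ρ 7 = b 2F
        ρ 8 = b 3F
        -- This serves name 9 and all larger names. The initial states list none of the latter, so
        -- their value is arbitrary until `new` assigns one.
        ρ _ = b 4F

        ρa : ∀ i → ρ (name (aV i)) ≡ a i
        ρa 0F = refl
        ρa 1F = refl
        ρa 2F = refl
        ρa 3F = refl
        ρa 4F = refl

        ρb : ∀ i → ρ (name (bV i)) ≡ b i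
        ρb 0F = refl
        ρb 1F = refl
        ρb 2F = refl
        ρb 3F = refl
        ρb 4F = refl

        placed : All (Placed G cls par par-cls par-adj par-disj 2K2-free no6 ρ) cycles
        -- As the walks are closed, each vertex is the parent of the vertex behind it in the walk:
        -- the child of a i is a (i + 1), and the child of b i is b (i + 2).
        placed = (a-cls 0F , a 1F , a-par 1F) ∷ (a-cls 1F , a 2F , a-par 2F) ∷ (a-cls 2F , a 3F , a-par 3F)
          ∷ (a-cls 3F , a 4F , a-par 4F) ∷ (a-cls 4F , a 0F , a-par 0F)
          ∷ (b-cls 0F , b 2F , b-par 2F) ∷ (b-cls 1F , b 3F , b-par 3F) ∷ (b-cls 2F , b 4F , b-par 4F)
          ∷ (b-cls 3F , b 0F , b-par 0F) ∷ (b-cls 4F , b 1F , b-par 1F) ∷ []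

        Joined : Vtx × Vtx → Set
        Joined e = Adj G (ρ (name (proj₁ e))) (ρ (name (proj₂ e)))

        join : ∀ {v w x y} → ρ (name v) ≡ x → ρ (name w) ≡ y → Adj G x y → Joined (v , w)
        join refl refl e = e

        cycle-joined : All Joined cycle-edges
        cycle-joined = ++⁺
          (around⁺ {P = Joined} (λ i → aV i , aV (prev i)) λ i → join {aV i} {aV (prev i)} (ρa i) (ρa (prev i)) (sym G (subst (λ z → Adj G z (a i)) (a-par i) (par-adj true (a i)))))
          (around⁺ {P = Joined} (λ i → bV i , bV (prev (prev i))) λ i → join {bV i} {bV (prev (prev i))} (ρb i) (ρb (prev (prev i))) (sym G (subst (λ z → Adj G z (b i)) (b-par i) (par-adj false (b i)))))

        refute′ : ∀ s t → T (wellFormed s []) → check s t ≡ true → _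
        refute′ s t wf h = λ placed edges nonedges → refute G cls par par-cls par-adj par-disj 2K2-free no6 s [] t ρ wf (passed s t h) placed edges nonedges []

      no-switch : ¬ Adj G (b 0F) (a 4F) → ¬ Adj G (b 1F) (a 0F)
      no-switch ne e = refute′ state-switch switch-tree tt check-switch placed (++⁺ cycle-joined (e ∷ [])) (ne ∷ [])

      some-joined : ¬ (∀ i → ¬ Adj G (b i) (a (prev i)))
      some-joined ne = refute′ state-none none-tree tt check-none placed cycle-joined (ne 0F ∷ ne 1F ∷ ne 2F ∷ ne 3F ∷ ne 4F ∷ [])

      module _ (pE : ∀ i → Adj G (b i) (a (prev i))) where

        private
          p-joined : All Joined p-edges
          p-joined = around⁺ {P = Joined} (λ i → bV i , aV (prev i)) λ i → join {bV i} {aV (prev i)} (ρb i) (ρa (prev i)) (pE i)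

        q-joined-0 : ¬ ¬ Adj G (a 0F) (b 3F)
        q-joined-0 ne = refute′ state-2 (new 0 false 10 q-tree) tt check-2 placed (++⁺ cycle-joined p-joined) (ne ∷ [])

        not-all-joined : ¬ (∀ i → Adj G (a i) (b (prev (prev i))))
        not-all-joined qE = refute′ state-3 last-tree tt check-3 placed (++⁺ cycle-joined (++⁺ p-joined
          (around⁺ {P = Joined} (λ i → aV i , bV (prev (prev i))) λ i → join {aV i} {bV (prev (prev i))} (ρa i) (ρb (prev (prev i))) (qE i)))) []

    -- Each adjacency is obtained only up to double negation. Five such statements can be combined,
    -- and this is enough because the conclusion to be reached is a contradiction.
    ¬¬-around : ∀ {X : Fin 5 → Set} → (∀ i → ¬ ¬ X i) → ¬ ¬ (∀ i → X i)
    ¬¬-around h k = h 0F λ x₀ → h 1F λ x₁ → h 2F λ x₂ → h 3F λ x₃ → h 4F λ x₄ →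
      k λ { 0F → x₀ ; 1F → x₁ ; 2F → x₂ ; 3F → x₃ ; 4F → x₄ }

    -- If position 0 is unjoined, `no-switch` carries this to position 1, and its rotated forms
    -- carry it on round the circle. Then no position is joined, which `some-joined` refutes.
    p-joined-0 : ∀ {cls a b} → Cycles cls a b → ¬ ¬ Adj G (b 0F) (a 4F)
    p-joined-0 C n₀ = some-joined C λ { 0F → n₀ ; 1F → n₁ ; 2F → n₂ ; 3F → n₃ ; 4F → n₄ }
      where
      n₁ = no-switch C n₀
      -- Four rotations move the reference position forward by one, because five rotations act as
      -- the identity on the positions.
      n₂ = no-switch (rotate (rotate (rotate (rotate C)))) n₁
      n₃ = no-switch (rotate (rotate (rotate C))) n₂
      n₄ = no-switch (rotate (rotate C)) n₃

    p-joined-all : ∀ {cls a b} → Cycles cls a b → ∀ i → ¬ ¬ Adj G (b i) (a (prev i))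
    p-joined-all C 0F = p-joined-0 C
    p-joined-all C 4F = p-joined-0 (rotate C)
    p-joined-all C 3F = p-joined-0 (rotate (rotate C))
    p-joined-all C 2F = p-joined-0 (rotate (rotate (rotate C)))
    p-joined-all C 1F = p-joined-0 (rotate (rotate (rotate (rotate C))))

    no-cycles : ∀ {cls a b} → ¬ Cycles cls a b
    no-cycles {a = a} {b} C = ¬¬-around (p-joined-all C) λ pE → ¬¬-around (q-joined pE) (not-all-joined C pE)
      where
      q-joined : (∀ i → Adj G (b i) (a (prev i))) → ∀ i → ¬ ¬ Adj G (a i) (b (prev (prev i)))
      q-joined pE 0F = q-joined-0 C pE
      -- A rotation shifts the known adjacencies by the same reindexing as the walks themselves.
      q-joined pE 4F = q-joined-0 (rotate C) (pE ∘ prev)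
      q-joined pE 3F = q-joined-0 (rotate (rotate C)) (pE ∘ prev ∘ prev)
      q-joined pE 2F = q-joined-0 (rotate (rotate (rotate C))) (pE ∘ prev ∘ prev ∘ prev)
      q-joined pE 1F = q-joined-0 (rotate (rotate (rotate (rotate C)))) (pE ∘ prev ∘ prev ∘ prev ∘ prev)

open Cycles

-- Creating a sink by moving vertices to another part

module Sinks where

  module _ {n k} (G : Graph n) (P : UpperDomaticPartition G k) where

    private
      c = proj₁ (proj₁ P)
      nonempty = proj₂ (proj₁ P)
      compare = proj₂ P

    -- The part i shrinks to {w}; its other vertices are put into part j.
    module _ (i j : Fin k) (i≢j : i ≢ j) (w : Fin n) (cw : c w ≡ i)
             (full : ∀ l → l ≢ i → ∃ λ u → c u ≡ l × Adj G u w)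
             (absorb : ∀ l → l ≢ i → l ≢ j → Dominates G c l i ⊎ Dominates G c j l) where

      private
        c′ : Fin n → Fin k
        c′ v with v ≟ w | c v ≟ i
        ... | yes _ | _     = i
        ... | no _  | yes _ = j
        ... | no _  | no _  = c v

        c′w : c′ w ≡ i
        c′w with w ≟ w | c w ≟ i
        ... | yes _ | _ = refl
        ... | no w≢w | _ = contradiction refl w≢w

        c′-keep : ∀ {v l} → c v ≡ l → l ≢ i → c′ v ≡ l
        c′-keep {v} eq l≢i with v ≟ w | c v ≟ i
        ... | yes v≡w | _ = contradiction (trans (≡-sym eq) (subst (λ x → c x ≡ i) (≡-sym v≡w) cw)) l≢i
        ... | no _ | yes cv≡i = contradiction (trans (≡-sym eq) cv≡i) l≢i
        ... | no _ | no _ = eq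

        c′-only : ∀ v → c′ v ≡ i → v ≡ w
        c′-only v eq with v ≟ w | c v ≟ i
        ... | yes v≡w | _ = v≡w
        ... | no _ | yes _ = contradiction (≡-sym eq) i≢j
        ... | no _ | no cv≢i = contradiction eq cv≢i

        c′-back : ∀ v {l} → c′ v ≡ l → l ≢ i → c v ≡ l ⊎ (l ≡ j × c v ≡ i)
        c′-back v eq l≢i with v ≟ w | c v ≟ i
        ... | yes _ | _ = contradiction (≡-sym eq) l≢i
        ... | no _ | yes cv≡i = inj₂ (≡-sym eq , cv≡i)
        ... | no _ | no _ = inj₁ eq

        sink : ∀ l → l ≢ i → Dominates G c′ l i
        sink l l≢i v eq with refl ← c′-only v eq | u , cu , e ← full l l≢i = u , c′-keep cu l≢i , e

        keep : ∀ {l m} → l ≢ i → m ≢ i → m ≢ j → Dominates G c l m → Dominates G c′ l m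
        keep l≢i m≢i m≢j d v eq with c′-back v eq m≢i
        ... | inj₂ (m≡j , _) = contradiction m≡j m≢j
        ... | inj₁ cv with u , cu , e ← d v cv = u , c′-keep cu l≢i , e

        grow : ∀ {l} → l ≢ i → Dominates G c l j → Dominates G c l i → Dominates G c′ l j
        grow l≢i d d′ v eq with c′-back v eq (i≢j ∘ ≡-sym)
        ... | inj₁ cv with u , cu , e ← d v cv = u , c′-keep cu l≢i , e
        ... | inj₂ (_ , cv) with u , cu , e ← d′ v cv = u , c′-keep cu l≢i , e

        -- If l dominates both j and i, it dominates the enlarged j; if j dominates l, it still
        -- does, as no vertex has left j. The hypothesis `absorb` excludes the remaining case, in
        -- which l dominates j but not i while j does not dominate l.
        compare-j : ∀ l → l ≢ i → l ≢ j → Dominates G c′ l j ⊎ Dominates G c′ j l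
        compare-j l l≢i l≢j with absorb l l≢i l≢j | compare l j l≢j
        ... | inj₂ d | _ = inj₂ (keep (i≢j ∘ ≡-sym) l≢i l≢j d)
        ... | inj₁ _ | inj₂ d = inj₂ (keep (i≢j ∘ ≡-sym) l≢i l≢j d)
        ... | inj₁ d′ | inj₁ d = inj₁ (grow l≢i d d′)

        compare′ : ∀ l m → l ≢ m → Dominates G c′ l m ⊎ Dominates G c′ m l
        compare′ l m l≢m with l ≟ i | m ≟ i | l ≟ j | m ≟ j
        ... | yes refl | _ | _ | _ = inj₂ (sink m (l≢m ∘ ≡-sym))
        ... | no _ | yes refl | _ | _ = inj₁ (sink l l≢m)
        ... | no _ | no m≢i | yes refl | _ = swap (compare-j m m≢i (l≢m ∘ ≡-sym))
        ... | no l≢i | no _ | no l≢j | yes refl = compare-j l l≢i l≢j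
        ... | no l≢i | no m≢i | no l≢j | no m≢j with compare l m l≢m
        ...   | inj₁ d = inj₁ (keep l≢i m≢i m≢j d)
        ...   | inj₂ d = inj₂ (keep m≢i l≢i l≢j d)

        nonempty′ : ∀ l → ∃ λ v → c′ v ≡ l
        nonempty′ l with l ≟ i
        ... | yes refl = w , c′w
        ... | no l≢i with v , cv ← nonempty l = v , c′-keep cv l≢i

      -- Shrunk to `w`, the part i is dominated by every other part, because `w` has a neighbour in
      -- each of them; this settles all comparisons with i. The other parts lose no vertices and
      -- only j gains some, so the comparisons with j are the only ones at risk.
      full-vertex⇒sink : Σ (UpperDomaticPartition G k) λ Q → ∃ λ s → IsSink G (proj₁ Q) s
      full-vertex⇒sink = ((c′ , nonempty′) , compare′) , i , sink

    -- If j dominates i, part i is a sink already. Otherwise i dominates the nonempty part j, so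
    -- some vertex of i has a neighbour in j. It has neighbours in the remaining parts too, because
    -- these dominate i, and the same dominations allow the rest of i to be moved to j.
    small-score⇒sink : ∀ i j → i ≢ j → (∀ l → l ≢ i → l ≢ j → Dominates G c l i) →
      Σ (UpperDomaticPartition G k) λ Q → ∃ λ s → IsSink G (proj₁ Q) s
    small-score⇒sink i j i≢j d with compare i j i≢j
    ... | inj₂ j→i = P , i , by
      where
      by : ∀ l → l ≢ i → Dominates G c l i
      by l l≢i with l ≟ j
      ... | yes refl = j→i
      ... | no l≢j = d l l≢i l≢j
    ... | inj₁ i→j with y , cy ← nonempty j with w , cw , w~y ← i→j y cy =
      full-vertex⇒sink i j i≢j w cw full (λ l l≢i l≢j → inj₁ (d l l≢i l≢j))
      where
      full : ∀ l → l ≢ i → ∃ λ u → c u ≡ l × Adj G u w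
      full l l≢i with l ≟ j
      ... | yes refl = y , cy , sym G w~y
      ... | no l≢j = d l l≢i l≢j w cw

open Sinks

-- Tournaments on five vertices

module Tournaments where

  -- Written as a conjunction over all vectors, so that a statement about every tournament can be
  -- proved by evaluation.
  ∀Bool : ∀ k → (Vec Bool k → Bool) → Bool
  ∀Bool zero f = f []
  ∀Bool (suc k) f = ∀Bool k (λ v → f (true ∷ v)) ∧ ∀Bool k (λ v → f (false ∷ v))

  ∀Bool-sound : ∀ k f → T (∀Bool k f) → ∀ v → T (f v)
  ∀Bool-sound zero f t [] = t
  ∀Bool-sound (suc k) f t (true ∷ v) = ∀Bool-sound k _ (proj₁ (∧-split {∀Bool k (λ v → f (true ∷ v))} t)) v
  ∀Bool-sound (suc k) f t (false ∷ v) = ∀Bool-sound k _ (proj₂ (∧-split {∀Bool k (λ v → f (true ∷ v))} t)) v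

  -- A tournament on five vertices, given by the ten bits of its upper triangle.
  beats : Vec Bool 10 → Fin 5 → Fin 5 → Bool
  beats (a ∷ b ∷ c ∷ d ∷ e ∷ f ∷ g ∷ h ∷ i ∷ j ∷ []) = m
    where
    m : Fin 5 → Fin 5 → Bool
    m zero (suc zero) = a
    m zero (suc (suc zero)) = b
    m zero (suc (suc (suc zero))) = c
    m zero (suc (suc (suc (suc zero)))) = d
    m (suc zero) (suc (suc zero)) = e
    m (suc zero) (suc (suc (suc zero))) = f
    m (suc zero) (suc (suc (suc (suc zero)))) = g
    m (suc (suc zero)) (suc (suc (suc zero))) = h
    m (suc (suc zero)) (suc (suc (suc (suc zero)))) = i
    m (suc (suc (suc zero))) (suc (suc (suc (suc zero)))) = j
    m (suc zero) zero = not a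
    m (suc (suc zero)) zero = not b
    m (suc (suc (suc zero))) zero = not c
    m (suc (suc (suc (suc zero)))) zero = not d
    m (suc (suc zero)) (suc zero) = not e
    m (suc (suc (suc zero))) (suc zero) = not f
    m (suc (suc (suc (suc zero)))) (suc zero) = not g
    m (suc (suc (suc zero))) (suc (suc zero)) = not h
    m (suc (suc (suc (suc zero)))) (suc (suc zero)) = not i
    m (suc (suc (suc (suc zero)))) (suc (suc (suc zero))) = not j
    m zero zero = false
    m (suc zero) (suc zero) = false
    m (suc (suc zero)) (suc (suc zero)) = false
    m (suc (suc (suc zero))) (suc (suc (suc zero))) = false
    m (suc (suc (suc (suc zero)))) (suc (suc (suc (suc zero)))) = false

  -- In a tournament this says that at least three vertices beat i; j is the one vertex that i may
  -- still beat.
  lowAt : (Fin 5 → Fin 5 → Bool) → Fin 5 → Fin 5 → Bool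
  lowAt w i j = not (i == j) ∧ all (λ l → (l == i) ∨ ((l == j) ∨ w l i)) (allFin 5)

  low : (Fin 5 → Fin 5 → Bool) → Bool
  low w = any (λ i → any (lowAt w i) (allFin 5)) (allFin 5)

  onto : Vec (Fin 5) 5 → Bool
  onto σ = all (λ x → any (λ i → lookup σ i == x) (allFin 5)) (allFin 5)

  injective : Vec (Fin 5) 5 → Bool
  injective σ = all (λ i → all (λ j → (i == j) ∨ not (lookup σ i == lookup σ j)) (allFin 5)) (allFin 5)

  circular : (Fin 5 → Fin 5 → Bool) → Vec (Fin 5) 5 → Bool
  circular w σ = all (λ i → w (lookup σ (shift true i)) (lookup σ i) ∧ w (lookup σ (shift false i)) (lookup σ i)) (allFin 5)

  -- Rotating an arrangement does not affect `circular`, so vertex 0 can be put in position 0. The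
  -- 24 arrangements of the other four vertices remain.
  orders : List (Vec (Fin 5) 5)
  orders =
    (# 0 ∷ # 1 ∷ # 2 ∷ # 3 ∷ # 4 ∷ []) ∷
    (# 0 ∷ # 1 ∷ # 2 ∷ # 4 ∷ # 3 ∷ []) ∷
    (# 0 ∷ # 1 ∷ # 3 ∷ # 2 ∷ # 4 ∷ []) ∷
    (# 0 ∷ # 1 ∷ # 3 ∷ # 4 ∷ # 2 ∷ []) ∷
    (# 0 ∷ # 1 ∷ # 4 ∷ # 2 ∷ # 3 ∷ []) ∷
    (# 0 ∷ # 1 ∷ # 4 ∷ # 3 ∷ # 2 ∷ []) ∷
    (# 0 ∷ # 2 ∷ # 1 ∷ # 3 ∷ # 4 ∷ []) ∷
    (# 0 ∷ # 2 ∷ # 1 ∷ # 4 ∷ # 3 ∷ []) ∷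
    (# 0 ∷ # 2 ∷ # 3 ∷ # 1 ∷ # 4 ∷ []) ∷
    (# 0 ∷ # 2 ∷ # 3 ∷ # 4 ∷ # 1 ∷ []) ∷
    (# 0 ∷ # 2 ∷ # 4 ∷ # 1 ∷ # 3 ∷ []) ∷
    (# 0 ∷ # 2 ∷ # 4 ∷ # 3 ∷ # 1 ∷ []) ∷
    (# 0 ∷ # 3 ∷ # 1 ∷ # 2 ∷ # 4 ∷ []) ∷
    (# 0 ∷ # 3 ∷ # 1 ∷ # 4 ∷ # 2 ∷ []) ∷
    (# 0 ∷ # 3 ∷ # 2 ∷ # 1 ∷ # 4 ∷ []) ∷
    (# 0 ∷ # 3 ∷ # 2 ∷ # 4 ∷ # 1 ∷ []) ∷
    (# 0 ∷ # 3 ∷ # 4 ∷ # 1 ∷ # 2 ∷ []) ∷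
    (# 0 ∷ # 3 ∷ # 4 ∷ # 2 ∷ # 1 ∷ []) ∷
    (# 0 ∷ # 4 ∷ # 1 ∷ # 2 ∷ # 3 ∷ []) ∷
    (# 0 ∷ # 4 ∷ # 1 ∷ # 3 ∷ # 2 ∷ []) ∷
    (# 0 ∷ # 4 ∷ # 2 ∷ # 1 ∷ # 3 ∷ []) ∷
    (# 0 ∷ # 4 ∷ # 2 ∷ # 3 ∷ # 1 ∷ []) ∷
    (# 0 ∷ # 4 ∷ # 3 ∷ # 1 ∷ # 2 ∷ []) ∷
    (# 0 ∷ # 4 ∷ # 3 ∷ # 2 ∷ # 1 ∷ []) ∷ []

  orders-onto : T (all onto orders)
  orders-onto = tt

  orders-injective : T (all injective orders)
  orders-injective = tt

  regular : (Fin 5 → Fin 5 → Bool) → Bool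
  regular w = any (circular w) orders

  -- The numbers of vertices that beat each vertex sum to ten. If none of these numbers is three or
  -- more, all are equal to two, and the tournament on five vertices with this property is unique up
  -- to isomorphism: it is the circular one. The proof evaluates all 1024 cases.
  low-or-regular : ∀ v → T (low (beats v) ∨ regular (beats v))
  low-or-regular = ∀Bool-sound 10 (λ v → low (beats v) ∨ regular (beats v)) tt

open Tournaments

-- Parents on the circle and their closed walks

module Parents where

  isLeft : ∀ {A B : Set} → A ⊎ B → Bool
  isLeft (inj₁ _) = true
  isLeft (inj₂ _) = false

  left : ∀ {A B : Set} (s : A ⊎ B) → T (isLeft s) → A
  left (inj₁ x) _ = x

  right : ∀ {A B : Set} (s : A ⊎ B) → T (not (isLeft s)) → B
  right (inj₂ y) _ = y

  -- The differences modulo 5 are 0, 1, 2, -1 and -2, so of two distinct classes one is always one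
  -- or two steps behind the other. Consequently the two parents and the two kinds of children of a
  -- vertex account for all four other classes.
  circle : ∀ (i l : Fin 5) → l ≡ i ⊎ l ≡ shift true i ⊎ l ≡ shift false i ⊎ i ≡ shift true l ⊎ i ≡ shift false l
  circle = from-yes (all? λ i → all? λ l →
    (l ≟ i) ⊎-dec (l ≟ shift true i) ⊎-dec (l ≟ shift false i) ⊎-dec (i ≟ shift true l) ⊎-dec (i ≟ shift false l))

  unshift : Bool → Fin 5 → Fin 5
  unshift true i = next i
  unshift false i = next (next i)

  unshift-shift : ∀ f i → unshift f (shift f i) ≡ i
  unshift-shift true i = next-prev i
  unshift-shift false i = trans (cong next (next-prev (prev i))) (next-prev i)

  shift-injective : ∀ f {i j} → shift f i ≡ shift f j → i ≡ j
  shift-injective f {i} {j} e = trans (≡-sym (unshift-shift f i)) (trans (cong (unshift f) e) (unshift-shift f j))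

  next-≢ : ∀ i → next i ≢ i
  next-≢ 0F ()
  next-≢ 1F ()
  next-≢ 2F ()
  next-≢ 3F ()
  next-≢ 4F ()

  -- The exponent k with shift^k 0 = i.
  turns : Bool → Fin 5 → ℕ
  turns _ 0F = 0
  turns true 4F = 1
  turns true 3F = 2
  turns true 2F = 3
  turns true 1F = 4
  turns false 3F = 1
  turns false 1F = 2
  turns false 4F = 3
  turns false 2F = 4

  shifts-turns : ∀ f i → shifts f (turns f i) ≡ i
  shifts-turns true 0F = refl
  shifts-turns true 1F = refl
  shifts-turns true 2F = refl
  shifts-turns true 3F = refl
  shifts-turns true 4F = refl
  shifts-turns false 0F = refl
  shifts-turns false 1F = refl
  shifts-turns false 2F = refl
  shifts-turns false 3F = refl
  shifts-turns false 4F = refl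

  -- 5 − turns f i modulo 5.
  back : Bool → Fin 5 → ℕ
  back _ 0F = 0
  back true 1F = 1
  back true 2F = 2
  back true 3F = 3
  back true 4F = 4
  back false 2F = 1
  back false 4F = 2
  back false 1F = 3
  back false 3F = 4

  shifts-home : ∀ f i → fold i (shift f) (back f i) ≡ 0F
  shifts-home true 0F = refl
  shifts-home true 1F = refl
  shifts-home true 2F = refl
  shifts-home true 3F = refl
  shifts-home true 4F = refl
  shifts-home false 0F = refl
  shifts-home false 1F = refl
  shifts-home false 2F = refl
  shifts-home false 3F = refl
  shifts-home false 4F = refl

  module _ {n} (G : Graph n) (cls : Fin n → Fin 5) (par : Bool → Fin n → Fin n)
    (par-cls : ∀ f v → cls (par f v) ≡ shift f (cls v))
    (par-adj : ∀ f v → Adj G (par f v) v)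
    (par-disj : ∀ x y → par true x ≢ par false y)
    (2K2-free : TwoK2Free G) (no6 : ¬ UpperDomaticPartition G 6)
    (inhabited : ∀ i → ∃ λ v → cls v ≡ i) where

    private
      walk : Bool → ℕ → Fin n → Fin n
      walk = iter G cls par par-cls par-adj par-disj 2K2-free no6
      walk-cls = iter-cls G cls par par-cls par-adj par-disj 2K2-free no6

      Closed : Bool → Fin n → Set
      Closed f z = cls z ≡ 0F × walk f 5 z ≡ z

      -- `some-5-cycle` refutes the absence of closed orbits in any class. The stronger demand that
      -- the orbit starts in class 0 costs nothing, since a closed orbit can be entered at any of
      -- its vertices.
      ¬¬closed : ∀ f → ¬ ¬ ∃ (Closed f)
      ¬¬closed f no-closed with u , cu ← inhabited (unshift f 0F) =
        some-5-cycle G cls par par-cls par-adj par-disj 2K2-free no6 f u (start f cu) λ z e →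
          -- A further `k` steps bring the orbit of `z` to class 0. It stays closed there because
          -- walking five steps and walking `k` steps commute.
          let k = back f (cls z) in
          no-closed (walk f k z , trans (walk-cls f k z) (shifts-home f (cls z)) ,
            trans (≡-sym (fold-+ z (par f) 5 {k})) (trans (cong (λ m → walk f m z) (+-comm 5 k)) (trans (fold-+ z (par f) k {5}) (cong (walk f k) e))))
        where
        start : ∀ f {u} → cls u ≡ unshift f 0F → shift f (cls u) ≡ 0F
        start true e = cong (shift true) e
        start false e = cong (shift false) e

      module _ (f : Bool) (z : Fin n) where
        -- A closed walk of five steps meets every class exactly once, for steps of length one as
        -- well as two, since both lengths are prime to 5.
        turn : Fin 5 → Fin n
        turn i = walk f (turns f i) z

        turn-cls : cls z ≡ 0F → ∀ i → cls (turn i) ≡ i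
        turn-cls e i = trans (walk-cls f (turns f i) z) (trans (cong (λ c → fold c (shift f) (turns f i)) e) (shifts-turns f i))

      -- Four of the five equations hold by computation. The fifth, at the class reached after four
      -- steps, is the one where the walk returns to its start.
      a-par : ∀ z → walk true 5 z ≡ z → ∀ i → par true (turn true z i) ≡ turn true z (prev i)
      a-par z e 0F = refl
      a-par z e 1F = e
      a-par z e 2F = refl
      a-par z e 3F = refl
      a-par z e 4F = refl

      b-par : ∀ z → walk false 5 z ≡ z → ∀ i → par false (turn false z i) ≡ turn false z (prev (prev i))
      b-par z e 0F = refl
      b-par z e 1F = refl
      b-par z e 2F = e
      b-par z e 3F = refl
      b-par z e 4F = refl

    no-disjoint-parents : ⊥
    no-disjoint-parents = ¬¬closed true λ (y , cy , ey) → ¬¬closed false λ (z , cz , ez) →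
      no-cycles G par par-adj par-disj 2K2-free no6 record
        { par-cls = par-cls
        ; a-cls = turn-cls true y cy
        ; b-cls = turn-cls false z cz
        ; a-par = a-par y ey
        ; b-par = b-par z ez }

  -- From the domination tournament to a sink

  module _ {n} (G : Graph n) (2K2-free : TwoK2Free G) (no6 : ¬ UpperDomaticPartition G 6)
           (P : UpperDomaticPartition G 5) where

    private
      c = proj₁ (proj₁ P)
      nonempty = proj₂ (proj₁ P)
      compare = proj₂ P

      Goal : Set
      Goal = Σ (UpperDomaticPartition G 5) λ Q → ∃ λ s → IsSink G (proj₁ Q) s

      cmp : ∀ i j {i≢j : False (i ≟ j)} → Dominates G c i j ⊎ Dominates G c j i
      cmp i j {i≢j} = compare i j (toWitnessFalse i≢j)

      bit : ∀ i j {i≢j : False (i ≟ j)} → Bool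
      bit i j {i≢j} = isLeft (cmp i j {i≢j})

      -- Two parts may dominate each other. `compare` then still reports one direction, so the
      -- recorded answers always form a tournament.
      bits : Vec Bool 10
      bits = bit 0F 1F ∷ bit 0F 2F ∷ bit 0F 3F ∷ bit 0F 4F ∷ bit 1F 2F
        ∷ bit 1F 3F ∷ bit 1F 4F ∷ bit 2F 3F ∷ bit 2F 4F ∷ bit 3F 4F ∷ []

      win : Fin 5 → Fin 5 → Bool
      win = beats bits

      win-sound : ∀ i j → T (win i j) → Dominates G c i j
      win-sound 0F 0F ()
      win-sound 0F 1F = left (cmp 0F 1F)
      win-sound 0F 2F = left (cmp 0F 2F)
      win-sound 0F 3F = left (cmp 0F 3F)
      win-sound 0F 4F = left (cmp 0F 4F)
      win-sound 1F 0F = right (cmp 0F 1F)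
      win-sound 1F 1F ()
      win-sound 1F 2F = left (cmp 1F 2F)
      win-sound 1F 3F = left (cmp 1F 3F)
      win-sound 1F 4F = left (cmp 1F 4F)
      win-sound 2F 0F = right (cmp 0F 2F)
      win-sound 2F 1F = right (cmp 1F 2F)
      win-sound 2F 2F ()
      win-sound 2F 3F = left (cmp 2F 3F)
      win-sound 2F 4F = left (cmp 2F 4F)
      win-sound 3F 0F = right (cmp 0F 3F)
      win-sound 3F 1F = right (cmp 1F 3F)
      win-sound 3F 2F = right (cmp 2F 3F)
      win-sound 3F 3F ()
      win-sound 3F 4F = left (cmp 3F 4F)
      win-sound 4F 0F = right (cmp 0F 4F)
      win-sound 4F 1F = right (cmp 1F 4F)
      win-sound 4F 2F = right (cmp 2F 4F)
      win-sound 4F 3F = right (cmp 3F 4F)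
      win-sound 4F 4F ()

    from-low : T (low win) → Goal
    from-low t with i , _ , ti ← any-∈ (λ i → any (lowAt win i) (allFin 5)) (allFin 5) t
      with j , _ , tj ← any-∈ (lowAt win i) (allFin 5) ti
      with i≠j , others ← ∧-split {not (i == j)} tj =
      small-score⇒sink G P i j (λ e → not-T i≠j (≡⇒== e)) dominated
      where
      dominated : ∀ l → l ≢ i → l ≢ j → Dominates G c l i
      dominated l l≢i l≢j with ∨-split {l == i} (all-∈ (λ l → (l == i) ∨ ((l == j) ∨ win l i)) others (∈-allFin l))
      ... | inj₁ e = contradiction (==⇒≡ e) l≢i
      ... | inj₂ t′ with ∨-split {l == j} t′
      ...   | inj₁ e = contradiction (==⇒≡ e) l≢j
      ...   | inj₂ w = win-sound l i w

    -- `σ` lists the parts in their order on the circle and `τ` gives the position of a part.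
    -- Passing to positions turns the dominations into the shifts by one and two steps on which the
    -- certificates are built.
    module Circular (σ τ : Fin 5 → Fin 5) (στ : ∀ l → σ (τ l) ≡ l) (τσ : ∀ i → τ (σ i) ≡ i)
                    (behind : ∀ f i → Dominates G c (σ (shift f i)) (σ i)) where

      private
        cls : Fin n → Fin 5
        cls v = τ (c v)

        -- A proof of domination is a function that returns a neighbour of each dominated vertex, so
        -- the parents are read off without any choice principle.
        parent : ∀ f v → ∃ λ u → c u ≡ σ (shift f (cls v)) × Adj G u v
        parent f v = behind f (cls v) v (≡-sym (στ (c v)))

        par : Bool → Fin n → Fin n
        par f v = proj₁ (parent f v)

        par-part : ∀ f v → c (par f v) ≡ σ (shift f (cls v))
        par-part f v = proj₁ (proj₂ (parent f v))

        par-adj : ∀ f v → Adj G (par f v) v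
        par-adj f v = proj₂ (proj₂ (parent f v))

        par-cls : ∀ f v → cls (par f v) ≡ shift f (cls v)
        par-cls f v = trans (cong τ (par-part f v)) (τσ _)

        part : ∀ {v l} → cls v ≡ τ l → c v ≡ l
        part {v} {l} e = trans (≡-sym (στ (c v))) (trans (cong σ e) (στ l))

        τ-injective : ∀ {l m} → τ l ≡ τ m → l ≡ m
        τ-injective {l} {m} e = trans (≡-sym (στ l)) (trans (cong σ e) (στ m))

        dominates : ∀ f {l m} → τ l ≡ shift f (τ m) → Dominates G c l m
        dominates f {l} {m} e = subst₂ (Dominates G c) (trans (cong σ (≡-sym e)) (στ l)) (στ m) (behind f (τ m))

        inhabited : ∀ i → ∃ λ v → cls v ≡ i
        inhabited i with v , e ← nonempty (σ i) = v , trans (cong τ e) (τσ i)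

        -- The two children of `v` lie one and two parts ahead of it, and its own parents one and
        -- two parts back. So `v` has neighbours in all four other parts and can form a sink by
        -- itself.
        from-common : ∀ v → (∀ f → ∃ λ x → par f x ≡ v) → Goal
        from-common v child = full-vertex⇒sink G P (c v) j v∉j v refl full absorb
          where
          j : Fin 5
          -- The rest of the part moves to the next part on the circle. Of the other three parts,
          -- the two behind `v` dominate its part, and the one two steps ahead is dominated by the
          -- next part; this is what `absorb` demands.
          j = σ (next (cls v))

          τj : τ j ≡ next (cls v)
          τj = τσ _

          v∉j : c v ≢ j
          v∉j e = next-≢ (cls v) (trans (≡-sym τj) (cong τ (≡-sym e)))

          child-full : ∀ f {l} → cls v ≡ shift f (τ l) → ∃ λ u → c u ≡ l × Adj G u v
          child-full f e with x , refl ← child f =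
            x , part (shift-injective f (trans (≡-sym (par-cls f x)) e)) , sym G (par-adj f x)

          parent-full : ∀ f {l} → τ l ≡ shift f (cls v) → ∃ λ u → c u ≡ l × Adj G u v
          parent-full f e = par f v , part (trans (par-cls f v) (≡-sym e)) , par-adj f v

          full : ∀ l → l ≢ c v → ∃ λ u → c u ≡ l × Adj G u v
          full l l≢v with circle (cls v) (τ l)
          ... | inj₁ e = contradiction (τ-injective e) l≢v
          ... | inj₂ (inj₁ e) = parent-full true e
          ... | inj₂ (inj₂ (inj₁ e)) = parent-full false e
          ... | inj₂ (inj₂ (inj₂ (inj₁ e))) = child-full true e
          ... | inj₂ (inj₂ (inj₂ (inj₂ e))) = child-full false e

          absorb : ∀ l → l ≢ c v → l ≢ j → Dominates G c l (c v) ⊎ Dominates G c j l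
          absorb l l≢v l≢j with circle (cls v) (τ l)
          ... | inj₁ e = contradiction (τ-injective e) l≢v
          ... | inj₂ (inj₁ e) = inj₁ (dominates true e)
          ... | inj₂ (inj₂ (inj₁ e)) = inj₁ (dominates false e)
          ... | inj₂ (inj₂ (inj₂ (inj₁ e))) = contradiction (τ-injective (trans (≡-sym (next-prev (τ l))) (trans (cong next (≡-sym e)) (≡-sym τj)))) l≢j
          ... | inj₂ (inj₂ (inj₂ (inj₂ e))) = inj₂ (dominates true (trans τj (trans (cong next e) (next-prev (prev (τ l))))))

      -- Whether some vertex is a parent of both kinds is decidable, unlike adjacency: the parents
      -- are functions on a finite set, so finitely many equations between vertices have to be
      -- tested.
      circular⇒sink : Goal
      circular⇒sink with any? (λ x → any? (λ y → par true x ≟ par false y))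
      ... | yes (x , y , e) = from-common (par true x) λ { true → x , refl ; false → y , ≡-sym e }
      ... | no none = ⊥-elim (no-disjoint-parents G cls par par-cls par-adj (λ x y e → none (x , y , e)) 2K2-free no6 inhabited)

    from-regular : T (regular win) → Goal
    from-regular t with s , s∈ , circ ← any-∈ (circular win) orders t = Circular.circular⇒sink σ τ στ τσ behind
      where
      σ : Fin 5 → Fin 5
      σ = lookup s

      preimage : ∀ l → ∃ λ i → i ∈ allFin 5 × T (σ i == l)
      preimage l = any-∈ (λ i → σ i == l) (allFin 5)
        (all-∈ (λ x → any (λ i → σ i == x) (allFin 5)) (all-∈ onto {orders} orders-onto s∈) (∈-allFin l))

      -- The orders are a concrete list, so their surjectivity and injectivity are established by
      -- evaluation; the inverse of the chosen order is the witness found by the test `onto`.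
      τ : Fin 5 → Fin 5
      τ l = proj₁ (preimage l)

      στ : ∀ l → σ (τ l) ≡ l
      στ l = ==⇒≡ (proj₂ (proj₂ (preimage l)))

      σ-injective : ∀ i j → σ i ≡ σ j → i ≡ j
      σ-injective i j e with ∨-split {i == j} (all-∈ (λ j → (i == j) ∨ not (σ i == σ j))
        (all-∈ (λ i → all (λ j → (i == j) ∨ not (σ i == σ j)) (allFin 5)) (all-∈ injective {orders} orders-injective s∈) (∈-allFin i)) (∈-allFin j))
      ... | inj₁ eq = ==⇒≡ eq
      ... | inj₂ ne = contradiction (≡⇒== e) (not-T ne)

      τσ : ∀ i → τ (σ i) ≡ i
      τσ i = σ-injective _ _ (στ (σ i))

      behind : ∀ f i → Dominates G c (σ (shift f i)) (σ i)
      behind f i with f | ∧-split {win (σ (shift true i)) (σ i)}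
        (all-∈ (λ i → win (σ (shift true i)) (σ i) ∧ win (σ (shift false i)) (σ i)) circ (∈-allFin i))
      ... | true | w , _ = win-sound _ _ w
      ... | false | _ , w = win-sound _ _ w

    sink-exists : Goal
    sink-exists with ∨-split {low win} (low-or-regular bits)
    ... | inj₁ t = from-low t
    ... | inj₂ t = from-regular t

open Parents

theorem5 : ∀ (n : ℕ) (G : Graph n) → TwoK2Free G → UpperDomaticNumberIs G 5 →
    Σ (UpperDomaticPartition G 5) λ P → ∃ λ (s : Fin 5) → IsSink G (proj₁ P) s
-- The maximality of 5 enters as the absence of an upper domatic partition into six parts, which is
-- what every labelling leaf contradicts.
theorem5 n G 2K2-free (P , largest) = sink-exists G 2K2-free (largest 6 (s≤s ≤-refl)) P
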